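{- For every integer $\ell\ge 4$ there exist constants $c_\ell,C_\ell>0$ such that for all sufficiently large $n$, $$c_\ell\, n^{3/2}\le \mathrm{ex}(n,C_{2\ell}^{\square})\le C_\ell\, n^{3/2}.$$
   Context: $\mathrm{ex}(n,F)$ denotes the maximum number of edges in an $n$-vertex graph containing no subgraph isomorphic to $F$. The prism $C_{2\ell}^{\square}=C_{2\ell}\square K_2$ is the Cartesian product of the cycle $C_{2\ell}$ with an edge: it consists of two vertex-disjoint $2\ell$-cycles $a_1a_2\cdots a_{2\ell}a_1$ and $b_1b_2\cdots b_{2\ell}b_1$ together with the matching edges $a_ib_i$, $1\le i\le 2\ell$. -}

module Defs where

open import Data.Nat.Base as ℕ using (ℕ; suc; _^_; NonZero)
open import Data.Nat.Properties as ℕₚ using ()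
open import Data.Integer.Base using (+_)
open import Data.Rational.Base as ℚ using (ℚ)
open import Data.Fin.Base using (Fin; zero; suc; toℕ; _<_; remQuot; combine; finToFun; funToFin)
open import Data.Fin.Properties
  using (_≟_; _<?_; any?; all?; finToFun-funToFin; remQuot-combine)
open import Data.List.Base using (List; map; filter; length; allFin; cartesianProduct)
open import Data.List.Properties using (filter-≐)
open import Data.List.Extrema.Nat using (max; xs≤max; argmax-sel)
open import Data.List.Membership.Propositional using (_∈_)
open import Data.List.Membership.Propositional.Properties
  using (∈-map⁺; ∈-map⁻; ∈-filter⁺; ∈-filter⁻; ∈-allFin)
import Data.List.Relation.Unary.All as All
open import Data.Product.Base using (_×_; _,_; Σ-syntax; proj₁; proj₂; uncurry)
open import Data.Sum.Base as Sum using (_⊎_; inj₁; inj₂)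
open import Data.Empty using (⊥; ⊥-elim)
open import Function.Base using (id; _∘_)
open import Function.Definitions using (Injective)
open import Level using (0ℓ)
open import Relation.Binary.Core using (Rel)
open import Relation.Binary.Definitions using (Symmetric; Irreflexive; Decidable)
open import Relation.Binary.PropositionalEquality
  using (_≡_; _≢_; refl; sym; trans; cong; subst; subst₂)
open import Relation.Nullary using (¬_; Dec; yes; no)
open import Relation.Nullary.Decidable using (map′; ¬?; _×-dec_; _⊎-dec_; _→-dec_)

record Graph (n : ℕ) : Set₁ where
  field
    _~_      : Rel (Fin n) 0ℓ
    ~-sym    : Symmetric _~_
    ~-irrefl : Irreflexive _≡_ _~_
    _~?_     : Decidable _~_

-- Every edge is counted once, through its increasing pair of endpoints.
edges : ∀ {n} → Graph n → ℕ
edges {n} G = length (filter edge? (cartesianProduct (allFin n) (allFin n)))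
  where
  open Graph G
  edge? : ∀ ((i , j) : Fin n × Fin n) → Dec (i < j × i ~ j)
  edge? (i , j) = (i <? j) ×-dec (i ~? j)

-- Subgraphs are not assumed to be induced.
IsCopy : ∀ {k n} → Graph k → Graph n → (Fin k → Fin n) → Set
IsCopy F G f = Injective _≡_ _≡_ f × (∀ {u v} → u ~F v → f u ~G f v)
  where
  open Graph F renaming (_~_ to _~F_)
  open Graph G renaming (_~_ to _~G_)

_⊑_ : ∀ {k n} → Graph k → Graph n → Set
_⊑_ {k} {n} F G = Σ[ f ∈ (Fin k → Fin n) ] IsCopy F G f

_-Free_ : ∀ {k n} → Graph k → Graph n → Set
F -Free G = ¬ (F ⊑ G)

complete : ∀ n → Graph n
complete n = record
  { _~_      = _≢_
  ; ~-sym    = λ i≢j → i≢j ∘ sym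
  ; ~-irrefl = λ i≡j i≢j → i≢j i≡j
  ; _~?_     = λ i j → ¬? (i ≟ j)
  }

-- j follows i in the cyclic order 0, 1, …, n - 1, 0.
Next : ∀ {n} → Rel (Fin n) 0ℓ
Next {n} i j = (suc (toℕ i) ≡ toℕ j) ⊎ (suc (toℕ i) ≡ n × toℕ j ≡ 0)

-- The conjunct i ≢ j only matters for n = 1.
cycle : ∀ n → Graph n
cycle n = record
  { _~_      = λ i j → i ≢ j × (Next i j ⊎ Next j i)
  ; ~-sym    = λ (i≢j , e) → i≢j ∘ sym , Sum.swap e
  ; ~-irrefl = λ i≡j (i≢j , _) → i≢j i≡j
  ; _~?_     = λ i j → ¬? (i ≟ j) ×-dec (next? i j ⊎-dec next? j i)
  }
  where
  next? : Decidable (Next {n})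
  next? i j = (suc (toℕ i) ℕₚ.≟ toℕ j) ⊎-dec ((suc (toℕ i) ℕₚ.≟ n) ×-dec (toℕ j ℕₚ.≟ 0))

-- Cartesian product; remQuot k identifies Fin (m * k) with Fin m × Fin k.
infixl 7 _□_
_□_ : ∀ {m k} → Graph m → Graph k → Graph (m ℕ.* k)
_□_ {m} {k} G H = record
  { _~_      = λ x y → remQuot k x ~□ remQuot k y
  ; ~-sym    = Sum.map (λ (e , q) → G.~-sym e , sym q) (λ (q , e) → sym q , H.~-sym e)
  ; ~-irrefl = λ { refl (inj₁ (e , _)) → G.~-irrefl refl e
                 ; refl (inj₂ (_ , e)) → H.~-irrefl refl e }
  ; _~?_     = λ x y → remQuot k x ~□? remQuot k y
  }
  where
  module G = Graph G
  module H = Graph H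
  _~□_ : Rel (Fin m × Fin k) 0ℓ
  (a , b) ~□ (a′ , b′) = (a G.~ a′ × b ≡ b′) ⊎ (a ≡ a′ × b H.~ b′)
  _~□?_ : Decidable _~□_
  (a , b) ~□? (a′ , b′) = ((a G.~? a′) ×-dec (b ≟ b′)) ⊎-dec ((a ≟ a′) ×-dec (b H.~? b′))

prism : ∀ ℓ → Graph (2 ℕ.* ℓ ℕ.* 2)
prism ℓ = cycle (2 ℕ.* ℓ) □ complete 2

-- finToFun enumerates all maps between two finite sets.
_⊑?_ : ∀ {k n} (F : Graph k) (G : Graph n) → Dec (F ⊑ G)
_⊑?_ {k} {n} F G = map′
  (λ (c , p) → finToFun c , p)
  (λ (f , p) → funToFin f , respects f p)
  (any? (λ c → isCopy? (finToFun c)))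
  where
  open Graph F renaming (_~_ to _~F_; _~?_ to _~F?_)
  open Graph G renaming (_~_ to _~G_; _~?_ to _~G?_)

  isCopy? : ∀ f → Dec (IsCopy F G f)
  isCopy? f =
    map′ (λ h {u} {v} → h u v) (λ h u v → h {u} {v})
      (all? λ u → all? λ v → (f u ≟ f v) →-dec (u ≟ v))
    ×-dec
    map′ (λ h {u} {v} → h u v) (λ h u v → h {u} {v})
      (all? λ u → all? λ v → (u ~F? v) →-dec (f u ~G? f v))

  respects : ∀ f → IsCopy F G f → IsCopy F G (finToFun (funToFin f))
  respects f (inj , hom) =
    (λ {u} {v} q → inj (trans (sym (eq u)) (trans q (eq v)))) ,
    (λ {u} {v} e → subst₂ _~G_ (sym (eq u)) (sym (eq v)) (hom e))
    where eq = finToFun-funToFin f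

-- The off-diagonal symmetric closure of a 0-1 matrix.
fromMatrix : ∀ {n} → (Fin (n ℕ.* n) → Fin 2) → Graph n
fromMatrix {n} b = record
  { _~_      = λ i j → i ≢ j × (One i j ⊎ One j i)
  ; ~-sym    = λ (i≢j , e) → i≢j ∘ sym , Sum.swap e
  ; ~-irrefl = λ i≡j (i≢j , _) → i≢j i≡j
  ; _~?_     = λ i j → ¬? (i ≟ j) ×-dec ((b (combine i j) ≟ suc zero)
                                          ⊎-dec (b (combine j i) ≟ suc zero))
  }
  where
  One : Rel (Fin n) 0ℓ
  One i j = b (combine i j) ≡ suc zero

graphs : ∀ n → List (Graph n)
graphs n = map (λ c → fromMatrix (finToFun c)) (allFin (2 ^ (n ℕ.* n)))

-- The value is 0 if every graph on n vertices contains F; this does not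
-- happen when F has an edge.
ex : ∀ {k} → ℕ → Graph k → ℕ
ex n F = max 0 (map edges (filter (λ G → ¬? (F ⊑? G)) (graphs n)))

IsExtremal : ∀ {k} → ℕ → Graph k → ℕ → Set₁
IsExtremal n F m = (Σ[ G ∈ Graph n ] (F -Free G × edges G ≡ m))
                 × (∀ (G : Graph n) → F -Free G → edges G ℕ.≤ m)

private
  bit : ∀ {A : Set} → Dec A → Fin 2
  bit (yes _) = suc zero
  bit (no  _) = zero

  bit⁺ : ∀ {A : Set} (d : Dec A) → A → bit d ≡ suc zero
  bit⁺ (yes _) _ = refl
  bit⁺ (no ¬a) a = ⊥-elim (¬a a)

  bit⁻ : ∀ {A : Set} (d : Dec A) → bit d ≡ suc zero → A
  bit⁻ (yes a) _ = a

  matrix : ∀ {n} → Graph n → Fin (n ℕ.* n) → Fin 2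
  matrix {n} G x = bit (uncurry (Graph._~?_ G) (remQuot {n} n x))

  matrix-combine : ∀ {n} (G : Graph n) i j → matrix G (combine i j) ≡ bit (Graph._~?_ G i j)
  matrix-combine {n} G i j =
    cong (λ p → bit (Graph._~?_ G (proj₁ p) (proj₂ p))) (remQuot-combine {n} {n} i j)

  matrix-one : ∀ {n} (G : Graph n) i j → Graph._~_ G i j → matrix G (combine i j) ≡ suc zero
  matrix-one G i j e = trans (matrix-combine G i j) (bit⁺ (Graph._~?_ G i j) e)

  matrix-one⁻ : ∀ {n} (G : Graph n) i j → matrix G (combine i j) ≡ suc zero → Graph._~_ G i j
  matrix-one⁻ G i j q = bit⁻ (Graph._~?_ G i j) (trans (sym (matrix-combine G i j)) q)

  module Representative {n} (G : Graph n) where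
    open Graph G

    c : Fin (2 ^ (n ℕ.* n))
    c = funToFin (matrix G)

    G′ : Graph n
    G′ = fromMatrix (finToFun c)

    open Graph G′ using () renaming (_~_ to _~′_)

    to : ∀ {i j} → i ~ j → i ~′ j
    to {i} {j} e = (λ i≡j → ~-irrefl i≡j e)
                 , inj₁ (trans (finToFun-funToFin (matrix G) (combine i j)) (matrix-one G i j e))

    from : ∀ {i j} → i ~′ j → i ~ j
    from {i} {j} (_ , inj₁ q) =
      matrix-one⁻ G i j (trans (sym (finToFun-funToFin (matrix G) (combine i j))) q)
    from {i} {j} (_ , inj₂ q) =
      ~-sym (matrix-one⁻ G j i (trans (sym (finToFun-funToFin (matrix G) (combine j i))) q))

    edges-≡ : edges G ≡ edges G′
    edges-≡ = cong length (filter-≐ _ _ ((λ (p , e) → p , to e) , (λ (p , e) → p , from e))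
                             (cartesianProduct (allFin n) (allFin n)))

    listed : G′ ∈ graphs n
    listed = ∈-map⁺ _ (∈-allFin c)

  empty : ∀ n → Graph n
  empty n = record
    { _~_ = λ _ _ → ⊥ ; ~-sym = id ; ~-irrefl = λ _ () ; _~?_ = λ _ _ → no id }

ex-isExtremal : ∀ {k} n (F : Graph k) {u v} → Graph._~_ F u v → IsExtremal n F (ex n F)
ex-isExtremal n F e = attained , bound
  where
  free? = λ (G : Graph n) → ¬? (F ⊑? G)
  sizes = map edges (filter free? (graphs n))

  bound : ∀ (G : Graph n) → F -Free G → edges G ℕ.≤ ex n F
  bound G free = subst (ℕ._≤ ex n F) (sym edges-≡)
    (All.lookup (xs≤max 0 sizes) (∈-map⁺ edges (∈-filter⁺ free? listed free′)))
    where
    open Representative G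
    free′ : F -Free G′
    free′ (f , inj , hom) = free (f , inj , λ e → from (hom e))

  attained : Σ[ G ∈ Graph n ] (F -Free G × edges G ≡ ex n F)
  attained with argmax-sel id 0 sizes
  ... | inj₁ q = empty n , empty-free ,
                 trans (ℕₚ.n≤0⇒n≡0 (subst (edges (empty n) ℕ.≤_) q (bound (empty n) empty-free)))
                       (sym q)
    where
    empty-free : F -Free empty n
    empty-free (_ , _ , hom) = hom e
  ... | inj₂ m∈ with ∈-map⁻ edges m∈
  ...   | G , G∈ , q = G , proj₂ (∈-filter⁻ free? {xs = graphs n} G∈) , sym q

ex-prism-isExtremal : ∀ n ℓ .{{_ : NonZero ℓ}} → IsExtremal n (prism ℓ) (ex n (prism ℓ))
ex-prism-isExtremal n (suc ℓ) =
  ex-isExtremal n (prism (suc ℓ)) {zero} {suc zero} (inj₂ (refl , λ ()))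

fromℕ : ℕ → ℚ
fromℕ n = + n ℚ./ 1

-- For c ≥ 0 and natural numbers n and m, the real inequality c n^{3/2} ≤ m
-- amounts to c² n³ ≤ m², and dually for ≥.
_·_^3/2≤_ : ℚ → ℕ → ℕ → Set
c · n ^3/2≤ m = c ℚ.* c ℚ.* fromℕ (n ^ 3) ℚ.≤ fromℕ (m ^ 2)

_≤_·_^3/2 : ℕ → ℚ → ℕ → Set
m ≤ c · n ^3/2 = fromℕ (m ^ 2) ℚ.≤ c ℚ.* c ℚ.* fromℕ (n ^ 3)

{-# OPTIONS --safe #-}
-- Lower bound: the point–line incidence graph of the affine plane over F_p has no 4-cycle,
-- hence no prism, and Chebyshev-type bounds supply primes p within a bounded ratio of √n.
--
-- Upper bound: one may assume the graph almost regular of degree about Δ, where Δ exceeds a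
-- large multiple of √n. A prism is a ring of 2ℓ disjoint rungs (edges), consecutive rungs
-- spanning a 4-cycle. A tight path among the triples in a common neighbourhood N(x , x′),
-- closed up by x and x′, gives such a ring; so without prisms few triples are rich in common
-- neighbours, and most 4-cycles have both diagonals of codegree O(√Δ). Walk on rungs along
-- those 4-cycles. Pairs of rungs joined by many walks of 2 or ℓ − 1 steps would close up to a
-- ring, so such pairs are rare and can be peeled off. From one rung there remain more good
-- ℓ-walks than end rungs can absorb, hence two with the same end and otherwise disjoint, and
-- these bound a ring of 2ℓ rungs.
module Submission where

open import Defs
open import Data.Nat as ℕ hiding (_≟_)
open import Data.Nat.Properties hiding (_≟_)
open import Data.Nat.Divisibility
open import Data.Nat.DivMod
open import Data.Nat.Induction using (<-rec)
open import Data.Nat.ListAction using (product)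
open import Data.Nat.Primality using (Prime; prime?; euclidsLemma; prime⇒nonZero; ¬prime[0]; ¬prime[1])
open import Data.Nat.Primality.Factorisation using (PrimeFactorisation; factorise)
open import Data.Nat.Tactic.RingSolver using (solve-∀)
import Data.Integer.Base as ℤ
import Data.Integer.Properties as ℤₚ
open import Data.Rational as ℚ using (ℚ; 0ℚ; toℚᵘ)
open import Data.Rational.Properties using (toℚᵘ-fromℚᵘ; toℚᵘ-homo-*; toℚᵘ-cancel-≤; positive⁻¹; normalize-pos)
open import Data.Rational.Unnormalised as ℚᵘ using (mkℚᵘ; _≃_; *≤*)
open import Data.Rational.Unnormalised.Properties as ℚᵘₚ using (≃-sym; ≃-trans; ≤-respˡ-≃; ≤-respʳ-≃)
open import Data.Fin.Base as Fin using (Fin; zero; suc; toℕ; fromℕ<; remQuot; combine)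
open import Data.Fin.Properties as Fin using (combine-remQuot; toℕ-injective; toℕ<n; toℕ-fromℕ<)
open import Data.List.Base
  using (List; []; _∷_; _++_; _∷ʳ_; map; filter; length; lookup; reverse; take; drop; allFin; cartesianProduct)
open import Data.List.Properties
  using (unfold-reverse; length-++; length-reverse; length-map; length-take; length-drop; length-tabulate; take++drop≡id)
open import Data.List.Membership.Propositional using (_∈_; _∉_; find; lose)
open import Data.List.Membership.Propositional.Properties
  using (∈-filter⁺; ∈-filter⁻; ∈-cartesianProduct⁺; ∈-allFin; ∈-map⁻; ∈-lookup)
import Data.List.Membership.DecPropositional as DecMem
open import Data.List.Relation.Unary.Any using (Any; here; there; any?)
open import Data.List.Relation.Unary.All as All using (All; []; _∷_)
import Data.List.Relation.Unary.All.Properties as Allₚ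
open import Data.List.Relation.Unary.AllPairs using (AllPairs; []; _∷_; allPairs?)
import Data.List.Relation.Unary.AllPairs.Properties as AllPairsₚ
open import Data.List.Relation.Unary.Unique.Propositional using (Unique)
open import Data.List.Relation.Unary.Unique.Propositional.Properties
  using (filter⁺; map⁺; take⁺; drop⁺; cartesianProduct⁺; allFin⁺)
open import Data.Product using (Σ-syntax; ∃-syntax; _×_; _,_; proj₁; proj₂; swap)
open import Data.Product.Properties using (≡-dec)
open import Data.Sum.Base as Sum using (_⊎_; inj₁; inj₂)
open import Data.Unit.Base using (⊤; tt)
open import Data.Empty using (⊥; ⊥-elim)
open import Function.Base using (_∘_; id; case_of_)
open import Relation.Binary.Definitions using (DecidableEquality)
open import Relation.Binary.PropositionalEquality
open import Relation.Nullary using (¬_; Dec; yes; no)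
open import Relation.Nullary.Decidable using (map′; _×-dec_; _⊎-dec_; ¬?; decidable-stable)

-- Finite sums and peeling

-- The final count is balanced in powers of Δ, and this dictates every threshold. After
-- regularisation n is at most Δ², so at most nΔ ≤ Δ³ rungs can be ends, against order Δ^ℓ walks of
-- ℓ steps from one rung; some end receives order Δ^(ℓ-3) of them. These must outnumber the walks to
-- that end which hit a given rung. A hit in the middle leaves 4Δ rungs to pass through, and since
-- unlinked rungs are joined by fewer than the constant `w` good two-step walks, each piece of i
-- steps has at most `w` Δ^(i-2) choices: order Δ^(ℓ-3) again. A hit next to either end leaves 4θ
-- rungs and a piece of ℓ-1 steps with fixed ends, which has order θ Δ^(ℓ-4) choices once long
-- linked pairs are avoided; so θ² must be O(Δ). Conversely, the Cauchy-Schwarz argument that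
-- discards pairs of codegree above θ needs θ² to be a large multiple of Δ. Hence θ is of order √Δ,
-- and what remains is a comparison of constants.

double : ∀ x → x + x ≡ 2 * x
double = solve-∀

m≤m*m : ∀ m → m ≤ m * m
m≤m*m zero    = z≤n
m≤m*m (suc m) = m≤m+n (suc m) _

m*m≤n*n⇒m≤n : ∀ m n → m * m ≤ n * n → m ≤ n
m*m≤n*n⇒m≤n m n h = ≮⇒≥ λ n<m → <⇒≱ (*-mono-< n<m n<m) h

∑ : {A : Set} → List A → (A → ℕ) → ℕ
∑ []       f = 0
∑ (x ∷ xs) f = f x + ∑ xs f

infix 4 ∑
syntax ∑ xs (λ x → e) = ∑[ x ∈ xs ] e

⟦_⟧ : {P : Set} → Dec P → ℕ
⟦ yes _ ⟧ = 1
⟦ no  _ ⟧ = 0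

⟦⟧-≤1 : {P : Set} (p : Dec P) → ⟦ p ⟧ ≤ 1
⟦⟧-≤1 (yes _) = ≤-refl
⟦⟧-≤1 (no _)  = z≤n

⟦⟧-mono : {P Q : Set} (p : Dec P) (q : Dec Q) → (P → Q) → ⟦ p ⟧ ≤ ⟦ q ⟧
⟦⟧-mono (yes a) (yes _) f = ≤-refl
⟦⟧-mono (yes a) (no ¬b) f = ⊥-elim (¬b (f a))
⟦⟧-mono (no _)  q       f = z≤n

⟦⟧-cong : {P Q : Set} (p : Dec P) (q : Dec Q) → (P → Q) → (Q → P) → ⟦ p ⟧ ≡ ⟦ q ⟧
⟦⟧-cong p q f g = ≤-antisym (⟦⟧-mono p q f) (⟦⟧-mono q p g)

⟦⟧-yes : {P : Set} (p : Dec P) → P → ⟦ p ⟧ ≡ 1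
⟦⟧-yes (yes _) _ = refl
⟦⟧-yes (no ¬a) a = ⊥-elim (¬a a)

⟦⟧≥1 : {P : Set} (p : Dec P) → P → 1 ≤ ⟦ p ⟧
⟦⟧≥1 p a = ≤-reflexive (sym (⟦⟧-yes p a))

⟦⟧-no : {P : Set} (p : Dec P) → ¬ P → ⟦ p ⟧ ≡ 0
⟦⟧-no (yes a) ¬a = ⊥-elim (¬a a)
⟦⟧-no (no _)  _  = refl

⟦⟧-pos : {P : Set} (p : Dec P) → 0 < ⟦ p ⟧ → P
⟦⟧-pos (yes a) _ = a

⟦⟧-× : {P Q : Set} (p : Dec P) (q : Dec Q) → ⟦ p ×-dec q ⟧ ≡ ⟦ p ⟧ * ⟦ q ⟧
⟦⟧-× (yes _) (yes _) = refl
⟦⟧-× (yes _) (no _)  = refl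
⟦⟧-× (no _)  _       = refl

⟦⟧-∪ : {P Q R : Set} (p : Dec P) (q : Dec Q) (r : Dec R) → (P → Q ⊎ R) → ⟦ p ⟧ ≤ ⟦ q ⟧ + ⟦ r ⟧
⟦⟧-∪ (no _)  q r f = z≤n
⟦⟧-∪ (yes a) q r f with f a
... | inj₁ b = ≤-trans (≤-reflexive (sym (⟦⟧-yes q b))) (m≤m+n _ _)
... | inj₂ c = ≤-trans (≤-reflexive (sym (⟦⟧-yes r c))) (m≤n+m _ _)

⟦⟧-idem : {P : Set} (p : Dec P) → ⟦ p ⟧ * ⟦ p ⟧ ≡ ⟦ p ⟧
⟦⟧-idem (yes _) = refl
⟦⟧-idem (no _)  = refl

⟦⟧-diff : {P Q : Set} (p : Dec P) (q : Dec Q) → ⟦ p ⟧ < ⟦ q ⟧ → Q × ¬ P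
⟦⟧-diff (no ¬a) (yes b) _ = b , ¬a
⟦⟧-diff (yes _) (yes _) (s≤s ())
⟦⟧-diff p (no _) ()

⟦⟧-≤ : {P : Set} (p : Dec P) {n : ℕ} → (P → 1 ≤ n) → ⟦ p ⟧ ≤ n
⟦⟧-≤ (yes a) h = h a
⟦⟧-≤ (no _)  h = z≤n

⟦⟧-scale : {P : Set} (p : Dec P) {a b : ℕ} → (P → a ≤ b) → ⟦ p ⟧ * a ≤ ⟦ p ⟧ * b
⟦⟧-scale (yes x) h = *-monoʳ-≤ 1 (h x)
⟦⟧-scale (no _)  h = z≤n

⟦⟧*≤ : {P : Set} (p : Dec P) {a : ℕ} → ⟦ p ⟧ * a ≤ a
⟦⟧*≤ (yes _) {a} = ≤-reflexive (+-identityʳ a)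
⟦⟧*≤ (no _)      = z≤n

∑-0 : {A : Set} (xs : List A) → ∑ xs (λ _ → 0) ≡ 0
∑-0 []       = refl
∑-0 (x ∷ xs) = ∑-0 xs

∑-+ : {A : Set} (xs : List A) (f g : A → ℕ) → ∑ xs (λ x → f x + g x) ≡ ∑ xs f + ∑ xs g
∑-+ []       f g = refl
∑-+ (x ∷ xs) f g = trans (cong (f x + g x +_) (∑-+ xs f g)) (lem (f x) (g x) (∑ xs f) (∑ xs g))
  where
  lem : ∀ a b c d → a + b + (c + d) ≡ a + c + (b + d)
  lem = solve-∀

∑-++ : {A : Set} (xs ys : List A) (f : A → ℕ) → ∑ (xs ++ ys) f ≡ ∑ xs f + ∑ ys f
∑-++ []       ys f = refl
∑-++ (x ∷ xs) ys f = trans (cong (f x +_) (∑-++ xs ys f)) (sym (+-assoc (f x) _ _))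

∑-map : {A B : Set} (h : B → A) (xs : List B) (f : A → ℕ) → ∑ (map h xs) f ≡ ∑ xs (f ∘ h)
∑-map h []       f = refl
∑-map h (x ∷ xs) f = cong (f (h x) +_) (∑-map h xs f)

module _ {A : Set} where

  ∑-mono∈ : (xs : List A) {f g : A → ℕ} → (∀ {x} → x ∈ xs → f x ≤ g x) → ∑ xs f ≤ ∑ xs g
  ∑-mono∈ []       h = z≤n
  ∑-mono∈ (x ∷ xs) h = +-mono-≤ (h (here refl)) (∑-mono∈ xs (h ∘ there))

  ∑-mono : (xs : List A) {f g : A → ℕ} → (∀ x → f x ≤ g x) → ∑ xs f ≤ ∑ xs g
  ∑-mono xs h = ∑-mono∈ xs (λ {x} _ → h x)

  ∑-cong : (xs : List A) {f g : A → ℕ} → (∀ x → f x ≡ g x) → ∑ xs f ≡ ∑ xs g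
  ∑-cong []       h = refl
  ∑-cong (x ∷ xs) h = cong₂ _+_ (h x) (∑-cong xs h)

  ∑-const : (xs : List A) (c : ℕ) → ∑ xs (λ _ → c) ≡ length xs * c
  ∑-const []       c = refl
  ∑-const (x ∷ xs) c = cong (c +_) (∑-const xs c)

  ∑-≤const : (xs : List A) {f : A → ℕ} (c : ℕ) → (∀ x → f x ≤ c) → ∑ xs f ≤ length xs * c
  ∑-≤const xs c h = ≤-trans (∑-mono xs h) (≤-reflexive (∑-const xs c))

  ∑-*ˡ : (xs : List A) (c : ℕ) (f : A → ℕ) → ∑ xs (λ x → c * f x) ≡ c * ∑ xs f
  ∑-*ˡ []       c f = sym (*-zeroʳ c)
  ∑-*ˡ (x ∷ xs) c f = trans (cong (c * f x +_) (∑-*ˡ xs c f)) (sym (*-distribˡ-+ c (f x) _))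

  ∑-*ʳ : (xs : List A) (f : A → ℕ) (c : ℕ) → ∑ xs (λ x → f x * c) ≡ ∑ xs f * c
  ∑-*ʳ xs f c = trans (∑-cong xs (λ x → *-comm (f x) c)) (trans (∑-*ˡ xs c f) (*-comm c _))

  ∑-swap : {B : Set} (xs : List A) (ys : List B) (f : A → B → ℕ) →
           (∑[ x ∈ xs ] ∑[ y ∈ ys ] f x y) ≡ (∑[ y ∈ ys ] ∑[ x ∈ xs ] f x y)
  ∑-swap []       ys f = sym (∑-0 ys)
  ∑-swap (x ∷ xs) ys f = trans (cong (∑ ys (f x) +_) (∑-swap xs ys f)) (sym (∑-+ ys (f x) _))

  ∑-⊗ : {B : Set} (xs : List A) (ys : List B) (f : A × B → ℕ) →
        ∑ (cartesianProduct xs ys) f ≡ (∑[ x ∈ xs ] ∑[ y ∈ ys ] f (x , y))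
  ∑-⊗ []       ys f = refl
  ∑-⊗ (x ∷ xs) ys f =
    trans (∑-++ (map (x ,_) ys) (cartesianProduct xs ys) f)
          (cong₂ _+_ (∑-map (x ,_) ys f) (∑-⊗ xs ys f))

  ∑-filter : {P : A → Set} (P? : ∀ x → Dec (P x)) (xs : List A) (f : A → ℕ) →
             ∑ (filter P? xs) f ≡ (∑[ x ∈ xs ] ⟦ P? x ⟧ * f x)
  ∑-filter P? []       f = refl
  ∑-filter P? (x ∷ xs) f with P? x
  ... | yes _ = cong₂ _+_ (sym (+-identityʳ _)) (∑-filter P? xs f)
  ... | no  _ = ∑-filter P? xs f

  length-filter : {P : A → Set} (P? : ∀ x → Dec (P x)) (xs : List A) →
                  length (filter P? xs) ≡ (∑[ x ∈ xs ] ⟦ P? x ⟧)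
  length-filter P? []       = refl
  length-filter P? (x ∷ xs) with P? x
  ... | yes _ = cong suc (length-filter P? xs)
  ... | no  _ = length-filter P? xs

  ∑-single : (xs : List A) (f : A → ℕ) {x : A} → x ∈ xs → f x ≤ ∑ xs f
  ∑-single (x ∷ xs) f (here refl) = m≤m+n _ _
  ∑-single (x ∷ xs) f (there p)   = ≤-trans (∑-single xs f p) (m≤n+m _ _)

  ∑-< : (xs : List A) (f g : A → ℕ) → ∑ xs f < ∑ xs g → ∃[ x ] (x ∈ xs × f x < g x)
  ∑-< (x ∷ xs) f g h with f x <? g x
  ... | yes p = x , here refl , p
  ... | no ¬p with ∑-< xs f g (+-cancelˡ-< (f x) _ _ (<-≤-trans h (+-monoˡ-≤ _ (≮⇒≥ ¬p))))
  ...   | y , y∈ , q = y , there y∈ , q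

  ∑-pos : (xs : List A) (f : A → ℕ) → 0 < ∑ xs f → ∃[ x ] (x ∈ xs × 0 < f x)
  ∑-pos xs f h = ∑-< xs (λ _ → 0) f (subst (_< ∑ xs f) (sym (∑-0 xs)) h)

  avoid : {P Q : A → Set} (P? : ∀ x → Dec (P x)) (Q? : ∀ x → Dec (Q x)) (xs : List A) →
          (∑[ x ∈ xs ] ⟦ Q? x ⟧) < (∑[ x ∈ xs ] ⟦ P? x ⟧) → ∃[ x ] (x ∈ xs × P x × ¬ Q x)
  avoid P? Q? xs h with ∑-< xs _ _ h
  ... | x , x∈ , q = x , x∈ , ⟦⟧-diff (Q? x) (P? x) q

  ∑-δ : (_≟_ : DecidableEquality A) {xs : List A} → Unique xs → ∀ x (g : A → ℕ) →
        (∑[ a ∈ xs ] ⟦ a ≟ x ⟧ * g a) ≤ g x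
  ∑-δ _≟_ []        x g = z≤n
  ∑-δ _≟_ {y ∷ ys} (y∉ ∷ u) x g with y ≟ x
  ... | no _     = ∑-δ _≟_ u x g
  ... | yes refl = ≤-reflexive (trans (cong₂ _+_ (+-identityʳ (g y)) (rest ys y∉)) (+-identityʳ _))
    where
    rest : ∀ ys → All (y ≢_) ys → (∑[ a ∈ ys ] ⟦ a ≟ y ⟧ * g a) ≡ 0
    rest []       []       = refl
    rest (z ∷ zs) (p ∷ ps) = trans (cong (λ k → k * g z + (∑[ a ∈ zs ] ⟦ a ≟ y ⟧ * g a)) (⟦⟧-no (z ≟ y) (p ∘ sym))) (rest zs ps)

  ∑-δ≤ : (_≟_ : DecidableEquality A) {xs : List A} → Unique xs → ∀ x →
         (∑[ a ∈ xs ] ⟦ a ≟ x ⟧) ≤ 1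
  ∑-δ≤ _≟_ {xs} u x = ≤-trans (≤-reflexive (∑-cong xs (λ a → sym (*-identityʳ _)))) (∑-δ _≟_ u x (λ _ → 1))

  cauchy-schwarz : (xs : List A) (f g : A → ℕ) →
    (∑[ x ∈ xs ] f x * g x) * (∑[ x ∈ xs ] f x * g x) ≤ (∑[ x ∈ xs ] f x * f x) * (∑[ x ∈ xs ] g x * g x)
  cauchy-schwarz [] f g = z≤n
  cauchy-schwarz (x ∷ xs) f g = begin
    (a * b + h) * (a * b + h)                     ≡⟨ e₁ a b h ⟩
    (a * b) * (a * b) + 2 * (a * b * h) + h * h   ≤⟨ +-mono-≤ (+-monoʳ-≤ ((a * b) * (a * b)) (cross a b h F G ih)) ih ⟩
    (a * b) * (a * b) + (a * a * G + b * b * F) + F * G ≡⟨ e₂ a b F G ⟩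
    (a * a + F) * (b * b + G)                     ∎
    where
    open ≤-Reasoning
    a = f x
    b = g x
    h = ∑[ x ∈ xs ] f x * g x
    F = ∑[ x ∈ xs ] f x * f x
    G = ∑[ x ∈ xs ] g x * g x
    ih : h * h ≤ F * G
    ih = cauchy-schwarz xs f g
    e₁ : ∀ a b h → (a * b + h) * (a * b + h) ≡ (a * b) * (a * b) + 2 * (a * b * h) + h * h
    e₁ = solve-∀
    e₂ : ∀ a b F G → (a * b) * (a * b) + (a * a * G + b * b * F) + F * G ≡ (a * a + F) * (b * b + G)
    e₂ = solve-∀
    amgm : ∀ p q → 4 * (p * q) ≤ (p + q) * (p + q)
    amgm p q with ≤-total p q
    ... | inj₁ p≤q with m≤n⇒∃[o]m+o≡n p≤q
    ...   | o , refl = ≤-trans (m≤m+n _ (o * o)) (≤-reflexive (lem p o))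
      where
      lem : ∀ p o → 4 * (p * (p + o)) + o * o ≡ (p + (p + o)) * (p + (p + o))
      lem = solve-∀
    amgm p q | inj₂ q≤p with m≤n⇒∃[o]m+o≡n q≤p
    ...   | o , refl = ≤-trans (m≤m+n _ (o * o)) (≤-reflexive (lem q o))
      where
      lem : ∀ p o → 4 * ((p + o) * p) + o * o ≡ (p + o + p) * (p + o + p)
      lem = solve-∀
    -- The mixed term is compared through squares: h² ≤ FG comes from induction, and AM-GM applied
    -- to a²G and b²F does the rest, without roots or subtraction.
    cross : ∀ a b h F G → h * h ≤ F * G → 2 * (a * b * h) ≤ a * a * G + b * b * F
    cross a b h F G hh = m*m≤n*n⇒m≤n _ _ (begin
      (2 * (a * b * h)) * (2 * (a * b * h))      ≡⟨ l₁ a b h ⟩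
      4 * ((a * b) * (a * b)) * (h * h)          ≤⟨ *-monoʳ-≤ (4 * ((a * b) * (a * b))) hh ⟩
      4 * ((a * b) * (a * b)) * (F * G)          ≡⟨ l₂ a b F G ⟩
      4 * ((a * a * G) * (b * b * F))            ≤⟨ amgm (a * a * G) (b * b * F) ⟩
      (a * a * G + b * b * F) * (a * a * G + b * b * F) ∎)
      where
      l₁ : ∀ a b h → (2 * (a * b * h)) * (2 * (a * b * h)) ≡ 4 * ((a * b) * (a * b)) * (h * h)
      l₁ = solve-∀
      l₂ : ∀ a b F G → 4 * ((a * b) * (a * b)) * (F * G) ≡ 4 * ((a * a * G) * (b * b * F))
      l₂ = solve-∀

  ∑² : (xs : List A) (f : A → ℕ) → ∑ xs f * ∑ xs f ≤ length xs * (∑[ x ∈ xs ] f x * f x)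
  ∑² xs f = begin
    ∑ xs f * ∑ xs f ≡⟨ cong (λ s → s * s) (∑-cong xs (λ x → sym (+-identityʳ (f x)))) ⟩
    (∑[ x ∈ xs ] 1 * f x) * (∑[ x ∈ xs ] 1 * f x) ≤⟨ cauchy-schwarz xs (λ _ → 1) f ⟩
    (∑[ x ∈ xs ] 1 * 1) * (∑[ x ∈ xs ] f x * f x) ≡⟨ cong (_* (∑[ x ∈ xs ] f x * f x)) (trans (∑-const xs 1) (*-identityʳ (length xs))) ⟩
    length xs * (∑[ x ∈ xs ] f x * f x) ∎
    where open ≤-Reasoning

∑-* : {A B : Set} (xs : List A) (ys : List B) (f : A → ℕ) (g : B → ℕ) →
      ∑ xs f * ∑ ys g ≡ (∑[ x ∈ xs ] ∑[ y ∈ ys ] f x * g y)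
∑-* xs ys f g = trans (sym (∑-*ʳ xs f (∑ ys g))) (∑-cong xs (λ x → sym (∑-*ˡ ys (f x) g)))

∑-swap₂ : {A B : Set} (xs : List A) (ys : List B) (f : A → A → B → B → ℕ) →
  (∑[ x ∈ xs ] ∑[ x′ ∈ xs ] ∑[ y ∈ ys ] ∑[ y′ ∈ ys ] f x x′ y y′) ≡
  (∑[ y ∈ ys ] ∑[ y′ ∈ ys ] ∑[ x ∈ xs ] ∑[ x′ ∈ xs ] f x x′ y y′)
∑-swap₂ xs ys f =
  trans (∑-cong xs (λ x → trans (∑-swap xs ys _) (∑-cong ys (λ y → ∑-swap xs ys _))))
  (trans (∑-swap xs ys _) (∑-cong ys (λ y → ∑-swap xs ys _)))

-- Both sides are the weighted number of closed walks x y x′ y′ in a bipartite graph: the trace of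
-- (m mᵀ)² equals that of (mᵀ m)².
gram : {A B : Set} (xs : List A) (ys : List B) (m : A → B → ℕ) →
  (∑[ x ∈ xs ] ∑[ x′ ∈ xs ] (∑[ y ∈ ys ] m x y * m x′ y) * (∑[ y ∈ ys ] m x y * m x′ y)) ≡
  (∑[ y ∈ ys ] ∑[ y′ ∈ ys ] (∑[ x ∈ xs ] m x y * m x y′) * (∑[ x ∈ xs ] m x y * m x y′))
gram xs ys m =
  trans (∑-cong xs (λ x → ∑-cong xs (λ x′ → ∑-* ys ys _ _)))
  (trans (∑-swap₂ xs ys (λ x x′ y y′ → (m x y * m x′ y) * (m x y′ * m x′ y′)))
  (∑-cong ys (λ y → ∑-cong ys (λ y′ →
    trans (∑-cong xs (λ x → ∑-cong xs (λ x′ → lem (m x y) (m x′ y) (m x y′) (m x′ y′))))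
          (sym (∑-* xs xs _ _))))))
  where
  lem : ∀ a b c d → (a * b) * (c * d) ≡ (a * c) * (b * d)
  lem = solve-∀

module _ {A C : Set} {Inc : A → C → Set} (inc? : ∀ x c → Dec (Inc x c)) (xs : List A) where

  degree : {P : A → Set} (P? : ∀ x → Dec (P x)) → C → ℕ
  degree P? c = ∑[ x ∈ xs ] ⟦ P? x ×-dec inc? x c ⟧

  private
    extract : {P : C → Set} {cs : List C} → Any P cs →
      ∃[ c ] ∃[ cs′ ] (P c × length cs ≡ suc (length cs′) × (∀ {d} → d ∈ cs → d ≡ c ⊎ d ∈ cs′))
    extract {cs = c ∷ cs} (here p) =
      c , cs , p , refl , λ { (here q) → inj₁ q ; (there q) → inj₂ q }
    extract {cs = c ∷ cs} (there ps) with extract ps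
    ... | d , cs′ , p , q , r = d , c ∷ cs′ , p , cong suc q ,
          λ { (here refl) → inj₂ (here refl)
            ; (there s) → case r s of λ { (inj₁ e) → inj₁ e ; (inj₂ e) → inj₂ (there e) } }

  -- A class of degree between 1 and m is emptied by discarding its at most m items; it stays empty
  -- from then on and can be struck off the list. So k classes cost at most m * k items, fewer than
  -- there are.
  peel : (m k : ℕ) (cs : List C) {P : A → Set} (P? : ∀ x → Dec (P x)) → length cs ≡ k →
    m * k < (∑[ x ∈ xs ] ⟦ P? x ⟧) →
    Σ[ Q ∈ (A → Set) ] Σ[ Q? ∈ (∀ x → Dec (Q x)) ]
      ((∀ {x} → Q x → P x) × 0 < (∑[ x ∈ xs ] ⟦ Q? x ⟧)
      × (∀ {c} → c ∈ cs → 0 < degree Q? c → m < degree Q? c))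
  peel m k cs {P} P? eq h with any? (λ c → (0 <? degree P? c) ×-dec (degree P? c ≤? m)) cs
  ... | no ¬bad = P , P? , id , ≤-<-trans z≤n h ,
        λ {c} c∈ pos → ≰⇒> (λ le → ¬bad (lose′ c∈ (pos , le)))
    where
    lose′ : ∀ {R : C → Set} {c cs} → c ∈ cs → R c → Any R cs
    lose′ (here refl) r = here r
    lose′ (there p)   r = there (lose′ p r)
  ... | yes bad with extract bad
  peel m zero    cs {P} P? eq h | yes bad | c , cs′ , _ , eq′ , _ = case trans (sym eq) eq′ of λ ()
  peel m (suc k) cs {P} P? eq h | yes bad | c , cs′ , (_ , le) , eq′ , split
    with peel m k cs′ {λ x → P x × ¬ Inc x c} (λ x → P? x ×-dec ¬? (inc? x c))
           (suc-injective (trans (sym eq′) eq)) bound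
    where
    bound : m * k < (∑[ x ∈ xs ] ⟦ P? x ×-dec ¬? (inc? x c) ⟧)
    bound = +-cancelˡ-< m _ _ (begin-strict
      m + m * k                        ≡⟨ sym (*-suc m k) ⟩
      m * suc k                        <⟨ h ⟩
      (∑[ x ∈ xs ] ⟦ P? x ⟧)           ≤⟨ ∑-mono xs (λ x → ⟦⟧-∪ (P? x) (P? x ×-dec inc? x c) (P? x ×-dec ¬? (inc? x c)) (λ p → dichotomy p (inc? x c))) ⟩
      (∑[ x ∈ xs ] ⟦ P? x ×-dec inc? x c ⟧ + ⟦ P? x ×-dec ¬? (inc? x c) ⟧) ≡⟨ ∑-+ xs _ _ ⟩
      degree P? c + (∑[ x ∈ xs ] ⟦ P? x ×-dec ¬? (inc? x c) ⟧) ≤⟨ +-monoˡ-≤ _ le ⟩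
      m + (∑[ x ∈ xs ] ⟦ P? x ×-dec ¬? (inc? x c) ⟧) ∎)
      where
      open ≤-Reasoning
      dichotomy : ∀ {X Y : Set} → X → Dec Y → (X × Y) ⊎ (X × ¬ Y)
      dichotomy x (yes y) = inj₁ (x , y)
      dichotomy x (no ¬y) = inj₂ (x , ¬y)
  ... | Q , Q? , Q⊆ , pos , big = Q , Q? , proj₁ ∘ Q⊆ , pos , λ {d} d∈ → final (split d∈)
    where
    final : ∀ {d} → d ≡ c ⊎ d ∈ cs′ → 0 < degree Q? d → m < degree Q? d
    final (inj₂ d∈) = big d∈
    final (inj₁ refl) pos with ∑-pos xs _ pos
    ... | x , _ , q with ⟦⟧-pos (Q? x ×-dec inc? x c) q
    ...   | qx , i = ⊥-elim (proj₂ (Q⊆ qx) i)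

module Endpoints {A : Set} (_≟_ : DecidableEquality A) {xs : List A} (u : Unique xs) where

  End : A × A → A → Set
  End (f , f′) c = f ≡ c ⊎ f′ ≡ c

  abstract
    End? : ∀ p c → Dec (End p c)
    End? (f , f′) c = (f ≟ c) ⊎-dec (f′ ≟ c)

  pairs : List (A × A)
  pairs = cartesianProduct xs xs

  -- A surviving pair may carry c in either coordinate, and either way its other coordinate is an
  -- `E`-successor of c; hence the factor 2.
  degree≤ : {Q : A × A → Set} (Q? : ∀ p → Dec (Q p)) {E : A → A → Set} (E? : ∀ f g → Dec (E f g)) →
    (∀ {f f′} → Q (f , f′) → E f f′) → (∀ {f f′} → Q (f , f′) → E f′ f) →
    ∀ c → degree End? pairs Q? c ≤ 2 * (∑[ f ∈ xs ] ⟦ E? c f ⟧)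
  degree≤ {Q} Q? {E} E? fwd bwd c = begin
    degree End? pairs Q? c ≡⟨ ∑-⊗ xs xs (λ p → ⟦ Q? p ×-dec End? p c ⟧) ⟩
    (∑[ f ∈ xs ] ∑[ f′ ∈ xs ] ⟦ Q? (f , f′) ×-dec End? (f , f′) c ⟧) ≤⟨ ∑-mono xs (λ f → ∑-mono xs λ f′ → pt f f′) ⟩
    (∑[ f ∈ xs ] ∑[ f′ ∈ xs ] ⟦ f ≟ c ⟧ * e f′ + ⟦ f′ ≟ c ⟧ * e f)
      ≡⟨ trans (∑-cong xs (λ f → ∑-+ xs _ _)) (∑-+ xs _ _) ⟩
    (∑[ f ∈ xs ] ∑[ f′ ∈ xs ] ⟦ f ≟ c ⟧ * e f′) + (∑[ f ∈ xs ] ∑[ f′ ∈ xs ] ⟦ f′ ≟ c ⟧ * e f)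
      ≤⟨ +-mono-≤ (≤-trans (≤-reflexive (∑-cong xs (λ f → ∑-*ˡ xs ⟦ f ≟ c ⟧ e))) (∑-δ _≟_ u c (λ _ → ∑ xs e)))
                  (∑-mono xs (λ f → ∑-δ _≟_ u c (λ _ → e f))) ⟩
    ∑ xs e + ∑ xs e ≡⟨ double (∑ xs e) ⟩
    2 * ∑ xs e ∎
    where
    open ≤-Reasoning
    e : A → ℕ
    e f = ⟦ E? c f ⟧
    pt : ∀ f f′ → ⟦ Q? (f , f′) ×-dec End? (f , f′) c ⟧ ≤ ⟦ f ≟ c ⟧ * e f′ + ⟦ f′ ≟ c ⟧ * e f
    pt f f′ = ⟦⟧-≤ (Q? (f , f′) ×-dec End? (f , f′) c) go
      where
      go : Q (f , f′) × End (f , f′) c → 1 ≤ ⟦ f ≟ c ⟧ * e f′ + ⟦ f′ ≟ c ⟧ * e f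
      go (q , inj₁ refl) = ≤-trans (*-mono-≤ (⟦⟧≥1 (f ≟ f) refl) (⟦⟧≥1 (E? f f′) (fwd q))) (m≤m+n _ _)
      go (q , inj₂ refl) = ≤-trans (*-mono-≤ (⟦⟧≥1 (f′ ≟ f′) refl) (⟦⟧≥1 (E? f′ f) (bwd q))) (m≤n+m _ (⟦ f ≟ f′ ⟧ * e f′))

-- Ladders and rings

Rung : Set → Set
Rung V = V × V

Disj : {V : Set} → Rung V → Rung V → Set
Disj (x , y) (x′ , y′) = x ≢ x′ × x ≢ y′ × y ≢ x′ × y ≢ y′

Disj-sym : {V : Set} {e f : Rung V} → Disj e f → Disj f e
Disj-sym (a , b , c , d) = a ∘ sym , c ∘ sym , b ∘ sym , d ∘ sym

AllPairs-∷ʳ : {A : Set} {R : A → A → Set} → (∀ {x y} → R x y → R y x) →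
              ∀ {xs x} → AllPairs R xs → All (R x) xs → AllPairs R (xs ∷ʳ x)
AllPairs-∷ʳ s p a = AllPairsₚ.++⁺ p ([] ∷ []) (All.map (λ r → s r ∷ []) a)

All-reverse : {A : Set} {P : A → Set} → ∀ xs → All P xs → All P (reverse xs)
All-reverse []       []       = []
All-reverse (x ∷ xs) (p ∷ ps) rewrite unfold-reverse x xs = Allₚ.++⁺ (All-reverse xs ps) (p ∷ [])

AllPairs-reverse : {A : Set} {R : A → A → Set} → (∀ {x y} → R x y → R y x) →
                   ∀ xs → AllPairs R xs → AllPairs R (reverse xs)
AllPairs-reverse s []       []       = []
AllPairs-reverse s (x ∷ xs) (p ∷ ps) rewrite unfold-reverse x xs =
  AllPairs-∷ʳ s (AllPairs-reverse s xs ps) (All-reverse xs p)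

AllPairs-lookup : {A : Set} {R : A → A → Set} → (∀ {x y} → R x y → R y x) →
                  ∀ {xs} → AllPairs R xs → ∀ i j → i ≢ j → R (lookup xs i) (lookup xs j)
AllPairs-lookup s (p ∷ ps) zero    zero    n = ⊥-elim (n refl)
AllPairs-lookup s (p ∷ ps) zero    (suc j) n = All.lookup p (∈-lookup j)
AllPairs-lookup s (p ∷ ps) (suc i) zero    n = s (AllPairs-lookup s (p ∷ ps) zero (suc i) (n ∘ sym))
AllPairs-lookup s (p ∷ ps) (suc i) (suc j) n = AllPairs-lookup s ps i j (n ∘ cong suc)

module Rings {V : Set} (_~_ : V → V → Set) (~-sym : ∀ {x y} → x ~ y → y ~ x) where

  -- Consecutive rungs of a ladder are written with their ends exchanged, so
  -- that first ends are joined to second ends; along an even ring this undoes itself.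
  Cross : Rung V → Rung V → Set
  Cross (x , y) (x′ , y′) = (x ~ y′) × (x′ ~ y)

  IsRung : Rung V → Set
  IsRung (x , y) = x ~ y

  Cross-sym : ∀ {e f} → Cross e f → Cross f e
  Cross-sym (a , b) = b , a

  data Walk (e : Rung V) : List (Rung V) → Rung V → Set where
    step : ∀ {f} → Cross e f → Walk e [] f
    cons : ∀ {g is f} → IsRung g → Cross e g → Walk g is f → Walk e (g ∷ is) f

  _++ʷ_ : ∀ {e is g js f} → Walk e is g → IsRung g × Walk g js f → Walk e (is ++ g ∷ js) f
  step c       ++ʷ (r , w) = cons r c w
  cons r c w   ++ʷ v       = cons r c (w ++ʷ v)

  reverseʷ : ∀ {e is f} → Walk e is f → Walk f (reverse is) e
  reverseʷ (step c) = step (Cross-sym c)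
  reverseʷ (cons {g} {is} r c w) rewrite unfold-reverse g is =
    reverseʷ w ++ʷ (r , step (Cross-sym c))

  record Ring (m : ℕ) : Set where
    constructor mkRing
    field
      base     : Rung V
      inner    : List (Rung V)
      walk     : Walk base inner base
      isRung   : IsRung base
      disjoint : AllPairs Disj (base ∷ inner)
      size     : suc (length inner) ≡ m

  rungs : ∀ {e is f} → Walk e is f → All IsRung is
  rungs (step _)     = []
  rungs (cons r _ w) = r ∷ rungs w

  ringOfTwo : ∀ {m e is f js} → IsRung e → IsRung f → Walk e is f → Walk e js f →
              AllPairs Disj (e ∷ is ++ f ∷ js) → suc (length is) + suc (length js) ≡ m → Ring m
  ringOfTwo {m} {e} {is} {f} {js} re rf w v (pe ∷ p) len =
    mkRing e (is ++ f ∷ reverse js) (w ++ʷ (rf , reverseʷ v)) re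
      (swapTail is pe ∷ go is p)
      (trans (cong suc (trans (length-++ is) (cong (λ k → length is + suc k) (length-reverse js)))) len)
    where
    swapTail : ∀ {P : Rung V → Set} is → All P (is ++ f ∷ js) → All P (is ++ f ∷ reverse js)
    swapTail []       (q ∷ qs) = q ∷ All-reverse js qs
    swapTail (i ∷ is) (q ∷ qs) = q ∷ swapTail is qs
    go : ∀ is → AllPairs Disj (is ++ f ∷ js) → AllPairs Disj (is ++ f ∷ reverse js)
    go []       (q ∷ qs) = All-reverse js q ∷ AllPairs-reverse Disj-sym js qs
    go (i ∷ is) (q ∷ qs) = swapTail is q ∷ go is qs

module _ {n : ℕ} (G : Graph n) where
  open Graph G
  open Rings {Fin n} _~_ ~-sym

  private
    flip : Fin 2 → Fin 2
    flip zero       = suc zero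
    flip (suc zero) = zero

    par : ℕ → Fin 2
    par zero    = zero
    par (suc k) = flip (par k)

    flip² : ∀ p → flip (flip p) ≡ p
    flip² zero       = refl
    flip² (suc zero) = refl

    parity-even : ∀ ℓ → par (2 * ℓ) ≡ zero
    parity-even zero    = refl
    parity-even (suc ℓ) = trans (cong (flip ∘ par) (+-suc ℓ (ℓ + 0)))
                                (trans (flip² _) (parity-even ℓ))

    -- `end p s e` is the end of `e` on side `s` of the prism, where `p` is the parity of its
    -- position: odd rungs are stored with their ends exchanged.
    end : Fin 2 → Fin 2 → Rung (Fin n) → Fin n
    end zero       zero       (x , y) = x
    end zero       (suc zero) (x , y) = y
    end (suc zero) zero       (x , y) = y
    end (suc zero) (suc zero) (x , y) = x

    end-rung : ∀ p {s s′} e → s ≢ s′ → IsRung e → end p s e ~ end p s′ e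
    end-rung p {zero}     {zero}     e n r = ⊥-elim (n refl)
    end-rung p {suc zero} {suc zero} e n r = ⊥-elim (n refl)
    end-rung zero       {zero}     {suc zero} e n r = r
    end-rung (suc zero) {zero}     {suc zero} e n r = ~-sym r
    end-rung zero       {suc zero} {zero}     e n r = ~-sym r
    end-rung (suc zero) {suc zero} {zero}     e n r = r

    end-cross : ∀ p s e f → Cross e f → end p s e ~ end (flip p) s f
    end-cross zero       zero       e f (a , b) = a
    end-cross zero       (suc zero) e f (a , b) = ~-sym b
    end-cross (suc zero) zero       e f (a , b) = ~-sym b
    end-cross (suc zero) (suc zero) e f (a , b) = a

    end-disj : ∀ p p′ s s′ e f → Disj e f → end p s e ≢ end p′ s′ f
    end-disj zero       zero       zero       zero       e f (a , b , c , d) = a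
    end-disj zero       zero       zero       (suc zero) e f (a , b , c , d) = b
    end-disj zero       zero       (suc zero) zero       e f (a , b , c , d) = c
    end-disj zero       zero       (suc zero) (suc zero) e f (a , b , c , d) = d
    end-disj zero       (suc zero) zero       zero       e f (a , b , c , d) = b
    end-disj zero       (suc zero) zero       (suc zero) e f (a , b , c , d) = a
    end-disj zero       (suc zero) (suc zero) zero       e f (a , b , c , d) = d
    end-disj zero       (suc zero) (suc zero) (suc zero) e f (a , b , c , d) = c
    end-disj (suc zero) zero       zero       zero       e f (a , b , c , d) = c
    end-disj (suc zero) zero       zero       (suc zero) e f (a , b , c , d) = d
    end-disj (suc zero) zero       (suc zero) zero       e f (a , b , c , d) = a
    end-disj (suc zero) zero       (suc zero) (suc zero) e f (a , b , c , d) = b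
    end-disj (suc zero) (suc zero) zero       zero       e f (a , b , c , d) = d
    end-disj (suc zero) (suc zero) zero       (suc zero) e f (a , b , c , d) = c
    end-disj (suc zero) (suc zero) (suc zero) zero       e f (a , b , c , d) = b
    end-disj (suc zero) (suc zero) (suc zero) (suc zero) e f (a , b , c , d) = a

    end-inj : ∀ p {s s′} e → IsRung e → end p s e ≡ end p s′ e → s ≡ s′
    end-inj p {zero}     {zero}     e r q = refl
    end-inj p {suc zero} {suc zero} e r q = refl
    end-inj p {zero}     {suc zero} e r q = ⊥-elim (~-irrefl q (end-rung p e (λ ()) r))
    end-inj p {suc zero} {zero}     e r q = ⊥-elim (~-irrefl q (end-rung p e (λ ()) r))

    walk-next : ∀ {e is f} → Walk e is f → ∀ i j → suc (toℕ i) ≡ toℕ j →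
                Cross (lookup (e ∷ is) i) (lookup (e ∷ is) j)
    walk-next (step c)     zero    zero          ()
    walk-next (cons r c w) zero    zero          ()
    walk-next (cons r c w) zero    (suc zero)    q = c
    walk-next (cons r c w) zero    (suc (suc j)) ()
    walk-next (cons r c w) (suc i) (suc j)       q = walk-next w i j (suc-injective q)

    walk-last : ∀ {e is f} → Walk e is f → ∀ i → suc (toℕ i) ≡ suc (length is) →
                Cross (lookup (e ∷ is) i) f
    walk-last (step c)     zero    q = c
    walk-last (cons r c w) zero    ()
    walk-last (cons r c w) (suc i) q = walk-last w i (suc-injective q)

    lookup-zero : ∀ {A : Set} (x : A) xs i → toℕ i ≡ 0 → lookup (x ∷ xs) i ≡ x
    lookup-zero x xs zero q = refl

  ring⇒prism : ∀ {ℓ} → Ring (2 * ℓ) → prism ℓ ⊑ G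
  ring⇒prism {ℓ} (mkRing e is w r dis size) =
    subst (λ m → (cycle m □ complete 2) ⊑ G) size (f , inj , λ {u} {v} → hom {u} {v})
    where
    m = suc (length is)

    at : Fin m → Rung (Fin n)
    at = lookup (e ∷ is)

    at-rung : ∀ i → IsRung (at i)
    at-rung zero    = r
    at-rung (suc i) = go (rungs w) i
      where
      go : ∀ {is} → All IsRung is → ∀ i → IsRung (lookup is i)
      go (p ∷ ps) zero    = p
      go (p ∷ ps) (suc i) = go ps i

    place : Fin m × Fin 2 → Fin n
    place (i , s) = end (par (toℕ i)) s (at i)

    f : Fin (m * 2) → Fin n
    f u = place (remQuot 2 u)

    place-inj : ∀ a b → place a ≡ place b → a ≡ b
    place-inj (i , s) (j , t) q with i Fin.≟ j
    ... | yes refl = cong (i ,_) (end-inj (par (toℕ i)) (at i) (at-rung i) q)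
    ... | no i≢j = ⊥-elim (end-disj (par (toℕ i)) (par (toℕ j)) s t (at i) (at j) (AllPairs-lookup Disj-sym dis i j i≢j) q)

    inj : ∀ {u v} → f u ≡ f v → u ≡ v
    inj {u} {v} q = trans (sym (combine-remQuot {m} 2 u))
      (trans (cong (λ (i , s) → combine i s) (place-inj (remQuot 2 u) (remQuot 2 v) q)) (combine-remQuot {m} 2 v))

    next-cross : ∀ {i j} → Next i j → Cross (at i) (at j)
    next-cross {i} {j} (inj₁ q)        = walk-next w i j q
    next-cross {i} {j} (inj₂ (q , q′)) = subst (Cross (at i)) (sym (lookup-zero e is j q′)) (walk-last w i q)

    next-parity : ∀ {i j} → Next {m} i j → par (toℕ j) ≡ flip (par (toℕ i))
    next-parity {i} {j} (inj₁ q)        = cong par (sym q)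
    -- At the wrap-around the even length enters: the last position is odd and the first is even, so
    -- the exchange of ends is consistent around the ring.
    next-parity {i} {j} (inj₂ (q , q′)) =
      trans (cong par q′) (sym (trans (cong par (trans q size)) (parity-even ℓ)))

    along : ∀ {i j} s → Next i j → place (i , s) ~ place (j , s)
    along {i} {j} s nx = subst (λ p → place (i , s) ~ end p s (at j)) (sym (next-parity nx))
      (end-cross (par (toℕ i)) s (at i) (at j) (next-cross nx))

    hom : ∀ {u v} → Graph._~_ (cycle m □ complete 2) u v → f u ~ f v
    hom {u} {v} = go (remQuot 2 u) (remQuot 2 v)
      where
      go : ∀ a b → (Graph._~_ (cycle m) (proj₁ a) (proj₁ b) × proj₂ a ≡ proj₂ b)
                   ⊎ (proj₁ a ≡ proj₁ b × proj₂ a ≢ proj₂ b) → place a ~ place b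
      go (i , s) (j , .s) (inj₁ ((_ , inj₁ nx) , refl)) = along s nx
      go (i , s) (j , .s) (inj₁ ((_ , inj₂ nx) , refl)) = ~-sym (along s nx)
      go (i , s) (.i , t) (inj₂ (refl , n)) = end-rung (par (toℕ i)) (at i) n (at-rung i)

-- Tight paths in a dense triple system

∑-∈ : {A : Set} (_≟_ : DecidableEquality A) {vs : List A} → Unique vs → ∀ Z →
      (∑[ v ∈ vs ] ⟦ DecMem._∈?_ _≟_ v Z ⟧) ≤ length Z
∑-∈ _≟_ {vs} u []      = ≤-reflexive (∑-0 vs)
∑-∈ _≟_ {vs} u (z ∷ Z) = begin
  (∑[ v ∈ vs ] ⟦ v ∈? (z ∷ Z) ⟧)            ≤⟨ ∑-mono vs (λ v → ⟦⟧-∪ (v ∈? (z ∷ Z)) (v ≟ z) (v ∈? Z) λ { (here q) → inj₁ q ; (there q) → inj₂ q }) ⟩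
  (∑[ v ∈ vs ] ⟦ v ≟ z ⟧ + ⟦ v ∈? Z ⟧)       ≡⟨ ∑-+ vs _ _ ⟩
  (∑[ v ∈ vs ] ⟦ v ≟ z ⟧) + (∑[ v ∈ vs ] ⟦ v ∈? Z ⟧) ≤⟨ +-mono-≤ (∑-δ≤ _≟_ u z) (∑-∈ _≟_ u Z) ⟩
  suc (length Z) ∎
  where
  open ≤-Reasoning
  open DecMem _≟_ using (_∈?_)

∑-sub : {A : Set} (_≟_ : DecidableEquality A) {us : List A} (ys : List A) → Unique ys → (∀ {y} → y ∈ ys → y ∈ us) →
        (g : A → ℕ) → ∑ ys g ≤ (∑[ v ∈ us ] ⟦ DecMem._∈?_ _≟_ v ys ⟧ * g v)
∑-sub _≟_      []       _        _   g = z≤n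
∑-sub _≟_ {us} (y ∷ ys) (y∉ ∷ u) sub g = begin
  g y + ∑ ys g ≤⟨ +-mono-≤ (≤-trans (≤-reflexive (sym (trans (cong (_* g y) (⟦⟧-yes (y ≟ y) refl)) (*-identityˡ (g y))))) (∑-single us (λ v → ⟦ v ≟ y ⟧ * g v) (sub (here refl))))
                           (∑-sub _≟_ {us} ys u (sub ∘ there) g) ⟩
  (∑[ v ∈ us ] ⟦ v ≟ y ⟧ * g v) + (∑[ v ∈ us ] ⟦ v ∈? ys ⟧ * g v) ≡⟨ sym (∑-+ us _ _) ⟩
  (∑[ v ∈ us ] ⟦ v ≟ y ⟧ * g v + ⟦ v ∈? ys ⟧ * g v) ≤⟨ ∑-mono us (λ v → ≤-trans (≤-reflexive (sym (*-distribʳ-+ (g v) ⟦ v ≟ y ⟧ ⟦ v ∈? ys ⟧))) (*-monoˡ-≤ (g v) (pt v (v ≟ y) (v ∈? ys)))) ⟩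
  (∑[ v ∈ us ] ⟦ v ∈? (y ∷ ys) ⟧ * g v) ∎
  where
  open ≤-Reasoning
  open DecMem _≟_ using (_∈?_)
  pt : ∀ v (p : Dec (v ≡ y)) (q : Dec (v ∈ ys)) → ⟦ p ⟧ + ⟦ q ⟧ ≤ ⟦ v ∈? (y ∷ ys) ⟧
  pt v (yes refl) (yes v∈) = ⊥-elim (All.lookup y∉ v∈ refl)
  pt v (yes e)    (no _)   = ≤-reflexive (sym (⟦⟧-yes (v ∈? (y ∷ ys)) (here e)))
  pt v (no _)     (yes v∈) = ≤-reflexive (sym (⟦⟧-yes (v ∈? (y ∷ ys)) (there v∈)))
  pt v (no _)     (no _)   = z≤n

length-⊗ : {A B : Set} (xs : List A) (ys : List B) → length (cartesianProduct xs ys) ≡ length xs * length ys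
length-⊗ xs ys = begin
  length (cartesianProduct xs ys)                     ≡⟨ sym (*-identityʳ _) ⟩
  length (cartesianProduct xs ys) * 1                 ≡⟨ sym (∑-const (cartesianProduct xs ys) 1) ⟩
  ∑ (cartesianProduct xs ys) (λ _ → 1)                ≡⟨ ∑-⊗ xs ys _ ⟩
  (∑[ x ∈ xs ] ∑[ y ∈ ys ] 1)                         ≡⟨ ∑-cong xs (λ _ → trans (∑-const ys 1) (*-identityʳ (length ys))) ⟩
  ∑ xs (λ _ → length ys)                              ≡⟨ ∑-const xs (length ys) ⟩
  length xs * length ys                               ∎
  where open ≡-Reasoning

module TightPaths {V : Set} (_≟_ : DecidableEquality V) {vs : List V} (uniq : Unique vs)
  {N : V → Set} (N? : ∀ v → Dec (N v)) (N⊆ : ∀ {v} → N v → v ∈ vs)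
  {F : V → V → V → Set} (F? : ∀ x y z → Dec (F x y z))
  (F-swap₁₂ : ∀ {x y z} → F x y z → F y x z) (F-swap₂₃ : ∀ {x y z} → F x y z → F x z y) where

  open DecMem _≟_ using (_∈?_)

  Tight : List V → Set
  Tight (x ∷ y ∷ z ∷ zs) = F x y z × Tight (y ∷ z ∷ zs)
  Tight _                = ⊤

  private
    T³ : Set
    T³ = V × V × V

    abstract
      _≟³_ : DecidableEquality T³
      _≟³_ = ≡-dec _≟_ (≡-dec _≟_ _≟_)

    open DecMem _≟³_ using () renaming (_∈?_ to _∈³?_)

    perms : V → V → V → List T³
    perms p q z = (p , q , z) ∷ (p , z , q) ∷ (z , p , q) ∷ (q , p , z) ∷ (q , z , p) ∷ (z , q , p) ∷ []

    triples : List T³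
    triples = cartesianProduct vs (cartesianProduct vs vs)

    Item : T³ → Set
    Item (x , y , z) = (N x × N y × N z) × F x y z

    Item? : ∀ t → Dec (Item t)
    Item? (x , y , z) = (N? x ×-dec (N? y ×-dec N? z)) ×-dec F? x y z

    -- Items are ordered triples, and peeling need not keep all reorderings of a survivor. Letting a
    -- pair be incident with a triple in any of the six orders makes the degrees insensitive to
    -- this.
    Inc : T³ → V × V → Set
    Inc t (p , q) = Any (λ z → t ∈ perms p q z) vs

    abstract
      Inc? : ∀ t c → Dec (Inc t c)
      Inc? t (p , q) = any? (λ z → t ∈³? perms p q z) vs

    rotate : ∀ {t} p q z → t ∈ perms p q z → t ∈ perms q z p
    rotate p q z (here e)                                 = there (there (here e))
    rotate p q z (there (here e))                         = there (there (there (there (there (here e)))))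
    rotate p q z (there (there (here e)))                 = there (there (there (there (here e))))
    rotate p q z (there (there (there (here e))))         = there (here e)
    rotate p q z (there (there (there (there (here e))))) = here e
    rotate p q z (there (there (there (there (there (here e)))))) = there (there (there (here e)))

    item-perm : ∀ {t} p q z → Item t → t ∈ perms p q z → Item (p , q , z)
    item-perm p q z (n , f) (here refl) = n , f
    item-perm p q z ((a , b , c) , f) (there (here refl)) = (a , c , b) , F-swap₂₃ f
    item-perm p q z ((a , b , c) , f) (there (there (here refl))) = (b , c , a) , F-swap₂₃ (F-swap₁₂ f)
    item-perm p q z ((a , b , c) , f) (there (there (there (here refl)))) = (b , a , c) , F-swap₁₂ f
    item-perm p q z ((a , b , c) , f) (there (there (there (there (here refl))))) = (c , a , b) , F-swap₁₂ (F-swap₂₃ f)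
    item-perm p q z ((a , b , c) , f) (there (there (there (there (there (here refl)))))) = (c , b , a) , F-swap₁₂ (F-swap₂₃ (F-swap₁₂ f))

  private
    d : ℕ
    d = ∑[ v ∈ vs ] ⟦ N? v ⟧

    ns : List V
    ns = filter N? vs

    pairs : List (V × V)
    pairs = cartesianProduct ns ns

    length-pairs : length pairs ≡ d * d
    length-pairs = trans (length-⊗ ns ns) (cong₂ _*_ (length-filter N? vs) (length-filter N? vs))

  module _ (k : ℕ) where

    module _ {Q : T³ → Set} (Q? : ∀ t → Dec (Q t)) (Q⊆ : ∀ {t} → Q t → Item t)
             (big : ∀ {c} → c ∈ pairs → 0 < degree Inc? triples Q? c → 6 * k < degree Inc? triples Q? c) where

      private
        deg : V × V → ℕ
        deg = degree Inc? triples Q?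

        -- The new last pair must itself have survived peeling, so that the path can be extended
        -- again.
        Ext : V → V → V → Set
        Ext p q z = (N z × F p q z) × 0 < deg (q , z)

        Ext? : ∀ p q z → Dec (Ext p q z)
        Ext? p q z = (N? z ×-dec F? p q z) ×-dec (0 <? deg (q , z))

        deg-pos : ∀ {t p q z} → Q t → z ∈ vs → t ∈ perms p q z → 0 < deg (p , q)
        deg-pos {t} {p} {q} {z} qt z∈ t∈ with item-perm p q z (Q⊆ qt) t∈
        ... | (np , nq , nz) , _ =
          subst (_≤ deg (p , q)) (⟦⟧-yes (Q? t ×-dec Inc? t (p , q)) (qt , lose z∈ t∈))
            (∑-single triples (λ t → ⟦ Q? t ×-dec Inc? t (p , q) ⟧) (mem (Q⊆ qt)))
          where
          mem : ∀ {t} → Item t → t ∈ triples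
          mem ((a , b , c) , _) = ∈-cartesianProduct⁺ (N⊆ a) (∈-cartesianProduct⁺ (N⊆ b) (N⊆ c))

        ext : ∀ {t p q z} → Q t → t ∈ perms p q z → Ext p q z
        ext {t} {p} {q} {z} qt t∈ with item-perm p q z (Q⊆ qt) t∈
        ... | (np , nq , nz) , f = (nz , f) , deg-pos qt (N⊆ np) (rotate p q z t∈)

        -- Every surviving triple at the pair is a reordering of p, q, z for some extension z, and
        -- each z accounts for six triples.
        deg≤ : ∀ p q → deg (p , q) ≤ 6 * (∑[ z ∈ vs ] ⟦ Ext? p q z ⟧)
        deg≤ p q = begin
          (∑[ t ∈ triples ] ⟦ Q? t ×-dec Inc? t (p , q) ⟧)
            ≤⟨ ∑-mono triples pointwise ⟩
          (∑[ t ∈ triples ] ∑[ z ∈ vs ] ∑[ s ∈ perms p q z ] ⟦ t ≟³ s ⟧ * ⟦ Ext? p q z ⟧)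
            ≡⟨ ∑-swap triples vs _ ⟩
          (∑[ z ∈ vs ] ∑[ t ∈ triples ] ∑[ s ∈ perms p q z ] ⟦ t ≟³ s ⟧ * ⟦ Ext? p q z ⟧)
            ≤⟨ ∑-mono vs column ⟩
          (∑[ z ∈ vs ] 6 * ⟦ Ext? p q z ⟧)
            ≡⟨ ∑-*ˡ vs 6 _ ⟩
          6 * (∑[ z ∈ vs ] ⟦ Ext? p q z ⟧) ∎
          where
          open ≤-Reasoning
          column : ∀ z → (∑[ t ∈ triples ] ∑[ s ∈ perms p q z ] ⟦ t ≟³ s ⟧ * ⟦ Ext? p q z ⟧) ≤ 6 * ⟦ Ext? p q z ⟧
          column z = ≤-trans (≤-reflexive (∑-swap triples (perms p q z) (λ t s → ⟦ t ≟³ s ⟧ * ⟦ Ext? p q z ⟧)))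
            (∑-≤const (perms p q z) {λ s → ∑[ t ∈ triples ] ⟦ t ≟³ s ⟧ * ⟦ Ext? p q z ⟧} ⟦ Ext? p q z ⟧
              (λ s → ∑-δ _≟³_ (cartesianProduct⁺ uniq (cartesianProduct⁺ uniq uniq)) s (λ _ → ⟦ Ext? p q z ⟧)))
          pointwise : ∀ t → ⟦ Q? t ×-dec Inc? t (p , q) ⟧ ≤ (∑[ z ∈ vs ] ∑[ s ∈ perms p q z ] ⟦ t ≟³ s ⟧ * ⟦ Ext? p q z ⟧)
          pointwise t = ⟦⟧-≤ (Q? t ×-dec Inc? t (p , q)) λ (qt , inc) →
            let z , z∈ , t∈ = find inc in ≤-trans
            (≤-reflexive (sym (cong₂ _*_ (⟦⟧-yes (t ≟³ t) refl) (⟦⟧-yes (Ext? p q z) (ext qt t∈)))))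
            (≤-trans (∑-single (perms p q z) (λ s → ⟦ t ≟³ s ⟧ * ⟦ Ext? p q z ⟧) t∈)
                     (∑-single vs (λ z → ∑[ s ∈ perms p q z ] ⟦ t ≟³ s ⟧ * ⟦ Ext? p q z ⟧) z∈))

        extend : ∀ p q Z → N p → N q → 0 < deg (p , q) → length Z ≤ k → ∃[ z ] (Ext p q z × z ∉ Z)
        extend p q Z np nq pos len =
          let z , _ , e , z∉ = avoid (Ext? p q) (_∈? Z) vs (≤-<-trans (≤-trans (∑-∈ _≟_ uniq Z) len)
                 (*-cancelˡ-< 6 _ _ (<-≤-trans (big (∈-cartesianProduct⁺ (∈-filter⁺ N? (N⊆ np) np) (∈-filter⁺ N? (N⊆ nq) nq)) pos) (deg≤ p q))))
          in z , e , z∉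

        grow : ∀ j p q r → 2 + length r + j ≤ k → Unique (q ∷ p ∷ r) → All N (q ∷ p ∷ r) → Tight (q ∷ p ∷ r) → 0 < deg (p , q) →
          ∃[ y₁ ] ∃[ y₂ ] ∃[ ys ] (length ys ≡ j + length r × Unique (y₁ ∷ y₂ ∷ ys) × All N (y₁ ∷ y₂ ∷ ys) × Tight (y₁ ∷ y₂ ∷ ys))
        grow zero    p q r le u (nq ∷ np ∷ nr) t pos = q , p , r , refl , u , (nq ∷ np ∷ nr) , t
        grow (suc j) p q r le u (nq ∷ np ∷ nr) t pos =
          let z , ((nz , f) , pos′) , z∉ = extend p q (q ∷ p ∷ r) np nq pos (≤-trans (m≤m+n _ (suc j)) le)
              y₁ , y₂ , ys , len , rest =
                grow j q z (p ∷ r) (≤-trans (≤-reflexive (cong (2 +_) (sym (+-suc (length r) j)))) le)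
                  (Allₚ.¬Any⇒All¬ _ z∉ ∷ u) (nz ∷ nq ∷ np ∷ nr) (F-swap₁₂ (F-swap₂₃ (F-swap₁₂ f)) , t) pos′
          in y₁ , y₂ , ys , trans len (+-suc j (length r)) , rest

      fromPeeled : ∀ j → 2 + j ≤ k → ∃[ t ] (Q t) →
        ∃[ y₁ ] ∃[ y₂ ] ∃[ ys ] (length ys ≡ j × Unique (y₁ ∷ y₂ ∷ ys) × All N (y₁ ∷ y₂ ∷ ys) × Tight (y₁ ∷ y₂ ∷ ys))
      fromPeeled j le ((x , y , z) , qt) =
        let (nx , ny , nz) , f = Q⊆ qt
            -- The surviving triple may have repeated entries, so the path starts from y and a fresh
            -- extension w different from y.
            w , ((nw , _) , pos) , w∉ = extend x y (y ∷ []) nx ny (deg-pos qt (N⊆ nz) (here refl)) (≤-trans (s≤s z≤n) le)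
            y₁ , y₂ , ys , len , rest = grow j y w [] le (((w∉ ∘ here) ∷ []) ∷ [] ∷ []) (nw ∷ ny ∷ []) tt pos
        in y₁ , y₂ , ys , trans len (+-identityʳ j) , rest

  -- The classes to peel are the d² pairs from N. A surviving pair has degree above 6(2 + j), hence
  -- more than 2 + j extensions, which suffices to avoid the vertices used so far.
  tightPath : ∀ j m → m ≡ 6 * (2 + j) →
    m * ((∑[ v ∈ vs ] ⟦ N? v ⟧) * (∑[ v ∈ vs ] ⟦ N? v ⟧)) <
      (∑[ x ∈ vs ] ∑[ y ∈ vs ] ∑[ z ∈ vs ] ⟦ (N? x ×-dec (N? y ×-dec N? z)) ×-dec F? x y z ⟧) →
    ∃[ y₁ ] ∃[ y₂ ] ∃[ ys ] (length ys ≡ j × Unique (y₁ ∷ y₂ ∷ ys) × All N (y₁ ∷ y₂ ∷ ys) × Tight (y₁ ∷ y₂ ∷ ys))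
  tightPath j m eq h =
    let Q , Q? , Q⊆ , pos , big =
          peel Inc? triples m (d * d) pairs Item? length-pairs
            (<-≤-trans h (≤-reflexive (sym (trans (∑-⊗ vs (cartesianProduct vs vs) (λ t → ⟦ Item? t ⟧))
                                                 (∑-cong vs (λ x → ∑-⊗ vs vs (λ t → ⟦ Item? (x , t) ⟧)))))))
        t , _ , qt = ∑-pos triples _ pos
    in fromPeeled (2 + j) Q? Q⊆ (λ {c} c∈ pos → subst (_< degree Inc? triples Q? c) eq (big c∈ pos)) j ≤-refl (t , ⟦⟧-pos (Q? t) qt)

-- Codegrees and rich triples

AllPairs-unsnoc : {A : Set} {R : A → A → Set} → (∀ {x y} → R x y → R y x) →
                  ∀ xs {x} → AllPairs R (xs ∷ʳ x) → AllPairs R (x ∷ xs)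
AllPairs-unsnoc s []       (p ∷ ps) = p ∷ ps
AllPairs-unsnoc s (y ∷ ys) (p ∷ ps) with AllPairs-unsnoc s ys ps | Allₚ.∷ʳ⁻ p
... | q ∷ qs | py , px = (s px ∷ q) ∷ py ∷ qs

disjointRungs : {V : Set} (es : List (Rung V)) → Unique (map proj₁ es) → Unique (map proj₂ es) →
  (∀ {a b} → a ∈ map proj₁ es → b ∈ map proj₂ es → a ≢ b) → AllPairs Disj es
disjointRungs []       _        _        _ = []
disjointRungs {V} (e ∷ es) (p ∷ ps) (q ∷ qs) h =
  go es p q (λ b∈ → h (here refl) (there b∈)) (λ a∈ → h (there a∈) (here refl))
  ∷ disjointRungs es ps qs (λ a∈ b∈ → h (there a∈) (there b∈))
  where
  go : ∀ es → All (proj₁ e ≢_) (map proj₁ es) → All (proj₂ e ≢_) (map proj₂ es) →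
       (∀ {b} → b ∈ map proj₂ es → proj₁ e ≢ b) → (∀ {a} → a ∈ map proj₁ es → a ≢ proj₂ e) →
       All (Disj e) es
  go []       _        _        _ _ = []
  go (f ∷ fs) (p ∷ ps) (q ∷ qs) h k =
    (p , h (here refl) , k (here refl) ∘ sym , q) ∷ go fs ps qs (h ∘ there) (k ∘ there)

record FinGraph : Set₁ where
  field
    V        : Set
    _≟_      : DecidableEquality V
    _~_      : V → V → Set
    ~-sym    : ∀ {x y} → x ~ y → y ~ x
    ~-irrefl : ∀ {x} → ¬ (x ~ x)
    _~?_     : ∀ x y → Dec (x ~ y)
    vs       : List V
    uniq     : Unique vs
    supp     : ∀ {x y} → x ~ y → x ∈ vs

module Codegrees (𝔾 : FinGraph) where

  open FinGraph 𝔾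
  open Rings _~_ ~-sym
  open DecMem _≟_ using (_∈?_)

  a : V → V → ℕ
  a x y = ⟦ x ~? y ⟧

  a-sym : ∀ x y → a x y ≡ a y x
  a-sym x y = ⟦⟧-cong (x ~? y) (y ~? x) ~-sym ~-sym

  a-idem : ∀ x y → a x y * a x y ≡ a x y
  a-idem x y = ⟦⟧-idem (x ~? y)

  deg : V → ℕ
  deg y = ∑[ w ∈ vs ] a w y

  D : V → V → ℕ
  D x y = ∑[ w ∈ vs ] a w x * a w y

  T : V → V → V → ℕ
  T x y z = ∑[ w ∈ vs ] a w x * (a w y * a w z)

  D-sym : ∀ x y → D x y ≡ D y x
  D-sym x y = ∑-cong vs (λ w → *-comm (a w x) (a w y))

  T-swap₁₂ : ∀ x y z → T x y z ≡ T y x z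
  T-swap₁₂ x y z = ∑-cong vs (λ w → lem (a w x) (a w y) (a w z))
    where
    lem : ∀ p q r → p * (q * r) ≡ q * (p * r)
    lem = solve-∀

  T-swap₂₃ : ∀ x y z → T x y z ≡ T x z y
  T-swap₂₃ x y z = ∑-cong vs (λ w → cong (a w x *_) (*-comm (a w y) (a w z)))

  module Richness (L : ℕ) where

    Rich : V → V → V → Set
    Rich x y z = L ≤ T x y z

    Rich? : ∀ x y z → Dec (Rich x y z)
    Rich? x y z = L ≤? T x y z

    Rich-swap₁₂ : ∀ {x y z} → Rich x y z → Rich y x z
    Rich-swap₁₂ {x} {y} {z} = subst (L ≤_) (T-swap₁₂ x y z)

    Rich-swap₂₃ : ∀ {x y z} → Rich x y z → Rich x z y
    Rich-swap₂₃ {x} {y} {z} = subst (L ≤_) (T-swap₂₃ x y z)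

    pick : ∀ {x y z} → Rich x y z → ∀ Z → length Z < L → ∃[ w ] ((w ~ x) × (w ~ y) × (w ~ z) × w ∉ Z)
    pick {x} {y} {z} rich Z lt =
      let w , _ , (wx , wy , wz) , w∉ =
            avoid (λ w → w ~? x ×-dec (w ~? y ×-dec w ~? z)) (_∈? Z) vs
              (≤-<-trans (∑-∈ _≟_ uniq Z) (<-≤-trans lt (≤-trans rich (≤-reflexive
                (∑-cong vs (λ w → sym (trans (⟦⟧-× (w ~? x) _) (cong (a w x *_) (⟦⟧-× (w ~? y) (w ~? z))))))))))
      in w , wx , wy , wz , w∉

    module _ {x x′ : V} (x≢x′ : x ≢ x′) where

      private
        N : V → Set
        N y = (y ~ x) × (y ~ x′)

        N? : ∀ y → Dec (N y)
        N? y = y ~? x ×-dec y ~? x′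

      open TightPaths _≟_ uniq N? (λ (p , _) → supp p) Rich? Rich-swap₁₂ Rich-swap₂₃

      private
        final : V → List V → V
        final y []       = y
        final y (z ∷ zs) = final z zs

        -- The rung at an interior vertex of the tight path is completed by a common neighbour of
        -- that vertex and its two neighbours on the path: one adjacency makes the rung, the other
        -- two make the 4-cycles with the adjacent rungs. Richness leaves a choice outside `Z`,
        -- which collects the vertices already in use.
        thread : ∀ y₁ y₂ ys x₁ Z → Tight (y₁ ∷ y₂ ∷ ys) → All N (y₁ ∷ y₂ ∷ ys) → x₁ ~ y₁ → x₁ ~ y₂ →
          length Z + length ys < L →
          ∃[ is ] (Walk (x₁ , y₁) is (x′ , final y₂ ys) × map proj₂ is ∷ʳ final y₂ ys ≡ y₂ ∷ ys
                   × Unique (map proj₁ is) × All (_∉ Z) (map proj₁ is))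
        thread y₁ y₂ [] x₁ Z t ((_ , q) ∷ _) r s lt = [] , step (s , ~-sym q) , refl , [] , []
        thread y₁ y₂ (y₃ ∷ ys) x₁ Z (rich , t) (n₁ ∷ ns) r s lt =
          let x₂ , e₁ , e₂ , e₃ , x₂∉ = pick rich Z (≤-<-trans (m≤m+n (length Z) _) lt)
              is , w , eq , u , av = thread y₂ y₃ ys x₂ (x₂ ∷ Z) t ns e₂ e₃ (subst (_< L) (+-suc (length Z) (length ys)) lt)
          in (x₂ , y₂) ∷ is , cons e₂ (s , e₁) w , cong (y₂ ∷_) eq ,
             All.map (λ z∉ x₂≡ → z∉ (here (sym x₂≡))) av ∷ u ,
             x₂∉ ∷ All.map (λ z∉ z∈ → z∉ (there z∈)) av

      -- The ring consists of (x , y₁), the threaded rungs and x′ paired with the last vertex of the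
      -- path. As x and x′ are adjacent to all of the path, they provide the missing edges,
      -- including those of the 4-cycle joining the last rung to the first.
      closeUp : ∀ y₁ y₂ ys → Tight (y₁ ∷ y₂ ∷ ys) → All N (y₁ ∷ y₂ ∷ ys) → Unique (y₁ ∷ y₂ ∷ ys) →
        2 * (2 + length ys) < L → Ring (2 + length ys)
      closeUp y₁ y₂ ys t ns@((n₁ , n₁′) ∷ _) (u₁ ∷ u₂) lt =
        let Z = x ∷ x′ ∷ y₁ ∷ y₂ ∷ ys
            is , w , eq , ux , av = thread y₁ y₂ ys x Z t ns (~-sym n₁) (~-sym (proj₁ (All.head (All.tail ns))))
                 (≤-<-trans (≤-trans (m≤n+m _ 0) (≤-reflexive (lem (length ys)))) lt)
            last∈ = finalN y₂ ys (All.tail ns)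
            lenis = trans (sym (+-comm (length (map proj₂ is)) 1)) (trans (sym (length-++ (map proj₂ is))) (cong length eq))
        in mkRing (x′ , final y₂ ys) ((x , y₁) ∷ is)
             (cons (~-sym n₁) (~-sym n₁′ , ~-sym (proj₁ last∈)) w)
             (~-sym (proj₂ last∈))
             (disjointRungs ((x′ , final y₂ ys) ∷ (x , y₁) ∷ is)
               (((x≢x′ ∘ sym) ∷ All.map (λ z∉ e → z∉ (there (here (sym e)))) av) ∷ All.map (λ z∉ e → z∉ (here (sym e))) av ∷ ux)
               (snds is eq)
               (cross is eq av))
             (cong (2 +_) (trans (sym (length-map proj₂ is)) (suc-injective lenis)))
        where
        lem : ∀ k → 4 + k + k ≡ 2 * (2 + k)
        lem = solve-∀
        finalN : ∀ y ys → All N (y ∷ ys) → N (final y ys)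
        finalN y []       (p ∷ _)  = p
        finalN y (z ∷ zs) (_ ∷ ps) = finalN z zs ps
        snds : ∀ is → map proj₂ is ∷ʳ final y₂ ys ≡ y₂ ∷ ys → Unique (final y₂ ys ∷ y₁ ∷ map proj₂ is)
        snds is eq = AllPairs-unsnoc (λ n e → n (sym e)) (y₁ ∷ map proj₂ is)
          (subst Unique (cong (y₁ ∷_) (sym eq)) (u₁ ∷ u₂))
        ∈ys : ∀ is → map proj₂ is ∷ʳ final y₂ ys ≡ y₂ ∷ ys → ∀ {b} → b ∈ final y₂ ys ∷ y₁ ∷ map proj₂ is → b ∈ y₁ ∷ y₂ ∷ ys
        ∈ys is eq (here refl) = there (subst (final y₂ ys ∈_) eq (∈-last (map proj₂ is)))
          where
          ∈-last : ∀ zs {z : V} → z ∈ zs ∷ʳ z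
          ∈-last []       = here refl
          ∈-last (_ ∷ zs) = there (∈-last zs)
        ∈ys is eq (there (here refl)) = here refl
        ∈ys is eq (there (there b∈)) = there (subst (_ ∈_) eq (∈-init (map proj₂ is) b∈))
          where
          ∈-init : ∀ zs {z b : V} → b ∈ zs → b ∈ zs ∷ʳ z
          ∈-init (_ ∷ zs) (here e)  = here e
          ∈-init (_ ∷ zs) (there p) = there (∈-init zs p)
        cross : ∀ is → map proj₂ is ∷ʳ final y₂ ys ≡ y₂ ∷ ys → All (_∉ (x ∷ x′ ∷ y₁ ∷ y₂ ∷ ys)) (map proj₁ is) →
          ∀ {a b} → a ∈ x′ ∷ x ∷ map proj₁ is → b ∈ final y₂ ys ∷ y₁ ∷ map proj₂ is → a ≢ b
        cross is eq av (here refl) b∈ refl = ~-irrefl (proj₂ (All.lookup ns (∈ys is eq b∈)))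
        cross is eq av (there (here refl)) b∈ refl = ~-irrefl (proj₁ (All.lookup ns (∈ys is eq b∈)))
        cross is eq av (there (there a∈)) b∈ refl = All.lookup av a∈ (there (there (∈ys is eq b∈)))

      fewRich : ∀ j m → m ≡ 6 * (2 + j) → 2 * (2 + j) < L → ¬ Ring (2 + j) →
        (∑[ p ∈ vs ] ∑[ q ∈ vs ] ∑[ r ∈ vs ] ⟦ (N? p ×-dec (N? q ×-dec N? r)) ×-dec Rich? p q r ⟧)
        ≤ m * (D x x′ * D x x′)
      fewRich j m eq lt noRing = ≮⇒≥ λ h →
        contra (tightPath j m eq (≤-<-trans (≤-reflexive (cong (λ d → m * (d * d)) D≡)) h))
        where
        contra : ∃[ y₁ ] ∃[ y₂ ] ∃[ ys ] (length ys ≡ j × Unique (y₁ ∷ y₂ ∷ ys) × All N (y₁ ∷ y₂ ∷ ys) × Tight (y₁ ∷ y₂ ∷ ys)) → ⊥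
        contra (y₁ , y₂ , ys , refl , u , ns , t) = noRing (closeUp y₁ y₂ ys t ns u lt)
        D≡ : (∑[ y ∈ vs ] ⟦ N? y ⟧) ≡ D x x′
        D≡ = ∑-cong vs (λ y → ⟦⟧-× (y ~? x) (y ~? x′))

m≤n+1*m : ∀ n m → m ≤ n + 1 * m
m≤n+1*m n m = ≤-trans (≤-reflexive (sym (*-identityˡ m))) (m≤n+m (1 * m) n)

module RichCount (𝔾 : FinGraph) (L : ℕ) where

  open FinGraph 𝔾
  open Codegrees 𝔾
  open Richness L

  n : ℕ
  n = length vs

  -- The number of homomorphic images of the 4-cycle, sorted by one diagonal.
  Q : ℕ
  Q = ∑[ x ∈ vs ] ∑[ y ∈ vs ] D x y * D x y

  rich : V → V → V → ℕ
  rich x y z = ⟦ Rich? x y z ⟧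

  -- The number of homomorphisms from K(2,3) whose three-vertex side is sent to a rich triple: T²
  -- counts the two vertices of the other side, which may coincide.
  Φ : ℕ
  Φ = ∑[ p ∈ vs ] ∑[ q ∈ vs ] ∑[ r ∈ vs ] rich p q r * (T p q r * T p q r)

  triples : List (V × V × V)
  triples = cartesianProduct vs (cartesianProduct vs vs)

  ∑-triples : (f : V × V × V → ℕ) →
    ∑ triples f ≡ (∑[ x ∈ vs ] ∑[ y ∈ vs ] ∑[ z ∈ vs ] f (x , y , z))
  ∑-triples f = trans (∑-⊗ vs (cartesianProduct vs vs) f) (∑-cong vs (λ x → ∑-⊗ vs vs (λ t → f (x , t))))

  FewRich : ℕ → Set
  FewRich K = ∀ {x x′} → x ≢ x′ →
    (∑[ p ∈ vs ] ∑[ q ∈ vs ] ∑[ r ∈ vs ]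
      ⟦ ((p ~? x ×-dec p ~? x′) ×-dec ((q ~? x ×-dec q ~? x′) ×-dec (r ~? x ×-dec r ~? x′))) ×-dec Rich? p q r ⟧)
    ≤ K * (D x x′ * D x x′)

  private
    R³ T³ : V × V × V → ℕ
    R³ (p , q , r) = rich p q r
    T³ (p , q , r) = T p q r

    m : V → V × V × V → ℕ
    m x (p , q , r) = a x p * (a x q * a x r)

    m-idem : ∀ x t → m x t * m x t ≡ m x t
    m-idem x (p , q , r) = trans (lem (a x p) (a x q) (a x r)) (cong₂ _*_ (a-idem x p) (cong₂ _*_ (a-idem x q) (a-idem x r)))
      where
      lem : ∀ a b c → (a * (b * c)) * (a * (b * c)) ≡ (a * a) * ((b * b) * (c * c))
      lem = solve-∀

    fc : V → V → ℕ
    fc x x′ = ∑ triples (λ t → R³ t * (m x t * m x′ t))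

    fc-≡ : ∀ x x′ →
      (∑[ p ∈ vs ] ∑[ q ∈ vs ] ∑[ r ∈ vs ]
        ⟦ ((p ~? x ×-dec p ~? x′) ×-dec ((q ~? x ×-dec q ~? x′) ×-dec (r ~? x ×-dec r ~? x′))) ×-dec Rich? p q r ⟧)
      ≡ fc x x′
    fc-≡ x x′ = trans (∑-cong vs (λ p → ∑-cong vs (λ q → ∑-cong vs (λ r → pt p q r))))
                      (sym (∑-triples (λ t → R³ t * (m x t * m x′ t))))
      where
      two : ∀ p → ⟦ p ~? x ×-dec p ~? x′ ⟧ ≡ a x p * a x′ p
      two p = trans (⟦⟧-× (p ~? x) (p ~? x′)) (cong₂ _*_ (a-sym p x) (a-sym p x′))
      lem : ∀ a a′ b b′ c c′ d → ((a * a′) * ((b * b′) * (c * c′))) * d ≡ d * ((a * (b * c)) * (a′ * (b′ * c′)))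
      lem = solve-∀
      pt : ∀ p q r → ⟦ ((p ~? x ×-dec p ~? x′) ×-dec ((q ~? x ×-dec q ~? x′) ×-dec (r ~? x ×-dec r ~? x′))) ×-dec Rich? p q r ⟧
           ≡ rich p q r * ((a x p * (a x q * a x r)) * (a x′ p * (a x′ q * a x′ r)))
      pt p q r = trans (⟦⟧-× ((p ~? x ×-dec p ~? x′) ×-dec ((q ~? x ×-dec q ~? x′) ×-dec (r ~? x ×-dec r ~? x′))) (Rich? p q r))
        (trans (cong (_* rich p q r) (trans (⟦⟧-× (p ~? x ×-dec p ~? x′) ((q ~? x ×-dec q ~? x′) ×-dec (r ~? x ×-dec r ~? x′)))
                  (cong₂ _*_ (two p) (trans (⟦⟧-× (q ~? x ×-dec q ~? x′) (r ~? x ×-dec r ~? x′)) (cong₂ _*_ (two q) (two r))))))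
               (lem (a x p) (a x′ p) (a x q) (a x′ q) (a x r) (a x′ r) (rich p q r)))

    Φ-≡ : (∑[ x ∈ vs ] ∑[ x′ ∈ vs ] fc x x′) ≡ Φ
    Φ-≡ = trans (∑-cong vs (λ x → ∑-swap vs triples (λ x′ t → R³ t * (m x t * m x′ t))))
      (trans (∑-swap vs triples (λ x t → ∑[ x′ ∈ vs ] R³ t * (m x t * m x′ t)))
      (trans (∑-cong triples inside)
             (∑-triples (λ t → R³ t * (T³ t * T³ t)))))
      where
      inside : ∀ t → (∑[ x ∈ vs ] ∑[ x′ ∈ vs ] R³ t * (m x t * m x′ t)) ≡ R³ t * (T³ t * T³ t)
      inside t = trans (∑-cong vs (λ x → ∑-*ˡ vs (R³ t) (λ x′ → m x t * m x′ t)))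
        (trans (∑-*ˡ vs (R³ t) (λ x → ∑[ x′ ∈ vs ] m x t * m x′ t))
               (cong (R³ t *_) (sym (∑-* vs vs (λ x → m x t) (λ x′ → m x′ t)))))

  -- The pairs x = x′ contribute only the sum of T over rich triples, at most half of Φ.
  Φ-bound : ∀ {K} → 2 ≤ L → FewRich K → Φ ≤ 2 * (K * Q)
  Φ-bound {K} 2≤L few = +-cancelʳ-≤ Φ _ _ (begin
    Φ + Φ                             ≡⟨ double Φ ⟩
    2 * Φ                             ≤⟨ *-monoʳ-≤ 2 total ⟩
    2 * (K * Q + diag)                ≡⟨ *-distribˡ-+ 2 (K * Q) diag ⟩
    2 * (K * Q) + 2 * diag            ≤⟨ +-monoʳ-≤ (2 * (K * Q)) half ⟩
    2 * (K * Q) + Φ                   ∎)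
    where
    open ≤-Reasoning
    diag : ℕ
    diag = ∑[ x ∈ vs ] fc x x
    point : ∀ x x′ → fc x x′ ≤ K * (D x x′ * D x x′) + ⟦ x′ ≟ x ⟧ * fc x x′
    point x x′ with x′ ≟ x
    ... | yes refl = m≤n+1*m (K * (D x x * D x x)) (fc x x)
    ... | no x′≢x = ≤-trans (≤-reflexive (sym (fc-≡ x x′))) (≤-trans (few (x′≢x ∘ sym)) (m≤m+n (K * (D x x′ * D x x′)) 0))
    total : Φ ≤ K * Q + diag
    total = begin
      Φ ≡⟨ sym Φ-≡ ⟩
      (∑[ x ∈ vs ] ∑[ x′ ∈ vs ] fc x x′) ≤⟨ ∑-mono vs (λ x → ∑-mono vs (point x)) ⟩
      (∑[ x ∈ vs ] ∑[ x′ ∈ vs ] K * (D x x′ * D x x′) + ⟦ x′ ≟ x ⟧ * fc x x′)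
        ≤⟨ ∑-mono vs (λ x → ≤-trans (≤-reflexive (∑-+ vs _ _)) (+-mono-≤ (≤-reflexive (∑-*ˡ vs K _)) (∑-δ _≟_ uniq x (fc x)))) ⟩
      (∑[ x ∈ vs ] K * (∑[ x′ ∈ vs ] D x x′ * D x x′) + fc x x) ≡⟨ ∑-+ vs _ _ ⟩
      (∑[ x ∈ vs ] K * (∑[ x′ ∈ vs ] D x x′ * D x x′)) + diag ≡⟨ cong (_+ diag) (∑-*ˡ vs K _) ⟩
      K * Q + diag ∎
    half : 2 * diag ≤ Φ
    half = begin
      2 * diag ≡⟨ cong (2 *_) (trans (∑-swap vs triples (λ x t → R³ t * (m x t * m x t))) (∑-cong triples (λ t → ∑-*ˡ vs (R³ t) (λ x → m x t * m x t)))) ⟩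
      2 * ∑ triples (λ t → R³ t * (∑[ x ∈ vs ] m x t * m x t)) ≡⟨ cong (2 *_) (∑-cong triples (λ t → cong (R³ t *_) (∑-cong vs (λ x → m-idem x t)))) ⟩
      2 * ∑ triples (λ t → R³ t * T³ t) ≡⟨ sym (∑-*ˡ triples 2 _) ⟩
      ∑ triples (λ t → 2 * (R³ t * T³ t)) ≤⟨ ∑-mono triples (λ (p , q , r) → ≤-trans (≤-reflexive (comm 2 (rich p q r) (T p q r))) (⟦⟧-scale (Rich? p q r) (λ le → *-monoˡ-≤ (T p q r) (≤-trans 2≤L le)))) ⟩
      ∑ triples (λ t → R³ t * (T³ t * T³ t)) ≡⟨ ∑-triples _ ⟩
      Φ ∎
      where
      comm : ∀ a b c → a * (b * c) ≡ b * (a * c)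
      comm = solve-∀

  module Heavy (Δ θ c : ℕ) .{{_ : NonZero Δ}} (deg≤Δ : ∀ y → deg y ≤ Δ) (θ² : θ * θ ≡ c * Δ) (c≥ : L + L * L ≤ c) where

    heavy? : ∀ y y′ → Dec (θ < D y y′)
    heavy? y y′ = θ <? D y y′

    h : V → V → ℕ
    h y y′ = ⟦ heavy? y y′ ⟧

    Qₕ : ℕ
    Qₕ = ∑[ y ∈ vs ] ∑[ y′ ∈ vs ] h y y′ * (D y y′ * D y y′)

    module _ (y : V) where

      private
        -- For the fixed y, this is the incidence between the vertices y′ that form a heavy pair
        -- with y and the common neighbours x of y and y′. `g` gives its degrees, `S` its codegrees
        -- and ρ the number of such y′.
        A : V → V → ℕ
        A y′ x = h y y′ * (a x y * a x y′)

        g : V → ℕ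
        g x = ∑[ y′ ∈ vs ] A y′ x

        S : V → V → ℕ
        S y′ y″ = ∑[ x ∈ vs ] A y′ x * A y″ x

        ρ : ℕ
        ρ = ∑[ y′ ∈ vs ] h y y′

        rr : V → V → ℕ
        rr y′ y″ = h y y′ * h y y″

        S-≡ : ∀ y′ y″ → S y′ y″ ≡ rr y′ y″ * T y y′ y″
        S-≡ y′ y″ = trans (∑-cong vs (λ x → trans (lem (h y y′) (h y y″) (a x y) (a x y′) (a x y″)) (cong (λ k → rr y′ y″ * (k * (a x y′ * a x y″))) (a-idem x y))))
                          (∑-*ˡ vs (rr y′ y″) _)
          where
          lem : ∀ h h′ a b c → (h * (a * b)) * (h′ * (a * c)) ≡ (h * h′) * ((a * a) * (b * c))
          lem = solve-∀

        ag : ∀ x → a x y * g x ≡ g x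
        ag x = trans (sym (∑-*ˡ vs (a x y) _)) (∑-cong vs (λ y′ → trans (lem (a x y) (h y y′) (a x y′)) (cong (λ k → h y y′ * (k * a x y′)) (a-idem x y))))
          where
          lem : ∀ a h b → a * (h * (a * b)) ≡ h * ((a * a) * b)
          lem = solve-∀

        ∑g : (∑[ x ∈ vs ] g x) ≡ (∑[ y′ ∈ vs ] h y y′ * D y y′)
        ∑g = trans (∑-swap vs vs (λ x y′ → A y′ x)) (∑-cong vs (λ y′ → ∑-*ˡ vs (h y y′) _))

        ∑g² : (∑[ x ∈ vs ] g x * g x) ≡ (∑[ y′ ∈ vs ] ∑[ y″ ∈ vs ] S y′ y″)
        ∑g² = trans (∑-cong vs (λ x → ∑-* vs vs (λ y′ → A y′ x) (λ y″ → A y″ x)))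
              (trans (∑-swap vs vs _) (∑-cong vs (λ y′ → ∑-swap vs vs (λ x y″ → A y′ x * A y″ x))))

        ∑rr : (∑[ y′ ∈ vs ] ∑[ y″ ∈ vs ] rr y′ y″) ≡ ρ * ρ
        ∑rr = sym (∑-* vs vs (h y) (h y))

        θρ : θ * ρ ≤ (∑[ x ∈ vs ] g x)
        θρ = begin
          θ * ρ ≡⟨ sym (∑-*ˡ vs θ _) ⟩
          (∑[ y′ ∈ vs ] θ * h y y′) ≤⟨ ∑-mono vs (λ y′ → ≤-trans (≤-reflexive (*-comm θ (h y y′))) (⟦⟧-scale (heavy? y y′) <⇒≤)) ⟩
          (∑[ y′ ∈ vs ] h y y′ * D y y′) ≡⟨ sym ∑g ⟩
          (∑[ x ∈ vs ] g x) ∎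
          where open ≤-Reasoning

        -- `g` lives on the at most Δ neighbours of y and has sum at least θρ. Cauchy-Schwarz gives
        -- θ²ρ² ≤ Δ ∑ g², and θ² = cΔ cancels the Δ.
        lower : c * (ρ * ρ) ≤ (∑[ y′ ∈ vs ] ∑[ y″ ∈ vs ] S y′ y″)
        lower = *-cancelˡ-≤ Δ (begin
          Δ * (c * (ρ * ρ))     ≡⟨ l₁ Δ c ρ ⟩
          (c * Δ) * (ρ * ρ)     ≡⟨ cong (_* (ρ * ρ)) (sym θ²) ⟩
          (θ * θ) * (ρ * ρ)     ≡⟨ l₂ θ ρ ⟩
          (θ * ρ) * (θ * ρ)     ≤⟨ *-mono-≤ θρ θρ ⟩
          ∑ vs g * ∑ vs g       ≡⟨ cong (λ k → k * k) (∑-cong vs (λ x → sym (ag x))) ⟩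
          (∑[ x ∈ vs ] a x y * g x) * (∑[ x ∈ vs ] a x y * g x) ≤⟨ cauchy-schwarz vs (λ x → a x y) g ⟩
          (∑[ x ∈ vs ] a x y * a x y) * (∑[ x ∈ vs ] g x * g x) ≡⟨ cong₂ _*_ (∑-cong vs (λ x → a-idem x y)) ∑g² ⟩
          deg y * (∑[ y′ ∈ vs ] ∑[ y″ ∈ vs ] S y′ y″) ≤⟨ *-monoˡ-≤ (∑[ y′ ∈ vs ] ∑[ y″ ∈ vs ] S y′ y″) (deg≤Δ y) ⟩
          Δ * (∑[ y′ ∈ vs ] ∑[ y″ ∈ vs ] S y′ y″) ∎)
          where
          open ≤-Reasoning
          l₁ : ∀ Δ c ρ → Δ * (c * (ρ * ρ)) ≡ (c * Δ) * (ρ * ρ)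
          l₁ = solve-∀
          l₂ : ∀ θ ρ → (θ * θ) * (ρ * ρ) ≡ (θ * ρ) * (θ * ρ)
          l₂ = solve-∀

        X : ℕ
        X = ∑[ y′ ∈ vs ] ∑[ y″ ∈ vs ] rich y y′ y″ * (S y′ y″ * S y′ y″)

        ∑∑-split : ∀ k (f : V → V → ℕ) → (∀ y′ y″ → f y′ y″ ≤ k * rr y′ y″ + rich y y′ y″ * (S y′ y″ * S y′ y″)) →
          (∑[ y′ ∈ vs ] ∑[ y″ ∈ vs ] f y′ y″) ≤ k * (ρ * ρ) + X
        ∑∑-split k f hyp = begin
          (∑[ y′ ∈ vs ] ∑[ y″ ∈ vs ] f y′ y″) ≤⟨ ∑-mono vs (λ y′ → ≤-trans (∑-mono vs (hyp y′)) (≤-reflexive (trans (∑-+ vs _ _) (cong (_+ _) (∑-*ˡ vs k _))))) ⟩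
          (∑[ y′ ∈ vs ] k * (∑[ y″ ∈ vs ] rr y′ y″) + (∑[ y″ ∈ vs ] rich y y′ y″ * (S y′ y″ * S y′ y″))) ≡⟨ trans (∑-+ vs _ _) (cong (_+ X) (trans (∑-*ˡ vs k _) (cong (k *_) ∑rr))) ⟩
          k * (ρ * ρ) + X ∎
          where open ≤-Reasoning

        rr≤1 : ∀ y′ y″ → rr y′ y″ ≤ 1
        rr≤1 y′ y″ = *-mono-≤ (⟦⟧-≤1 (heavy? y y′)) (⟦⟧-≤1 (heavy? y y″))

        split₁ : ∀ y′ y″ → S y′ y″ ≤ L * rr y′ y″ + rich y y′ y″ * (S y′ y″ * S y′ y″)
        split₁ y′ y″ with Rich? y y′ y″
        ... | yes _ = ≤-trans (m≤m*m (S y′ y″)) (m≤n+1*m (L * rr y′ y″) (S y′ y″ * S y′ y″))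
        ... | no ¬r = ≤-trans (≤-reflexive (S-≡ y′ y″)) (≤-trans (*-monoʳ-≤ (rr y′ y″) (<⇒≤ (≰⇒> ¬r))) (≤-trans (≤-reflexive (*-comm (rr y′ y″) L)) (m≤m+n (L * rr y′ y″) 0)))

        split₂ : ∀ y′ y″ → S y′ y″ * S y′ y″ ≤ (L * L) * rr y′ y″ + rich y y′ y″ * (S y′ y″ * S y′ y″)
        split₂ y′ y″ with Rich? y y′ y″
        ... | yes _ = m≤n+1*m ((L * L) * rr y′ y″) (S y′ y″ * S y′ y″)
        ... | no ¬r = begin
          S y′ y″ * S y′ y″                            ≡⟨ cong (λ k → k * k) (S-≡ y′ y″) ⟩
          (rr y′ y″ * T y y′ y″) * (rr y′ y″ * T y y′ y″) ≤⟨ *-mono-≤ (*-monoʳ-≤ (rr y′ y″) (<⇒≤ (≰⇒> ¬r))) (*-monoʳ-≤ (rr y′ y″) (<⇒≤ (≰⇒> ¬r))) ⟩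
          (rr y′ y″ * L) * (rr y′ y″ * L)              ≡⟨ lem (rr y′ y″) L ⟩
          rr y′ y″ * (rr y′ y″ * (L * L))              ≤⟨ *-monoˡ-≤ (rr y′ y″ * (L * L)) (rr≤1 y′ y″) ⟩
          1 * (rr y′ y″ * (L * L))                     ≡⟨ lem′ (rr y′ y″) (L * L) ⟩
          (L * L) * rr y′ y″                           ≤⟨ m≤m+n ((L * L) * rr y′ y″) 0 ⟩
          (L * L) * rr y′ y″ + 0 ∎
          where
          open ≤-Reasoning
          lem : ∀ r l → (r * l) * (r * l) ≡ r * (r * (l * l))
          lem = solve-∀
          lem′ : ∀ r l → 1 * (r * l) ≡ l * r
          lem′ = solve-∀

        X≤ : X ≤ (∑[ y′ ∈ vs ] ∑[ y″ ∈ vs ] rich y y′ y″ * (T y y′ y″ * T y y′ y″))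
        X≤ = ∑-mono vs λ y′ → ∑-mono vs λ y″ → *-monoʳ-≤ (rich y y′ y″) (*-mono-≤ (S≤T y′ y″) (S≤T y′ y″))
          where
          S≤T : ∀ y′ y″ → S y′ y″ ≤ T y y′ y″
          S≤T y′ y″ = ≤-trans (≤-reflexive (S-≡ y′ y″)) (≤-trans (*-monoˡ-≤ (T y y′ y″) (rr≤1 y′ y″)) (≤-reflexive (*-identityˡ (T y y′ y″))))

      -- The triples that are not rich contribute at most Lρ² to the sum of S and at most L²ρ² to
      -- the sum of S². As the sum of S is at least (L + L²)ρ², the rich part X of the sum of S² is
      -- at least L²ρ², so it makes up half or more of the whole.
      richShare : (∑[ y′ ∈ vs ] ∑[ y″ ∈ vs ] S y′ y″ * S y′ y″) ≤ 2 * (∑[ y′ ∈ vs ] ∑[ y″ ∈ vs ] rich y y′ y″ * (T y y′ y″ * T y y′ y″))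
      richShare = begin
        (∑[ y′ ∈ vs ] ∑[ y″ ∈ vs ] S y′ y″ * S y′ y″) ≤⟨ ∑∑-split (L * L) _ split₂ ⟩
        (L * L) * (ρ * ρ) + X ≤⟨ +-monoˡ-≤ X small ⟩
        X + X ≡⟨ double X ⟩
        2 * X ≤⟨ *-monoʳ-≤ 2 X≤ ⟩
        2 * (∑[ y′ ∈ vs ] ∑[ y″ ∈ vs ] rich y y′ y″ * (T y y′ y″ * T y y′ y″)) ∎
        where
        open ≤-Reasoning
        small : (L * L) * (ρ * ρ) ≤ X
        small = +-cancelˡ-≤ (L * (ρ * ρ)) _ _ (begin
          L * (ρ * ρ) + (L * L) * (ρ * ρ) ≡⟨ sym (*-distribʳ-+ (ρ * ρ) L (L * L)) ⟩
          (L + L * L) * (ρ * ρ) ≤⟨ *-monoˡ-≤ (ρ * ρ) c≥ ⟩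
          c * (ρ * ρ) ≤⟨ lower ⟩
          (∑[ y′ ∈ vs ] ∑[ y″ ∈ vs ] S y′ y″) ≤⟨ ∑∑-split L _ split₁ ⟩
          L * (ρ * ρ) + X ∎)

      pairing : V → V → ℕ
      pairing x x′ = ∑[ y′ ∈ vs ] A y′ x * A y′ x′

      pairing-total : (∑[ x ∈ vs ] ∑[ x′ ∈ vs ] pairing x x′) ≡ (∑[ y′ ∈ vs ] h y y′ * (D y y′ * D y y′))
      pairing-total = trans (∑-cong vs (λ x → ∑-swap vs vs (λ x′ y′ → A y′ x * A y′ x′)))
        (trans (∑-swap vs vs (λ x y′ → ∑[ x′ ∈ vs ] A y′ x * A y′ x′))
        (∑-cong vs (λ y′ → trans (sym (∑-* vs vs (A y′) (A y′)))
          (trans (cong (λ k → k * k) (∑-*ˡ vs (h y y′) _)) (trans (lem (h y y′) (D y y′)) (cong (_* (D y y′ * D y y′)) (⟦⟧-idem (heavy? y y′))))))))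
        where
        lem : ∀ h d → (h * d) * (h * d) ≡ (h * h) * (d * d)
        lem = solve-∀

      pairing-absorb : ∀ x x′ → (a x y * a x′ y) * pairing x x′ ≡ pairing x x′
      pairing-absorb x x′ = trans (sym (∑-*ˡ vs (a x y * a x′ y) _)) (∑-cong vs (λ y′ →
        trans (lem (a x y) (a x′ y) (h y y′) (a x y′) (a x′ y′))
              (cong₂ (λ k k′ → (h y y′ * (k * a x y′)) * (h y y′ * (k′ * a x′ y′))) (a-idem x y) (a-idem x′ y))))
        where
        lem : ∀ a a′ h b b′ → (a * a′) * ((h * (a * b)) * (h * (a′ * b′))) ≡ (h * ((a * a) * b)) * (h * ((a′ * a′) * b′))
        lem = solve-∀

      pairing-square : (∑[ x ∈ vs ] ∑[ x′ ∈ vs ] pairing x x′ * pairing x x′) ≤ 2 * (∑[ y′ ∈ vs ] ∑[ y″ ∈ vs ] rich y y′ y″ * (T y y′ y″ * T y y′ y″))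
      pairing-square = ≤-trans (≤-reflexive (gram vs vs (λ x y′ → A y′ x))) richShare

    -- Cauchy-Schwarz over the at most nΔ² triples (y , x , x′) with x and x′ adjacent to y.
    -- `pairing` counts the heavy y′ completing such a triple to a 4-cycle; its second moment is
    -- that of `S` by `gram`, and hence is controlled by rich triples.
    Qₕ² : Qₕ * Qₕ ≤ (n * (Δ * Δ)) * (2 * Φ)
    Qₕ² = begin
      Qₕ * Qₕ ≡⟨ cong (λ k → k * k) (sym total) ⟩
      ∑ triples (λ t → f t * g t) * ∑ triples (λ t → f t * g t) ≤⟨ cauchy-schwarz triples f g ⟩
      ∑ triples (λ t → f t * f t) * ∑ triples (λ t → g t * g t) ≤⟨ *-mono-≤ first second ⟩
      (n * (Δ * Δ)) * (2 * Φ) ∎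
      where
      open ≤-Reasoning
      f g : V × V × V → ℕ
      f (y , x , x′) = a x y * a x′ y
      g (y , x , x′) = pairing y x x′
      total : ∑ triples (λ t → f t * g t) ≡ Qₕ
      total = trans (∑-cong triples (λ (y , x , x′) → pairing-absorb y x x′)) (trans (∑-triples g) (∑-cong vs pairing-total))
      first : ∑ triples (λ t → f t * f t) ≤ n * (Δ * Δ)
      first = ≤-trans (≤-reflexive (∑-triples (λ t → f t * f t))) (∑-≤const vs (Δ * Δ) λ y →
        ≤-trans (≤-reflexive (trans (∑-cong vs (λ x → ∑-cong vs (λ x′ → trans (lem (a x y) (a x′ y)) (cong₂ _*_ (a-idem x y) (a-idem x′ y)))))
                                    (sym (∑-* vs vs (λ x → a x y) (λ x → a x y)))))
                (*-mono-≤ (deg≤Δ y) (deg≤Δ y)))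
        where
        lem : ∀ a b → (a * b) * (a * b) ≡ (a * a) * (b * b)
        lem = solve-∀
      second : ∑ triples (λ t → g t * g t) ≤ 2 * Φ
      second = ≤-trans (≤-reflexive (∑-triples (λ t → g t * g t)))
        (≤-trans (∑-mono vs pairing-square) (≤-reflexive (∑-*ˡ vs 2 _)))

-- Ladder steps of small codegree

module Arcs (𝔾 : FinGraph) (L θ : ℕ) where

  open FinGraph 𝔾
  open Codegrees 𝔾
  open Richness L
  open RichCount 𝔾 L
  open Rings _~_ ~-sym

  IsRung? : ∀ e → Dec (IsRung e)
  IsRung? (x , y) = x ~? y

  rs : List (Rung V)
  rs = filter IsRung? (cartesianProduct vs vs)

  rs-unique : Unique rs
  rs-unique = filter⁺ IsRung? (cartesianProduct⁺ uniq uniq)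

  ∈-rs : ∀ {e} → IsRung e → e ∈ rs
  ∈-rs r = ∈-filter⁺ IsRung? (∈-cartesianProduct⁺ (supp r) (supp (~-sym r))) r

  -- The rungs are opposite edges of the 4-cycle x y x′ y′, whose diagonals are xx′ and yy′; the
  -- last four fields make the cycle nondegenerate and both diagonals light.
  record Γ (e e′ : Rung V) : Set where
    constructor mkΓ
    field
      rung₁  : IsRung e
      rung₂  : IsRung e′
      cross  : Cross e e′
      apart₁ : proj₁ e ≢ proj₁ e′
      apart₂ : proj₂ e ≢ proj₂ e′
      light₁ : D (proj₁ e) (proj₁ e′) ≤ θ
      light₂ : D (proj₂ e) (proj₂ e′) ≤ θ

  open Γ

  abstract
    Γ? : ∀ e e′ → Dec (Γ e e′)
    Γ? e@(x , y) e′@(x′ , y′) =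
      map′ (λ (((r , r′) , (c , c′)) , ((p , q) , (l , l′))) → mkΓ r r′ (c , c′) p q l l′)
           (λ (mkΓ r r′ (c , c′) p q l l′) → (((r , r′) , (c , c′)) , ((p , q) , (l , l′))))
           (((x ~? y ×-dec x′ ~? y′) ×-dec (x ~? y′ ×-dec x′ ~? y))
            ×-dec ((¬? (x ≟ x′) ×-dec ¬? (y ≟ y′)) ×-dec ((D x x′ ≤? θ) ×-dec (D y y′ ≤? θ))))

    Disj? : ∀ (e f : Rung V) → Dec (Disj e f)
    Disj? (x , y) (x′ , y′) = ¬? (x ≟ x′) ×-dec (¬? (x ≟ y′) ×-dec (¬? (y ≟ x′) ×-dec ¬? (y ≟ y′)))

  Γ-sym : ∀ {e f} → Γ e f → Γ f e
  Γ-sym {x , y} {x′ , y′} (mkΓ r r′ c p q l l′) =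
    mkΓ r′ r (Cross-sym c) (p ∘ sym) (q ∘ sym) (subst (_≤ θ) (D-sym x x′) l) (subst (_≤ θ) (D-sym y y′) l′)

  Γ-disj : ∀ {e f} → Γ e f → Disj e f
  Γ-disj g = apart₁ g , (λ { refl → ~-irrefl (proj₁ (cross g)) }) , (λ { refl → ~-irrefl (proj₂ (cross g)) }) , apart₂ g

  swapΓ : ∀ {x y x′ y′} → Γ (x , y) (x′ , y′) → Γ (y , x) (y′ , x′)
  swapΓ (mkΓ r r′ (c , c′) p q l l′) = mkΓ (~-sym r) (~-sym r′) (~-sym c′ , ~-sym c) q p l′ l

  ∑ᵉ : (Rung V → ℕ) → ℕ
  ∑ᵉ f = ∑[ x ∈ vs ] ∑[ y ∈ vs ] f (x , y)

  ∑ᵉ-mono : ∀ {f g} → (∀ e → f e ≤ g e) → ∑ᵉ f ≤ ∑ᵉ g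
  ∑ᵉ-mono h = ∑-mono vs (λ x → ∑-mono vs (λ y → h (x , y)))

  ∑ᵉ-cong : ∀ {f g} → (∀ e → f e ≡ g e) → ∑ᵉ f ≡ ∑ᵉ g
  ∑ᵉ-cong h = ∑-cong vs (λ x → ∑-cong vs (λ y → h (x , y)))

  ∑ᵉ-swap : ∀ f → ∑ᵉ f ≡ ∑ᵉ (f ∘ swap)
  ∑ᵉ-swap f = ∑-swap vs vs (λ x y → f (x , y))

  ∑-rs : ∀ f → ∑ rs f ≡ ∑ᵉ (λ e → ⟦ IsRung? e ⟧ * f e)
  ∑-rs f = trans (∑-filter IsRung? (cartesianProduct vs vs) f) (∑-⊗ vs vs (λ e → ⟦ IsRung? e ⟧ * f e))

  ∑-rs≤ : ∀ f → ∑ rs f ≤ ∑ᵉ f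
  ∑-rs≤ f = ≤-trans (≤-reflexive (∑-rs f)) (∑ᵉ-mono (λ e → ⟦⟧*≤ (IsRung? e)))

  arcs : ℕ
  arcs = ∑[ e ∈ rs ] ∑[ e′ ∈ rs ] ⟦ Γ? e e′ ⟧

  private
    P : V → V → V → V → ℕ
    P x x′ y y′ = (a y x * a y x′) * (a y′ x * a y′ x′)

    weigh₁ : (k : V → V → ℕ) → (∑[ x ∈ vs ] ∑[ x′ ∈ vs ] ∑[ y ∈ vs ] ∑[ y′ ∈ vs ] k x x′ * P x x′ y y′)
             ≡ (∑[ x ∈ vs ] ∑[ x′ ∈ vs ] k x x′ * (D x x′ * D x x′))
    weigh₁ k = ∑-cong vs λ x → ∑-cong vs λ x′ →
      trans (∑-cong vs (λ y → ∑-*ˡ vs (k x x′) _)) (trans (∑-*ˡ vs (k x x′) _)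
        (cong (k x x′ *_) (sym (∑-* vs vs (λ y → a y x * a y x′) (λ y → a y x * a y x′)))))

    weigh₂ : (k : V → V → ℕ) → (∑[ x ∈ vs ] ∑[ x′ ∈ vs ] ∑[ y ∈ vs ] ∑[ y′ ∈ vs ] k y y′ * P x x′ y y′)
             ≡ (∑[ y ∈ vs ] ∑[ y′ ∈ vs ] k y y′ * (D y y′ * D y y′))
    weigh₂ k = trans (∑-swap₂ vs vs (λ x x′ y y′ → k y y′ * P x x′ y y′))
      (trans (∑-cong vs λ y → ∑-cong vs λ y′ → ∑-cong vs λ x → ∑-cong vs λ x′ → cong (k y y′ *_)
        (trans (lem (a y x) (a y x′) (a y′ x) (a y′ x′)) (cong₂ _*_ (cong₂ _*_ (a-sym y x) (a-sym y′ x)) (cong₂ _*_ (a-sym y x′) (a-sym y′ x′)))))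
        (weigh₁ k))
      where
      lem : ∀ p q r s → (p * q) * (r * s) ≡ (p * r) * (q * s)
      lem = solve-∀

  D-diag : ∀ x → D x x ≡ deg x
  D-diag x = ∑-cong vs (λ w → a-idem w x)

  module _ (Δ : ℕ) (deg≤Δ : ∀ y → deg y ≤ Δ) where

    private
      heavy : V → V → ℕ
      heavy x x′ = ⟦ θ <? D x x′ ⟧

      Qₕ : ℕ
      Qₕ = ∑[ y ∈ vs ] ∑[ y′ ∈ vs ] heavy y y′ * (D y y′ * D y y′)

      diagonal : (∑[ x ∈ vs ] ∑[ x′ ∈ vs ] ⟦ x′ ≟ x ⟧ * (D x x′ * D x x′)) ≤ n * (Δ * Δ)
      diagonal = ∑-≤const vs (Δ * Δ) λ x → ≤-trans (∑-δ _≟_ uniq x (λ x′ → D x x′ * D x x′))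
        (*-mono-≤ (≤-trans (≤-reflexive (D-diag x)) (deg≤Δ x)) (≤-trans (≤-reflexive (D-diag x)) (deg≤Δ x)))

      good : V → V → V → V → ℕ
      good x x′ y y′ = ⟦ Γ? (x , y) (x′ , y′) ⟧

      point : ∀ x x′ y y′ → P x x′ y y′ ≤
        good x x′ y y′ + ((⟦ x′ ≟ x ⟧ * P x x′ y y′ + ⟦ y′ ≟ y ⟧ * P x x′ y y′) + (heavy x x′ * P x x′ y y′ + heavy y y′ * P x x′ y y′))
      point x x′ y y′ = go (x′ ≟ x) (y′ ≟ y) (θ <? D x x′) (θ <? D y y′) (y ~? x) (y ~? x′) (y′ ~? x) (y′ ~? x′) (Γ? (x , y) (x′ , y′))
        where
        go : ∀ (d₁ : Dec (x′ ≡ x)) (d₂ : Dec (y′ ≡ y)) (d₃ : Dec (θ < D x x′)) (d₄ : Dec (θ < D y y′))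
             (e₁ : Dec (y ~ x)) (e₂ : Dec (y ~ x′)) (e₃ : Dec (y′ ~ x)) (e₄ : Dec (y′ ~ x′)) (g : Dec (Γ (x , y) (x′ , y′))) →
             let p = (⟦ e₁ ⟧ * ⟦ e₂ ⟧) * (⟦ e₃ ⟧ * ⟦ e₄ ⟧) in
             p ≤ ⟦ g ⟧ + ((⟦ d₁ ⟧ * p + ⟦ d₂ ⟧ * p) + (⟦ d₃ ⟧ * p + ⟦ d₄ ⟧ * p))
        go _ _ _ _ (no _)  _       _       _       _ = z≤n
        go _ _ _ _ (yes _) (no _)  _       _       _ = z≤n
        go _ _ _ _ (yes _) (yes _) (no _)  _       _ = z≤n
        go _ _ _ _ (yes _) (yes _) (yes _) (no _)  _ = z≤n
        go _ _ _ _ (yes _) (yes _) (yes _) (yes _) (yes _) = s≤s z≤n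
        go (yes _) _ _ _ (yes _) (yes _) (yes _) (yes _) (no _) = s≤s z≤n
        go (no _) (yes _) _ _ (yes _) (yes _) (yes _) (yes _) (no _) = s≤s z≤n
        go (no _) (no _) (yes _) _ (yes _) (yes _) (yes _) (yes _) (no _) = s≤s z≤n
        go (no _) (no _) (no _) (yes _) (yes _) (yes _) (yes _) (yes _) (no _) = s≤s z≤n
        go (no n₁) (no n₂) (no n₃) (no n₄) (yes p₁) (yes p₂) (yes p₃) (yes p₄) (no ¬g) =
          ⊥-elim (¬g (mkΓ (~-sym p₁) (~-sym p₄) (~-sym p₃ , ~-sym p₂) (n₁ ∘ sym) (n₂ ∘ sym) (≮⇒≥ n₃) (≮⇒≥ n₄)))

      ∑⁴-+ : ∀ (f g : V → V → V → V → ℕ) →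
        (∑[ x ∈ vs ] ∑[ x′ ∈ vs ] ∑[ y ∈ vs ] ∑[ y′ ∈ vs ] f x x′ y y′ + g x x′ y y′) ≡
        (∑[ x ∈ vs ] ∑[ x′ ∈ vs ] ∑[ y ∈ vs ] ∑[ y′ ∈ vs ] f x x′ y y′) + (∑[ x ∈ vs ] ∑[ x′ ∈ vs ] ∑[ y ∈ vs ] ∑[ y′ ∈ vs ] g x x′ y y′)
      ∑⁴-+ f g = trans (∑-cong vs λ x → trans (∑-cong vs λ x′ → trans (∑-cong vs λ y → ∑-+ vs (f x x′ y) (g x x′ y)) (∑-+ vs _ _)) (∑-+ vs _ _)) (∑-+ vs _ _)

      good-arcs : (∑[ x ∈ vs ] ∑[ x′ ∈ vs ] ∑[ y ∈ vs ] ∑[ y′ ∈ vs ] good x x′ y y′) ≤ arcs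
      good-arcs = begin
        (∑[ x ∈ vs ] ∑[ x′ ∈ vs ] ∑[ y ∈ vs ] ∑[ y′ ∈ vs ] good x x′ y y′) ≡⟨ ∑-cong vs (λ x → ∑-swap vs vs (λ x′ y → ∑[ y′ ∈ vs ] good x x′ y y′)) ⟩
        ∑ᵉ (λ e → ∑ᵉ (λ e′ → ⟦ Γ? e e′ ⟧)) ≤⟨ ∑ᵉ-mono (λ e → ≤-trans (∑ᵉ-mono (λ e′ → pt e e′)) (≤-reflexive (trans (∑ᵉ-*ˡ ⟦ IsRung? e ⟧ _) (cong (⟦ IsRung? e ⟧ *_) (sym (∑-rs (λ e′ → ⟦ Γ? e e′ ⟧))))))) ⟩
        ∑ᵉ (λ e → ⟦ IsRung? e ⟧ * (∑[ e′ ∈ rs ] ⟦ Γ? e e′ ⟧)) ≡⟨ sym (∑-rs (λ e → ∑[ e′ ∈ rs ] ⟦ Γ? e e′ ⟧)) ⟩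
        arcs ∎
        where
        open ≤-Reasoning
        ∑ᵉ-*ˡ : ∀ k f → ∑ᵉ (λ e → k * f e) ≡ k * ∑ᵉ f
        ∑ᵉ-*ˡ k f = trans (∑-cong vs (λ x → ∑-*ˡ vs k _)) (∑-*ˡ vs k _)
        pt : ∀ e e′ → ⟦ Γ? e e′ ⟧ ≤ ⟦ IsRung? e ⟧ * (⟦ IsRung? e′ ⟧ * ⟦ Γ? e e′ ⟧)
        pt e e′ = ⟦⟧-≤ (Γ? e e′) λ g → ≤-reflexive (sym (cong₂ _*_ (⟦⟧-yes (IsRung? e) (rung₁ g)) (cong₂ _*_ (⟦⟧-yes (IsRung? e′) (rung₂ g)) (⟦⟧-yes (Γ? e e′) g))))

    -- A homomorphic 4-cycle that is not an arc has a collapsed or a heavy diagonal. A collapsed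
    -- diagonal leaves the square of a degree per vertex; each of the two diagonals is charged
    -- separately.
    arcs-bound : Q ≤ arcs + ((n * (Δ * Δ) + n * (Δ * Δ)) + (Qₕ + Qₕ))
    arcs-bound = begin
      Q ≡⟨ ∑-cong vs (λ x → ∑-cong vs (λ x′ → sym (+-identityʳ (D x x′ * D x x′)))) ⟩
      (∑[ x ∈ vs ] ∑[ x′ ∈ vs ] 1 * (D x x′ * D x x′)) ≡⟨ sym (weigh₁ (λ _ _ → 1)) ⟩
      (∑[ x ∈ vs ] ∑[ x′ ∈ vs ] ∑[ y ∈ vs ] ∑[ y′ ∈ vs ] 1 * P x x′ y y′)
        ≤⟨ ∑-mono vs (λ x → ∑-mono vs λ x′ → ∑-mono vs λ y → ∑-mono vs λ y′ → ≤-trans (≤-reflexive (*-identityˡ (P x x′ y y′))) (point x x′ y y′)) ⟩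
      (∑[ x ∈ vs ] ∑[ x′ ∈ vs ] ∑[ y ∈ vs ] ∑[ y′ ∈ vs ] good x x′ y y′ + ((⟦ x′ ≟ x ⟧ * P x x′ y y′ + ⟦ y′ ≟ y ⟧ * P x x′ y y′) + (heavy x x′ * P x x′ y y′ + heavy y y′ * P x x′ y y′)))
        ≡⟨ trans (∑⁴-+ good (λ x x′ y y′ → ((⟦ x′ ≟ x ⟧ * P x x′ y y′ + ⟦ y′ ≟ y ⟧ * P x x′ y y′) + (heavy x x′ * P x x′ y y′ + heavy y y′ * P x x′ y y′))))
            (cong₂ _+_ refl (trans (∑⁴-+ (λ x x′ y y′ → ⟦ x′ ≟ x ⟧ * P x x′ y y′ + ⟦ y′ ≟ y ⟧ * P x x′ y y′) (λ x x′ y y′ → heavy x x′ * P x x′ y y′ + heavy y y′ * P x x′ y y′))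
               (cong₂ _+_ (∑⁴-+ (λ x x′ y y′ → ⟦ x′ ≟ x ⟧ * P x x′ y y′) (λ x x′ y y′ → ⟦ y′ ≟ y ⟧ * P x x′ y y′))
                          (∑⁴-+ (λ x x′ y y′ → heavy x x′ * P x x′ y y′) (λ x x′ y y′ → heavy y y′ * P x x′ y y′))))) ⟩
      (∑[ x ∈ vs ] ∑[ x′ ∈ vs ] ∑[ y ∈ vs ] ∑[ y′ ∈ vs ] good x x′ y y′) +
        (((∑[ x ∈ vs ] ∑[ x′ ∈ vs ] ∑[ y ∈ vs ] ∑[ y′ ∈ vs ] ⟦ x′ ≟ x ⟧ * P x x′ y y′) + (∑[ x ∈ vs ] ∑[ x′ ∈ vs ] ∑[ y ∈ vs ] ∑[ y′ ∈ vs ] ⟦ y′ ≟ y ⟧ * P x x′ y y′))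
         + ((∑[ x ∈ vs ] ∑[ x′ ∈ vs ] ∑[ y ∈ vs ] ∑[ y′ ∈ vs ] heavy x x′ * P x x′ y y′) + (∑[ x ∈ vs ] ∑[ x′ ∈ vs ] ∑[ y ∈ vs ] ∑[ y′ ∈ vs ] heavy y y′ * P x x′ y y′)))
        ≤⟨ +-mono-≤ good-arcs (+-mono-≤ (+-mono-≤ (≤-trans (≤-reflexive (weigh₁ (λ x x′ → ⟦ x′ ≟ x ⟧))) diagonal) (≤-trans (≤-reflexive (weigh₂ (λ x x′ → ⟦ x′ ≟ x ⟧))) diagonal))
                                        (+-mono-≤ (≤-reflexive (weigh₁ heavy)) (≤-reflexive (weigh₂ heavy)))) ⟩
      arcs + ((n * (Δ * Δ) + n * (Δ * Δ)) + (Qₕ + Qₕ)) ∎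
      where open ≤-Reasoning

    rs-length : length rs ≤ n * Δ
    rs-length = begin
      length rs ≡⟨ sym (trans (∑-const rs 1) (*-identityʳ (length rs))) ⟩
      ∑ rs (λ _ → 1) ≡⟨ ∑-rs (λ _ → 1) ⟩
      ∑ᵉ (λ e → ⟦ IsRung? e ⟧ * 1) ≡⟨ ∑ᵉ-cong (λ e → *-identityʳ ⟦ IsRung? e ⟧) ⟩
      (∑[ x ∈ vs ] ∑[ y ∈ vs ] a x y) ≡⟨ ∑-swap vs vs a ⟩
      (∑[ y ∈ vs ] deg y) ≤⟨ ∑-≤const vs Δ deg≤Δ ⟩
      n * Δ ∎
      where open ≤-Reasoning

    private
      meets-split : (p q x y : V) → ¬ Disj (p , q) (x , y) → (x ≡ p ⊎ x ≡ q) ⊎ (y ≡ p ⊎ y ≡ q)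
      meets-split p q x y ¬d with x ≟ p | x ≟ q | y ≟ p | y ≟ q
      ... | yes e | _ | _ | _ = inj₁ (inj₁ e)
      ... | no _ | yes e | _ | _ = inj₁ (inj₂ e)
      ... | no _ | no _ | yes e | _ = inj₂ (inj₁ e)
      ... | no _ | no _ | no _ | yes e = inj₂ (inj₂ e)
      ... | no a | no b | no c | no d = ⊥-elim (¬d (a ∘ sym , c ∘ sym , b ∘ sym , d ∘ sym))

    -- Meeting f means that one of two ends equals one of two vertices: four cases, each with k
    -- choices for the other end.
    meets≤ : {R : Rung V → Set} (R? : ∀ e → Dec (R e)) (k : ℕ) →
      (∀ x → (∑[ y ∈ vs ] ⟦ R? (x , y) ⟧) ≤ k) → (∀ y → (∑[ x ∈ vs ] ⟦ R? (x , y) ⟧) ≤ k) →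
      ∀ f → (∑[ e ∈ rs ] ⟦ R? e ×-dec ¬? (Disj? f e) ⟧) ≤ 4 * k
    meets≤ R? k h₁ h₂ (p , q) = begin
      (∑[ e ∈ rs ] ⟦ R? e ×-dec ¬? (Disj? (p , q) e) ⟧) ≤⟨ ∑-rs≤ _ ⟩
      ∑ᵉ (λ e → ⟦ R? e ×-dec ¬? (Disj? (p , q) e) ⟧) ≤⟨ ∑ᵉ-mono (λ (x , y) → pt x y) ⟩
      (∑[ x ∈ vs ] ∑[ y ∈ vs ] (⟦ x ≟ p ⟧ * r x y + ⟦ x ≟ q ⟧ * r x y) + (⟦ y ≟ p ⟧ * r x y + ⟦ y ≟ q ⟧ * r x y))
        ≡⟨ trans (∑∑-+ _ _) (cong₂ _+_ (∑∑-+ _ _) (∑∑-+ _ _)) ⟩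
      ((∑[ x ∈ vs ] ∑[ y ∈ vs ] ⟦ x ≟ p ⟧ * r x y) + (∑[ x ∈ vs ] ∑[ y ∈ vs ] ⟦ x ≟ q ⟧ * r x y)) +
      ((∑[ x ∈ vs ] ∑[ y ∈ vs ] ⟦ y ≟ p ⟧ * r x y) + (∑[ x ∈ vs ] ∑[ y ∈ vs ] ⟦ y ≟ q ⟧ * r x y))
        ≤⟨ +-mono-≤ (+-mono-≤ (one p) (one q)) (+-mono-≤ (two p) (two q)) ⟩
      (k + k) + (k + k) ≡⟨ lem k ⟩
      4 * k ∎
      where
      open ≤-Reasoning
      r : V → V → ℕ
      r x y = ⟦ R? (x , y) ⟧
      lem : ∀ k → (k + k) + (k + k) ≡ 4 * k
      lem = solve-∀
      ∑∑-+ : ∀ (f g : V → V → ℕ) → (∑[ x ∈ vs ] ∑[ y ∈ vs ] f x y + g x y) ≡ (∑[ x ∈ vs ] ∑[ y ∈ vs ] f x y) + (∑[ x ∈ vs ] ∑[ y ∈ vs ] g x y)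
      ∑∑-+ f g = trans (∑-cong vs (λ x → ∑-+ vs (f x) (g x))) (∑-+ vs _ _)
      one : ∀ p → (∑[ x ∈ vs ] ∑[ y ∈ vs ] ⟦ x ≟ p ⟧ * r x y) ≤ k
      one p = ≤-trans (≤-reflexive (∑-cong vs (λ x → ∑-*ˡ vs ⟦ x ≟ p ⟧ (r x)))) (≤-trans (∑-δ _≟_ uniq p (λ x → ∑ vs (r x))) (h₁ p))
      two : ∀ p → (∑[ x ∈ vs ] ∑[ y ∈ vs ] ⟦ y ≟ p ⟧ * r x y) ≤ k
      two p = ≤-trans (≤-reflexive (∑-swap vs vs (λ x y → ⟦ y ≟ p ⟧ * r x y))) (≤-trans (≤-reflexive (∑-cong vs (λ y → ∑-*ˡ vs ⟦ y ≟ p ⟧ (λ x → r x y)))) (≤-trans (∑-δ _≟_ uniq p (λ y → ∑[ x ∈ vs ] r x y)) (h₂ p)))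
      pt : ∀ x y → ⟦ R? (x , y) ×-dec ¬? (Disj? (p , q) (x , y)) ⟧ ≤ (⟦ x ≟ p ⟧ * r x y + ⟦ x ≟ q ⟧ * r x y) + (⟦ y ≟ p ⟧ * r x y + ⟦ y ≟ q ⟧ * r x y)
      pt x y = ⟦⟧-≤ (R? (x , y) ×-dec ¬? (Disj? (p , q) (x , y))) λ (m , ¬d) → go m (meets-split p q x y ¬d)
        where
        hit : ∀ {z w} → R? (x , y) ≡ R? (x , y) → ∀ (m : _) → z ≡ w → 1 ≤ ⟦ z ≟ w ⟧ * r x y
        hit {z} {w} _ m e = ≤-reflexive (sym (cong₂ _*_ (⟦⟧-yes (z ≟ w) e) (⟦⟧-yes (R? (x , y)) m)))
        go : _ → _ → _
        go m (inj₁ (inj₁ e)) = ≤-trans (hit refl m e) (≤-trans (m≤m+n _ _) (m≤m+n _ _))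
        go m (inj₁ (inj₂ e)) = ≤-trans (hit refl m e) (≤-trans (m≤n+m _ (⟦ x ≟ p ⟧ * r x y)) (m≤m+n _ _))
        go m (inj₂ (inj₁ e)) = ≤-trans (hit refl m e) (≤-trans (m≤m+n _ _) (m≤n+m _ (⟦ x ≟ p ⟧ * r x y + ⟦ x ≟ q ⟧ * r x y)))
        go m (inj₂ (inj₂ e)) = ≤-trans (hit refl m e) (≤-trans (m≤n+m _ (⟦ y ≟ p ⟧ * r x y)) (m≤n+m _ (⟦ x ≟ p ⟧ * r x y + ⟦ x ≟ q ⟧ * r x y)))

    rungs-meeting : ∀ f → (∑[ e ∈ rs ] ⟦ ¬? (Disj? f e) ⟧) ≤ 4 * Δ
    rungs-meeting f = ≤-trans (∑-mono∈ rs (λ {e} e∈ → ⟦⟧-mono (¬? (Disj? f e)) (IsRung? e ×-dec ¬? (Disj? f e)) (λ ¬d → proj₂ (∈-filter⁻ IsRung? {xs = cartesianProduct vs vs} e∈) , ¬d)))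
      (meets≤ IsRung? Δ (λ x → ≤-trans (≤-reflexive (∑-cong vs (a-sym x))) (deg≤Δ x)) deg≤Δ f)

    -- Once x′ is fixed, y′ is a common neighbour of x and x′, and that diagonal is light; fixing y′
    -- instead is the same after `swap`. This is where the small codegrees beat the trivial bound 4Δ
    -- of `rungs-meeting`.
    Γ-meeting : ∀ e f → (∑[ e′ ∈ rs ] ⟦ Γ? e e′ ×-dec ¬? (Disj? f e′) ⟧) ≤ 4 * θ
    Γ-meeting e f = meets≤ (Γ? e) θ (λ x′ → one e x′) (λ y′ → ≤-trans (∑-mono vs (λ x′ → ⟦⟧-mono (Γ? e (x′ , y′)) (Γ? (swap e) (y′ , x′)) swapΓ)) (one (swap e) y′)) f
      where
      one : ∀ e x′ → (∑[ y′ ∈ vs ] ⟦ Γ? e (x′ , y′) ⟧) ≤ θ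
      one (x , y) x′ with D x x′ ≤? θ
      ... | yes le = ≤-trans (∑-mono vs (λ y′ → ≤-trans (⟦⟧-mono (Γ? (x , y) (x′ , y′)) (y′ ~? x ×-dec y′ ~? x′) (λ g → ~-sym (proj₁ (cross g)) , ~-sym (rung₂ g))) (≤-reflexive (⟦⟧-× (y′ ~? x) (y′ ~? x′))))) le
      ... | no ¬le = ≤-trans (≤-reflexive (trans (∑-cong vs (λ y′ → ⟦⟧-no (Γ? (x , y) (x′ , y′)) (¬le ∘ light₁))) (∑-0 vs))) z≤n

  Rich₂ : Rung V → Rung V → Rung V → Set
  Rich₂ (x₀ , y₀) (x₁ , y₁) (x₂ , y₂) = Rich x₀ x₁ x₂ ⊎ Rich y₀ y₁ y₂

  abstract
    Rich₂? : ∀ e₀ e₁ e₂ → Dec (Rich₂ e₀ e₁ e₂)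
    Rich₂? (x₀ , y₀) (x₁ , y₁) (x₂ , y₂) = Rich? x₀ x₁ x₂ ⊎-dec Rich? y₀ y₁ y₂

  Rich₂-rev : ∀ {e₀ e₁ e₂} → Rich₂ e₀ e₁ e₂ → Rich₂ e₂ e₁ e₀
  Rich₂-rev (inj₁ r) = inj₁ (Rich-swap₁₂ (Rich-swap₂₃ (Rich-swap₁₂ r)))
  Rich₂-rev (inj₂ r) = inj₂ (Rich-swap₁₂ (Rich-swap₂₃ (Rich-swap₁₂ r)))

  private
    A₁ : Rung V → Rung V → Rung V → ℕ
    A₁ e₀ e₁ e₂ = ⟦ (Γ? e₀ e₁ ×-dec Γ? e₁ e₂) ×-dec Rich? (proj₁ e₀) (proj₁ e₁) (proj₁ e₂) ⟧

    -- Given the first ends, y₀ and y₂ are common neighbours of light pairs, with at most θ choices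
    -- each, and y₁ is one of T x₀ x₁ x₂ vertices. Bounding T by T² brings in `Φ`.
    onFirst : ∑ᵉ (λ e₀ → ∑ᵉ (λ e₁ → ∑ᵉ (λ e₂ → A₁ e₀ e₁ e₂))) ≤ (θ * θ) * Φ
    onFirst = begin
      (∑[ x₀ ∈ vs ] ∑[ y₀ ∈ vs ] ∑[ x₁ ∈ vs ] ∑[ y₁ ∈ vs ] ∑[ x₂ ∈ vs ] ∑[ y₂ ∈ vs ] A₁ (x₀ , y₀) (x₁ , y₁) (x₂ , y₂))
        ≡⟨ ∑-cong vs (λ x₀ → trans (∑-swap vs vs (λ y₀ x₁ → ∑[ y₁ ∈ vs ] ∑[ x₂ ∈ vs ] ∑[ y₂ ∈ vs ] A₁ (x₀ , y₀) (x₁ , y₁) (x₂ , y₂)))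
             (∑-cong vs (λ x₁ → trans (∑-cong vs (λ y₀ → ∑-swap vs vs (λ y₁ x₂ → ∑[ y₂ ∈ vs ] A₁ (x₀ , y₀) (x₁ , y₁) (x₂ , y₂))))
               (∑-swap vs vs (λ y₀ x₂ → ∑[ y₁ ∈ vs ] ∑[ y₂ ∈ vs ] A₁ (x₀ , y₀) (x₁ , y₁) (x₂ , y₂)))))) ⟩
      (∑[ x₀ ∈ vs ] ∑[ x₁ ∈ vs ] ∑[ x₂ ∈ vs ] ∑[ y₀ ∈ vs ] ∑[ y₁ ∈ vs ] ∑[ y₂ ∈ vs ] A₁ (x₀ , y₀) (x₁ , y₁) (x₂ , y₂))
        ≤⟨ ∑-mono vs (λ x₀ → ∑-mono vs λ x₁ → ∑-mono vs λ x₂ → pt x₀ x₁ x₂) ⟩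
      (∑[ x₀ ∈ vs ] ∑[ x₁ ∈ vs ] ∑[ x₂ ∈ vs ] (θ * θ) * (rich x₀ x₁ x₂ * (T x₀ x₁ x₂ * T x₀ x₁ x₂)))
        ≡⟨ trans (∑-cong vs (λ x₀ → trans (∑-cong vs (λ x₁ → ∑-*ˡ vs (θ * θ) _)) (∑-*ˡ vs (θ * θ) _))) (∑-*ˡ vs (θ * θ) _) ⟩
      (θ * θ) * Φ ∎
      where
      open ≤-Reasoning
      pt : ∀ x₀ x₁ x₂ → (∑[ y₀ ∈ vs ] ∑[ y₁ ∈ vs ] ∑[ y₂ ∈ vs ] A₁ (x₀ , y₀) (x₁ , y₁) (x₂ , y₂))
                         ≤ (θ * θ) * (rich x₀ x₁ x₂ * (T x₀ x₁ x₂ * T x₀ x₁ x₂))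
      pt x₀ x₁ x₂ = go (D x₀ x₁ ≤? θ) (D x₁ x₂ ≤? θ)
        where
        all0 : (∀ y₀ y₁ y₂ → ¬ ((Γ (x₀ , y₀) (x₁ , y₁) × Γ (x₁ , y₁) (x₂ , y₂)) × Rich x₀ x₁ x₂)) →
          (∑[ y₀ ∈ vs ] ∑[ y₁ ∈ vs ] ∑[ y₂ ∈ vs ] A₁ (x₀ , y₀) (x₁ , y₁) (x₂ , y₂)) ≤ (θ * θ) * (rich x₀ x₁ x₂ * (T x₀ x₁ x₂ * T x₀ x₁ x₂))
        all0 h = ≤-trans (≤-reflexive (trans (∑-cong vs (λ y₀ → trans (∑-cong vs (λ y₁ → trans (∑-cong vs (λ y₂ → ⟦⟧-no ((Γ? _ _ ×-dec Γ? _ _) ×-dec Rich? _ _ _) (h y₀ y₁ y₂))) (∑-0 vs))) (∑-0 vs))) (∑-0 vs))) z≤n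
        b₀ b₂ : V → ℕ
        b₀ y₀ = a y₀ x₀ * a y₀ x₁
        b₂ y₂ = a y₂ x₁ * a y₂ x₂
        b₁ : V → ℕ
        b₁ y₁ = a y₁ x₀ * (a y₁ x₁ * a y₁ x₂)
        ρ = rich x₀ x₁ x₂
        each : ∀ y₀ y₁ y₂ → A₁ (x₀ , y₀) (x₁ , y₁) (x₂ , y₂) ≤ ρ * (b₀ y₀ * (b₁ y₁ * b₂ y₂))
        each y₀ y₁ y₂ = ⟦⟧-≤ ((Γ? (x₀ , y₀) (x₁ , y₁) ×-dec Γ? (x₁ , y₁) (x₂ , y₂)) ×-dec Rich? x₀ x₁ x₂) λ ((g , g′) , r) →
          ≤-reflexive (sym (cong₂ _*_ (⟦⟧-yes (Rich? x₀ x₁ x₂) r) (cong₂ _*_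
            (cong₂ _*_ (⟦⟧-yes (y₀ ~? x₀) (~-sym (rung₁ g))) (⟦⟧-yes (y₀ ~? x₁) (~-sym (proj₂ (cross g)))))
            (cong₂ _*_ (cong₂ _*_ (⟦⟧-yes (y₁ ~? x₀) (~-sym (proj₁ (cross g)))) (cong₂ _*_ (⟦⟧-yes (y₁ ~? x₁) (~-sym (rung₂ g))) (⟦⟧-yes (y₁ ~? x₂) (~-sym (proj₂ (cross g′))))))
              (cong₂ _*_ (⟦⟧-yes (y₂ ~? x₁) (~-sym (proj₁ (cross g′)))) (⟦⟧-yes (y₂ ~? x₂) (~-sym (rung₂ g′))))))))
        go : Dec (D x₀ x₁ ≤ θ) → Dec (D x₁ x₂ ≤ θ) → _
        go (no h) _ = all0 (λ y₀ y₁ y₂ ((g , _) , _) → h (light₁ g))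
        go (yes _) (no h) = all0 (λ y₀ y₁ y₂ ((_ , g) , _) → h (light₁ g))
        go (yes l) (yes l′) = begin
          (∑[ y₀ ∈ vs ] ∑[ y₁ ∈ vs ] ∑[ y₂ ∈ vs ] A₁ (x₀ , y₀) (x₁ , y₁) (x₂ , y₂)) ≤⟨ ∑-mono vs (λ y₀ → ∑-mono vs λ y₁ → ∑-mono vs λ y₂ → each y₀ y₁ y₂) ⟩
          (∑[ y₀ ∈ vs ] ∑[ y₁ ∈ vs ] ∑[ y₂ ∈ vs ] ρ * (b₀ y₀ * (b₁ y₁ * b₂ y₂)))
            ≡⟨ trans (∑-cong vs (λ y₀ → trans (∑-cong vs (λ y₁ → ∑-*ˡ vs ρ _)) (∑-*ˡ vs ρ _))) (∑-*ˡ vs ρ _) ⟩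
          ρ * (∑[ y₀ ∈ vs ] ∑[ y₁ ∈ vs ] ∑[ y₂ ∈ vs ] b₀ y₀ * (b₁ y₁ * b₂ y₂))
            ≡⟨ cong (ρ *_) (trans (∑-cong vs (λ y₀ → trans (∑-cong vs (λ y₁ → ∑-*ˡ vs (b₀ y₀) _)) (trans (∑-*ˡ vs (b₀ y₀) _) (cong (b₀ y₀ *_) (sym (∑-* vs vs b₁ b₂)))))) (∑-*ʳ vs b₀ _)) ⟩
          ρ * (D x₀ x₁ * (T x₀ x₁ x₂ * D x₁ x₂)) ≤⟨ *-monoʳ-≤ ρ (*-mono-≤ l (*-mono-≤ (m≤m*m (T x₀ x₁ x₂)) l′)) ⟩
          ρ * (θ * ((T x₀ x₁ x₂ * T x₀ x₁ x₂) * θ)) ≡⟨ lem ρ θ (T x₀ x₁ x₂ * T x₀ x₁ x₂) ⟩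
          (θ * θ) * (ρ * (T x₀ x₁ x₂ * T x₀ x₁ x₂)) ∎
          where
          lem : ∀ r t x → r * (t * (x * t)) ≡ (t * t) * (r * x)
          lem = solve-∀

  rich-walks : (∑[ e₀ ∈ rs ] ∑[ e₁ ∈ rs ] ∑[ e₂ ∈ rs ] ⟦ (Γ? e₀ e₁ ×-dec Γ? e₁ e₂) ×-dec Rich₂? e₀ e₁ e₂ ⟧) ≤ 2 * ((θ * θ) * Φ)
  rich-walks = begin
    (∑[ e₀ ∈ rs ] ∑[ e₁ ∈ rs ] ∑[ e₂ ∈ rs ] ⟦ (Γ? e₀ e₁ ×-dec Γ? e₁ e₂) ×-dec Rich₂? e₀ e₁ e₂ ⟧)
      ≤⟨ ≤-trans (∑-mono rs (λ e₀ → ≤-trans (∑-mono rs (λ e₁ → ∑-rs≤ _)) (∑-rs≤ _))) (∑-rs≤ _) ⟩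
    ∑ᵉ (λ e₀ → ∑ᵉ (λ e₁ → ∑ᵉ (λ e₂ → ⟦ (Γ? e₀ e₁ ×-dec Γ? e₁ e₂) ×-dec Rich₂? e₀ e₁ e₂ ⟧)))
      ≤⟨ ∑ᵉ-mono (λ e₀ → ∑ᵉ-mono λ e₁ → ∑ᵉ-mono λ e₂ → pt e₀ e₁ e₂) ⟩
    ∑ᵉ (λ e₀ → ∑ᵉ (λ e₁ → ∑ᵉ (λ e₂ → A₁ e₀ e₁ e₂ + A₁ (swap e₀) (swap e₁) (swap e₂))))
      ≡⟨ trans (∑ᵉ-cong (λ e₀ → trans (∑ᵉ-cong (λ e₁ → ∑ᵉ-+ _ _)) (∑ᵉ-+ _ _))) (∑ᵉ-+ _ _) ⟩
    ∑ᵉ (λ e₀ → ∑ᵉ (λ e₁ → ∑ᵉ (λ e₂ → A₁ e₀ e₁ e₂))) + ∑ᵉ (λ e₀ → ∑ᵉ (λ e₁ → ∑ᵉ (λ e₂ → A₁ (swap e₀) (swap e₁) (swap e₂))))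
      ≡⟨ cong (∑ᵉ (λ e₀ → ∑ᵉ (λ e₁ → ∑ᵉ (λ e₂ → A₁ e₀ e₁ e₂))) +_) (sym (trans (∑ᵉ-swap _) (∑ᵉ-cong (λ e₀ → trans (∑ᵉ-swap _) (∑ᵉ-cong (λ e₁ → ∑ᵉ-swap _)))))) ⟩
    ∑ᵉ (λ e₀ → ∑ᵉ (λ e₁ → ∑ᵉ (λ e₂ → A₁ e₀ e₁ e₂))) + ∑ᵉ (λ e₀ → ∑ᵉ (λ e₁ → ∑ᵉ (λ e₂ → A₁ e₀ e₁ e₂)))
      ≤⟨ +-mono-≤ onFirst onFirst ⟩
    (θ * θ) * Φ + (θ * θ) * Φ ≡⟨ double ((θ * θ) * Φ) ⟩
    2 * ((θ * θ) * Φ) ∎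
    where
    open ≤-Reasoning
    ∑ᵉ-+ : ∀ f g → ∑ᵉ (λ e → f e + g e) ≡ ∑ᵉ f + ∑ᵉ g
    ∑ᵉ-+ f g = trans (∑-cong vs (λ x → ∑-+ vs _ _)) (∑-+ vs _ _)
    pt : ∀ e₀ e₁ e₂ → ⟦ (Γ? e₀ e₁ ×-dec Γ? e₁ e₂) ×-dec Rich₂? e₀ e₁ e₂ ⟧ ≤ A₁ e₀ e₁ e₂ + A₁ (swap e₀) (swap e₁) (swap e₂)
    pt e₀ e₁ e₂ = ⟦⟧-∪ ((Γ? e₀ e₁ ×-dec Γ? e₁ e₂) ×-dec Rich₂? e₀ e₁ e₂)
      ((Γ? e₀ e₁ ×-dec Γ? e₁ e₂) ×-dec Rich? (proj₁ e₀) (proj₁ e₁) (proj₁ e₂))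
      ((Γ? (swap e₀) (swap e₁) ×-dec Γ? (swap e₁) (swap e₂)) ×-dec Rich? (proj₂ e₀) (proj₂ e₁) (proj₂ e₂))
      λ { (gs , inj₁ r) → inj₁ (gs , r) ; ((g , g′) , inj₂ r) → inj₂ ((swapΓ g , swapΓ g′) , r) }

-- Pairs of rungs joined by many two-step walks

module Links (𝔾 : FinGraph) (L θ Δ : ℕ) (deg≤Δ : ∀ y → Codegrees.deg 𝔾 y ≤ Δ) (w ℓ : ℕ) where

  open FinGraph 𝔾
  open Codegrees 𝔾
  open Richness L
  open RichCount 𝔾 L
  open Rings _~_ ~-sym
  open Arcs 𝔾 L θ
  open Γ

  _≟ʳ_ : DecidableEquality (Rung V)
  _≟ʳ_ = ≡-dec _≟_ _≟_

  Clear : List (Rung V) → Rung V → Set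
  Clear Z e = All (λ f → Disj f e) Z

  abstract
    Clear? : ∀ Z e → Dec (Clear Z e)
    Clear? Z e = All.all? (λ f → Disj? f e) Z

  module _ {R : Rung V → Set} (R? : ∀ e → Dec (R e)) (xs : List (Rung V)) (k : ℕ)
           (meet : ∀ f → (∑[ e ∈ xs ] ⟦ R? e ×-dec ¬? (Disj? f e) ⟧) ≤ k) where

    notClear≤ : ∀ Z → (∑[ e ∈ xs ] ⟦ R? e ×-dec ¬? (Clear? Z e) ⟧) ≤ length Z * k
    notClear≤ [] = ≤-reflexive (trans (∑-cong xs (λ e → ⟦⟧-no (R? e ×-dec ¬? (Clear? [] e)) (λ (_ , ¬c) → ¬c []))) (∑-0 xs))
    notClear≤ (f ∷ Z) = begin
      (∑[ e ∈ xs ] ⟦ R? e ×-dec ¬? (Clear? (f ∷ Z) e) ⟧)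
        ≤⟨ ∑-mono xs (λ e → ⟦⟧-∪ (R? e ×-dec ¬? (Clear? (f ∷ Z) e)) (R? e ×-dec ¬? (Disj? f e)) (R? e ×-dec ¬? (Clear? Z e)) (pt e)) ⟩
      (∑[ e ∈ xs ] ⟦ R? e ×-dec ¬? (Disj? f e) ⟧ + ⟦ R? e ×-dec ¬? (Clear? Z e) ⟧) ≡⟨ ∑-+ xs _ _ ⟩
      (∑[ e ∈ xs ] ⟦ R? e ×-dec ¬? (Disj? f e) ⟧) + (∑[ e ∈ xs ] ⟦ R? e ×-dec ¬? (Clear? Z e) ⟧) ≤⟨ +-mono-≤ (meet f) (notClear≤ Z) ⟩
      k + length Z * k ∎
      where
      open ≤-Reasoning
      pt : ∀ e → R e × ¬ Clear (f ∷ Z) e → (R e × ¬ Disj f e) ⊎ (R e × ¬ Clear Z e)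
      pt e (r , ¬c) with Disj? f e
      ... | yes d = inj₂ (r , λ c → ¬c (d ∷ c))
      ... | no ¬d = inj₁ (r , ¬d)

    clear : ∀ Z → length Z * k < (∑[ e ∈ xs ] ⟦ R? e ⟧) → ∃[ e ] (e ∈ xs × R e × Clear Z e)
    clear Z lt = fix (avoid R? (λ e → R? e ×-dec ¬? (Clear? Z e)) xs (≤-<-trans (notClear≤ Z) lt))
      where
      fix : ∃[ e ] (e ∈ xs × R e × ¬ (R e × ¬ Clear Z e)) → ∃[ e ] (e ∈ xs × R e × Clear Z e)
      fix (e , e∈ , r , h) = e , e∈ , r , decidable-stable (Clear? Z e) (λ ¬c → h (r , ¬c))

  Mid : Rung V → Rung V → Rung V → Set
  Mid e₀ e₂ e₁ = (Γ e₀ e₁ × Γ e₁ e₂) × ¬ Rich₂ e₀ e₁ e₂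

  abstract
    Mid? : ∀ e₀ e₂ e₁ → Dec (Mid e₀ e₂ e₁)
    Mid? e₀ e₂ e₁ = (Γ? e₀ e₁ ×-dec Γ? e₁ e₂) ×-dec ¬? (Rich₂? e₀ e₁ e₂)

  W₂ : Rung V → Rung V → ℕ
  W₂ e₀ e₂ = ∑[ e₁ ∈ rs ] ⟦ Mid? e₀ e₂ e₁ ⟧

  Linked₂ : Rung V → Rung V → Set
  Linked₂ e₀ e₂ = w ≤ W₂ e₀ e₂

  abstract
    Linked₂? : ∀ e₀ e₂ → Dec (Linked₂ e₀ e₂)
    Linked₂? e₀ e₂ = w ≤? W₂ e₀ e₂

  Mid-rev : ∀ {e₀ e₂ e₁} → Mid e₀ e₂ e₁ → Mid e₂ e₀ e₁
  Mid-rev ((g , g′) , ¬r) = (Γ-sym g′ , Γ-sym g) , (¬r ∘ Rich₂-rev)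

  Linked₂-sym : ∀ {e₀ e₂} → Linked₂ e₀ e₂ → Linked₂ e₂ e₀
  Linked₂-sym {e₀} {e₂} l = ≤-trans l (∑-mono rs (λ e₁ → ⟦⟧-mono (Mid? e₀ e₂ e₁) (Mid? e₂ e₀ e₁) Mid-rev))

  -- A triple of first ends that is not rich has fewer than L common neighbours, so few
  -- middle rungs share a vertex.
  Mid-meeting : ∀ e₀ e₂ f → (∑[ e₁ ∈ rs ] ⟦ Mid? e₀ e₂ e₁ ×-dec ¬? (Disj? f e₁) ⟧) ≤ 4 * L
  Mid-meeting e₀@(x₀ , y₀) e₂@(x₂ , y₂) f = meets≤ Δ deg≤Δ (Mid? e₀ e₂) L first second f
    where
    first : ∀ x → (∑[ y ∈ vs ] ⟦ Mid? e₀ e₂ (x , y) ⟧) ≤ L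
    first x with Rich? x₀ x x₂
    ... | yes r = ≤-trans (≤-reflexive (trans (∑-cong vs (λ y → ⟦⟧-no (Mid? e₀ e₂ (x , y)) (λ (_ , ¬r) → ¬r (inj₁ r)))) (∑-0 vs))) z≤n
    ... | no ¬r = ≤-trans (∑-mono vs (λ y → ≤-trans (⟦⟧-mono (Mid? e₀ e₂ (x , y)) (y ~? x₀ ×-dec (y ~? x ×-dec y ~? x₂))
                    (λ ((g , g′) , _) → ~-sym (proj₁ (cross g)) , ~-sym (rung₂ g) , ~-sym (proj₂ (cross g′))))
                    (≤-reflexive (trans (⟦⟧-× (y ~? x₀) (y ~? x ×-dec y ~? x₂)) (cong (a y x₀ *_) (⟦⟧-× (y ~? x) (y ~? x₂))))))) (<⇒≤ (≰⇒> ¬r))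
    second : ∀ y → (∑[ x ∈ vs ] ⟦ Mid? e₀ e₂ (x , y) ⟧) ≤ L
    second y with Rich? y₀ y y₂
    ... | yes r = ≤-trans (≤-reflexive (trans (∑-cong vs (λ x → ⟦⟧-no (Mid? e₀ e₂ (x , y)) (λ (_ , ¬r) → ¬r (inj₂ r)))) (∑-0 vs))) z≤n
    ... | no ¬r = ≤-trans (∑-mono vs (λ x → ≤-trans (⟦⟧-mono (Mid? e₀ e₂ (x , y)) (x ~? y₀ ×-dec (x ~? y ×-dec x ~? y₂))
                    (λ ((g , g′) , _) → proj₂ (cross g) , rung₂ g , proj₁ (cross g′)))
                    (≤-reflexive (trans (⟦⟧-× (x ~? y₀) (x ~? y ×-dec x ~? y₂)) (cong (a x y₀ *_) (⟦⟧-× (x ~? y) (x ~? y₂))))))) (<⇒≤ (≰⇒> ¬r))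

  Bad : Rung V → Rung V → Rung V → Set
  Bad e₀ e₁ e₂ = Rich₂ e₀ e₁ e₂ ⊎ Linked₂ e₀ e₂

  abstract
    Bad? : ∀ e₀ e₁ e₂ → Dec (Bad e₀ e₁ e₂)
    Bad? e₀ e₁ e₂ = Rich₂? e₀ e₁ e₂ ⊎-dec Linked₂? e₀ e₂

  Good : Rung V → Rung V → Rung V → Set
  Good e₀ e₂ e₁ = (Γ e₀ e₁ × Γ e₁ e₂) × ¬ Bad e₀ e₁ e₂

  abstract
    Good? : ∀ e₀ e₂ e₁ → Dec (Good e₀ e₂ e₁)
    Good? e₀ e₂ e₁ = (Γ? e₀ e₁ ×-dec Γ? e₁ e₂) ×-dec ¬? (Bad? e₀ e₁ e₂)

  -- `Bad` contains the linked pairs, so between linked rungs there is no good middle at all;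
  -- between unlinked ones there are fewer than w by definition.
  good≤w : ∀ e₀ e₂ → (∑[ e₁ ∈ rs ] ⟦ Good? e₀ e₂ e₁ ⟧) ≤ w
  good≤w e₀ e₂ = go (Linked₂? e₀ e₂)
    where
    go : Dec (Linked₂ e₀ e₂) → _
    go (yes l) = ≤-trans (≤-reflexive (trans (∑-cong rs (λ e₁ → ⟦⟧-no (Good? e₀ e₂ e₁) (λ (_ , ¬b) → ¬b (inj₂ l)))) (∑-0 rs))) z≤n
    go (no ¬l) = ≤-trans (∑-mono rs (λ e₁ → ⟦⟧-mono (Good? e₀ e₂ e₁) (Mid? e₀ e₂ e₁) (λ (gs , ¬b) → gs , ¬b ∘ inj₁))) (<⇒≤ (≰⇒> ¬l))

  module Linking (ℓ≢0 : ℓ ≢ 0) (w> : 2 * ℓ * (4 * L) < w) (noRing : ¬ Ring (2 * ℓ)) (K : ℕ) (K≥ : 2 * ℓ * (4 * θ) ≤ K) where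

    -- Each rung of `Z` meets at most 4L of the middle rungs, and w exceeds 2ℓ times that.
    viaMiddle : ∀ {e₀ e₂} → Linked₂ e₀ e₂ → ∀ Z → length Z ≤ 2 * ℓ → ∃[ e₁ ] (Mid e₀ e₂ e₁ × Clear Z e₁)
    viaMiddle {e₀} {e₂} l Z le =
      forget∈ (clear (Mid? e₀ e₂) rs (4 * L) (Mid-meeting e₀ e₂) Z (≤-<-trans (*-monoˡ-≤ (4 * L) le) (<-≤-trans w> l)))
      where
      forget∈ : ∃[ e ] (e ∈ rs × Mid e₀ e₂ e × Clear Z e) → ∃[ e ] (Mid e₀ e₂ e × Clear Z e)
      forget∈ (e , _ , m , c) = e , m , c

    open Endpoints _≟ʳ_ rs-unique

    module _ (g : Rung V) where

      private
        LinkedPair : Rung V × Rung V → Set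
        LinkedPair (f , f′) = (Γ g f × Γ g f′) × Linked₂ f f′

        LinkedPair? : ∀ p → Dec (LinkedPair p)
        LinkedPair? (f , f′) = (Γ? g f ×-dec Γ? g f′) ×-dec Linked₂? f f′

        nbrs : List (Rung V)
        nbrs = filter (Γ? g) rs

        module Peeled {Q : Rung V × Rung V → Set} (Q? : ∀ p → Dec (Q p)) (Q⊆ : ∀ {p} → Q p → LinkedPair p)
          (big : ∀ {c} → c ∈ nbrs → 0 < degree End? pairs Q? c → 2 * K < degree End? pairs Q? c) where

          dg : Rung V → ℕ
          dg = degree End? pairs Q?

          Ext : Rung V → Rung V → Set
          Ext f f′ = (Γ g f′ × Linked₂ f f′) × 0 < dg f′

          Ext? : ∀ f f′ → Dec (Ext f f′)
          Ext? f f′ = (Γ? g f′ ×-dec Linked₂? f f′) ×-dec (0 <? dg f′)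

          alive : ∀ {p c} → Q p → End p c → 0 < dg c
          alive {p} {c} q i = subst (_≤ dg c) (⟦⟧-yes (Q? p ×-dec End? p c) (q , i))
            (∑-single pairs (λ p → ⟦ Q? p ×-dec End? p c ⟧) (mem {p} (Q⊆ {p} q)))
            where
            mem : ∀ {p} → LinkedPair p → p ∈ pairs
            mem ((g₁ , g₂) , _) = ∈-cartesianProduct⁺ (∈-rs (rung₂ g₁)) (∈-rs (rung₂ g₂))

          dg≤ : ∀ c → dg c ≤ 2 * (∑[ f ∈ rs ] ⟦ Ext? c f ⟧)
          dg≤ = degree≤ Q? Ext?
            (λ {f} {f′} q → (proj₂ (proj₁ (Q⊆ {f , f′} q)) , proj₂ (Q⊆ {f , f′} q)) , alive {f , f′} q (inj₂ refl))
            (λ {f} {f′} q → (proj₁ (proj₁ (Q⊆ {f , f′} q)) , Linked₂-sym (proj₂ (Q⊆ {f , f′} q))) , alive {f , f′} q (inj₁ refl))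

          extend : ∀ {f} → Γ g f → 0 < dg f → ∀ Z → length Z ≤ 2 * ℓ → ∃[ f′ ] (Ext f f′ × Clear Z f′)
          extend {f} gf pos Z le = forget∈ (clear (Ext? f) rs (4 * θ)
            (λ h → ≤-trans (∑-mono rs (λ e → ⟦⟧-mono (Ext? f e ×-dec ¬? (Disj? h e)) (Γ? g e ×-dec ¬? (Disj? h e)) (λ (((ge , _) , _) , d) → ge , d))) (Γ-meeting Δ deg≤Δ g h)) Z
            (≤-<-trans (≤-trans (*-monoˡ-≤ (4 * θ) le) K≥) (*-cancelˡ-< 2 _ _ (<-≤-trans (big (∈-filter⁺ (Γ? g) (∈-rs (rung₂ gf)) gf) pos) (dg≤ f)))))
            where
            forget∈ : ∃[ e ] (e ∈ rs × Ext f e × Clear Z e) → ∃[ e ] (Ext f e × Clear Z e)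
            forget∈ (e , _ , m , c) = e , m , c

          -- j counts the neighbours of g still to be added; each arrives together with the middle
          -- rung linking it to its predecessor, hence two rungs per step. The growing walk always
          -- ends at g, so it closes up at any moment.
          grow : ∀ j f us → AllPairs Disj (g ∷ f ∷ us) → Walk f us g → Γ g f → 0 < dg f →
                 2 + length us + 2 * j ≤ 2 * ℓ → Ring (2 + length us + 2 * j)
          grow zero f us dis wk gf pos le =
            mkRing g (f ∷ us) (cons (rung₂ gf) (cross gf) wk) (rung₁ gf) dis (sym (+-identityʳ (2 + length us)))
          grow (suc j) f us dis wk gf pos le = go₁ (extend gf pos (g ∷ f ∷ us) (≤-trans (m≤m+n _ _) le))
            where
            lem : ∀ u j → 2 + (2 + u) + 2 * j ≡ 2 + u + 2 * suc j
            lem = solve-∀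
            lem′ : ∀ u j → 3 + u + (1 + 2 * j) ≡ 2 + u + 2 * suc j
            lem′ = solve-∀
            go₂ : ∀ f′ → Ext f f′ → Clear (g ∷ f ∷ us) f′ → ∃[ h ] (Mid f f′ h × Clear (f′ ∷ g ∷ f ∷ us) h) → Ring (2 + length us + 2 * suc j)
            go₂ f′ ((gf′ , lk) , pos′) (c₁ ∷ c₂ ∷ cs) (h , ((γ₁ , γ₂) , _) , (d₀ ∷ d₁ ∷ d₂ ∷ ds)) =
              subst Ring (lem (length us) j) (grow j f′ (h ∷ f ∷ us) (extended dis)
                (cons (rung₂ γ₁) (Cross-sym (cross γ₂)) (cons (rung₁ γ₁) (Cross-sym (cross γ₁)) wk)) gf′ pos′ (subst (_≤ 2 * ℓ) (sym (lem (length us) j)) le))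
              where
              extended : AllPairs Disj (g ∷ f ∷ us) → AllPairs Disj (g ∷ f′ ∷ h ∷ f ∷ us)
              extended (p ∷ ps) =
                (c₁ ∷ d₁ ∷ p) ∷ (d₀ ∷ Disj-sym c₂ ∷ All.map Disj-sym cs) ∷ (Disj-sym d₂ ∷ All.map Disj-sym ds) ∷ ps
            go₁ : ∃[ f′ ] (Ext f f′ × Clear (g ∷ f ∷ us) f′) → Ring (2 + length us + 2 * suc j)
            go₁ (f′ , ext@((_ , lk) , _) , c) = go₂ f′ ext c (viaMiddle lk (f′ ∷ g ∷ f ∷ us)
              (≤-trans (≤-trans (m≤m+n (3 + length us) (1 + 2 * j)) (≤-reflexive (lem′ (length us) j))) le))

      -- With more linked pairs, peeling would leave a relation in which ℓ neighbours of g can be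
      -- strung together, consecutive ones linked. One middle rung in each of the ℓ - 1 gaps, and g
      -- itself, make a ring of ℓ + (ℓ - 1) + 1 = 2ℓ rungs.
      fewLinked : (∑[ f ∈ rs ] ∑[ f′ ∈ rs ] ⟦ (Γ? g f ×-dec Γ? g f′) ×-dec Linked₂? f f′ ⟧) ≤ 2 * K * (∑[ f ∈ rs ] ⟦ Γ? g f ⟧)
      fewLinked = ≮⇒≥ λ h → contra (peel End? pairs (2 * K) (∑[ f ∈ rs ] ⟦ Γ? g f ⟧) nbrs LinkedPair? (length-filter (Γ? g) rs)
                    (<-≤-trans h (≤-reflexive (sym (∑-⊗ rs rs (λ p → ⟦ LinkedPair? p ⟧))))))
        where
        ring : ∀ k → 2 + 2 * k ≡ 2 * suc k
        ring = solve-∀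
        finish : ∀ ℓ′ → ℓ ≡ suc ℓ′ → Ring (2 + 0 + 2 * ℓ′) → ⊥
        finish ℓ′ refl r = noRing (subst Ring (ring ℓ′) r)
        contra : ∃[ Q ] Σ[ Q? ∈ (∀ p → Dec (Q p)) ]
          ((∀ {p} → Q p → LinkedPair p) × 0 < (∑[ p ∈ pairs ] ⟦ Q? p ⟧)
           × (∀ {c} → c ∈ nbrs → 0 < degree End? pairs Q? c → 2 * K < degree End? pairs Q? c)) → ⊥
        contra (Q , Q? , Q⊆ , pos , big) = start (∑-pos pairs (λ p → ⟦ Q? p ⟧) pos)
          where
          open Peeled {Q} Q? (λ {p} → Q⊆ {p}) (λ {c} → big {c})
          start : ∃[ p ] (p ∈ pairs × 0 < ⟦ Q? p ⟧) → ⊥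
          start ((f , f′) , _ , lt) = go ℓ refl
            where
            q : Q (f , f′)
            q = ⟦⟧-pos (Q? (f , f′)) lt
            gf : Γ g f
            gf = proj₁ (proj₁ (Q⊆ {f , f′} q))
            go : ∀ k → ℓ ≡ k → ⊥
            go zero    e = ℓ≢0 e
            go (suc k) e = finish k e (grow k f [] ((Γ-disj gf ∷ []) ∷ [] ∷ []) (step (Cross-sym (cross gf))) gf (alive {f , f′} q (inj₁ refl))
                             (≤-reflexive (trans (ring k) (cong (2 *_) (sym e)))))

-- A core of arcs with large degrees and few bad continuations

module Cores (𝔾 : FinGraph) (L θ Δ : ℕ) (deg≤Δ : ∀ y → Codegrees.deg 𝔾 y ≤ Δ) (w ℓ : ℕ) where

  open FinGraph 𝔾
  open Codegrees 𝔾
  open RichCount 𝔾 L using (n; Φ)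
  open Rings _~_ ~-sym
  open Arcs 𝔾 L θ
  open Links 𝔾 L θ Δ deg≤Δ w ℓ
  open Γ

  -- `fewBad` counts continuations in all of `Γ`, not only in `Γ′`, so the bound survives any later
  -- thinning of the successors.
  record Core (r r₀ : ℕ) : Set₁ where
    field
      Γ′         : Rung V → Rung V → Set
      Γ′?        : ∀ e f → Dec (Γ′ e f)
      Γ′⊆        : ∀ {e f} → Γ′ e f → Γ e f
      Alive      : Rung V → Set
      alive-deg  : ∀ {e} → Alive e → r < (∑[ f ∈ rs ] ⟦ Γ′? e f ⟧)
      alive-next : ∀ {e f} → Γ′ e f → Alive f
      fewBad     : ∀ {e f} → Γ′ e f → (∑[ g ∈ rs ] ⟦ Γ? f g ×-dec Bad? e f g ⟧) ≤ r₀
      start      : ∃[ e ] Alive e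

  module _ (r r₀ K : ℕ) .{{_ : NonZero r₀}}
    (fewLinked : ∀ g → (∑[ f ∈ rs ] ∑[ f′ ∈ rs ] ⟦ (Γ? g f ×-dec Γ? g f′) ×-dec Linked₂? f f′ ⟧) ≤ 2 * K * (∑[ f ∈ rs ] ⟦ Γ? g f ⟧)) where

    badWalks : ℕ
    badWalks = ∑[ e₀ ∈ rs ] ∑[ e₁ ∈ rs ] ∑[ e₂ ∈ rs ] ⟦ (Γ? e₀ e₁ ×-dec Γ? e₁ e₂) ×-dec Bad? e₀ e₁ e₂ ⟧

    -- A two-step walk with linked ends is seen from its middle rung, where both ends are
    -- neighbours; `fewLinked` is then summed over the middles.
    badWalks≤ : badWalks ≤ 2 * ((θ * θ) * Φ) + 2 * K * arcs
    badWalks≤ = begin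
      badWalks ≤⟨ ∑-mono rs (λ e₀ → ∑-mono rs λ e₁ → ∑-mono rs λ e₂ → ⟦⟧-∪ ((Γ? e₀ e₁ ×-dec Γ? e₁ e₂) ×-dec Bad? e₀ e₁ e₂)
                    ((Γ? e₀ e₁ ×-dec Γ? e₁ e₂) ×-dec Rich₂? e₀ e₁ e₂) ((Γ? e₁ e₀ ×-dec Γ? e₁ e₂) ×-dec Linked₂? e₀ e₂)
                    λ { (gs , inj₁ b) → inj₁ (gs , b) ; ((g , g′) , inj₂ b) → inj₂ ((Γ-sym g , g′) , b) }) ⟩
      (∑[ e₀ ∈ rs ] ∑[ e₁ ∈ rs ] ∑[ e₂ ∈ rs ] ⟦ (Γ? e₀ e₁ ×-dec Γ? e₁ e₂) ×-dec Rich₂? e₀ e₁ e₂ ⟧ + ⟦ (Γ? e₁ e₀ ×-dec Γ? e₁ e₂) ×-dec Linked₂? e₀ e₂ ⟧)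
        ≡⟨ trans (∑-cong rs (λ e₀ → trans (∑-cong rs (λ e₁ → ∑-+ rs _ _)) (∑-+ rs _ _))) (∑-+ rs _ _) ⟩
      (∑[ e₀ ∈ rs ] ∑[ e₁ ∈ rs ] ∑[ e₂ ∈ rs ] ⟦ (Γ? e₀ e₁ ×-dec Γ? e₁ e₂) ×-dec Rich₂? e₀ e₁ e₂ ⟧)
        + (∑[ e₀ ∈ rs ] ∑[ e₁ ∈ rs ] ∑[ e₂ ∈ rs ] ⟦ (Γ? e₁ e₀ ×-dec Γ? e₁ e₂) ×-dec Linked₂? e₀ e₂ ⟧)
        ≤⟨ +-mono-≤ rich-walks (≤-trans (≤-reflexive (∑-swap rs rs _)) (≤-trans (∑-mono rs fewLinked) (≤-reflexive (∑-*ˡ rs (2 * K) _)))) ⟩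
      2 * ((θ * θ) * Φ) + 2 * K * arcs ∎
      where open ≤-Reasoning

    open Endpoints _≟ʳ_ rs-unique

    private
      badNext : Rung V → Rung V → ℕ
      badNext e f = ∑[ g ∈ rs ] ⟦ Γ? f g ×-dec Bad? e f g ⟧

      Poor : Rung V → Rung V → Set
      Poor e f = r₀ < badNext e f

      abstract
        Poor? : ∀ e f → Dec (Poor e f)
        Poor? e f = r₀ <? badNext e f

      poor : ℕ
      poor = ∑[ e ∈ rs ] ∑[ f ∈ rs ] ⟦ Γ? e f ×-dec Poor? e f ⟧

      poor≤ : r₀ * poor ≤ badWalks
      poor≤ = begin
        r₀ * poor ≡⟨ sym (trans (∑-cong rs (λ e → ∑-*ˡ rs r₀ _)) (∑-*ˡ rs r₀ _)) ⟩
        (∑[ e ∈ rs ] ∑[ f ∈ rs ] r₀ * ⟦ Γ? e f ×-dec Poor? e f ⟧) ≤⟨ ∑-mono rs (λ e → ∑-mono rs (pt e)) ⟩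
        badWalks ∎
        where
        open ≤-Reasoning
        pt : ∀ e f → r₀ * ⟦ Γ? e f ×-dec Poor? e f ⟧ ≤ (∑[ g ∈ rs ] ⟦ (Γ? e f ×-dec Γ? f g) ×-dec Bad? e f g ⟧)
        pt e f = go (Γ? e f ×-dec Poor? e f)
          where
          go : (d : Dec (Γ e f × Poor e f)) → r₀ * ⟦ d ⟧ ≤ (∑[ g ∈ rs ] ⟦ (Γ? e f ×-dec Γ? f g) ×-dec Bad? e f g ⟧)
          go (no _) = ≤-trans (≤-reflexive (*-zeroʳ r₀)) z≤n
          go (yes (γ , p)) = ≤-trans (≤-reflexive (*-identityʳ r₀)) (≤-trans (<⇒≤ p)
            (∑-mono rs (λ g → ⟦⟧-mono (Γ? f g ×-dec Bad? e f g) ((Γ? e f ×-dec Γ? f g) ×-dec Bad? e f g) (λ (γ′ , b) → (γ , γ′) , b))))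

      -- Neither direction may be poor, because `Γ′` symmetrises the surviving pairs and walks use
      -- them both ways.
      Item : Rung V × Rung V → Set
      Item (e , f) = Γ e f × (¬ Poor e f × ¬ Poor f e)

      abstract
        Item? : ∀ p → Dec (Item p)
        Item? (e , f) = Γ? e f ×-dec (¬? (Poor? e f) ×-dec ¬? (Poor? f e))

      arcs≤ : arcs ≤ (∑[ p ∈ pairs ] ⟦ Item? p ⟧) + (poor + poor)
      arcs≤ = begin
        arcs ≤⟨ ∑-mono rs (λ e → ∑-mono rs (pt e)) ⟩
        (∑[ e ∈ rs ] ∑[ f ∈ rs ] ⟦ Item? (e , f) ⟧ + (⟦ Γ? e f ×-dec Poor? e f ⟧ + ⟦ Γ? f e ×-dec Poor? f e ⟧))
          ≡⟨ trans (∑-cong rs (λ e → trans (∑-+ rs _ _) (cong ((∑[ f ∈ rs ] ⟦ Item? (e , f) ⟧) +_) (∑-+ rs _ _)))) (trans (∑-+ rs _ _) (cong ((∑[ e ∈ rs ] ∑[ f ∈ rs ] ⟦ Item? (e , f) ⟧) +_) (∑-+ rs _ _))) ⟩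
        (∑[ e ∈ rs ] ∑[ f ∈ rs ] ⟦ Item? (e , f) ⟧) + (poor + (∑[ e ∈ rs ] ∑[ f ∈ rs ] ⟦ Γ? f e ×-dec Poor? f e ⟧))
          ≡⟨ cong₂ (λ s t → s + (poor + t)) (sym (∑-⊗ rs rs (λ p → ⟦ Item? p ⟧))) (∑-swap rs rs (λ e f → ⟦ Γ? f e ×-dec Poor? f e ⟧)) ⟩
        (∑[ p ∈ pairs ] ⟦ Item? p ⟧) + (poor + poor) ∎
        where
        open ≤-Reasoning
        pt : ∀ e f → ⟦ Γ? e f ⟧ ≤ ⟦ Item? (e , f) ⟧ + (⟦ Γ? e f ×-dec Poor? e f ⟧ + ⟦ Γ? f e ×-dec Poor? f e ⟧)
        pt e f = ⟦⟧-≤ (Γ? e f) (go (Poor? e f) (Poor? f e))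
          where
          go : Dec (Poor e f) → Dec (Poor f e) → Γ e f → 1 ≤ ⟦ Item? (e , f) ⟧ + (⟦ Γ? e f ×-dec Poor? e f ⟧ + ⟦ Γ? f e ×-dec Poor? f e ⟧)
          go (yes p) _ γ = ≤-trans (⟦⟧≥1 (Γ? e f ×-dec Poor? e f) (γ , p)) (≤-trans (m≤m+n _ ⟦ Γ? f e ×-dec Poor? f e ⟧) (m≤n+m _ ⟦ Item? (e , f) ⟧))
          go (no _) (yes p) γ = ≤-trans (⟦⟧≥1 (Γ? f e ×-dec Poor? f e) (Γ-sym γ , p)) (≤-trans (m≤n+m _ ⟦ Γ? e f ×-dec Poor? e f ⟧) (m≤n+m _ ⟦ Item? (e , f) ⟧))
          go (no p) (no q) γ = ≤-trans (⟦⟧≥1 (Item? (e , f)) (γ , p , q)) (m≤m+n _ _)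

      module Peeled {Q : Rung V × Rung V → Set} (Q? : ∀ p → Dec (Q p)) (Q⊆ : ∀ p → Q p → Item p)
        (pos : 0 < (∑[ p ∈ pairs ] ⟦ Q? p ⟧))
        (big : ∀ c → c ∈ rs → 0 < degree End? pairs Q? c → 2 * r < degree End? pairs Q? c) where

        dg : Rung V → ℕ
        dg = degree End? pairs Q?

        Γ′ : Rung V → Rung V → Set
        Γ′ e f = Q (e , f) ⊎ Q (f , e)

        abstract
          Γ′? : ∀ e f → Dec (Γ′ e f)
          Γ′? e f = Q? (e , f) ⊎-dec Q? (f , e)

        alive : ∀ {p c} → Q p → End p c → 0 < dg c
        alive {p} {c} q i = subst (_≤ dg c) (⟦⟧-yes (Q? p ×-dec End? p c) (q , i))
          (∑-single pairs (λ p → ⟦ Q? p ×-dec End? p c ⟧) (mem (Q⊆ p q)))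
          where
          mem : ∀ {p} → Item p → p ∈ pairs
          mem (γ , _) = ∈-cartesianProduct⁺ (∈-rs (rung₁ γ)) (∈-rs (rung₂ γ))

        inRs : ∀ p c → Q p → End p c → c ∈ rs
        inRs p c q (inj₁ refl) = ∈-rs (rung₁ (proj₁ (Q⊆ p q)))
        inRs p c q (inj₂ refl) = ∈-rs (rung₂ (proj₁ (Q⊆ p q)))

        dg≤ : ∀ c → dg c ≤ 2 * (∑[ f ∈ rs ] ⟦ Γ′? c f ⟧)
        dg≤ = degree≤ Q? Γ′? inj₁ inj₂

        core : Core r r₀
        core = record
          { Γ′         = Γ′
          ; Γ′?        = Γ′?
          ; Γ′⊆        = λ { {e} {f} (inj₁ q) → proj₁ (Q⊆ (e , f) q) ; {e} {f} (inj₂ q) → Γ-sym (proj₁ (Q⊆ (f , e) q)) }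
          ; Alive      = λ c → c ∈ rs × 0 < dg c
          ; alive-deg  = λ {c} (c∈ , p) → *-cancelˡ-< 2 _ _ (<-≤-trans (big c c∈ p) (dg≤ c))
          ; alive-next = λ { {e} {f} (inj₁ q) → inRs (e , f) f q (inj₂ refl) , alive q (inj₂ refl)
                           ; {e} {f} (inj₂ q) → inRs (f , e) f q (inj₁ refl) , alive q (inj₁ refl) }
          ; fewBad     = λ { {e} {f} (inj₁ q) → ≮⇒≥ (proj₁ (proj₂ (Q⊆ (e , f) q))) ; {e} {f} (inj₂ q) → ≮⇒≥ (proj₂ (proj₂ (Q⊆ (f , e) q))) }
          ; start      = first (∑-pos pairs (λ p → ⟦ Q? p ⟧) pos)
          }
          where
          first : ∃[ p ] (p ∈ pairs × 0 < ⟦ Q? p ⟧) → ∃[ c ] (c ∈ rs × 0 < dg c)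
          first ((e , f) , _ , lt) = e , inRs (e , f) e (⟦⟧-pos (Q? (e , f)) lt) (inj₁ refl) , alive (⟦⟧-pos (Q? (e , f)) lt) (inj₁ refl)

    -- A poor arc begins more than r₀ bad walks, so poor arcs are at most a quarter of all arcs and
    -- at least half of the arcs are items. Peeling removes at most 2r of them for each of at most
    -- nΔ rungs, the factor 2 being that of `degree≤`.
    core : 4 * (2 * ((θ * θ) * Φ) + 2 * K * arcs) ≤ r₀ * arcs → 4 * (r * (n * Δ)) < arcs → Core r r₀
    core h₁ h₂ = fix (peel End? pairs (2 * r) (length rs) rs Item? refl enough)
      where
      4poor : 4 * poor ≤ arcs
      4poor = *-cancelˡ-≤ r₀ (begin
        r₀ * (4 * poor) ≡⟨ lem r₀ poor ⟩
        4 * (r₀ * poor) ≤⟨ *-monoʳ-≤ 4 (≤-trans poor≤ badWalks≤) ⟩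
        4 * (2 * ((θ * θ) * Φ) + 2 * K * arcs) ≤⟨ h₁ ⟩
        r₀ * arcs ∎)
        where
        open ≤-Reasoning
        lem : ∀ a b → a * (4 * b) ≡ 4 * (a * b)
        lem = solve-∀
      items = ∑[ p ∈ pairs ] ⟦ Item? p ⟧
      arcs≤2items : arcs ≤ 2 * items
      arcs≤2items = +-cancelʳ-≤ arcs _ _ (begin
        arcs + arcs ≡⟨ double arcs ⟩
        2 * arcs ≤⟨ *-monoʳ-≤ 2 arcs≤ ⟩
        2 * (items + (poor + poor)) ≡⟨ l₂ items poor ⟩
        2 * items + 4 * poor ≤⟨ +-monoʳ-≤ (2 * items) 4poor ⟩
        2 * items + arcs ∎)
        where
        open ≤-Reasoning
        l₂ : ∀ a b → 2 * (a + (b + b)) ≡ 2 * a + 4 * b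
        l₂ = solve-∀
      enough : 2 * r * length rs < items
      enough = *-cancelˡ-< 2 _ _ (begin-strict
        2 * (2 * r * length rs) ≡⟨ lem r (length rs) ⟩
        4 * (r * length rs) ≤⟨ *-monoʳ-≤ 4 (*-monoʳ-≤ r (rs-length Δ deg≤Δ)) ⟩
        4 * (r * (n * Δ)) <⟨ h₂ ⟩
        arcs ≤⟨ arcs≤2items ⟩
        2 * items ∎)
        where
        open ≤-Reasoning
        lem : ∀ a b → 2 * (2 * a * b) ≡ 4 * (a * b)
        lem = solve-∀
      fix : ∃[ Q ] Σ[ Q? ∈ (∀ p → Dec (Q p)) ]
          ((∀ {p} → Q p → Item p) × 0 < (∑[ p ∈ pairs ] ⟦ Q? p ⟧)
           × (∀ {c} → c ∈ rs → 0 < degree End? pairs Q? c → 2 * r < degree End? pairs Q? c)) → Core r r₀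
      fix (Q , Q? , Q⊆ , pos , big) = Peeled.core {Q} Q? (λ p → Q⊆ {p}) pos (λ c → big {c})

-- Counting walks

∑< : ℕ → (ℕ → ℕ) → ℕ
∑< zero    f = 0
∑< (suc m) f = f 0 + ∑< m (f ∘ suc)

∑<-ends : ∀ m f {A M B : ℕ} → f 0 ≤ A → (∀ i → i < m → f (suc i) ≤ M) → f (suc m) ≤ B →
          ∑< (2 + m) f ≤ A + (m * M + B)
∑<-ends m f {A} {M} {B} h₀ hᵢ hₘ = +-mono-≤ h₀ (go m (f ∘ suc) hᵢ hₘ)
  where
  go : ∀ m g → (∀ i → i < m → g i ≤ M) → g m ≤ B → ∑< (suc m) g ≤ m * M + B
  go zero    g _ h = ≤-trans (≤-reflexive (+-identityʳ (g 0))) h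
  go (suc m) g k h = ≤-trans (+-mono-≤ (k 0 (s≤s z≤n)) (go m (g ∘ suc) (λ i lt → k (suc i) (s≤s lt)) h))
                             (≤-reflexive (sym (+-assoc M (m * M) B)))

∑-∑< : {A : Set} (xs : List A) (m : ℕ) (f : A → ℕ → ℕ) → (∑[ x ∈ xs ] ∑< m (f x)) ≡ ∑< m (λ i → ∑[ x ∈ xs ] f x i)
∑-∑< xs zero    f = ∑-0 xs
∑-∑< xs (suc m) f = trans (∑-+ xs _ _) (cong ((∑[ x ∈ xs ] f x 0) +_) (∑-∑< xs m (λ x → f x ∘ suc)))

∑-take≤ : {A : Set} (k : ℕ) (xs : List A) (f : A → ℕ) → ∑ (take k xs) f ≤ ∑ xs f
∑-take≤ zero    xs       f = z≤n
∑-take≤ (suc k) []       f = z≤n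
∑-take≤ (suc k) (x ∷ xs) f = +-monoʳ-≤ (f x) (∑-take≤ k xs f)

∈-take : {A : Set} (k : ℕ) (xs : List A) {x : A} → x ∈ take k xs → x ∈ xs
∈-take (suc k) (x ∷ xs) (here e)  = here e
∈-take (suc k) (x ∷ xs) (there p) = there (∈-take k xs p)

module Walks (𝔾 : FinGraph) (L θ Δ : ℕ) (deg≤Δ : ∀ y → Codegrees.deg 𝔾 y ≤ Δ) (w q r r₀ : ℕ)
             (core : Cores.Core 𝔾 L θ Δ deg≤Δ w (4 + q) r r₀) where

  ℓ : ℕ
  ℓ = 4 + q

  open FinGraph 𝔾
  open Codegrees 𝔾
  open Rings _~_ ~-sym
  open Arcs 𝔾 L θ
  open Links 𝔾 L θ Δ deg≤Δ w ℓ
  open Cores 𝔾 L θ Δ deg≤Δ w ℓ using (Core)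
  open Core core
  open Γ

  R : Set
  R = Rung V

  abstract
    -- Cutting the successors down to r, of which every alive rung has more, bounds the number of
    -- k-step walks by r^k without weakening the lower counts.
    S : R → List R
    S e = take r (filter (Γ′? e) rs)

    S⊆ : ∀ {e f} → f ∈ S e → Γ′ e f
    S⊆ {e} f∈ = proj₂ (∈-filter⁻ (Γ′? e) {xs = rs} (∈-take r (filter (Γ′? e) rs) f∈))

    S-unique : ∀ e → Unique (S e)
    S-unique e = take⁺ r (filter⁺ (Γ′? e) rs-unique)

    S-length : ∀ e → length (S e) ≤ r
    S-length e = ≤-trans (≤-reflexive (length-take r (filter (Γ′? e) rs))) (m⊓n≤m r _)

    S-full : ∀ {e} → Alive e → length (S e) ≡ r
    S-full {e} al = trans (length-take r (filter (Γ′? e) rs)) (m≤n⇒m⊓n≡m (≤-trans (<⇒≤ (alive-deg al)) (≤-reflexive (sym (length-filter (Γ′? e) rs)))))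

    ∑S≤ : ∀ e f → ∑ (S e) f ≤ ∑ rs f
    ∑S≤ e f = ≤-trans (∑-take≤ r (filter (Γ′? e) rs) f) (≤-trans (≤-reflexive (∑-filter (Γ′? e) rs f)) (∑-mono rs (λ x → ⟦⟧*≤ (Γ′? e x))))

  Γ∈ : ∀ {e f} → f ∈ S e → Γ e f
  Γ∈ f∈ = Γ′⊆ (S⊆ f∈)

  ∑S≤r : ∀ e {f : R → ℕ} k → (∀ x → x ∈ S e → f x ≤ k) → ∑ (S e) f ≤ r * k
  ∑S≤r e {f} k h = ≤-trans (∑-mono∈ (S e) (λ {x} → h x)) (≤-trans (≤-reflexive (∑-const (S e) k)) (*-monoˡ-≤ k (S-length e)))

  ∑W : ℕ → R → (List R → ℕ) → ℕ
  ∑W zero    e f = f []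
  ∑W (suc k) e f = ∑[ x ∈ S e ] ∑W k x (λ u → f (x ∷ u))

  Valid : ℕ → R → List R → Set
  Valid zero    e []      = ⊤
  Valid zero    e (_ ∷ _) = ⊥
  Valid (suc k) e []      = ⊥
  Valid (suc k) e (x ∷ u) = x ∈ S e × Valid k x u

  ∑W-mono : ∀ k e {f g : List R → ℕ} → (∀ u → Valid k e u → f u ≤ g u) → ∑W k e f ≤ ∑W k e g
  ∑W-mono zero    e h = h [] tt
  ∑W-mono (suc k) e h = ∑-mono∈ (S e) (λ {x} x∈ → ∑W-mono k x (λ u v → h (x ∷ u) (x∈ , v)))

  ∑W-∑ : ∀ k e {A : Set} (ys : List A) (f : List R → A → ℕ) →
         ∑W k e (λ u → ∑[ y ∈ ys ] f u y) ≡ (∑[ y ∈ ys ] ∑W k e (λ u → f u y))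
  ∑W-∑ zero    e ys f = refl
  ∑W-∑ (suc k) e ys f = trans (∑-cong (S e) (λ x → ∑W-∑ k x ys (λ u → f (x ∷ u)))) (∑-swap (S e) ys _)

  ∑W-+ : ∀ k e (f g : List R → ℕ) → ∑W k e (λ u → f u + g u) ≡ ∑W k e f + ∑W k e g
  ∑W-+ zero    e f g = refl
  ∑W-+ (suc k) e f g = trans (∑-cong (S e) (λ x → ∑W-+ k x (λ u → f (x ∷ u)) (λ u → g (x ∷ u)))) (∑-+ (S e) _ _)

  ∑W-*ˡ : ∀ k e c (f : List R → ℕ) → ∑W k e (λ u → c * f u) ≡ c * ∑W k e f
  ∑W-*ˡ zero    e c f = refl
  ∑W-*ˡ (suc k) e c f = trans (∑-cong (S e) (λ x → ∑W-*ˡ k x c (λ u → f (x ∷ u)))) (∑-*ˡ (S e) c _)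

  ∑W-*ʳ : ∀ k e (f : List R → ℕ) c → ∑W k e (λ u → f u * c) ≡ ∑W k e f * c
  ∑W-*ʳ zero    e f c = refl
  ∑W-*ʳ (suc k) e f c = trans (∑-cong (S e) (λ x → ∑W-*ʳ k x (λ u → f (x ∷ u)) c)) (∑-*ʳ (S e) _ c)

  ∑W-< : ∀ k e (f g : List R → ℕ) → ∑W k e f < ∑W k e g → ∃[ u ] (Valid k e u × f u < g u)
  ∑W-< zero    e f g h = [] , tt , h
  ∑W-< (suc k) e f g h = go (∑-< (S e) _ _ h)
    where
    go : ∃[ x ] (x ∈ S e × ∑W k x (λ u → f (x ∷ u)) < ∑W k x (λ u → g (x ∷ u))) → ∃[ u ] (Valid (suc k) e u × f u < g u)
    go (x , x∈ , lt) = go′ (∑W-< k x _ _ lt)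
      where
      go′ : ∃[ u ] (Valid k x u × f (x ∷ u) < g (x ∷ u)) → ∃[ u ] (Valid (suc k) e u × f u < g u)
      go′ (u , v , lt) = x ∷ u , (x∈ , v) , lt

  endOf : R → List R → R
  endOf e []      = e
  endOf e (x ∷ u) = endOf x u

  endOf-++ : ∀ e p v → endOf e (p ++ v) ≡ endOf (endOf e p) v
  endOf-++ e []      v = refl
  endOf-++ e (x ∷ p) v = endOf-++ x p v

  valid-end : ∀ k e u → Valid (suc k) e u → endOf e u ∈ rs
  valid-end zero    e (x ∷ [])    (x∈ , _) = ∈-rs (rung₂ (Γ∈ x∈))
  valid-end (suc k) e (x ∷ y ∷ u) (_ , v)  = valid-end k x (y ∷ u) v

  -- `NB` stands for: no bad two-step subwalk. The arguments `e` and `x` are the last two rungs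
  -- already passed.
  NB₂ : R → R → List R → Set
  NB₂ e x []      = ⊤
  NB₂ e x (y ∷ u) = ¬ Bad e x y × NB₂ x y u

  NB : R → List R → Set
  NB e []      = ⊤
  NB e (x ∷ u) = NB₂ e x u

  NB₂⇒NB : ∀ {e x} u → NB₂ e x u → NB x u
  NB₂⇒NB []      _       = tt
  NB₂⇒NB (y ∷ u) (_ , h) = h

  NB₂-split : ∀ e x p v → NB₂ e x (p ++ v) → NB₂ e x p × NB (endOf x p) v
  NB₂-split e x []      v h       = tt , NB₂⇒NB v h
  NB₂-split e x (y ∷ p) v (b , h) = (b , proj₁ (NB₂-split x y p v h)) , proj₂ (NB₂-split x y p v h)

  NB-split : ∀ e p v → NB e (p ++ v) → NB e p × NB (endOf e p) v
  NB-split e []      v h = tt , h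
  NB-split e (x ∷ p) v h = NB₂-split e x p v h

  abstract
    NB₂? : ∀ e x u → Dec (NB₂ e x u)
    NB₂? e x []      = yes tt
    NB₂? e x (y ∷ u) = ¬? (Bad? e x y) ×-dec NB₂? x y u

    NB? : ∀ e u → Dec (NB e u)
    NB? e []      = yes tt
    NB? e (x ∷ u) = NB₂? e x u

    endsAt? : ∀ e u f → Dec (endOf e u ≡ f)
    endsAt? e u f = endOf e u ≟ʳ f

  nbCount : ℕ → R → R → ℕ
  nbCount k e f = ∑W k e (λ u → ⟦ NB? e u ×-dec endsAt? e u f ⟧)

  -- The last inner rung of a walk is confined to the at most w good middle rungs.
  nbCount≤ : ∀ i e f → nbCount (2 + i) e f ≤ r ^ i * w
  nbCount≤ zero e f = begin
    (∑[ x ∈ S e ] ∑[ y ∈ S x ] ⟦ NB? e (x ∷ y ∷ []) ×-dec endsAt? e (x ∷ y ∷ []) f ⟧)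
      ≤⟨ ∑-mono∈ (S e) (λ {x} x∈ → ≤-trans (∑-mono∈ (S x) (λ {y} y∈ → pt x∈ y∈)) (∑-δ _≟ʳ_ (S-unique x) f (λ _ → ⟦ Good? e f x ⟧))) ⟩
    (∑[ x ∈ S e ] ⟦ Good? e f x ⟧) ≤⟨ ∑S≤ e (λ x → ⟦ Good? e f x ⟧) ⟩
    (∑[ x ∈ rs ] ⟦ Good? e f x ⟧) ≤⟨ good≤w e f ⟩
    w ≡⟨ sym (*-identityˡ w) ⟩
    1 * w ∎
    where
    open ≤-Reasoning
    pt : ∀ {x y} → x ∈ S e → y ∈ S x → ⟦ NB? e (x ∷ y ∷ []) ×-dec endsAt? e (x ∷ y ∷ []) f ⟧ ≤ ⟦ y ≟ʳ f ⟧ * ⟦ Good? e f x ⟧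
    pt {x} {y} x∈ y∈ = ⟦⟧-≤ (NB? e (x ∷ y ∷ []) ×-dec endsAt? e (x ∷ y ∷ []) f) go
      where
      go : NB e (x ∷ y ∷ []) × y ≡ f → 1 ≤ ⟦ y ≟ʳ f ⟧ * ⟦ Good? e f x ⟧
      go ((b , _) , refl) = ≤-reflexive (sym (cong₂ _*_ (⟦⟧-yes (y ≟ʳ y) refl) (⟦⟧-yes (Good? e y x) ((Γ∈ x∈ , Γ∈ y∈) , b))))
  nbCount≤ (suc i) e f = ≤-trans
    (∑S≤r e (r ^ i * w) (λ x _ → ≤-trans (∑W-mono (2 + i) x (λ u _ → ⟦⟧-mono (NB? e (x ∷ u) ×-dec endsAt? e (x ∷ u) f) (NB? x u ×-dec endsAt? x u f) (λ (b , q) → NB₂⇒NB u b , q))) (nbCount≤ i x f)))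
    (≤-reflexive (sym (*-assoc r (r ^ i) w)))

  -- The last rung is exempt, because the walks to be made disjoint share their end.
  Hit : R → List R → Set
  Hit z []          = ⊥
  Hit z (x ∷ [])    = ⊥
  Hit z (x ∷ y ∷ u) = ¬ Disj z x ⊎ Hit z (y ∷ u)

  abstract
    Hit? : ∀ z u → Dec (Hit z u)
    Hit? z []          = no λ ()
    Hit? z (x ∷ [])    = no λ ()
    Hit? z (x ∷ y ∷ u) = ¬? (Disj? z x) ⊎-dec Hit? z (y ∷ u)

  -- A union bound over the position of the hit: a prefix p of i + 1 steps ends in the hit rung and
  -- v is made of the remaining m - i steps.
  hits : ∀ m e z F → ∑W (suc m) e (λ u → ⟦ Hit? z u ⟧ * F u) ≤
    ∑< m (λ i → ∑W (suc i) e (λ p → ⟦ ¬? (Disj? z (endOf e p)) ⟧ * ∑W (m ∸ i) (endOf e p) (λ v → F (p ++ v))))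
  hits zero e z F = ≤-trans (≤-reflexive (trans (∑-cong (S e) (λ x → cong (_* F (x ∷ [])) (⟦⟧-no (Hit? z (x ∷ [])) λ ()))) (∑-0 (S e)))) z≤n
  hits (suc m) e z F = begin
    (∑[ x ∈ S e ] ∑W (suc m) x (λ u → ⟦ Hit? z (x ∷ u) ⟧ * F (x ∷ u)))
      ≤⟨ ∑-mono (S e) (λ x → ≤-trans (∑W-mono (suc m) x (pt x)) (≤-reflexive (trans (∑W-+ (suc m) x (λ u → ⟦ ¬? (Disj? z x) ⟧ * F (x ∷ u)) (λ u → ⟦ Hit? z u ⟧ * F (x ∷ u))) (cong (_+ ∑W (suc m) x (λ u → ⟦ Hit? z u ⟧ * F (x ∷ u))) (∑W-*ˡ (suc m) x ⟦ ¬? (Disj? z x) ⟧ (λ u → F (x ∷ u))))))) ⟩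
    (∑[ x ∈ S e ] ⟦ ¬? (Disj? z x) ⟧ * ∑W (suc m) x (λ u → F (x ∷ u)) + ∑W (suc m) x (λ u → ⟦ Hit? z u ⟧ * F (x ∷ u)))
      ≡⟨ ∑-+ (S e) _ _ ⟩
    (∑[ x ∈ S e ] ⟦ ¬? (Disj? z x) ⟧ * ∑W (suc m) x (λ u → F (x ∷ u))) + (∑[ x ∈ S e ] ∑W (suc m) x (λ u → ⟦ Hit? z u ⟧ * F (x ∷ u)))
      ≤⟨ +-monoʳ-≤ _ (≤-trans (∑-mono (S e) (λ x → hits m x z (λ u → F (x ∷ u)))) (≤-reflexive (∑-∑< (S e) m _))) ⟩
    _ ∎
    where
    open ≤-Reasoning
    pt : ∀ x u → Valid (suc m) x u → ⟦ Hit? z (x ∷ u) ⟧ * F (x ∷ u) ≤ ⟦ ¬? (Disj? z x) ⟧ * F (x ∷ u) + ⟦ Hit? z u ⟧ * F (x ∷ u)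
    pt x (y ∷ u) _ = ≤-trans (*-monoˡ-≤ (F (x ∷ y ∷ u)) (⟦⟧-∪ (Hit? z (x ∷ y ∷ u)) (¬? (Disj? z x)) (Hit? z (y ∷ u)) (λ h → h)))
      (≤-reflexive (*-distribʳ-+ (F (x ∷ y ∷ u)) ⟦ ¬? (Disj? z x) ⟧ ⟦ Hit? z (y ∷ u) ⟧))

  module HitBound (k : ℕ) (e f z : R) {C : List R → Set} (C? : ∀ u → Dec (C u)) (C⇒NB : ∀ {u} → C u → NB e u) (U : ℕ)
    (h₁ : ∀ x → ∑W (2 + k) x (λ v → ⟦ C? (x ∷ v) ×-dec endsAt? x v f ⟧) ≤ U)
    (h₂ : ∀ g → ∑W (2 + k) e (λ p → ⟦ C? (p ∷ʳ f) ×-dec endsAt? e p g ⟧) ≤ U) where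

    private
      F : List R → ℕ
      F u = ⟦ C? u ×-dec endsAt? e u f ⟧

      term : ℕ → ℕ
      term i = ∑W (suc i) e (λ p → ⟦ ¬? (Disj? z (endOf e p)) ⟧ * ∑W (2 + k ∸ i) (endOf e p) (λ v → F (p ++ v)))

      byEnd : ∀ j (φ : R → ℕ) {P : List R → Set} (P? : ∀ p → Dec (P p)) →
        ∑W (suc j) e (λ p → φ (endOf e p) * ⟦ P? p ⟧) ≤ (∑[ g ∈ rs ] φ g * ∑W (suc j) e (λ p → ⟦ P? p ×-dec endsAt? e p g ⟧))
      byEnd j φ P? = begin
        ∑W (suc j) e (λ p → φ (endOf e p) * ⟦ P? p ⟧) ≤⟨ ∑W-mono (suc j) e pt ⟩
        ∑W (suc j) e (λ p → ∑[ g ∈ rs ] φ g * ⟦ P? p ×-dec endsAt? e p g ⟧) ≡⟨ ∑W-∑ (suc j) e rs (λ p g → φ g * ⟦ P? p ×-dec endsAt? e p g ⟧) ⟩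
        (∑[ g ∈ rs ] ∑W (suc j) e (λ p → φ g * ⟦ P? p ×-dec endsAt? e p g ⟧)) ≡⟨ ∑-cong rs (λ g → ∑W-*ˡ (suc j) e (φ g) (λ p → ⟦ P? p ×-dec endsAt? e p g ⟧)) ⟩
        (∑[ g ∈ rs ] φ g * ∑W (suc j) e (λ p → ⟦ P? p ×-dec endsAt? e p g ⟧)) ∎
        where
        open ≤-Reasoning
        pt : ∀ p → Valid (suc j) e p → φ (endOf e p) * ⟦ P? p ⟧ ≤ (∑[ g ∈ rs ] φ g * ⟦ P? p ×-dec endsAt? e p g ⟧)
        pt p v = ≤-trans (*-monoʳ-≤ (φ (endOf e p)) (⟦⟧-mono (P? p) (P? p ×-dec endsAt? e p (endOf e p)) (_, refl)))
          (∑-single rs (λ g → φ g * ⟦ P? p ×-dec endsAt? e p g ⟧) (valid-end j e p v))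

      first : term 0 ≤ 4 * θ * U
      first = begin
        (∑[ x ∈ S e ] ⟦ ¬? (Disj? z x) ⟧ * ∑W (2 + k) x (λ v → ⟦ C? (x ∷ v) ×-dec endsAt? e (x ∷ v) f ⟧))
          ≤⟨ ∑-mono (S e) (λ x → *-monoʳ-≤ ⟦ ¬? (Disj? z x) ⟧ (≤-trans (∑W-mono (2 + k) x (λ v _ → ⟦⟧-mono (C? (x ∷ v) ×-dec endsAt? e (x ∷ v) f) (C? (x ∷ v) ×-dec endsAt? x v f) (λ h → h))) (h₁ x))) ⟩
        (∑[ x ∈ S e ] ⟦ ¬? (Disj? z x) ⟧ * U) ≡⟨ ∑-*ʳ (S e) _ U ⟩
        (∑[ x ∈ S e ] ⟦ ¬? (Disj? z x) ⟧) * U ≤⟨ *-monoˡ-≤ U (≤-trans (∑-mono∈ (S e) (λ {x} x∈ → ⟦⟧-mono (¬? (Disj? z x)) (Γ? e x ×-dec ¬? (Disj? z x)) (Γ∈ x∈ ,_))) (≤-trans (∑S≤ e _) (Γ-meeting Δ deg≤Δ e z))) ⟩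
        4 * θ * U ∎
        where open ≤-Reasoning

      last : term (suc k) ≤ 4 * θ * U
      last = begin
        term (suc k) ≡⟨ cong (λ j → ∑W (2 + k) e (λ p → ⟦ ¬? (Disj? z (endOf e p)) ⟧ * ∑W j (endOf e p) (λ v → F (p ++ v)))) (m+n∸n≡m 1 k) ⟩
        ∑W (2 + k) e (λ p → ⟦ ¬? (Disj? z (endOf e p)) ⟧ * (∑[ y ∈ S (endOf e p) ] F (p ∷ʳ y)))
          ≤⟨ ∑W-mono (2 + k) e (λ p _ → ≤-trans (*-monoʳ-≤ ⟦ ¬? (Disj? z (endOf e p)) ⟧ (step₁ p)) (≤-reflexive (sym (*-assoc ⟦ ¬? (Disj? z (endOf e p)) ⟧ ⟦ Γ? (endOf e p) f ⟧ ⟦ C? (p ∷ʳ f) ⟧)))) ⟩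
        ∑W (2 + k) e (λ p → (⟦ ¬? (Disj? z (endOf e p)) ⟧ * ⟦ Γ? (endOf e p) f ⟧) * ⟦ C? (p ∷ʳ f) ⟧)
          ≤⟨ byEnd (suc k) (λ g → ⟦ ¬? (Disj? z g) ⟧ * ⟦ Γ? g f ⟧) (λ p → C? (p ∷ʳ f)) ⟩
        (∑[ g ∈ rs ] (⟦ ¬? (Disj? z g) ⟧ * ⟦ Γ? g f ⟧) * ∑W (2 + k) e (λ p → ⟦ C? (p ∷ʳ f) ×-dec endsAt? e p g ⟧))
          ≤⟨ ∑-mono rs (λ g → *-mono-≤ (step₂ g) (h₂ g)) ⟩
        (∑[ g ∈ rs ] ⟦ Γ? f g ×-dec ¬? (Disj? z g) ⟧ * U) ≡⟨ ∑-*ʳ rs _ U ⟩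
        (∑[ g ∈ rs ] ⟦ Γ? f g ×-dec ¬? (Disj? z g) ⟧) * U ≤⟨ *-monoˡ-≤ U (Γ-meeting Δ deg≤Δ f z) ⟩
        4 * θ * U ∎
        where
        open ≤-Reasoning
        step₂ : ∀ g → ⟦ ¬? (Disj? z g) ⟧ * ⟦ Γ? g f ⟧ ≤ ⟦ Γ? f g ×-dec ¬? (Disj? z g) ⟧
        step₂ g = ≤-trans (≤-reflexive (sym (⟦⟧-× (¬? (Disj? z g)) (Γ? g f)))) (⟦⟧-mono (¬? (Disj? z g) ×-dec Γ? g f) (Γ? f g ×-dec ¬? (Disj? z g)) (λ (d , γ) → Γ-sym γ , d))
        step₁ : ∀ p → (∑[ y ∈ S (endOf e p) ] F (p ∷ʳ y)) ≤ ⟦ Γ? (endOf e p) f ⟧ * ⟦ C? (p ∷ʳ f) ⟧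
        step₁ p = ≤-trans (∑-mono∈ (S (endOf e p)) (λ {y} y∈ → ⟦⟧-≤ (C? (p ∷ʳ y) ×-dec endsAt? e (p ∷ʳ y) f) (go y∈)))
                          (∑-δ _≟ʳ_ (S-unique (endOf e p)) f (λ _ → ⟦ Γ? (endOf e p) f ⟧ * ⟦ C? (p ∷ʳ f) ⟧))
          where
          go : ∀ {y} → y ∈ S (endOf e p) → C (p ∷ʳ y) × endOf e (p ∷ʳ y) ≡ f → 1 ≤ ⟦ y ≟ʳ f ⟧ * (⟦ Γ? (endOf e p) f ⟧ * ⟦ C? (p ∷ʳ f) ⟧)
          go {y} y∈ (c , eq) = go′ (trans (sym (endOf-++ e p (y ∷ []))) eq)
            where
            go′ : y ≡ f → 1 ≤ ⟦ y ≟ʳ f ⟧ * (⟦ Γ? (endOf e p) f ⟧ * ⟦ C? (p ∷ʳ f) ⟧)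
            go′ refl = ≤-reflexive (sym (cong₂ _*_ (⟦⟧-yes (y ≟ʳ y) refl) (cong₂ _*_ (⟦⟧-yes (Γ? (endOf e p) y) (Γ∈ y∈)) (⟦⟧-yes (C? (p ∷ʳ y)) c))))

      middle : ∀ i → i < k → term (suc i) ≤ 4 * Δ * (w * w * r ^ (k ∸ 1))
      middle i i<k = go (m≤n⇒∃[o]m+o≡n i<k)
        where
        go : ∃[ t ] (suc i + t ≡ k) → term (suc i) ≤ 4 * Δ * (w * w * r ^ (k ∸ 1))
        go (t , eq) = begin
          term (suc i) ≡⟨ cong (λ j → ∑W (2 + i) e (λ p → ⟦ ¬? (Disj? z (endOf e p)) ⟧ * ∑W j (endOf e p) (λ v → F (p ++ v)))) remaining ⟩
          ∑W (2 + i) e (λ p → ⟦ ¬? (Disj? z (endOf e p)) ⟧ * ∑W (2 + t) (endOf e p) (λ v → F (p ++ v)))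
            ≤⟨ ∑W-mono (2 + i) e (λ p _ → ≤-trans (*-monoʳ-≤ ⟦ ¬? (Disj? z (endOf e p)) ⟧ (inner p)) (≤-reflexive (sym (*-assoc ⟦ ¬? (Disj? z (endOf e p)) ⟧ ⟦ NB? e p ⟧ (r ^ t * w))))) ⟩
          ∑W (2 + i) e (λ p → ⟦ ¬? (Disj? z (endOf e p)) ⟧ * ⟦ NB? e p ⟧ * (r ^ t * w)) ≡⟨ ∑W-*ʳ (2 + i) e (λ p → ⟦ ¬? (Disj? z (endOf e p)) ⟧ * ⟦ NB? e p ⟧) (r ^ t * w) ⟩
          ∑W (2 + i) e (λ p → ⟦ ¬? (Disj? z (endOf e p)) ⟧ * ⟦ NB? e p ⟧) * (r ^ t * w)
            ≤⟨ *-monoˡ-≤ (r ^ t * w) (≤-trans (byEnd (suc i) (λ g → ⟦ ¬? (Disj? z g) ⟧) (NB? e)) (∑-mono rs (λ g → *-monoʳ-≤ ⟦ ¬? (Disj? z g) ⟧ (nbCount≤ i e g)))) ⟩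
          (∑[ g ∈ rs ] ⟦ ¬? (Disj? z g) ⟧ * (r ^ i * w)) * (r ^ t * w) ≡⟨ cong (_* (r ^ t * w)) (∑-*ʳ rs _ (r ^ i * w)) ⟩
          (∑[ g ∈ rs ] ⟦ ¬? (Disj? z g) ⟧) * (r ^ i * w) * (r ^ t * w) ≤⟨ *-monoˡ-≤ (r ^ t * w) (*-monoˡ-≤ (r ^ i * w) (rungs-meeting Δ deg≤Δ z)) ⟩
          4 * Δ * (r ^ i * w) * (r ^ t * w) ≡⟨ lem (4 * Δ) (r ^ i) (r ^ t) w ⟩
          4 * Δ * (w * w * (r ^ i * r ^ t)) ≡⟨ cong (λ s → 4 * Δ * (w * w * s)) (trans (sym (^-distribˡ-+-* r i t)) (cong (λ j → r ^ (j ∸ 1)) eq)) ⟩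
          4 * Δ * (w * w * r ^ (k ∸ 1)) ∎
          where
          open ≤-Reasoning
          lem : ∀ d a b w → d * (a * w) * (b * w) ≡ d * (w * w * (a * b))
          lem = solve-∀
          remaining : 2 + k ∸ suc i ≡ 2 + t
          remaining = trans (cong (λ j → 2 + j ∸ suc i) (sym eq)) (trans (cong (_∸ i) (sym (trans (+-suc i (suc t)) (cong suc (+-suc i t))))) (m+n∸m≡n i (2 + t)))
          inner : ∀ p → ∑W (2 + t) (endOf e p) (λ v → F (p ++ v)) ≤ ⟦ NB? e p ⟧ * (r ^ t * w)
          inner p = ≤-trans (∑W-mono (2 + t) (endOf e p) (λ v _ → ⟦⟧-≤ (C? (p ++ v) ×-dec endsAt? e (p ++ v) f) (pt v)))
            (≤-trans (≤-reflexive (∑W-*ˡ (2 + t) (endOf e p) ⟦ NB? e p ⟧ (λ v → ⟦ NB? (endOf e p) v ×-dec endsAt? (endOf e p) v f ⟧))) (*-monoʳ-≤ ⟦ NB? e p ⟧ (nbCount≤ t (endOf e p) f)))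
            where
            pt : ∀ v → C (p ++ v) × endOf e (p ++ v) ≡ f → 1 ≤ ⟦ NB? e p ⟧ * ⟦ NB? (endOf e p) v ×-dec endsAt? (endOf e p) v f ⟧
            pt v (c , eq) = ≤-reflexive (sym (cong₂ _*_ (⟦⟧-yes (NB? e p) (proj₁ (NB-split e p v (C⇒NB c))))
              (⟦⟧-yes (NB? (endOf e p) v ×-dec endsAt? (endOf e p) v f) (proj₂ (NB-split e p v (C⇒NB c)) , trans (sym (endOf-++ e p v)) eq))))

    -- There are 2 + k inner positions. At the first, the rung follows e and meets z, which leaves
    -- 4θ choices, and `h₁` counts the rest; at the last the same holds around f, with `h₂`. At each
    -- of the k others there are 4Δ rungs meeting z, and `nbCount≤` counts the walks before and
    -- after it, r^i w and r^t w with i + t = k - 1.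
    hitBound : ∑W (3 + k) e (λ u → ⟦ Hit? z u ⟧ * ⟦ C? u ×-dec endsAt? e u f ⟧) ≤ 4 * θ * U + (k * (4 * Δ * (w * w * r ^ (k ∸ 1))) + 4 * θ * U)
    hitBound = ≤-trans (hits (2 + k) e z F) (∑<-ends k term first middle last)

  dodge : ∀ k e {A : List R → Set} (A? : ∀ u → Dec (A u)) b → (∀ z → ∑W k e (λ u → ⟦ Hit? z u ⟧ * ⟦ A? u ⟧) ≤ b) →
    ∀ Z → length Z * b < ∑W k e (λ u → ⟦ A? u ⟧) → ∃[ u ] (Valid k e u × A u × (∀ {z} → z ∈ Z → ¬ Hit z u))
  dodge k e {A} A? b hb Z lt = fix (∑W-< k e (λ u → ∑[ z ∈ Z ] ⟦ Hit? z u ⟧ * ⟦ A? u ⟧) (λ u → ⟦ A? u ⟧) (≤-<-trans total lt))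
    where
    total : ∑W k e (λ u → ∑[ z ∈ Z ] ⟦ Hit? z u ⟧ * ⟦ A? u ⟧) ≤ length Z * b
    total = ≤-trans (≤-reflexive (∑W-∑ k e Z (λ u z → ⟦ Hit? z u ⟧ * ⟦ A? u ⟧))) (∑-≤const Z b hb)
    fix : ∃[ u ] (Valid k e u × (∑[ z ∈ Z ] ⟦ Hit? z u ⟧ * ⟦ A? u ⟧) < ⟦ A? u ⟧) → ∃[ u ] (Valid k e u × A u × (∀ {z} → z ∈ Z → ¬ Hit z u))
    fix (u , v , lt) = u , v , au , λ {z} z∈ h → <⇒≱ lt (≤-trans (≤-reflexive (trans (sym (*-identityˡ ⟦ A? u ⟧)) (cong (_* ⟦ A? u ⟧) (sym (⟦⟧-yes (Hit? z u) h)))))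
                         (∑-single Z (λ z → ⟦ Hit? z u ⟧ * ⟦ A? u ⟧) z∈))
      where
      au : A u
      au = ⟦⟧-pos (A? u) (≤-<-trans z≤n lt)

-- Closing pairs of walks into rings

module Finish (𝔾 : FinGraph) (L θ Δ : ℕ) (deg≤Δ : ∀ y → Codegrees.deg 𝔾 y ≤ Δ) (w q r r₀ : ℕ)
              (core : Cores.Core 𝔾 L θ Δ deg≤Δ w (4 + q) r r₀) where

  open FinGraph 𝔾
  open Codegrees 𝔾
  open RichCount 𝔾 L using (n)
  open Rings _~_ ~-sym
  open Arcs 𝔾 L θ
  open Walks 𝔾 L θ Δ deg≤Δ w q r r₀ core
  open Links 𝔾 L θ Δ deg≤Δ w ℓ
  open Cores 𝔾 L θ Δ deg≤Δ w ℓ using (Core)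
  open Core core
  open Γ

  record Path (e f : R) (k : ℕ) (Z : List R) : Set where
    field
      is   : List R
      walk : Walk e is f
      len  : length is ≡ k
      dis  : AllPairs Disj (f ∷ e ∷ is)
      free : ∀ {z} → z ∈ Z → All (Disj z) is
      rung : IsRung f

  open Path

  inn : List R → List R
  inn []          = []
  inn (x ∷ [])    = []
  inn (x ∷ y ∷ u) = x ∷ inn (y ∷ u)

  private
    inn-snoc : ∀ x u → inn (x ∷ u) ∷ʳ endOf x u ≡ x ∷ u
    inn-snoc x []      = refl
    inn-snoc x (y ∷ u) = cong (x ∷_) (inn-snoc y u)

    inn-walk : ∀ k e x u → Valid (suc k) e (x ∷ u) → Walk e (inn (x ∷ u)) (endOf x u)
    inn-walk zero    e x []      (x∈ , _) = step (cross (Γ∈ x∈))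
    inn-walk (suc k) e x (y ∷ u) (x∈ , v) = cons (rung₂ (Γ∈ x∈)) (cross (Γ∈ x∈)) (inn-walk k x y u v)

    inn-length : ∀ k e x u → Valid (suc k) e (x ∷ u) → length (inn (x ∷ u)) ≡ k
    inn-length zero    e x []      _       = refl
    inn-length (suc k) e x (y ∷ u) (_ , v) = cong suc (inn-length k x y u v)

    inn-free : ∀ z x u → ¬ Hit z (x ∷ u) → All (Disj z) (inn (x ∷ u))
    inn-free z x []      _ = []
    inn-free z x (y ∷ u) h = decidable-stable (Disj? z x) (h ∘ inj₁) ∷ inn-free z y u (h ∘ inj₂)

  Gd : R → List R → Set
  Gd e u = NB e u × AllPairs Disj (e ∷ u)

  abstract
    Gd? : ∀ e u → Dec (Gd e u)
    Gd? e u = NB? e u ×-dec allPairs? Disj? (e ∷ u)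

  toPath : ∀ {k e f} u {Z} → Valid (suc k) e u → Gd e u → endOf e u ≡ f → (∀ {z} → z ∈ Z → ¬ Hit z u) → Path e f k Z
  toPath {k} {e} (x ∷ u) v (_ , d) refl h = record
    { is   = inn (x ∷ u)
    ; walk = inn-walk k e x u v
    ; len  = inn-length k e x u v
    ; dis  = AllPairs-unsnoc Disj-sym (e ∷ inn (x ∷ u)) (subst (AllPairs Disj) (cong (e ∷_) (sym (inn-snoc x u))) d)
    ; free = λ {z} z∈ → inn-free z x u (h z∈)
    ; rung = proj₂ (∈-filter⁻ IsRung? {xs = cartesianProduct vs vs} (valid-end k e (x ∷ u) v))
    }

  twoPaths : ∀ {e f k k′ Z Z′} → IsRung e → (p : Path e f k Z) (p′ : Path e f k′ Z′) → (∀ {z} → z ∈ is p → z ∈ Z′) → Ring (suc k + suc k′)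
  twoPaths {e} {f} re p p′ sub = go (dis p) (dis p′)
    where
    go : AllPairs Disj (f ∷ e ∷ is p) → AllPairs Disj (f ∷ e ∷ is p′) → Ring _
    go ((fe ∷ fi) ∷ ei ∷ ii) ((_ ∷ fj) ∷ ej ∷ jj) =
      ringOfTwo re (rung p) (walk p) (walk p′)
        (Allₚ.++⁺ ei (Disj-sym fe ∷ ej) ∷ AllPairsₚ.++⁺ ii (fj ∷ jj) (All.tabulate (λ z∈ → Disj-sym (All.lookup fi z∈) ∷ free p′ (sub z∈))))
        (cong₂ (λ a b → suc a + suc b) (len p) (len p′))

  -- Prolongs p through y and g to y′. That g and y′ were reserved in `Z` when p was chosen keeps
  -- the inner rungs of p disjoint from them.
  bridge : ∀ {s y y′ g k Z} → (p : Path s y k Z) → g ∈ Z → y′ ∈ Z → Γ y g → Γ g y′ → Disj s g → Disj y y′ → Disj s y′ →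
           Σ[ p′ ∈ Path s y′ (k + 2) [] ] (∀ {z} → z ∈ is p′ → z ∈ g ∷ y ∷ is p)
  bridge {s} {y} {y′} {g} p g∈ y′∈ γ γ′ sg yy′ sy′ = go (dis p)
    where
    member : ∀ is {z} → z ∈ is ++ y ∷ g ∷ [] → z ∈ g ∷ y ∷ is
    member []       (here e)         = there (here e)
    member []       (there (here e)) = here e
    member (x ∷ xs) (here e)         = there (there (here e))
    member (x ∷ xs) (there z∈) = shift (member xs z∈)
      where
      shift : ∀ {z} → z ∈ g ∷ y ∷ xs → z ∈ g ∷ y ∷ x ∷ xs
      shift (here e)           = here e
      shift (there (here e))   = there (here e)
      shift (there (there z∈)) = there (there (there z∈))
    go : AllPairs Disj (y ∷ s ∷ is p) → Σ[ p′ ∈ Path s y′ _ [] ] (∀ {z} → z ∈ is p′ → z ∈ g ∷ y ∷ is p)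
    go ((ys ∷ yi) ∷ si ∷ ii) = record
      { is   = is p ++ y ∷ g ∷ []
      ; walk = walk p ++ʷ (rung p , cons (rung₂ γ) (cross γ) (step (cross γ′)))
      ; len  = trans (length-++ (is p)) (cong (_+ 2) (len p))
      ; dis  = (Disj-sym sy′ ∷ Allₚ.++⁺ (free p y′∈) (Disj-sym yy′ ∷ Disj-sym (Γ-disj γ′) ∷ []))
             ∷ Allₚ.++⁺ si (Disj-sym ys ∷ sg ∷ [])
             ∷ AllPairsₚ.++⁺ ii ((Γ-disj γ ∷ []) ∷ [] ∷ []) (All.tabulate (λ z∈ → Disj-sym (All.lookup yi z∈) ∷ Disj-sym (All.lookup (free p g∈) z∈) ∷ []))
      ; free = λ ()
      ; rung = rung₂ γ′
      } , member (is p)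

  module _ (B : ℕ) (hB : 2 * ℓ * (4 * θ * (r ^ q * w) + (q * (4 * Δ * (w * w * r ^ (q ∸ 1))) + 4 * θ * (r ^ q * w))) ≤ B)
           (noRing : ¬ Ring (2 * ℓ)) where

    private
      U hb : ℕ
      U  = r ^ q * w
      hb = 4 * θ * U + (q * (4 * Δ * (w * w * r ^ (q ∸ 1))) + 4 * θ * U)

    linkCount : R → R → ℕ
    linkCount e f = ∑W (3 + q) e (λ u → ⟦ Gd? e u ×-dec endsAt? e u f ⟧)

    Linked : R → R → Set
    Linked e f = B < linkCount e f

    abstract
      Linked? : ∀ e f → Dec (Linked e f)
      Linked? e f = B <? linkCount e f

    AllPairs-prefix : ∀ {A : Set} {P : A → A → Set} xs {ys} → AllPairs P (xs ++ ys) → AllPairs P xs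
    AllPairs-prefix []       _        = []
    AllPairs-prefix (x ∷ xs) (p ∷ ps) = Allₚ.++⁻ˡ xs p ∷ AllPairs-prefix xs ps

    -- A single rung is hit by at most `hb` of the good walks from e to f, and B is at least 2ℓ
    -- times `hb`.
    linkedPath : ∀ {e f} → Linked e f → ∀ Z → length Z ≤ 2 * ℓ → Path e f (2 + q) Z
    linkedPath {e} {f} lk Z le = fix (dodge (3 + q) e (λ u → Gd? e u ×-dec endsAt? e u f) hb
        (λ z → HitBound.hitBound q e f z (Gd? e) proj₁ U h₁ h₂) Z (≤-<-trans (≤-trans (*-monoˡ-≤ hb le) hB) lk))
      where
      fix : ∃[ u ] (Valid (3 + q) e u × (Gd e u × endOf e u ≡ f) × (∀ {z} → z ∈ Z → ¬ Hit z u)) → Path e f (2 + q) Z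
      fix (u , v , (g , eq) , h) = toPath u v g eq h
      h₁ : ∀ x → ∑W (2 + q) x (λ v → ⟦ Gd? e (x ∷ v) ×-dec endsAt? x v f ⟧) ≤ U
      h₁ x = ≤-trans (∑W-mono (2 + q) x (λ v _ → ⟦⟧-mono (Gd? e (x ∷ v) ×-dec endsAt? x v f) (NB? x v ×-dec endsAt? x v f) (λ ((b , _) , eq) → NB₂⇒NB v b , eq))) (nbCount≤ q x f)
      h₂ : ∀ g → ∑W (2 + q) e (λ p → ⟦ Gd? e (p ∷ʳ f) ×-dec endsAt? e p g ⟧) ≤ U
      h₂ g = ≤-trans (∑W-mono (2 + q) e (λ p _ → ⟦⟧-mono (Gd? e (p ∷ʳ f) ×-dec endsAt? e p g) (NB? e p ×-dec endsAt? e p g) (λ ((b , _) , eq) → proj₁ (NB-split e p (f ∷ []) b) , eq))) (nbCount≤ q e g)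

    -- Otherwise s, a path to y, the rungs y, g, y′ and a disjoint path back from y′ form a ring.
    -- The two paths have 2 + q inner rungs each, which makes 1 + (2 + q) + 3 + (2 + q) = 2(4 + q)
    -- rungs in all.
    closeBridge : ∀ {s g y y′} → IsRung s → Disj s g → Γ g y → Γ g y′ → Linked s y → Linked s y′ → ¬ Disj y y′
    closeBridge {s} {g} {y} {y′} rs sg γ γ′ l l′ yy′ = go (linkedPath l (g ∷ y′ ∷ []) (s≤s (s≤s z≤n)))
      where
      size : ∀ q → suc ((2 + q) + 2) + suc (2 + q) ≡ 2 * (4 + q)
      size = solve-∀
      room : ∀ q → 2 + (2 + q) + (4 + q) ≡ 2 * (4 + q)
      room = solve-∀
      go : Path s y (2 + q) (g ∷ y′ ∷ []) → ⊥
      go p = go′ (linkedPath l′ (g ∷ y ∷ is p) (≤-trans (≤-reflexive (cong (2 +_) (len p))) (≤-trans (m≤m+n (2 + (2 + q)) (4 + q)) (≤-reflexive (room q)))))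
        where
        go′ : Path s y′ (2 + q) (g ∷ y ∷ is p) → ⊥
        go′ p′ = go″ (bridge p (here refl) (there (here refl)) (Γ-sym γ) γ′ sg yy′ (Disj-sym (All.head (head′ (dis p′)))))
          where
          head′ : ∀ {x : R} {xs} → AllPairs Disj (x ∷ xs) → All (Disj x) xs
          head′ (h ∷ _) = h
          go″ : Σ[ b ∈ Path s y′ ((2 + q) + 2) [] ] (∀ {z} → z ∈ is b → z ∈ g ∷ y ∷ is p) → ⊥
          go″ (b , sub) = noRing (subst Ring (size q) (twoPaths rs b p′ sub))

    -- By `closeBridge` all the rungs counted meet any one of them, and `Γ-meeting` bounds those.
    fewLong : ∀ {s g} → IsRung s → Disj s g → (∑[ y ∈ rs ] ⟦ Γ? g y ×-dec Linked? s y ⟧) ≤ 4 * θ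
    fewLong {s} {g} r sg = go (0 <? (∑[ y ∈ rs ] ⟦ Γ? g y ×-dec Linked? s y ⟧))
      where
      go : Dec (0 < (∑[ y ∈ rs ] ⟦ Γ? g y ×-dec Linked? s y ⟧)) → (∑[ y ∈ rs ] ⟦ Γ? g y ×-dec Linked? s y ⟧) ≤ 4 * θ
      go (no h)  = ≤-trans (≮⇒≥ h) z≤n
      go (yes h) = go′ (∑-pos rs _ h)
        where
        go′ : ∃[ y ] (y ∈ rs × 0 < ⟦ Γ? g y ×-dec Linked? s y ⟧) → (∑[ y ∈ rs ] ⟦ Γ? g y ×-dec Linked? s y ⟧) ≤ 4 * θ
        go′ (y , _ , lt) = ≤-trans (∑-mono rs (λ y′ → ⟦⟧-mono (Γ? g y′ ×-dec Linked? s y′) (Γ? g y′ ×-dec ¬? (Disj? y y′)) (λ (γ′ , l′) → γ′ , closeBridge r sg (proj₁ gl) γ′ (proj₂ gl) l′))) (Γ-meeting Δ deg≤Δ g y)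
          where
          gl : Γ g y × Linked s y
          gl = ⟦⟧-pos (Γ? g y ×-dec Linked? s y) lt

    module Grow (ρ : ℕ) (hρ : ρ + (ℓ * (4 * θ) + r₀ + (4 * θ + 4 * θ)) ≤ r) (e₀ : R) (re₀ : IsRung e₀) where

      -- Keeping away from the rungs linked to e₀ and to x₁ is what bounds, in `h₂` and `h₁`, the
      -- walks of ℓ - 1 steps that remain when the last or the first step is fixed. The step out of
      -- x₁ is exempt from the second condition, since `fewLong` speaks of neighbours of a rung
      -- disjoint from x₁.
      Ok : R → R → R → List R → R → Set
      Ok x₁ h g p y = (Clear (g ∷ h ∷ p) y × ¬ Bad h g y) × (¬ Linked e₀ y × (g ≡ x₁ ⊎ ¬ Linked x₁ y))

      Ext : R → R → R → List R → List R → Set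
      Ext x₁ h g p []      = ⊤
      Ext x₁ h g p (y ∷ u) = Ok x₁ h g p y × Ext x₁ g y (h ∷ p) u

      abstract
        Ok? : ∀ x₁ h g p y → Dec (Ok x₁ h g p y)
        Ok? x₁ h g p y = (Clear? (g ∷ h ∷ p) y ×-dec ¬? (Bad? h g y)) ×-dec (¬? (Linked? e₀ y) ×-dec ((g ≟ʳ x₁) ⊎-dec ¬? (Linked? x₁ y)))

        Ext? : ∀ x₁ h g p u → Dec (Ext x₁ h g p u)
        Ext? x₁ h g p []      = yes tt
        Ext? x₁ h g p (y ∷ u) = Ok? x₁ h g p y ×-dec Ext? x₁ g y (h ∷ p) u

        Ext?-∷ : ∀ x₁ h g p y u → ⟦ Ext? x₁ h g p (y ∷ u) ⟧ ≡ ⟦ Ok? x₁ h g p y ⟧ * ⟦ Ext? x₁ g y (h ∷ p) u ⟧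
        Ext?-∷ x₁ h g p y u = ⟦⟧-× (Ok? x₁ h g p y) (Ext? x₁ g y (h ∷ p) u)

        Ext?-[] : ∀ x₁ h g p → 1 ≤ ⟦ Ext? x₁ h g p [] ⟧
        Ext?-[] x₁ h g p = ≤-refl

      -- Of the r successors of g, at most ℓ * (4 * θ) meet a rung already used, r₀ continue badly,
      -- and 4 * θ each are linked to e₀ and to x₁; `hρ` leaves ρ.
      okCount : ∀ {x₁ h g} p → IsRung x₁ → Γ′ h g → Alive g → Disj e₀ g → (g ≡ x₁ ⊎ Disj x₁ g) → 2 + length p ≤ ℓ →
                ρ ≤ (∑[ y ∈ S g ] ⟦ Ok? x₁ h g p y ⟧)
      okCount {x₁} {h} {g} p rx₁ γ al d₀ d₁ le = +-cancelʳ-≤ (ℓ * (4 * θ) + r₀ + (4 * θ + 4 * θ)) _ _ (begin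
        ρ + (ℓ * (4 * θ) + r₀ + (4 * θ + 4 * θ)) ≤⟨ hρ ⟩
        r ≡⟨ sym (trans (trans (∑-const (S g) 1) (*-identityʳ (length (S g)))) (S-full al)) ⟩
        (∑[ y ∈ S g ] 1) ≤⟨ ∑-mono∈ (S g) (λ {y} y∈ → pt (Γ∈ y∈)) ⟩
        (∑[ y ∈ S g ] ok y + ((c₁ y + c₂ y) + (c₃ y + c₄ y)))
          ≡⟨ trans (∑-+ (S g) _ _) (cong (∑ (S g) ok +_) (trans (∑-+ (S g) _ _) (cong₂ _+_ (∑-+ (S g) _ _) (∑-+ (S g) _ _)))) ⟩
        ∑ (S g) ok + ((∑ (S g) c₁ + ∑ (S g) c₂) + (∑ (S g) c₃ + ∑ (S g) c₄))
          ≤⟨ +-monoʳ-≤ (∑ (S g) ok) (+-mono-≤ (+-mono-≤ (≤-trans (∑S≤ g c₁) (≤-trans (notClear≤ (Γ? g) rs (4 * θ) (Γ-meeting Δ deg≤Δ g) (g ∷ h ∷ p)) (*-monoˡ-≤ (4 * θ) le)))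
                                                          (≤-trans (∑S≤ g c₂) (fewBad γ)))
                                                (+-mono-≤ (≤-trans (∑S≤ g c₃) (fewLong re₀ d₀)) (≤-trans (∑S≤ g c₄) (last d₁)))) ⟩
        ∑ (S g) ok + (ℓ * (4 * θ) + r₀ + (4 * θ + 4 * θ)) ∎)
        where
        open ≤-Reasoning
        ok c₁ c₂ c₃ c₄ : R → ℕ
        ok y = ⟦ Ok? x₁ h g p y ⟧
        c₁ y = ⟦ Γ? g y ×-dec ¬? (Clear? (g ∷ h ∷ p) y) ⟧
        c₂ y = ⟦ Γ? g y ×-dec Bad? h g y ⟧
        c₃ y = ⟦ Γ? g y ×-dec Linked? e₀ y ⟧
        c₄ y = ⟦ ¬? (g ≟ʳ x₁) ×-dec (Γ? g y ×-dec Linked? x₁ y) ⟧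
        last : (g ≡ x₁ ⊎ Disj x₁ g) → ∑ rs c₄ ≤ 4 * θ
        last (inj₁ e) = ≤-trans (≤-reflexive (trans (∑-cong rs (λ y → ⟦⟧-no (¬? (g ≟ʳ x₁) ×-dec (Γ? g y ×-dec Linked? x₁ y)) (λ (n , _) → n e))) (∑-0 rs))) z≤n
        last (inj₂ d) = ≤-trans (∑-mono rs (λ y → ⟦⟧-mono (¬? (g ≟ʳ x₁) ×-dec (Γ? g y ×-dec Linked? x₁ y)) (Γ? g y ×-dec Linked? x₁ y) proj₂)) (fewLong rx₁ d)
        pt : ∀ {y} → Γ g y → 1 ≤ ok y + ((c₁ y + c₂ y) + (c₃ y + c₄ y))
        pt {y} γy = go (Clear? (g ∷ h ∷ p) y) (Bad? h g y) (Linked? e₀ y) (g ≟ʳ x₁) (Linked? x₁ y)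
          where
          go : Dec (Clear (g ∷ h ∷ p) y) → Dec (Bad h g y) → Dec (Linked e₀ y) → Dec (g ≡ x₁) → Dec (Linked x₁ y) →
               1 ≤ ok y + ((c₁ y + c₂ y) + (c₃ y + c₄ y))
          go (no c) _ _ _ _ = ≤-trans (⟦⟧≥1 (Γ? g y ×-dec ¬? (Clear? (g ∷ h ∷ p) y)) (γy , c)) (≤-trans (≤-trans (m≤m+n (c₁ y) (c₂ y)) (m≤m+n _ (c₃ y + c₄ y))) (m≤n+m _ (ok y)))
          go (yes _) (yes b) _ _ _ = ≤-trans (⟦⟧≥1 (Γ? g y ×-dec Bad? h g y) (γy , b)) (≤-trans (≤-trans (m≤n+m (c₂ y) (c₁ y)) (m≤m+n _ (c₃ y + c₄ y))) (m≤n+m _ (ok y)))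
          go (yes _) (no _) (yes l) _ _ = ≤-trans (⟦⟧≥1 (Γ? g y ×-dec Linked? e₀ y) (γy , l)) (≤-trans (≤-trans (m≤m+n (c₃ y) (c₄ y)) (m≤n+m _ (c₁ y + c₂ y))) (m≤n+m _ (ok y)))
          go (yes c) (no b) (no l) (yes e) _ = ≤-trans (⟦⟧≥1 (Ok? x₁ h g p y) ((c , b) , (l , inj₁ e))) (m≤m+n (ok y) _)
          go (yes c) (no b) (no l) (no _) (no l₁) = ≤-trans (⟦⟧≥1 (Ok? x₁ h g p y) ((c , b) , (l , inj₂ l₁))) (m≤m+n (ok y) _)
          go (yes _) (no _) (no _) (no n) (yes l₁) = ≤-trans (⟦⟧≥1 (¬? (g ≟ʳ x₁) ×-dec (Γ? g y ×-dec Linked? x₁ y)) (n , γy , l₁)) (≤-trans (≤-trans (m≤n+m (c₄ y) (c₃ y)) (m≤n+m _ (c₁ y + c₂ y))) (m≤n+m _ (ok y)))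

      extCount : ∀ k {x₁ h g} p → IsRung x₁ → Γ′ h g → Alive g → Disj e₀ g → (g ≡ x₁ ⊎ Disj x₁ g) →
                 e₀ ∈ g ∷ h ∷ p → x₁ ∈ g ∷ h ∷ p → 1 + length p + k ≤ ℓ → ρ ^ k ≤ ∑W k g (λ u → ⟦ Ext? x₁ h g p u ⟧)
      extCount zero    {x₁} {h} {g} p _ _ _ _ _ _ _ _ = Ext?-[] x₁ h g p
      extCount (suc k) {x₁} {h} {g} p rx₁ γ al d₀ d₁ m₀ m₁ le = begin
        ρ * ρ ^ k ≤⟨ *-monoˡ-≤ (ρ ^ k) (okCount p rx₁ γ al d₀ d₁ (≤-trans (≤-trans (m≤m+n (2 + length p) k) (≤-reflexive (sym (+-suc (1 + length p) k)))) le)) ⟩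
        (∑[ y ∈ S g ] ⟦ Ok? x₁ h g p y ⟧) * ρ ^ k ≡⟨ sym (∑-*ʳ (S g) (λ y → ⟦ Ok? x₁ h g p y ⟧) (ρ ^ k)) ⟩
        (∑[ y ∈ S g ] ⟦ Ok? x₁ h g p y ⟧ * ρ ^ k) ≤⟨ ∑-mono∈ (S g) (λ {y} y∈ → ⟦⟧-scale (Ok? x₁ h g p y) (λ ok →
              extCount k (h ∷ p) rx₁ (S⊆ y∈) (alive-next (S⊆ y∈)) (All.lookup (proj₁ (proj₁ ok)) m₀) (inj₂ (All.lookup (proj₁ (proj₁ ok)) m₁)) (there m₀) (there m₁)
                (≤-trans (≤-reflexive (sym (+-suc (1 + length p) k))) le))) ⟩
        (∑[ y ∈ S g ] ⟦ Ok? x₁ h g p y ⟧ * ∑W k y (λ u → ⟦ Ext? x₁ g y (h ∷ p) u ⟧))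
          ≡⟨ ∑-cong (S g) (λ y → trans (sym (∑W-*ˡ k y ⟦ Ok? x₁ h g p y ⟧ (λ u → ⟦ Ext? x₁ g y (h ∷ p) u ⟧)))
               (≤-antisym (∑W-mono k y (λ u _ → ≤-reflexive (sym (Ext?-∷ x₁ h g p y u)))) (∑W-mono k y (λ u _ → ≤-reflexive (Ext?-∷ x₁ h g p y u))))) ⟩
        (∑[ y ∈ S g ] ∑W k y (λ u → ⟦ Ext? x₁ h g p (y ∷ u) ⟧)) ∎
        where open ≤-Reasoning

      ext-NB : ∀ {x₁ h g} p u → Ext x₁ h g p u → NB₂ h g u
      ext-NB p []      _       = tt
      ext-NB {h = h} p (y ∷ u) (ok , e) = proj₂ (proj₁ ok) , ext-NB (h ∷ p) u e

      ext-dis : ∀ {x₁ h g} p u → Ext x₁ h g p u → AllPairs Disj u × All (λ z → All (Disj z) u) (g ∷ h ∷ p)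
      ext-dis p []      _        = [] , All.tabulate (λ _ → [])
      ext-dis {h = h} p (y ∷ u) (ok , e) = go (proj₁ (proj₁ ok)) (ext-dis (h ∷ p) u e)
        where
        zip : ∀ {zs} → All (λ f → Disj f y) zs → All (λ z → All (Disj z) u) zs → All (λ z → All (Disj z) (y ∷ u)) zs
        zip []       []       = []
        zip (a ∷ as) (b ∷ bs) = (a ∷ b) ∷ zip as bs
        go : ∀ {zs} → Clear zs y → AllPairs Disj u × All (λ z → All (Disj z) u) (y ∷ zs) → AllPairs Disj (y ∷ u) × All (λ z → All (Disj z) (y ∷ u)) zs
        go c (d , (a ∷ as)) = (a ∷ d) , zip c as

      ext-prefix : ∀ {x₁ h g} p v {v′} → Ext x₁ h g p (v ++ v′) → Ext x₁ h g p v
      ext-prefix p []      _        = tt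
      ext-prefix {h = h} p (y ∷ v) (ok , e) = ok , ext-prefix (h ∷ p) v e

      ext-end₀ : ∀ {x₁ h g} p y u → Ext x₁ h g p (y ∷ u) → ¬ Linked e₀ (endOf y u)
      ext-end₀ p y []      (ok , _) = proj₁ (proj₂ ok)
      ext-end₀ {h = h} p y (z ∷ u) (_ , e) = ext-end₀ (h ∷ p) z u e

      ext-end₁ : ∀ {x₁ h g} p y u → g ≢ x₁ → x₁ ∈ g ∷ h ∷ p → Ext x₁ h g p (y ∷ u) → ¬ Linked x₁ (endOf y u)
      ext-end₁ p y []      n _ ((_ , _ , inj₁ e) , _) = ⊥-elim (n e)
      ext-end₁ p y []      n _ ((_ , _ , inj₂ l) , _) = l
      ext-end₁ {h = h} p y (z ∷ u) n m (ok , e) =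
        ext-end₁ (h ∷ p) z u (λ { refl → proj₁ (All.lookup (proj₁ (proj₁ ok)) m) refl }) (there m) e

      Fam : List R → Set
      Fam []      = ⊥
      Fam (x ∷ u) = Disj e₀ x × Ext x e₀ x [] u

      abstract
        Fam? : ∀ u → Dec (Fam u)
        Fam? []      = no λ ()
        Fam? (x ∷ u) = Disj? e₀ x ×-dec Ext? x e₀ x [] u

        Fam?-∷ : ∀ x u → ⟦ Fam? (x ∷ u) ⟧ ≡ ⟦ Disj? e₀ x ⟧ * ⟦ Ext? x e₀ x [] u ⟧
        Fam?-∷ x u = ⟦⟧-× (Disj? e₀ x) (Ext? x e₀ x [] u)

      fam-Gd : ∀ u → Fam u → Gd e₀ u
      fam-Gd (x ∷ u) (d , e) = ext-NB [] u e , go (ext-dis [] u e)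
        where
        go : AllPairs Disj u × All (λ z → All (Disj z) u) (x ∷ e₀ ∷ []) → AllPairs Disj (e₀ ∷ x ∷ u)
        go (p , (a ∷ b ∷ [])) = (d ∷ b) ∷ a ∷ p

      fam-tail : ∀ x u → Fam (x ∷ u) → Gd x u
      fam-tail x u f = NB₂⇒NB u (proj₁ (fam-Gd (x ∷ u) f)) , tailPairs (proj₂ (fam-Gd (x ∷ u) f))
        where
        tailPairs : ∀ {y : R} {ys} → AllPairs Disj (y ∷ ys) → AllPairs Disj ys
        tailPairs (_ ∷ p) = p

      fam-prefix : ∀ v {v′} → Fam (v ++ v′) → 0 < length v → Fam v
      fam-prefix (x ∷ v) (d , e) _ = d , ext-prefix [] v e

      famCount : Alive e₀ → r * ρ ^ (3 + q) ≤ ∑W ℓ e₀ (λ u → ⟦ Fam? u ⟧)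
      famCount al = begin
        r * ρ ^ (3 + q) ≡⟨ cong (_* ρ ^ (3 + q)) (sym (S-full al)) ⟩
        length (S e₀) * ρ ^ (3 + q) ≡⟨ sym (∑-const (S e₀) (ρ ^ (3 + q))) ⟩
        (∑[ x ∈ S e₀ ] ρ ^ (3 + q)) ≤⟨ ∑-mono∈ (S e₀) (λ {x} x∈ → pt x x∈) ⟩
        ∑W ℓ e₀ (λ u → ⟦ Fam? u ⟧) ∎
        where
        open ≤-Reasoning
        pt : ∀ x → x ∈ S e₀ → ρ ^ (3 + q) ≤ ∑W (3 + q) x (λ u → ⟦ Fam? (x ∷ u) ⟧)
        pt x x∈ = ≤-trans (extCount (3 + q) [] (rung₂ (Γ∈ x∈)) (S⊆ x∈) (alive-next (S⊆ x∈)) (Γ-disj (Γ∈ x∈)) (inj₁ refl) (there (here refl)) (here refl) ≤-refl)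
          (∑W-mono (3 + q) x (λ u _ → ≤-trans (≤-reflexive (sym (trans (cong (_* ⟦ Ext? x e₀ x [] u ⟧) (⟦⟧-yes (Disj? e₀ x) (Γ-disj (Γ∈ x∈)))) (*-identityˡ ⟦ Ext? x e₀ x [] u ⟧)))) (≤-reflexive (sym (Fam?-∷ x u)))))

      module _ (f : R) where

        private
          hb′ : ℕ
          hb′ = 4 * θ * B + (suc q * (4 * Δ * (w * w * r ^ q)) + 4 * θ * B)

          -- If x is linked to f, no walk of the family through x ends at f; if not, the failure of
          -- `Linked` is itself the bound.
          h₁ : ∀ x → ∑W (3 + q) x (λ v → ⟦ Fam? (x ∷ v) ×-dec endsAt? x v f ⟧) ≤ B
          h₁ x = go (Linked? x f)
            where
            go : Dec (Linked x f) → ∑W (3 + q) x (λ v → ⟦ Fam? (x ∷ v) ×-dec endsAt? x v f ⟧) ≤ B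
            go (no nl) = ≤-trans (∑W-mono (3 + q) x (λ v _ → ⟦⟧-mono (Fam? (x ∷ v) ×-dec endsAt? x v f) (Gd? x v ×-dec endsAt? x v f) (λ (fm , e) → fam-tail x v fm , e))) (≮⇒≥ nl)
            go (yes lk) = ≤-trans (∑W-mono (3 + q) x {g = λ _ → 0} (λ v val → ≤-reflexive (⟦⟧-no (Fam? (x ∷ v) ×-dec endsAt? x v f) (absurd v val)))) (zeros (3 + q) x)
              where
              zeros : ∀ k e → ∑W k e (λ _ → 0) ≤ B
              zeros k e = ≤-trans (≤-reflexive (∑W-*ˡ k e 0 (λ _ → 0))) z≤n
              absurd : ∀ v → Valid (3 + q) x v → ¬ (Fam (x ∷ v) × endOf x v ≡ f)
              absurd (y ∷ z ∷ v) _ ((_ , (ok , ext)) , refl) =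
                ext-end₁ (e₀ ∷ []) z v (λ { refl → proj₁ (All.head (proj₁ (proj₁ ok))) refl }) (there (here refl)) ext lk

          h₂ : ∀ g → ∑W (3 + q) e₀ (λ p → ⟦ Fam? (p ∷ʳ f) ×-dec endsAt? e₀ p g ⟧) ≤ B
          h₂ g = go (Linked? e₀ g)
            where
            go : Dec (Linked e₀ g) → ∑W (3 + q) e₀ (λ p → ⟦ Fam? (p ∷ʳ f) ×-dec endsAt? e₀ p g ⟧) ≤ B
            go (no nl) = ≤-trans (∑W-mono (3 + q) e₀ (λ p val → ⟦⟧-mono (Fam? (p ∷ʳ f) ×-dec endsAt? e₀ p g) (Gd? e₀ p ×-dec endsAt? e₀ p g) (λ (fm , e) → fam-Gd p (fam-prefix p fm (nonempty p val)) , e))) (≮⇒≥ nl)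
              where
              nonempty : ∀ p → Valid (3 + q) e₀ p → 0 < length p
              nonempty (_ ∷ _) _ = s≤s z≤n
            go (yes lk) = ≤-trans (∑W-mono (3 + q) e₀ {g = λ _ → 0} (λ p val → ≤-reflexive (⟦⟧-no (Fam? (p ∷ʳ f) ×-dec endsAt? e₀ p g) (absurd p val)))) (zeros (3 + q) e₀)
              where
              zeros : ∀ k e → ∑W k e (λ _ → 0) ≤ B
              zeros k e = ≤-trans (≤-reflexive (∑W-*ˡ k e 0 (λ _ → 0))) z≤n
              absurd : ∀ p → Valid (3 + q) e₀ p → ¬ (Fam (p ∷ʳ f) × endOf e₀ p ≡ g)
              absurd (x ∷ y ∷ v) _ ((_ , ext) , refl) = ext-end₀ [] y v (ext-prefix [] (y ∷ v) ext) lk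

        -- One walk to f has 3 + q inner rungs, each hit by at most `hb′` walks of the family ending
        -- at f. With more walks than that, a second one avoids them all, and the two bound a ring
        -- of 2(4 + q) rungs.
        fewEnd : ∑W ℓ e₀ (λ u → ⟦ Fam? u ×-dec endsAt? e₀ u f ⟧) ≤ (3 + q) * hb′
        fewEnd = ≮⇒≥ λ big → contra big (first (∑W-< ℓ e₀ (λ _ → 0) _ (≤-<-trans (≤-trans (≤-reflexive (∑W-*ˡ ℓ e₀ 0 (λ _ → 0))) z≤n) big)))
          where
          size : ∀ q → suc (3 + q) + suc (3 + q) ≡ 2 * (4 + q)
          size = solve-∀
          first : ∃[ u ] (Valid ℓ e₀ u × 0 < ⟦ Fam? u ×-dec endsAt? e₀ u f ⟧) → Path e₀ f (3 + q) []
          first (u , v , lt) = toPath u v (fam-Gd u (proj₁ fe)) (proj₂ fe) (λ ())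
            where
            fe : Fam u × endOf e₀ u ≡ f
            fe = ⟦⟧-pos (Fam? u ×-dec endsAt? e₀ u f) lt
          contra : (3 + q) * hb′ < ∑W ℓ e₀ (λ u → ⟦ Fam? u ×-dec endsAt? e₀ u f ⟧) → Path e₀ f (3 + q) [] → ⊥
          contra big p = second (dodge ℓ e₀ (λ u → Fam? u ×-dec endsAt? e₀ u f) hb′
              (λ z → HitBound.hitBound (suc q) e₀ f z Fam? (λ {u} fm → proj₁ (fam-Gd u fm)) B h₁ h₂)
              (is p) (subst (λ k → k * hb′ < _) (sym (len p)) big))
            where
            second : ∃[ u ] (Valid ℓ e₀ u × (Fam u × endOf e₀ u ≡ f) × (∀ {z} → z ∈ is p → ¬ Hit z u)) → ⊥
            second (u , v , (fm , eq) , h) = noRing (subst Ring (size q) (twoPaths {Z = []} {Z′ = is p} re₀ p (toPath u v (fam-Gd u fm) eq h) (λ z∈ → z∈)))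

      impossible : Alive e₀ → ¬ (n * Δ * ((3 + q) * (4 * θ * B + (suc q * (4 * Δ * (w * w * r ^ q)) + 4 * θ * B))) < r * ρ ^ (3 + q))
      impossible al lt = <⇒≱ lt (begin
        r * ρ ^ (3 + q) ≤⟨ famCount al ⟩
        ∑W ℓ e₀ (λ u → ⟦ Fam? u ⟧) ≤⟨ ∑W-mono ℓ e₀ pt ⟩
        ∑W ℓ e₀ (λ u → ∑[ f ∈ rs ] ⟦ Fam? u ×-dec endsAt? e₀ u f ⟧) ≡⟨ ∑W-∑ ℓ e₀ rs (λ u f → ⟦ Fam? u ×-dec endsAt? e₀ u f ⟧) ⟩
        (∑[ f ∈ rs ] ∑W ℓ e₀ (λ u → ⟦ Fam? u ×-dec endsAt? e₀ u f ⟧)) ≤⟨ ∑-≤const rs bound fewEnd ⟩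
        length rs * bound ≤⟨ *-monoˡ-≤ bound (rs-length Δ deg≤Δ) ⟩
        n * Δ * bound ∎)
        where
        open ≤-Reasoning
        bound : ℕ
        bound = (3 + q) * (4 * θ * B + (suc q * (4 * Δ * (w * w * r ^ q)) + 4 * θ * B))
        pt : ∀ u → Valid ℓ e₀ u → ⟦ Fam? u ⟧ ≤ (∑[ f ∈ rs ] ⟦ Fam? u ×-dec endsAt? e₀ u f ⟧)
        pt u v = ≤-trans (⟦⟧-mono (Fam? u) (Fam? u ×-dec endsAt? e₀ u (endOf e₀ u)) (_, refl))
          (∑-single rs (λ f → ⟦ Fam? u ×-dec endsAt? e₀ u f ⟧) (valid-end (3 + q) e₀ u v))

-- Fitting the thresholds together

module Assemble (q L K₁ t w s₀ s ρ₀ b₁ b₂ M : ℕ)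
  (hL  : 2 * (2 + (6 + 2 * q)) < L)
  (hK₁ : K₁ ≡ 6 * (2 + (6 + 2 * q)))
  (ht  : L + L * L ≤ t * t)
  (hw  : 2 * (4 + q) * (4 * L) < w)
  (hs₀ : 32 * (t * t * K₁) + 64 * (4 + q) * t ≤ s₀)
  (s₀>0 : 0 < s₀)
  (hρ  : ρ₀ + ((4 + q) * (4 * t) + s₀ + (4 * t + 4 * t)) ≤ s)
  (hs  : s ≤ 2 * ρ₀)
  (hb₁ : 2 * (4 + q) * (8 * w + 4 * q * (w * w)) ≤ b₁)
  (hb₂ : (3 + q) * (8 * b₁ * (t * t) + 4 * suc q * (w * w)) ≤ b₂)
  (hs′ : b₂ * 2 ^ (3 + q) < s)
  (hM₁ : 256 * K₁ ≤ M) (hM₂ : 8 ≤ M) (hM₃ : 8 * s < M)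
  (t>0 : 0 < t)
  (𝔾 : FinGraph) (m : ℕ) .{{_ : NonZero m}}
  (deg≤ : ∀ y → Codegrees.deg 𝔾 y ≤ m * m)
  (n>0 : 0 < RichCount.n 𝔾 L)
  (n≤ : RichCount.n 𝔾 L ≤ (m * m) * (m * m))
  (Q≥ : M * (RichCount.n 𝔾 L * ((m * m) * (m * m))) ≤ RichCount.Q 𝔾 L) where

  private
    -- Δ is a perfect square so that θ = t m is an integer with θ² = cΔ exactly. The numbers r, r₀
    -- and ρ are constant multiples of Δ.
    ℓ Δ θ c r r₀ ρ : ℕ
    ℓ  = 4 + q
    Δ  = m * m
    θ  = t * m
    c  = t * t
    r  = s * Δ
    r₀ = s₀ * Δ
    ρ  = ρ₀ * Δ

    open FinGraph 𝔾
    open Codegrees 𝔾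
    open Richness L
    open RichCount 𝔾 L
    open Rings _~_ ~-sym
    open Arcs 𝔾 L θ

    m≤Δ : m ≤ Δ
    m≤Δ = m≤m*n m m

    m>0 : 0 < m
    m>0 = >-nonZero⁻¹ m

    Δ>0 : 0 < Δ
    Δ>0 = *-mono-< m>0 m>0

    instance
      Δ≢0 : NonZero Δ
      Δ≢0 = >-nonZero Δ>0
      r₀≢0 : NonZero r₀
      r₀≢0 = >-nonZero (*-mono-< s₀>0 Δ>0)

    θ² : θ * θ ≡ c * Δ
    θ² = lem t m
      where
      lem : ∀ t m → (t * m) * (t * m) ≡ (t * t) * (m * m)
      lem = solve-∀

    θ≤ : θ ≤ t * Δ
    θ≤ = *-monoʳ-≤ t m≤Δ

    θ>0 : 0 < θ
    θ>0 = *-mono-< t>0 m>0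

    N : ℕ
    N = n * (Δ * Δ)

    module _ (noRing : ¬ Ring (2 * ℓ)) where

      size : ∀ q → 2 + (6 + 2 * q) ≡ 2 * (4 + q)
      size = solve-∀

      Φ≤ : Φ ≤ 2 * (K₁ * Q)
      Φ≤ = Φ-bound {K₁} (≤-trans (s≤s (s≤s z≤n)) hL) (λ x≢x′ → fewRich x≢x′ (6 + 2 * q) K₁ hK₁ hL (noRing ∘ subst Ring (size q)))

      open Heavy Δ θ c deg≤ θ² ht using (Qₕ; Qₕ²)

      -- Combining `Qₕ²` with `Φ≤` gives Qₕ² ≤ 4 K₁ N Q, and Q ≥ 256 K₁ N by the choice of M; 256 is
      -- 4 times 8².
      8Qₕ≤Q : 8 * Qₕ ≤ Q
      8Qₕ≤Q = m*m≤n*n⇒m≤n (8 * Qₕ) Q (begin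
        8 * Qₕ * (8 * Qₕ)                  ≡⟨ l₁ Qₕ ⟩
        64 * (Qₕ * Qₕ)                     ≤⟨ *-monoʳ-≤ 64 Qₕ² ⟩
        64 * (N * (2 * Φ))                 ≤⟨ *-monoʳ-≤ 64 (*-monoʳ-≤ N (*-monoʳ-≤ 2 Φ≤)) ⟩
        64 * (N * (2 * (2 * (K₁ * Q))))    ≡⟨ l₂ N K₁ Q ⟩
        (256 * K₁) * N * Q                 ≤⟨ *-monoˡ-≤ Q (≤-trans (*-monoˡ-≤ N hM₁) Q≥) ⟩
        Q * Q                              ∎)
        where
        open ≤-Reasoning
        l₁ : ∀ x → 8 * x * (8 * x) ≡ 64 * (x * x)
        l₁ = solve-∀
        l₂ : ∀ n k q → 64 * (n * (2 * (2 * (k * q)))) ≡ (256 * k) * n * q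
        l₂ = solve-∀

      -- The degenerate part 2N and the heavy part 2Qₕ in `arcs-bound` are at most a quarter of Q
      -- each.
      Q≤2arcs : Q ≤ 2 * arcs
      Q≤2arcs = *-cancelˡ-≤ 2 (+-cancelʳ-≤ (2 * Q) _ _ (begin
        2 * Q + 2 * Q                                        ≡⟨ l₁ Q ⟩
        4 * Q                                                ≤⟨ *-monoʳ-≤ 4 (arcs-bound Δ deg≤) ⟩
        4 * (arcs + ((N + N) + (Qₕ + Qₕ)))                   ≡⟨ l₂ arcs N Qₕ ⟩
        2 * (2 * arcs) + (8 * N + 8 * Qₕ)                    ≤⟨ +-monoʳ-≤ (2 * (2 * arcs)) (+-mono-≤ (≤-trans (*-monoˡ-≤ N hM₂) Q≥) 8Qₕ≤Q) ⟩
        2 * (2 * arcs) + (Q + Q)                             ≡⟨ l₃ arcs Q ⟩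
        2 * (2 * arcs) + 2 * Q                               ∎))
        where
        open ≤-Reasoning
        l₁ : ∀ x → 2 * x + 2 * x ≡ 4 * x
        l₁ = solve-∀
        l₂ : ∀ a n h → 4 * (a + ((n + n) + (h + h))) ≡ 2 * (2 * a) + (8 * n + 8 * h)
        l₂ = solve-∀
        l₃ : ∀ a q → 2 * (2 * a) + (q + q) ≡ 2 * (2 * a) + 2 * q
        l₃ = solve-∀

      K₂ : ℕ
      K₂ = 2 * ℓ * (4 * θ)

      module Lk = Links 𝔾 L θ Δ deg≤ w ℓ

      open Cores 𝔾 L θ Δ deg≤ w ℓ using (Core) renaming (core to mkCore)

      core₁ : 4 * (2 * ((θ * θ) * Φ) + 2 * K₂ * arcs) ≤ r₀ * arcs
      core₁ = begin
        4 * (2 * ((θ * θ) * Φ) + 2 * K₂ * arcs)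
          ≤⟨ *-monoʳ-≤ 4 (+-mono-≤ (*-monoʳ-≤ 2 (*-monoʳ-≤ (θ * θ) (≤-trans Φ≤ (*-monoʳ-≤ 2 (*-monoʳ-≤ K₁ Q≤2arcs)))))
                                    (*-monoˡ-≤ arcs (*-monoʳ-≤ 2 (*-monoʳ-≤ (2 * ℓ) (*-monoʳ-≤ 4 θ≤))))) ⟩
        4 * (2 * ((θ * θ) * (2 * (K₁ * (2 * arcs)))) + 2 * (2 * ℓ * (4 * (t * Δ))) * arcs)
          ≡⟨ cong (λ x → 4 * (2 * (x * (2 * (K₁ * (2 * arcs)))) + 2 * (2 * ℓ * (4 * (t * Δ))) * arcs)) θ² ⟩
        4 * (2 * ((c * Δ) * (2 * (K₁ * (2 * arcs)))) + 2 * (2 * ℓ * (4 * (t * Δ))) * arcs)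
          ≡⟨ lem c Δ K₁ arcs ℓ t ⟩
        (32 * (c * K₁) + 64 * ℓ * t) * Δ * arcs ≤⟨ *-monoˡ-≤ arcs (*-monoˡ-≤ Δ hs₀) ⟩
        r₀ * arcs ∎
        where
        open ≤-Reasoning
        lem : ∀ c Δ k a l t → 4 * (2 * ((c * Δ) * (2 * (k * (2 * a)))) + 2 * (2 * l * (4 * (t * Δ))) * a) ≡ (32 * (c * k) + 64 * l * t) * Δ * a
        lem = solve-∀

      core₂ : 4 * (r * (n * Δ)) < arcs
      core₂ = *-cancelˡ-< 2 _ _ (begin-strict
        2 * (4 * (r * (n * Δ)))  ≡⟨ lem s Δ n ⟩
        8 * s * N                <⟨ *-monoˡ-< N {{>-nonZero (*-mono-< n>0 (*-mono-< Δ>0 Δ>0))}} hM₃ ⟩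
        M * N                    ≤⟨ Q≥ ⟩
        Q                        ≤⟨ Q≤2arcs ⟩
        2 * arcs                 ∎)
        where
        open ≤-Reasoning
        lem : ∀ s d n → 2 * (4 * (s * d * (n * d))) ≡ 8 * s * (n * (d * d))
        lem = solve-∀

      theCore : Core r r₀
      theCore = mkCore r r₀ K₂ (Lk.Linking.fewLinked (λ ()) hw noRing K₂ ≤-refl) core₁ core₂

      hρ′ : ρ + (ℓ * (4 * θ) + r₀ + (4 * θ + 4 * θ)) ≤ r
      hρ′ = begin
        ρ + (ℓ * (4 * θ) + r₀ + (4 * θ + 4 * θ))
          ≤⟨ +-monoʳ-≤ ρ (+-mono-≤ (+-monoˡ-≤ r₀ (*-monoʳ-≤ ℓ (*-monoʳ-≤ 4 θ≤))) (+-mono-≤ (*-monoʳ-≤ 4 θ≤) (*-monoʳ-≤ 4 θ≤))) ⟩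
        ρ₀ * Δ + (ℓ * (4 * (t * Δ)) + s₀ * Δ + (4 * (t * Δ) + 4 * (t * Δ))) ≡⟨ lem ρ₀ Δ ℓ t s₀ ⟩
        (ρ₀ + (ℓ * (4 * t) + s₀ + (4 * t + 4 * t))) * Δ ≤⟨ *-monoˡ-≤ Δ hρ ⟩
        s * Δ ∎
        where
        open ≤-Reasoning
        lem : ∀ p d l t s → p * d + (l * (4 * (t * d)) + s * d + (4 * (t * d) + 4 * (t * d))) ≡ (p + (l * (4 * t) + s + (4 * t + 4 * t))) * d
        lem = solve-∀

      s>0 : 0 < s
      s>0 = ≤-<-trans z≤n hs′

      Δ≤r : Δ ≤ r
      Δ≤r = ≤-trans (≤-reflexive (sym (*-identityˡ Δ))) (*-monoˡ-≤ Δ s>0)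

      U B : ℕ
      U = r ^ q * w
      B = 2 * ℓ * (4 * θ * U + (q * (4 * Δ * (w * w * r ^ (q ∸ 1))) + 4 * θ * U))

      -- One factor Δ is absorbed by r. At q = 0 the truncated exponent q ∸ 1 does no harm because
      -- the factor q vanishes.
      lower-power : ∀ q → q * (4 * Δ * (w * w * r ^ (q ∸ 1))) ≤ q * (4 * (w * w) * r ^ q)
      lower-power zero    = z≤n
      lower-power (suc q) = *-monoʳ-≤ (suc q) (begin
        4 * Δ * (w * w * r ^ q)   ≡⟨ lem Δ (w * w) (r ^ q) ⟩
        4 * (w * w) * (Δ * r ^ q) ≤⟨ *-monoʳ-≤ (4 * (w * w)) (*-monoˡ-≤ (r ^ q) Δ≤r) ⟩
        4 * (w * w) * (r * r ^ q) ∎)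
        where
        open ≤-Reasoning
        lem : ∀ d w p → 4 * d * (w * p) ≡ 4 * w * (d * p)
        lem = solve-∀

      B≤ : B ≤ b₁ * (θ * r ^ q)
      B≤ = begin
        B ≤⟨ *-monoʳ-≤ (2 * ℓ) (+-monoʳ-≤ (4 * θ * U) (+-monoˡ-≤ (4 * θ * U) (≤-trans (lower-power q) (*-monoʳ-≤ q (≤-trans (≤-reflexive (sym (*-identityˡ (4 * (w * w) * r ^ q)))) (*-monoˡ-≤ (4 * (w * w) * r ^ q) θ>0)))))) ⟩
        2 * ℓ * (4 * θ * U + (q * (θ * (4 * (w * w) * r ^ q)) + 4 * θ * U)) ≡⟨ lem (2 * ℓ) θ (r ^ q) w q ⟩
        2 * ℓ * (8 * w + 4 * q * (w * w)) * (θ * r ^ q) ≤⟨ *-monoˡ-≤ (θ * r ^ q) hb₁ ⟩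
        b₁ * (θ * r ^ q) ∎
        where
        open ≤-Reasoning
        lem : ∀ l θ p w q → l * (4 * θ * (p * w) + (q * (θ * (4 * (w * w) * p)) + 4 * θ * (p * w))) ≡ l * (8 * w + 4 * q * (w * w)) * (θ * p)
        lem = solve-∀

      -- Both sides are of order Δ⁴ r^q: on the left nΔ ≤ Δ³ and each summand in the bracket is O(Δ
      -- r^q), using θ² = cΔ; on the right ρ ≥ r / 2 gives at least r^(4+q) / 2^(3+q), with r = sΔ.
      -- It remains that s⁴ ≥ s exceeds b₂ 2^(3+q).
      final : n * Δ * ((3 + q) * (4 * θ * B + (suc q * (4 * Δ * (w * w * r ^ q)) + 4 * θ * B))) < r * ρ ^ (3 + q)
      final = *-cancelˡ-< (2 ^ (3 + q)) _ _ (begin-strict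
        2 ^ (3 + q) * (n * Δ * ((3 + q) * (4 * θ * B + (suc q * (4 * Δ * (w * w * r ^ q)) + 4 * θ * B))))
          ≤⟨ *-monoʳ-≤ (2 ^ (3 + q)) (*-mono-≤ (*-monoˡ-≤ Δ n≤) (*-monoʳ-≤ (3 + q) (+-mono-≤ (*-monoʳ-≤ (4 * θ) B≤) (+-monoʳ-≤ (suc q * (4 * Δ * (w * w * r ^ q))) (*-monoʳ-≤ (4 * θ) B≤))))) ⟩
        2 ^ (3 + q) * (Δ * Δ * Δ * ((3 + q) * (4 * θ * (b₁ * (θ * r ^ q)) + (suc q * (4 * Δ * (w * w * r ^ q)) + 4 * θ * (b₁ * (θ * r ^ q))))))
          ≡⟨ l₁ (2 ^ (3 + q)) Δ (3 + q) θ b₁ (r ^ q) (suc q) (w * w) ⟩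
        2 ^ (3 + q) * (Δ * Δ * Δ * ((3 + q) * (8 * b₁ * (θ * θ) + 4 * suc q * (w * w) * Δ) * r ^ q))
          ≡⟨ cong (λ x → 2 ^ (3 + q) * (Δ * Δ * Δ * ((3 + q) * (8 * b₁ * x + 4 * suc q * (w * w) * Δ) * r ^ q))) θ² ⟩
        2 ^ (3 + q) * (Δ * Δ * Δ * ((3 + q) * (8 * b₁ * (c * Δ) + 4 * suc q * (w * w) * Δ) * r ^ q))
          ≡⟨ l₂ (2 ^ (3 + q)) Δ (3 + q) b₁ c (suc q) (w * w) (r ^ q) ⟩
        ((3 + q) * (8 * b₁ * c + 4 * suc q * (w * w))) * 2 ^ (3 + q) * (Δ * Δ * (Δ * Δ) * r ^ q)
          ≤⟨ *-monoˡ-≤ (Δ * Δ * (Δ * Δ) * r ^ q) (*-monoˡ-≤ (2 ^ (3 + q)) hb₂) ⟩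
        b₂ * 2 ^ (3 + q) * (Δ * Δ * (Δ * Δ) * r ^ q)
          <⟨ *-monoˡ-< (Δ * Δ * (Δ * Δ) * r ^ q) {{>-nonZero (*-mono-< (*-mono-< (*-mono-< Δ>0 Δ>0) (*-mono-< Δ>0 Δ>0)) (m^n>0 r {{>-nonZero (≤-trans Δ>0 Δ≤r)}} q))}} hs′ ⟩
        s * (Δ * Δ * (Δ * Δ) * r ^ q)
          ≤⟨ *-monoˡ-≤ (Δ * Δ * (Δ * Δ) * r ^ q) s≤s⁴ ⟩
        s * (s * (s * s)) * (Δ * Δ * (Δ * Δ) * r ^ q) ≡⟨ l₃ s Δ (r ^ q) ⟩
        r * (r * (r * (r * r ^ q))) ≡⟨⟩
        r * r ^ (3 + q) ≤⟨ *-monoʳ-≤ r (^-monoˡ-≤ (3 + q) r≤2ρ) ⟩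
        r * (2 * ρ) ^ (3 + q) ≡⟨ cong (r *_) (^-distribʳ-* (3 + q) 2 ρ) ⟩
        r * (2 ^ (3 + q) * ρ ^ (3 + q)) ≡⟨ l₄ r (2 ^ (3 + q)) (ρ ^ (3 + q)) ⟩
        2 ^ (3 + q) * (r * ρ ^ (3 + q)) ∎)
        where
        open ≤-Reasoning
        r≤2ρ : r ≤ 2 * ρ
        r≤2ρ = ≤-trans (*-monoˡ-≤ Δ hs) (≤-reflexive (*-assoc 2 ρ₀ Δ))
        s≤s⁴ : s ≤ s * (s * (s * s))
        s≤s⁴ = m≤m*n s (s * (s * s)) {{>-nonZero (*-mono-< s>0 (*-mono-< s>0 s>0))}}
        ^-distribʳ-* : ∀ k a b → (a * b) ^ k ≡ a ^ k * b ^ k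
        ^-distribʳ-* zero    a b = refl
        ^-distribʳ-* (suc k) a b = trans (cong (a * b *_) (^-distribʳ-* k a b)) (lem a b (a ^ k) (b ^ k))
          where
          lem : ∀ a b x y → a * b * (x * y) ≡ a * x * (b * y)
          lem = solve-∀
        l₁ : ∀ z d k θ b p e w → z * (d * d * d * (k * (4 * θ * (b * (θ * p)) + (e * (4 * d * (w * p)) + 4 * θ * (b * (θ * p)))))) ≡ z * (d * d * d * (k * (8 * b * (θ * θ) + 4 * e * w * d) * p))
        l₁ = solve-∀
        l₂ : ∀ z d k b c e w p → z * (d * d * d * (k * (8 * b * (c * d) + 4 * e * w * d) * p)) ≡ (k * (8 * b * c + 4 * e * w)) * z * (d * d * (d * d) * p)
        l₂ = solve-∀
        l₃ : ∀ s d p → s * (s * (s * s)) * (d * d * (d * d) * p) ≡ s * d * (s * d * (s * d * (s * d * p)))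
        l₃ = solve-∀
        l₄ : ∀ r z x → r * (z * x) ≡ z * (r * x)
        l₄ = solve-∀

  hasRing : ¬ ¬ Ring (2 * (4 + q))
  hasRing noRing = go (Cores.Core.start (theCore noRing))
    where
    open Cores.Core (theCore noRing) using (Alive; Γ′; Γ′?; Γ′⊆; alive-deg)
    go : ∃[ e ] Alive e → ⊥
    go (e , al) = Finish.Grow.impossible 𝔾 L θ Δ deg≤ w q r r₀ (theCore noRing) (B noRing) ≤-refl noRing ρ (hρ′ noRing) e rung al (final noRing)
      where
      rung : IsRung e
      rung = pick′ (∑-pos rs _ (≤-<-trans z≤n (alive-deg al)))
        where
        pick′ : ∃[ f ] (f ∈ rs × 0 < ⟦ Γ′? e f ⟧) → IsRung e
        pick′ (f , _ , lt) = Γ.rung₁ (Γ′⊆ (⟦⟧-pos (Γ′? e f) lt))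

-- Regularisation

module Regularise {V : Set} (_≟_ : DecidableEquality V) (_~_ : V → V → Set)
  (~-sym : ∀ {x y} → x ~ y → y ~ x) (~-irrefl : ∀ {x} → ¬ (x ~ x)) (_~?_ : ∀ x y → Dec (x ~ y)) where

  open DecMem _≟_ using (_∈?_)

  adj : V → V → ℕ
  adj x y = ⟦ x ~? y ⟧

  adj-sym : ∀ x y → adj x y ≡ adj y x
  adj-sym x y = ⟦⟧-cong (x ~? y) (y ~? x) ~-sym ~-sym

  e[_,_] : List V → List V → ℕ
  e[ xs , ys ] = ∑[ x ∈ xs ] ∑[ y ∈ ys ] adj x y

  E : List V → ℕ
  E us = e[ us , us ]

  induced : ∀ {us} → Unique us → FinGraph
  induced {us} u = record
    { V        = V
    ; _≟_      = _≟_
    ; _~_      = λ x y → x ~ y × (x ∈ us × y ∈ us)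
    ; ~-sym    = λ (e , x∈ , y∈) → ~-sym e , y∈ , x∈
    ; ~-irrefl = λ (e , _) → ~-irrefl e
    ; _~?_     = λ x y → x ~? y ×-dec (x ∈? us ×-dec y ∈? us)
    ; vs       = us
    ; uniq     = u
    ; supp     = λ (_ , x∈ , _) → x∈
    }

  -- `E` counts ordered pairs, so the clauses say that all degrees are at most m², that their
  -- average is at least m² / κ, and that m² is at least the square root of d |us|.
  Regular : ℕ → ℕ → List V → ℕ → Set
  Regular κ d us m = 0 < length us × (∀ y → y ∈ us → (∑[ w ∈ us ] adj w y) ≤ m * m)
                     × m * m * length us ≤ κ * E us × d * length us ≤ m * m * (m * m)

  private
    E≤ : ∀ us → E us ≤ length us * length us
    E≤ us = ≤-trans (∑-≤const us (length us * 1) (λ x → ∑-≤const us 1 (λ y → ⟦⟧-≤1 (x ~? y))))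
                    (≤-reflexive (cong (length us *_) (*-identityʳ (length us))))

    halve : ∀ (f : V → ℕ) xs → Unique xs →
      ∃[ ys ] (Unique ys × (∀ {y} → y ∈ ys → y ∈ xs) × 2 * length ys ≤ length xs + 1 × ∑ xs f ≤ 2 * ∑ ys f)
    halve f xs u = pick (≤-total (∑ (take h xs) f) (∑ (drop h xs) f))
      where
      h : ℕ
      h = ⌈ length xs /2⌉
      total : ∑ xs f ≡ ∑ (take h xs) f + ∑ (drop h xs) f
      total = trans (cong (λ zs → ∑ zs f) (sym (take++drop≡id h xs))) (∑-++ (take h xs) (drop h xs) f)
      2⌈⌉ : ∀ n → 2 * ⌈ n /2⌉ ≤ n + 1
      2⌈⌉ zero          = z≤n
      2⌈⌉ (suc zero)    = ≤-refl
      2⌈⌉ (suc (suc n)) = ≤-trans (≤-reflexive (step ⌈ n /2⌉)) (s≤s (s≤s (2⌈⌉ n)))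
        where
        step : ∀ k → 2 * suc k ≡ suc (suc (2 * k))
        step = solve-∀
      ⌊⌋≤ : ∀ n → n ∸ ⌈ n /2⌉ ≤ ⌈ n /2⌉
      ⌊⌋≤ n = ≤-trans (≤-reflexive (trans (cong (_∸ ⌈ n /2⌉) (trans (sym (⌊n/2⌋+⌈n/2⌉≡n n)) (+-comm ⌊ n /2⌋ ⌈ n /2⌉))) (m+n∸m≡n ⌈ n /2⌉ ⌊ n /2⌋))) (⌊n/2⌋≤⌈n/2⌉ n)
      pick : ∑ (take h xs) f ≤ ∑ (drop h xs) f ⊎ ∑ (drop h xs) f ≤ ∑ (take h xs) f → _
      pick (inj₁ le) = drop h xs , drop⁺ h u , (λ {_} → ∈-drop h xs) ,
        ≤-trans (*-monoʳ-≤ 2 (≤-trans (≤-reflexive (length-drop h xs)) (⌊⌋≤ (length xs)))) (2⌈⌉ (length xs)) ,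
        ≤-trans (≤-reflexive total) (≤-trans (+-monoˡ-≤ (∑ (drop h xs) f) le) (≤-reflexive (double (∑ (drop h xs) f))))
        where
        ∈-drop : ∀ k (xs : List V) {y} → y ∈ drop k xs → y ∈ xs
        ∈-drop zero    xs       y∈ = y∈
        ∈-drop (suc k) (x ∷ xs) y∈ = there (∈-drop k xs y∈)
      pick (inj₂ le) = take h xs , take⁺ h u , (λ {_} → ∈-take h xs) ,
        ≤-trans (*-monoʳ-≤ 2 (≤-trans (≤-reflexive (length-take h xs)) (m⊓n≤m h (length xs)))) (2⌈⌉ (length xs)) ,
        ≤-trans (≤-reflexive total) (≤-trans (+-monoʳ-≤ (∑ (take h xs) f) le) (≤-reflexive (double (∑ (take h xs) f))))

    -- Repeatedly keeping the heavier half retains a 2^-k share of the sum. The roundings of all k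
    -- halvings together cost one vertex, which is the summand 2 ^ k.
    chunk : ∀ (f : V → ℕ) xs → Unique xs → ∀ k →
      ∃[ ys ] (Unique ys × (∀ {y} → y ∈ ys → y ∈ xs) × 2 ^ k * length ys ≤ length xs + 2 ^ k × ∑ xs f ≤ 2 ^ k * ∑ ys f)
    chunk f xs u zero = xs , u , (λ {_} y∈ → y∈) , ≤-trans (≤-reflexive (*-identityˡ (length xs))) (m≤m+n _ 1) , ≤-reflexive (sym (*-identityˡ (∑ xs f)))
    chunk f xs u (suc k) = go (chunk f xs u k)
      where
      go : ∃[ ys ] (Unique ys × (∀ {y} → y ∈ ys → y ∈ xs) × 2 ^ k * length ys ≤ length xs + 2 ^ k × ∑ xs f ≤ 2 ^ k * ∑ ys f) → _
      go (ys , uy , sub , len , le) = go′ (halve f ys uy)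
        where
        go′ : ∃[ zs ] (Unique zs × (∀ {y} → y ∈ zs → y ∈ ys) × 2 * length zs ≤ length ys + 1 × ∑ ys f ≤ 2 * ∑ zs f) → _
        go′ (zs , uz , sub′ , len′ , le′) = zs , uz , (λ {_} z∈ → sub (sub′ z∈)) ,
          (begin
            2 * 2 ^ k * length zs        ≡⟨ l₁ (2 ^ k) (length zs) ⟩
            2 ^ k * (2 * length zs)      ≤⟨ *-monoʳ-≤ (2 ^ k) len′ ⟩
            2 ^ k * (length ys + 1)      ≡⟨ l₂ (2 ^ k) (length ys) ⟩
            2 ^ k * length ys + 2 ^ k    ≤⟨ +-monoˡ-≤ (2 ^ k) len ⟩
            length xs + 2 ^ k + 2 ^ k    ≡⟨ l₃ (length xs) (2 ^ k) ⟩
            length xs + 2 * 2 ^ k        ∎) ,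
          ≤-trans le (≤-trans (*-monoʳ-≤ (2 ^ k) le′) (≤-reflexive (l₄ (2 ^ k) (∑ zs f))))
          where
          open ≤-Reasoning
          l₁ : ∀ p z → 2 * p * z ≡ p * (2 * z)
          l₁ = solve-∀
          l₂ : ∀ p z → p * (z + 1) ≡ p * z + p
          l₂ = solve-∀
          l₃ : ∀ x p → x + p + p ≡ x + 2 * p
          l₃ = solve-∀
          l₄ : ∀ p z → p * (2 * z) ≡ 2 * p * z
          l₄ = solve-∀

    least : ∀ (P : ℕ → Set) → (∀ k → Dec (P k)) → ∀ b → P b → ¬ P 0 → ∃[ k ] (P (suc k) × ¬ P k)
    least P P? zero    pb n₀ = ⊥-elim (n₀ pb)
    least P P? (suc b) pb n₀ with P? b
    ... | yes p = least P P? b p n₀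
    ... | no ¬p = b , pb , ¬p

  -- Vertices of degree above about A times the average are called high; a dense set whose
  -- edges mostly touch high vertices has a denser subset smaller by the factor s.
  module Peak (j P A s x n₀ : ℕ) (hP : P ≡ 2 ^ j) (hA : A ≡ 8 * P) (h₁ : 9 * s + x ≡ 8 * P)
    (h₂ : 8 * (s * P) ≤ x * n₀) (h₃ : (4 * P) * (4 * P) ≤ s * (s * s)) (P>0 : 0 < P) (s>1 : 1 < s) (n₀>0 : 0 < n₀)
    (d : ℕ) (d≥ : n₀ ≤ d) where

    κ : ℕ
    κ = 4 * A * 2

    -- At least √d |us|^(3/2) ordered edges, squared.
    Dense : List V → Set
    Dense us = 0 < length us × d * (length us * (length us * length us)) ≤ E us * E us

    Outcome : ℕ → Set
    Outcome n = (∃[ ws ] ∃[ m ] (Unique ws × NonZero m × Regular κ d ws m)) ⊎ (∃[ ws ] (Unique ws × length ws < n × Dense ws))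

    module Step {us : List V} (u : Unique us) (dense : Dense us) where

      private
        n Eᵤ : ℕ
        n  = length us
        Eᵤ = E us

        n>0 : 0 < n
        n>0 = proj₁ dense

        d>0 : 0 < d
        d>0 = ≤-trans n₀>0 d≥

        A>0 : 0 < A
        A>0 = ≤-trans P>0 (≤-trans (m≤n*m P 8) (≤-reflexive (sym hA)))

        n³>0 : 0 < n * (n * n)
        n³>0 = *-mono-< n>0 (*-mono-< n>0 n>0)

        n≤E : n ≤ Eᵤ
        n≤E = m*m≤n*n⇒m≤n n Eᵤ (begin
          n * n             ≤⟨ m≤n*m (n * n) n {{>-nonZero n>0}} ⟩
          n * (n * n)       ≤⟨ m≤n*m (n * (n * n)) d {{>-nonZero d>0}} ⟩
          d * (n * (n * n)) ≤⟨ proj₂ dense ⟩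
          Eᵤ * Eᵤ           ∎)
          where open ≤-Reasoning

        E>0 : 0 < Eᵤ
        E>0 = ≤-trans n>0 n≤E

        n₀≤n : n₀ ≤ n
        n₀≤n = ≤-trans d≥ (*-cancelʳ-≤ d n (n * (n * n)) {{>-nonZero n³>0}} (begin
          d * (n * (n * n)) ≤⟨ proj₂ dense ⟩
          Eᵤ * Eᵤ           ≤⟨ *-mono-≤ (E≤ us) (E≤ us) ⟩
          n * n * (n * n)   ≡⟨ lem n ⟩
          n * (n * (n * n)) ∎))
          where
          open ≤-Reasoning
          lem : ∀ n → n * n * (n * n) ≡ n * (n * (n * n))
          lem = solve-∀

        -- The level m is the least one for which m² is at least A times the average degree;
        -- minimality keeps m² within a factor 4 of that.
        Enough : ℕ → Set
        Enough k = A * Eᵤ ≤ k * k * n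

        level : ∃[ k ] (Enough (suc k) × ¬ Enough k)
        level = least Enough (λ k → A * Eᵤ ≤? k * k * n) (A * Eᵤ) (begin
          A * Eᵤ ≤⟨ m≤m*n (A * Eᵤ) (A * Eᵤ) {{>-nonZero AE>0}} ⟩
          A * Eᵤ * (A * Eᵤ) ≤⟨ m≤m*n (A * Eᵤ * (A * Eᵤ)) n {{>-nonZero n>0}} ⟩
          A * Eᵤ * (A * Eᵤ) * n ∎) (<⇒≱ AE>0)
          where
          open ≤-Reasoning
          AE>0 : 0 < A * Eᵤ
          AE>0 = *-mono-< A>0 E>0

      module Level (k : ℕ) (enough : Enough (suc k)) (notEnough : ¬ Enough k) where

        private
          m Δ : ℕ
          m = suc k
          Δ = m * m

          Δn≤ : Δ * n ≤ 4 * A * Eᵤ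
          Δn≤ = go k notEnough
            where
            open ≤-Reasoning
            lem : ∀ j n → suc (suc j) * suc (suc j) * n + (3 * (j * j) + 4 * j) * n ≡ 4 * (suc j * suc j * n)
            lem = solve-∀
            go : ∀ k → ¬ Enough k → suc k * suc k * n ≤ 4 * A * Eᵤ
            -- Here m = 1, and failure of the previous level says too little; n ≤ E takes its place.
            go zero    _ = ≤-trans (≤-reflexive (+-identityʳ n)) (≤-trans n≤E (≤-trans (m≤n*m Eᵤ A {{>-nonZero A>0}}) (≤-trans (m≤n*m (A * Eᵤ) 4) (≤-reflexive (sym (*-assoc 4 A Eᵤ))))))
            go (suc j) h = begin
              suc (suc j) * suc (suc j) * n  ≤⟨ m≤m+n _ ((3 * (j * j) + 4 * j) * n) ⟩
              suc (suc j) * suc (suc j) * n + (3 * (j * j) + 4 * j) * n ≡⟨ lem j n ⟩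
              4 * (suc j * suc j * n) ≤⟨ *-monoʳ-≤ 4 (<⇒≤ (≰⇒> h)) ⟩
              4 * (A * Eᵤ) ≡⟨ sym (*-assoc 4 A Eᵤ) ⟩
              4 * A * Eᵤ ∎

          dn≤ : d * n ≤ Δ * Δ
          dn≤ = *-cancelʳ-≤ (d * n) (Δ * Δ) (n * n) {{>-nonZero (*-mono-< n>0 n>0)}} (begin
            d * n * (n * n)       ≡⟨ *-assoc d n (n * n) ⟩
            d * (n * (n * n))     ≤⟨ proj₂ dense ⟩
            Eᵤ * Eᵤ               ≤⟨ *-mono-≤ E≤Δn E≤Δn ⟩
            Δ * n * (Δ * n)       ≡⟨ lem Δ n ⟩
            Δ * Δ * (n * n)       ∎)
            where
            open ≤-Reasoning
            E≤Δn : Eᵤ ≤ Δ * n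
            E≤Δn = ≤-trans (m≤n*m Eᵤ A {{>-nonZero A>0}}) enough
            lem : ∀ a b → a * b * (a * b) ≡ a * a * (b * b)
            lem = solve-∀

          degᵤ : V → ℕ
          degᵤ x = ∑[ w ∈ us ] adj w x

          low? : ∀ x → Dec (degᵤ x ≤ Δ)
          low? x = degᵤ x ≤? Δ

          low high : List V
          low  = filter low? us
          high = filter (λ x → ¬? (low? x)) us

          low-regular : Eᵤ ≤ 2 * E low → Regular κ d low m
          low-regular h = nonempty , bounded , many , ≤-trans (*-monoʳ-≤ d low≤n) dn≤
            where
            open ≤-Reasoning
            low≤n : length low ≤ n
            low≤n = length-filter′ low? us
              where
              length-filter′ : ∀ {P : V → Set} (P? : ∀ x → Dec (P x)) xs → length (filter P? xs) ≤ length xs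
              length-filter′ P? xs = ≤-trans (≤-reflexive (length-filter P? xs)) (≤-trans (∑-≤const xs 1 (λ x → ⟦⟧-≤1 (P? x))) (≤-reflexive (*-identityʳ (length xs))))
            nonempty : 0 < length low
            nonempty = n≢0⇒n>0 λ z → <⇒≱ E>0 (≤-trans h (≤-trans (*-monoʳ-≤ 2 (≤-trans (E≤ low) (≤-reflexive (cong (λ t → t * t) z)))) z≤n))
            bounded : ∀ y → y ∈ low → (∑[ w ∈ low ] adj w y) ≤ m * m
            bounded y y∈ = ≤-trans (≤-reflexive (∑-filter low? us (λ w → adj w y)))
              (≤-trans (∑-mono us (λ w → ⟦⟧*≤ (low? w))) (proj₂ (∈-filter⁻ low? {xs = us} y∈)))
            many : m * m * length low ≤ κ * E low
            many = begin
              Δ * length low ≤⟨ *-monoʳ-≤ Δ low≤n ⟩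
              Δ * n ≤⟨ Δn≤ ⟩
              4 * A * Eᵤ ≤⟨ *-monoʳ-≤ (4 * A) h ⟩
              4 * A * (2 * E low) ≡⟨ sym (*-assoc (4 * A) 2 (E low)) ⟩
              κ * E low ∎

          high-size : A * length high ≤ n
          high-size = *-cancelʳ-≤ (A * length high) n Eᵤ {{>-nonZero E>0}} (begin
            A * length high * Eᵤ   ≡⟨ l₁ A (length high) Eᵤ ⟩
            length high * (A * Eᵤ) ≤⟨ *-monoʳ-≤ (length high) enough ⟩
            length high * (Δ * n)    ≡⟨ sym (*-assoc (length high) Δ n) ⟩
            length high * Δ * n      ≡⟨ cong (_* n) (trans (cong (_* Δ) (length-filter (λ x → ¬? (low? x)) us)) (sym (∑-*ʳ us _ Δ))) ⟩
            (∑[ x ∈ us ] ⟦ ¬? (low? x) ⟧ * Δ) * n ≤⟨ *-monoˡ-≤ n (∑-mono us (λ x → ≤-trans (⟦⟧-scale (¬? (low? x)) (λ h → <⇒≤ (≰⇒> h))) (⟦⟧*≤ (¬? (low? x))))) ⟩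
            (∑[ x ∈ us ] degᵤ x) * n ≡⟨ cong (_* n) (∑-swap us us (λ x w → adj w x)) ⟩
            Eᵤ * n                   ≡⟨ *-comm Eᵤ n ⟩
            n * Eᵤ                   ∎)
            where
            open ≤-Reasoning
            l₁ : ∀ a h e → a * h * e ≡ h * (a * e)
            l₁ = solve-∀

          f : V → ℕ
          f v = ∑[ h ∈ high ] adj v h

          -- Ordered edges with a high end number at most 2 ∑ f, one sum for each end, and they make
          -- up more than half of all.
          high-edges : 2 * E low < Eᵤ → Eᵤ ≤ 4 * ∑ us f
          high-edges lt = +-cancelˡ-≤ Eᵤ _ _ (begin
            Eᵤ + Eᵤ ≤⟨ +-mono-≤ split split ⟩
            (E low + (X + X)) + (E low + (X + X)) ≡⟨ lem (E low) X ⟩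
            2 * E low + 4 * X ≤⟨ +-monoˡ-≤ (4 * X) (<⇒≤ lt) ⟩
            Eᵤ + 4 * X ∎)
            where
            open ≤-Reasoning
            X : ℕ
            X = ∑ us f
            lem : ∀ a x → (a + (x + x)) + (a + (x + x)) ≡ 2 * a + 4 * x
            lem = solve-∀
            pt : ∀ x y → adj x y ≤ ⟦ low? x ⟧ * (⟦ low? y ⟧ * adj x y) + (⟦ ¬? (low? y) ⟧ * adj x y + ⟦ ¬? (low? x) ⟧ * adj y x)
            pt x y = go (low? x) (low? y)
              where
              go : (p : Dec (degᵤ x ≤ Δ)) (q : Dec (degᵤ y ≤ Δ)) → adj x y ≤ ⟦ p ⟧ * (⟦ q ⟧ * adj x y) + (⟦ ¬? q ⟧ * adj x y + ⟦ ¬? p ⟧ * adj y x)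
              go (yes _) (yes _) = ≤-trans (≤-reflexive (sym (trans (+-identityʳ (adj x y + 0)) (+-identityʳ (adj x y))))) (m≤m+n (adj x y + 0 + 0) 0)
              go (yes _) (no _)  = ≤-trans (m≤m+n (adj x y) 0) (m≤m+n (adj x y + 0) 0)
              go (no _)  q       = ≤-trans (≤-reflexive (adj-sym x y)) (≤-trans (m≤m+n (adj y x) 0) (m≤n+m (adj y x + 0) (⟦ ¬? q ⟧ * adj x y)))
            ∑high : ∀ x → f x ≡ (∑[ y ∈ us ] ⟦ ¬? (low? y) ⟧ * adj x y)
            ∑high x = ∑-filter (λ y → ¬? (low? y)) us (adj x)
            split : Eᵤ ≤ E low + (X + X)
            split = begin
              Eᵤ ≤⟨ ∑-mono us (λ x → ∑-mono us (pt x)) ⟩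
              (∑[ x ∈ us ] ∑[ y ∈ us ] ⟦ low? x ⟧ * (⟦ low? y ⟧ * adj x y) + (⟦ ¬? (low? y) ⟧ * adj x y + ⟦ ¬? (low? x) ⟧ * adj y x))
                ≡⟨ trans (∑-cong us (λ x → trans (∑-+ us _ _) (cong ((∑[ y ∈ us ] ⟦ low? x ⟧ * (⟦ low? y ⟧ * adj x y)) +_) (∑-+ us _ _))))
                         (trans (∑-+ us _ _) (cong ((∑[ x ∈ us ] ∑[ y ∈ us ] ⟦ low? x ⟧ * (⟦ low? y ⟧ * adj x y)) +_) (∑-+ us _ _))) ⟩
              (∑[ x ∈ us ] ∑[ y ∈ us ] ⟦ low? x ⟧ * (⟦ low? y ⟧ * adj x y)) +
                ((∑[ x ∈ us ] ∑[ y ∈ us ] ⟦ ¬? (low? y) ⟧ * adj x y) + (∑[ x ∈ us ] ∑[ y ∈ us ] ⟦ ¬? (low? x) ⟧ * adj y x))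
                ≡⟨ cong₂ _+_ (trans (∑-cong us (λ x → trans (∑-*ˡ us ⟦ low? x ⟧ _) (cong (⟦ low? x ⟧ *_) (sym (∑-filter low? us (adj x)))))) (sym (∑-filter low? us (λ x → ∑[ y ∈ low ] adj x y))))
                    (cong₂ _+_ (∑-cong us (λ x → sym (∑high x))) (trans (∑-swap us us (λ x y → ⟦ ¬? (low? x) ⟧ * adj y x)) (∑-cong us (λ x → sym (∑high x))))) ⟩
              E low + (X + X) ∎

        module Denser (lt : 2 * E low < Eᵤ) {ys : List V} (uy : Unique ys) (sub : ∀ {y} → y ∈ ys → y ∈ us)
          (len : P * length ys ≤ n + P) (cover : ∑ us f ≤ P * ∑ ys f) where

          private
            new? : ∀ x → Dec (x ∈ ys ⊎ ¬ (degᵤ x ≤ Δ))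
            new? x = (x ∈? ys) ⊎-dec ¬? (low? x)

          new : List V
          new = filter new? us

          new-unique : Unique new
          new-unique = filter⁺ new? u

          private
            enoughEdges : Eᵤ ≤ 4 * P * E new
            enoughEdges = begin
              Eᵤ ≤⟨ high-edges lt ⟩
              4 * ∑ us f ≤⟨ *-monoʳ-≤ 4 cover ⟩
              4 * (P * ∑ ys f) ≡⟨ sym (*-assoc 4 P (∑ ys f)) ⟩
              4 * P * ∑ ys f ≤⟨ *-monoʳ-≤ (4 * P) (begin
                ∑ ys f ≤⟨ ∑-sub _≟_ ys uy sub f ⟩
                (∑[ v ∈ us ] ⟦ v ∈? ys ⟧ * f v) ≤⟨ ∑-mono us (λ v → *-mono-≤ (⟦⟧-mono (v ∈? ys) (new? v) inj₁) (≤-trans (≤-reflexive (∑-filter (λ y → ¬? (low? y)) us (adj v)))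
                     (≤-trans (∑-mono us (λ y → *-monoˡ-≤ (adj v y) (⟦⟧-mono (¬? (low? y)) (new? y) inj₂))) (≤-reflexive (sym (∑-filter new? us (adj v))))))) ⟩
                (∑[ v ∈ us ] ⟦ new? v ⟧ * (∑[ y ∈ new ] adj v y)) ≡⟨ sym (∑-filter new? us (λ v → ∑[ y ∈ new ] adj v y)) ⟩
                E new ∎) ⟩
              4 * P * E new ∎
              where open ≤-Reasoning

            -- The chunk has at most n / P + 1 vertices and the high part at most n / (8P), together
            -- 9n / (8P) + 1. The slack x between 9s and 8P absorbs the 1, because n is at least n₀.
            size : s * length new ≤ n
            size = *-cancelˡ-≤ (8 * P) {{>-nonZero (≤-trans P>0 (m≤n*m P 8))}} (begin
              8 * P * (s * length new) ≤⟨ *-monoʳ-≤ (8 * P) (*-monoʳ-≤ s parts) ⟩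
              8 * P * (s * (length ys + length high)) ≡⟨ l₁ P s (length ys) (length high) ⟩
              8 * s * (P * length ys) + s * (8 * P * length high) ≤⟨ +-mono-≤ (*-monoʳ-≤ (8 * s) len) (*-monoʳ-≤ s (subst (λ a → a * length high ≤ n) hA high-size)) ⟩
              8 * s * (n + P) + s * n ≡⟨ l₂ s P n ⟩
              9 * s * n + 8 * (s * P) ≤⟨ +-monoʳ-≤ (9 * s * n) (≤-trans h₂ (*-monoʳ-≤ x n₀≤n)) ⟩
              9 * s * n + x * n ≡⟨ sym (*-distribʳ-+ n (9 * s) x) ⟩
              (9 * s + x) * n ≡⟨ cong (_* n) h₁ ⟩
              8 * P * n ∎)
              where
              open ≤-Reasoning
              l₁ : ∀ p s a b → 8 * p * (s * (a + b)) ≡ 8 * s * (p * a) + s * (8 * p * b)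
              l₁ = solve-∀
              l₂ : ∀ s p n → 8 * s * (n + p) + s * n ≡ 9 * s * n + 8 * (s * p)
              l₂ = solve-∀
              parts : length new ≤ length ys + length high
              parts = begin
                length new ≡⟨ length-filter new? us ⟩
                (∑[ x ∈ us ] ⟦ new? x ⟧) ≤⟨ ∑-mono us (λ x → ⟦⟧-∪ (new? x) (x ∈? ys) (¬? (low? x)) (λ h → h)) ⟩
                (∑[ x ∈ us ] ⟦ x ∈? ys ⟧ + ⟦ ¬? (low? x) ⟧) ≡⟨ ∑-+ us _ _ ⟩
                (∑[ x ∈ us ] ⟦ x ∈? ys ⟧) + (∑[ x ∈ us ] ⟦ ¬? (low? x) ⟧) ≤⟨ +-mono-≤ (∑-∈ _≟_ u ys) (≤-reflexive (sym (length-filter (λ x → ¬? (low? x)) us))) ⟩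
                length ys + length high ∎

          new-smaller : length new < n
          new-smaller = go (length new) size
            where
            go : ∀ k → s * k ≤ n → k < n
            go zero    _ = n>0
            go (suc k) h = <-≤-trans (m<n*m (suc k) s s>1) h
              where
              m<n*m : ∀ a b → .{{NonZero a}} → 1 < b → a < b * a
              m<n*m a b lt = <-≤-trans (≤-reflexive (cong suc (sym (*-identityˡ a)))) (*-monoˡ-< a lt)

          -- Edges shrink by a factor of at most 4P and vertices by at least s, so E² / n³ does not
          -- drop as long as (4P)² ≤ s³.
          new-dense : Dense new
          new-dense = nonempty , *-cancelˡ-≤ (4 * P * (4 * P)) {{>-nonZero (*-mono-< 4P>0 4P>0)}} (begin
            4 * P * (4 * P) * (d * (l * (l * l))) ≤⟨ *-monoˡ-≤ (d * (l * (l * l))) h₃ ⟩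
            s * (s * s) * (d * (l * (l * l))) ≡⟨ l₁ s d l ⟩
            d * (s * l * (s * l * (s * l))) ≤⟨ *-monoʳ-≤ d (*-mono-≤ size (*-mono-≤ size size)) ⟩
            d * (n * (n * n)) ≤⟨ proj₂ dense ⟩
            Eᵤ * Eᵤ ≤⟨ *-mono-≤ enoughEdges enoughEdges ⟩
            4 * P * E new * (4 * P * E new) ≡⟨ l₂ (4 * P) (E new) ⟩
            4 * P * (4 * P) * (E new * E new) ∎)
            where
            open ≤-Reasoning
            4P>0 : 0 < 4 * P
            4P>0 = ≤-trans P>0 (m≤n*m P 4)
            l : ℕ
            l = length new
            l₁ : ∀ s d l → s * (s * s) * (d * (l * (l * l))) ≡ d * (s * l * (s * l * (s * l)))
            l₁ = solve-∀
            l₂ : ∀ p e → p * e * (p * e) ≡ p * p * (e * e)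
            l₂ = solve-∀
            nonempty : 0 < l
            nonempty = n≢0⇒n>0 λ z → <⇒≱ E>0 (≤-trans enoughEdges (≤-trans (*-monoʳ-≤ (4 * P) (≤-trans (E≤ new) (≤-reflexive (cong (λ t → t * t) z)))) (≤-reflexive (*-zeroʳ (4 * P)))))

        outcome : Outcome n
        outcome = go (Eᵤ ≤? 2 * E low)
          where
          finish : 2 * E low < Eᵤ → ∃[ ys ] (Unique ys × (∀ {y} → y ∈ ys → y ∈ us) × 2 ^ j * length ys ≤ length us + 2 ^ j × ∑ us f ≤ 2 ^ j * ∑ ys f) → Outcome n
          finish lt (ys , uy , sub , len , cover) = inj₂ (D.new , D.new-unique , D.new-smaller , D.new-dense)
            where module D = Denser lt {ys} uy (λ {_} → sub) (subst (λ p → p * length ys ≤ n + p) (sym hP) len) (subst (λ p → ∑ us f ≤ p * ∑ ys f) (sym hP) cover)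
          go : Dec (Eᵤ ≤ 2 * E low) → Outcome n
          go (yes h) = inj₁ (low , m , filter⁺ low? u , _ , low-regular h)
          go (no h)  = finish (≰⇒> h) (chunk f us u j)

      outcomeOf : ∃[ k ] (Enough (suc k) × ¬ Enough k) → Outcome n
      outcomeOf (k , en , ne) = Level.outcome k en ne

      next : Outcome n
      next = outcomeOf level

    regularise : ∀ b {us} → Unique us → Dense us → length us ≤ b → ∃[ ws ] ∃[ m ] (Unique ws × NonZero m × Regular κ d ws m)
    regularise zero    u (n>0 , _) le = ⊥-elim (<⇒≱ n>0 le)
    regularise (suc b) {us} u dense le = go (Step.next u dense)
      where
      go : Outcome (length us) → ∃[ ws ] ∃[ m ] (Unique ws × NonZero m × Regular κ d ws m)
      go (inj₁ r) = r
      go (inj₂ (ws , uw , lt , dw)) = regularise b uw dw (≤-pred (≤-trans lt le))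

-- The number of 4-cycles

module FourthMoment (𝔾 : FinGraph) (L : ℕ) where

  open FinGraph 𝔾
  open Codegrees 𝔾
  open RichCount 𝔾 L using (n; Q)

  private
    row : V → ℕ
    row w = ∑[ x ∈ vs ] a w x

    total S : ℕ
    total = ∑[ w ∈ vs ] row w
    S     = ∑[ x ∈ vs ] ∑[ x′ ∈ vs ] D x x′

    S-≡ : S ≡ (∑[ w ∈ vs ] row w * row w)
    S-≡ = trans (∑-cong vs (λ x → ∑-swap vs vs (λ x′ w → a w x * a w x′)))
      (trans (∑-swap vs vs (λ x w → ∑[ x′ ∈ vs ] a w x * a w x′)) (∑-cong vs (λ w → sym (∑-* vs vs (a w) (a w)))))

    S²≤ : S * S ≤ n * n * Q
    S²≤ = begin
      S * S ≡⟨ cong (λ k → k * k) (sym (∑-⊗ vs vs (λ (x , x′) → D x x′))) ⟩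
      ∑ (cartesianProduct vs vs) (λ (x , x′) → D x x′) * ∑ (cartesianProduct vs vs) (λ (x , x′) → D x x′) ≤⟨ ∑² (cartesianProduct vs vs) _ ⟩
      length (cartesianProduct vs vs) * ∑ (cartesianProduct vs vs) (λ (x , x′) → D x x′ * D x x′) ≡⟨ cong₂ _*_ (length-⊗ vs vs) (∑-⊗ vs vs _) ⟩
      n * n * Q ∎
      where open ≤-Reasoning

  -- Cauchy-Schwarz twice: from degrees to paths of two edges, and from codegrees to 4-cycles.
  fourth : (total * total) * (total * total) ≤ (n * n) * (n * n) * Q
  fourth = begin
    (total * total) * (total * total) ≤⟨ *-mono-≤ (∑² vs row) (∑² vs row) ⟩
    (n * (∑[ w ∈ vs ] row w * row w)) * (n * (∑[ w ∈ vs ] row w * row w)) ≡⟨ cong (λ k → (n * k) * (n * k)) (sym S-≡) ⟩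
    (n * S) * (n * S) ≡⟨ l₁ n S ⟩
    n * n * (S * S) ≤⟨ *-monoʳ-≤ (n * n) S²≤ ⟩
    n * n * (n * n * Q) ≡⟨ sym (*-assoc (n * n) (n * n) Q) ⟩
    (n * n) * (n * n) * Q ∎
    where
    open ≤-Reasoning
    l₁ : ∀ n s → (n * s) * (n * s) ≡ n * n * (s * s)
    l₁ = solve-∀

-- Constants and the upper bound

module Constants (q : ℕ) where

  abstract
    -- The order of choice matters: b₁ and b₂ do not involve s, so s can be taken beyond N = b₂
    -- 2^(3+q), and M comes last. b is the loss per step in units of Δ; as ρ₀ is a multiple of b,
    -- adding b at most doubles it, which gives s ≤ 2 ρ₀.
    L K₁ t w s₀ b b₁ b₂ N ρ₀ s M : ℕ
    L  = suc (2 * (2 + (6 + 2 * q)))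
    K₁ = 6 * (2 + (6 + 2 * q))
    t  = suc L
    w  = suc (2 * (4 + q) * (4 * L))
    s₀ = suc (32 * (t * t * K₁) + 64 * (4 + q) * t)
    b  = (4 + q) * (4 * t) + s₀ + (4 * t + 4 * t)
    b₁ = 2 * (4 + q) * (8 * w + 4 * q * (w * w))
    b₂ = (3 + q) * (8 * b₁ * (t * t) + 4 * suc q * (w * w))
    N  = b₂ * 2 ^ (3 + q)
    ρ₀ = suc N * b
    s  = ρ₀ + b
    M  = 256 * K₁ + (8 + suc (8 * s))

    hL : 2 * (2 + (6 + 2 * q)) < L
    hL = ≤-refl

    hK₁ : K₁ ≡ 6 * (2 + (6 + 2 * q))
    hK₁ = refl

    ht : L + L * L ≤ t * t
    ht = ≤-trans (m≤m+n (L + L * L) (suc L)) (≤-reflexive (lem L))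
      where
      lem : ∀ l → l + l * l + suc l ≡ suc l * suc l
      lem = solve-∀

    hw : 2 * (4 + q) * (4 * L) < w
    hw = ≤-refl

    hs₀ : 32 * (t * t * K₁) + 64 * (4 + q) * t ≤ s₀
    hs₀ = n≤1+n _

    s₀>0 : 0 < s₀
    s₀>0 = s≤s z≤n

    b>0 : 0 < b
    b>0 = ≤-trans s₀>0 (≤-trans (m≤n+m s₀ ((4 + q) * (4 * t))) (m≤m+n _ (4 * t + 4 * t)))

    hρ : ρ₀ + ((4 + q) * (4 * t) + s₀ + (4 * t + 4 * t)) ≤ s
    hρ = ≤-refl

    hs : s ≤ 2 * ρ₀
    hs = +-monoʳ-≤ ρ₀ (≤-trans (m≤n*m b (suc N)) (≤-reflexive (sym (+-identityʳ ρ₀))))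

    hb₁ : 2 * (4 + q) * (8 * w + 4 * q * (w * w)) ≤ b₁
    hb₁ = ≤-refl

    hb₂ : (3 + q) * (8 * b₁ * (t * t) + 4 * suc q * (w * w)) ≤ b₂
    hb₂ = ≤-refl

    hs′ : b₂ * 2 ^ (3 + q) < s
    hs′ = ≤-trans (m≤m*n (suc N) b {{>-nonZero b>0}}) (m≤m+n ρ₀ b)

    hM₁ : 256 * K₁ ≤ M
    hM₁ = m≤m+n (256 * K₁) (8 + suc (8 * s))

    hM₂ : 8 ≤ M
    hM₂ = ≤-trans (m≤m+n 8 (suc (8 * s))) (m≤n+m (8 + suc (8 * s)) (256 * K₁))

    hM₃ : 8 * s < M
    hM₃ = ≤-trans (m≤n+m (suc (8 * s)) 8) (m≤n+m (8 + suc (8 * s)) (256 * K₁))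

    t>0 : 0 < t
    t>0 = s≤s z≤n

module UpperBound (q : ℕ) where

  open Constants q

  abstract
    κ n₀ : ℕ
    κ  = 4 * 512 * 2
    n₀ = 147

    κ>0 : 0 < κ
    κ>0 = s≤s z≤n

  -- κ⁴ M is what `ringInRegular` needs to produce M N many 4-cycles; the other summand keeps the
  -- density positive and above n₀.
  density : ℕ
  density = κ * κ * (κ * κ) * M + suc n₀

  module _ {V : Set} (_≟_ : DecidableEquality V) (_~_ : V → V → Set)
    (~-sym : ∀ {x y} → x ~ y → y ~ x) (~-irrefl : ∀ {x} → ¬ (x ~ x)) (_~?_ : ∀ x y → Dec (x ~ y)) where

    open Regularise _≟_ _~_ ~-sym ~-irrefl _~?_
    open Rings _~_ ~-sym
    open DecMem _≟_ using (_∈?_)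

    private
      module Induced {us : List V} (u : Unique us) where
        open Rings (FinGraph._~_ (induced u)) (λ {x} {y} → FinGraph.~-sym (induced u) {x} {y}) renaming (Ring to Ring′; Walk to Walk′; step to step′; cons to cons′; mkRing to mkRing′) using () public

        forget : ∀ {e is f} → Walk′ e is f → Walk e is f
        forget (step′ ((c , _) , (c′ , _)))                = step (c , c′)
        forget (cons′ (r , _) ((c , _) , (c′ , _)) w) = cons r (c , c′) (forget w)

        forgetRing : ∀ {k} → Ring′ k → Ring k
        forgetRing (mkRing′ e is w (r , _) d s) = mkRing e is (forget w) r d s

      -- `fourth` turns Δn ≤ κ total into Δ⁴ ≤ κ⁴ Q. Since Δ² is at least dn, which is at least κ⁴ M
      -- n, this yields Q ≥ M n Δ².
      ringInRegular : ∀ κ d {us m} (u : Unique us) → .{{NonZero m}} → 0 < d → κ * κ * (κ * κ) * M ≤ d → 0 < κ → Regular κ d us m → ¬ ¬ Ring (2 * (4 + q))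
      ringInRegular κ d {us} {m} u d>0 hd κ>0 (n>0 , degs , edges , dn) noRing =
        Assemble.hasRing q L K₁ t w s₀ s ρ₀ b₁ b₂ M hL hK₁ ht hw hs₀ s₀>0 hρ hs hb₁ hb₂ hs′ hM₁ hM₂ hM₃ t>0
          (induced u) m deg≤ n>0 n≤ Q≥ (noRing ∘ Induced.forgetRing u)
        where
        open Codegrees (induced u) using (deg; a)
        open RichCount (induced u) L using (n; Q)
        Δ : ℕ
        Δ = m * m
        deg≤ : ∀ y → deg y ≤ Δ
        deg≤ y = go (y ∈? us)
          where
          go : Dec (y ∈ us) → deg y ≤ Δ
          go (yes y∈) = ≤-trans (∑-mono us (λ x → ⟦⟧-mono (FinGraph._~?_ (induced u) x y) (x ~? y) proj₁)) (degs y y∈)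
          go (no y∉)  = ≤-trans (≤-reflexive (trans (∑-cong us (λ x → ⟦⟧-no (FinGraph._~?_ (induced u) x y) (λ (_ , _ , y∈) → y∉ y∈))) (∑-0 us))) z≤n
        n≤ : n ≤ Δ * Δ
        n≤ = ≤-trans (m≤n*m n d {{>-nonZero d>0}}) dn
        total : ℕ
        total = ∑[ x ∈ us ] ∑[ y ∈ us ] a x y
        E≤total : E us ≤ total
        E≤total = ∑-mono∈ us (λ {x} x∈ → ∑-mono∈ us (λ {y} y∈ → ⟦⟧-mono (x ~? y) (FinGraph._~?_ (induced u) x y) (λ e → e , x∈ , y∈)))
        κ⁴ : ℕ
        κ⁴ = κ * κ * (κ * κ)
        instance
          n⁴≢0 : NonZero ((n * n) * (n * n))
          n⁴≢0 = >-nonZero (*-mono-< (*-mono-< n>0 n>0) (*-mono-< n>0 n>0))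
          κ⁴≢0 : NonZero κ⁴
          κ⁴≢0 = >-nonZero (*-mono-< (*-mono-< κ>0 κ>0) (*-mono-< κ>0 κ>0))
        Δ⁴≤ : (Δ * Δ) * (Δ * Δ) ≤ κ⁴ * Q
        Δ⁴≤ = *-cancelˡ-≤ ((n * n) * (n * n)) (begin
          (n * n) * (n * n) * ((Δ * Δ) * (Δ * Δ)) ≡⟨ l₁ n Δ ⟩
          (Δ * n) * (Δ * n) * ((Δ * n) * (Δ * n)) ≤⟨ *-mono-≤ (*-mono-≤ Δn≤ Δn≤) (*-mono-≤ Δn≤ Δn≤) ⟩
          (κ * total) * (κ * total) * ((κ * total) * (κ * total)) ≡⟨ l₂ κ total ⟩
          κ⁴ * ((total * total) * (total * total)) ≤⟨ *-monoʳ-≤ κ⁴ (FourthMoment.fourth (induced u) L) ⟩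
          κ⁴ * ((n * n) * (n * n) * Q) ≡⟨ l₃ κ⁴ ((n * n) * (n * n)) Q ⟩
          (n * n) * (n * n) * (κ⁴ * Q) ∎)
          where
          open ≤-Reasoning
          Δn≤ : Δ * n ≤ κ * total
          Δn≤ = ≤-trans edges (*-monoʳ-≤ κ E≤total)
          l₁ : ∀ n d → (n * n) * (n * n) * ((d * d) * (d * d)) ≡ (d * n) * (d * n) * ((d * n) * (d * n))
          l₁ = solve-∀
          l₂ : ∀ k e → (k * e) * (k * e) * ((k * e) * (k * e)) ≡ k * k * (k * k) * ((e * e) * (e * e))
          l₂ = solve-∀
          l₃ : ∀ k n q → k * (n * q) ≡ n * (k * q)
          l₃ = solve-∀
        Q≥ : M * (n * (Δ * Δ)) ≤ Q
        Q≥ = *-cancelˡ-≤ κ⁴ (begin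
          κ⁴ * (M * (n * (Δ * Δ))) ≡⟨ lem κ⁴ M n (Δ * Δ) ⟩
          κ⁴ * M * n * (Δ * Δ) ≤⟨ *-monoˡ-≤ (Δ * Δ) (≤-trans (*-monoˡ-≤ n hd) dn) ⟩
          (Δ * Δ) * (Δ * Δ) ≤⟨ Δ⁴≤ ⟩
          κ⁴ * Q ∎)
          where
          open ≤-Reasoning
          lem : ∀ k m n d → k * (m * (n * d)) ≡ k * m * n * d
          lem = solve-∀

    abstract
      regularSubset : ∀ d → n₀ ≤ d → ∀ {us} → Unique us → 0 < length us × d * (length us * (length us * length us)) ≤ E us * E us →
        ∃[ ws ] ∃[ m ] (Unique ws × NonZero m × Regular κ d ws m)
      -- P = 2⁶ and A = 8P = 512, matching κ; s = 41 is the least integer with s³ ≥ (4P)² = 65536; x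
      -- = 8P - 9s = 143; and n₀ = 147 is the least with 8sP ≤ x n₀.
      regularSubset d le {us} u dense = Peak.regularise 6 64 512 41 143 147 refl refl refl (≤ᵇ⇒≤ (8 * (41 * 64)) (143 * 147) _) (≤ᵇ⇒≤ (256 * 256) (41 * (41 * 41)) _)
        (s≤s z≤n) (s≤s (s≤s z≤n)) (s≤s z≤n) d le (length us) u dense ≤-refl

    few-edges : ¬ Ring (2 * (4 + q)) → ∀ {us} → Unique us → 0 < length us → E us * E us < density * (length us * (length us * length us))
    few-edges noRing {us} u pos = ≰⇒> λ dense → contra (regularSubset density (≤-trans (n≤1+n n₀) (m≤n+m (suc n₀) _)) u (pos , dense))
      where
      contra : ∃[ ws ] ∃[ m ] (Unique ws × NonZero m × Regular κ density ws m) → ⊥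
      contra (ws , m , uw , nz , reg) =
        ringInRegular κ density uw {{nz}} (≤-trans (s≤s z≤n) (m≤n+m (suc n₀) (κ * κ * (κ * κ) * M))) (m≤m+n (κ * κ * (κ * κ) * M) (suc n₀)) κ>0 reg noRing

  edges≤ : ∀ {n} (G : Graph n) → 0 < n → prism (4 + q) -Free G → edges G * edges G ≤ density * (n * (n * n))
  edges≤ {n} G n>0 free = ≤-trans (*-mono-≤ edges≤E edges≤E) (<⇒≤ E²<)
    where
    open Graph G
    open Regularise {Fin n} Fin._≟_ _~_ ~-sym (λ {x} → ~-irrefl refl) _~?_ using (E)
    vs : List (Fin n)
    vs = allFin n
    ∣vs∣ : length vs ≡ n
    ∣vs∣ = length-tabulate (λ i → i)
    E²< : E vs * E vs < density * (n * (n * n))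
    E²< = subst (λ k → E vs * E vs < density * (k * (k * k))) ∣vs∣
      (few-edges Fin._≟_ _~_ ~-sym (λ {x} → ~-irrefl refl) _~?_ (free ∘ ring⇒prism G {4 + q}) {vs} (allFin⁺ n) (subst (0 <_) (sym ∣vs∣) n>0))
    filter≤ : {P R : Fin n × Fin n → Set} (P? : ∀ p → Dec (P p)) (R? : ∀ p → Dec (R p)) → (∀ p → P p → R p) →
      ∀ ps → length (filter P? ps) ≤ (∑[ p ∈ ps ] ⟦ R? p ⟧)
    filter≤ P? R? h ps = ≤-trans (≤-reflexive (length-filter P? ps)) (∑-mono ps (λ p → ⟦⟧-mono (P? p) (R? p) (h p)))
    edges≤E : edges G ≤ E vs
    edges≤E = ≤-trans (filter≤ _ (λ (i , j) → i ~? j) (λ _ → proj₂) (cartesianProduct vs vs)) (≤-reflexive (∑-⊗ vs vs (λ (i , j) → ⟦ i ~? j ⟧)))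

-- Primes within a bounded ratio

-- bin a b is the binomial coefficient a + b over a.
bin : ℕ → ℕ → ℕ
bin zero    b       = 1
bin (suc a) zero    = 1
bin (suc a) (suc b) = bin a (suc b) + bin (suc a) b

bin-! : ∀ a b → a ! * b ! * bin a b ≡ (a + b) !
bin-! zero    b       = trans (*-identityʳ (b ! + 0)) (+-identityʳ (b !))
bin-! (suc a) zero    = trans (*-identityʳ ((suc a) ! * 1)) (trans (*-identityʳ ((suc a) !)) (cong _! (sym (+-identityʳ (suc a)))))
bin-! (suc a) (suc b) = begin
  (suc a) ! * (suc b) ! * (bin a (suc b) + bin (suc a) b)
    ≡⟨ l₁ (suc a) (a !) (suc b) (b !) (bin a (suc b)) (bin (suc a) b) ⟩
  suc a * (a ! * (suc b) ! * bin a (suc b)) + suc b * ((suc a) ! * b ! * bin (suc a) b)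
    ≡⟨ cong₂ (λ x y → suc a * x + suc b * y) (bin-! a (suc b)) (bin-! (suc a) b) ⟩
  suc a * (a + suc b) ! + suc b * (suc a + b) !
    ≡⟨ cong (λ z → suc a * z ! + suc b * (suc a + b) !) (+-suc a b) ⟩
  suc a * (suc a + b) ! + suc b * (suc a + b) !
    ≡⟨ sym (*-distribʳ-+ ((suc a + b) !) (suc a) (suc b)) ⟩
  (suc a + suc b) * (suc a + b) ! ≡⟨ cong (λ z → (suc a + suc b) * z !) (sym (+-suc a b)) ⟩
  (suc a + suc b) ! ∎
  where
  open ≡-Reasoning
  l₁ : ∀ x p y q u v → x * p * (y * q) * (u + v) ≡ x * (p * (y * q) * u) + y * (x * p * q * v)
  l₁ = solve-∀

bin>0 : ∀ a b → 0 < bin a b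
bin>0 zero    b       = s≤s z≤n
bin>0 (suc a) zero    = s≤s z≤n
bin>0 (suc a) (suc b) = ≤-trans (bin>0 a (suc b)) (m≤m+n _ _)

bin≤2^ : ∀ a b → bin a b ≤ 2 ^ (a + b)
bin≤2^ zero    b       = m^n>0 2 b
bin≤2^ (suc a) zero    = m^n>0 2 (suc a + 0)
bin≤2^ (suc a) (suc b) = ≤-trans
  (+-mono-≤ (bin≤2^ a (suc b)) (≤-trans (bin≤2^ (suc a) b) (≤-reflexive (cong (2 ^_) (sym (+-suc a b))))))
  (≤-reflexive (double (2 ^ (a + suc b))))

private
  fact≢0 : ∀ a b → NonZero (a ! * b !)
  fact≢0 a b = a !* b !≢0

bin-right : ∀ a b → suc b * bin a (suc b) ≡ suc (a + b) * bin a b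
bin-right a b = *-cancelˡ-≡ _ _ (a ! * b !) {{fact≢0 a b}} (begin
  a ! * b ! * (suc b * bin a (suc b)) ≡⟨ l₁ (a !) (b !) (suc b) (bin a (suc b)) ⟩
  a ! * (suc b) ! * bin a (suc b)     ≡⟨ bin-! a (suc b) ⟩
  (a + suc b) !                       ≡⟨ cong _! (+-suc a b) ⟩
  suc (a + b) * (a + b) !             ≡⟨ cong (suc (a + b) *_) (sym (bin-! a b)) ⟩
  suc (a + b) * (a ! * b ! * bin a b) ≡⟨ l₂ (suc (a + b)) (a ! * b !) (bin a b) ⟩
  a ! * b ! * (suc (a + b) * bin a b) ∎)
  where
  open ≡-Reasoning
  l₁ : ∀ p q s x → p * q * (s * x) ≡ p * (s * q) * x
  l₁ = solve-∀
  l₂ : ∀ s p x → s * (p * x) ≡ p * (s * x)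
  l₂ = solve-∀

bin-left : ∀ a b → suc a * bin (suc a) b ≡ suc (a + b) * bin a b
bin-left a b = *-cancelˡ-≡ _ _ (a ! * b !) {{fact≢0 a b}} (begin
  a ! * b ! * (suc a * bin (suc a) b) ≡⟨ l₁ (a !) (b !) (suc a) (bin (suc a) b) ⟩
  (suc a) ! * b ! * bin (suc a) b     ≡⟨ bin-! (suc a) b ⟩
  suc (a + b) * (a + b) !             ≡⟨ cong (suc (a + b) *_) (sym (bin-! a b)) ⟩
  suc (a + b) * (a ! * b ! * bin a b) ≡⟨ l₂ (suc (a + b)) (a ! * b !) (bin a b) ⟩
  a ! * b ! * (suc (a + b) * bin a b) ∎)
  where
  open ≡-Reasoning
  l₁ : ∀ p q s x → p * q * (s * x) ≡ s * p * q * x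
  l₁ = solve-∀
  l₂ : ∀ s p x → s * (p * x) ≡ p * (s * x)
  l₂ = solve-∀

-- The reciprocals of (a + b + 1) bin a b form Leibniz' harmonic triangle, whose entries
-- are differences of entries in the previous diagonal.
leibniz : ∀ X N → (∀ i → 0 < i → i ≤ N → i ∣ X) → ∀ a b → suc (a + b) ≤ N → suc (a + b) * bin a b ∣ X
leibniz X N h zero    b le = subst (_∣ X) (sym (*-identityʳ (suc b))) (h (suc b) (s≤s z≤n) le)
leibniz X N h (suc a) b le = go (leibniz X N h a b (≤-trans (n≤1+n _) le)) (leibniz X N h a (suc b) (≤-trans (≤-reflexive (cong suc (+-suc a b))) le))
  where
  C C₁ C₂ x y z s : ℕ
  s  = suc (a + b)
  C  = bin a b
  C₁ = bin a (suc b)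
  C₂ = bin (suc a) b
  x  = s * C
  y  = suc (a + suc b) * C₁
  z  = suc (suc a + b) * C₂
  harmonic : x * y + z * x ≡ z * y
  harmonic = begin
    x * y + z * x                                      ≡⟨ cong (λ k → x * (suc k * C₁) + z * x) (+-suc a b) ⟩
    x * (suc s * C₁) + suc s * C₂ * x                  ≡⟨ l₁ x (suc s) C₁ C₂ ⟩
    suc s * (x * C₁ + x * C₂)                          ≡⟨ cong₂ (λ p q → suc s * (p * C₁ + q * C₂)) (sym (bin-left a b)) (sym (bin-right a b)) ⟩
    suc s * (suc a * C₂ * C₁ + suc b * C₁ * C₂)        ≡⟨ l₂ s (suc a) (suc b) C₁ C₂ ⟩
    suc s * (suc a + suc b) * (C₁ * C₂)                ≡⟨ cong (λ k → suc s * suc k * (C₁ * C₂)) (+-suc a b) ⟩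
    suc s * suc s * (C₁ * C₂)                          ≡⟨ l₃ (suc s) C₁ C₂ ⟩
    suc s * C₂ * (suc s * C₁)                          ≡⟨ cong (λ k → z * (suc k * C₁)) (sym (+-suc a b)) ⟩
    z * y                                              ∎
    where
    open ≡-Reasoning
    l₁ : ∀ x s c d → x * (s * c) + s * d * x ≡ s * (x * c + x * d)
    l₁ = solve-∀
    l₂ : ∀ s p q c d → suc s * (p * d * c + q * c * d) ≡ suc s * (p + q) * (c * d)
    l₂ = solve-∀
    l₃ : ∀ s c d → s * s * (c * d) ≡ s * d * (s * c)
    l₃ = solve-∀
  xy>0 : 0 < x * y
  xy>0 = *-mono-< (*-mono-< {0} {s} (s≤s z≤n) (bin>0 a b)) (*-mono-< {0} {suc (a + suc b)} (s≤s z≤n) (bin>0 a (suc b)))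
  go : x ∣ X → y ∣ X → z ∣ X
  go (divides u eu) (divides v ev) = ∣m+n∣m⇒∣n (subst (z ∣_) split (m∣m*n u)) (m∣m*n v)
    where
    split : z * u ≡ z * v + X
    split = *-cancelʳ-≡ _ _ (x * y) {{>-nonZero xy>0}} (begin
      z * u * (x * y)               ≡⟨ l₁ z u x y ⟩
      z * y * (u * x)               ≡⟨ cong (z * y *_) (sym eu) ⟩
      z * y * X                     ≡⟨ cong (_* X) (sym harmonic) ⟩
      (x * y + z * x) * X           ≡⟨ l₂ x y z X ⟩
      z * x * X + X * (x * y)       ≡⟨ cong (λ k → z * x * k + X * (x * y)) ev ⟩
      z * x * (v * y) + X * (x * y) ≡⟨ l₃ z x v y X ⟩
      (z * v + X) * (x * y)         ∎)
      where
      open ≡-Reasoning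
      l₁ : ∀ z u x y → z * u * (x * y) ≡ z * y * (u * x)
      l₁ = solve-∀
      l₂ : ∀ x y z X → (x * y + z * x) * X ≡ z * x * X + X * (x * y)
      l₂ = solve-∀
      l₃ : ∀ z x v y X → z * x * (v * y) + X * (x * y) ≡ (z * v + X) * (x * y)
      l₃ = solve-∀

-- From m to m + 1 the right side grows by the factor 2(2m + 3) / (m + 1), which exceeds 4.
central : ∀ m → 4 ^ m ≤ suc (m + m) * bin m m
central zero    = ≤-refl
central (suc m) = *-cancelˡ-≤ (suc m) (begin
  suc m * 4 ^ suc m                                ≡⟨ l₁ m (4 ^ m) ⟩
  (4 * suc m) * 4 ^ m                              ≤⟨ *-monoʳ-≤ (4 * suc m) (central m) ⟩
  (4 * suc m) * (suc (m + m) * bin m m)            ≤⟨ *-monoˡ-≤ (suc (m + m) * bin m m) (≤-trans (m≤m+n (4 * suc m) 2) (≤-reflexive (l₂ m))) ⟩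
  (2 * suc (suc m + suc m)) * (suc (m + m) * bin m m) ≡⟨ cong ((2 * suc (suc m + suc m)) *_) (sym (bin-right m m)) ⟩
  (2 * suc (suc m + suc m)) * (suc m * bin m (suc m)) ≡⟨ l₃ (suc (suc m + suc m)) (suc m) (bin m (suc m)) ⟩
  suc m * (suc (suc m + suc m) * (bin m (suc m) + bin m (suc m))) ≡⟨ cong (λ k → suc m * (suc (suc m + suc m) * (bin m (suc m) + k))) (sym-bin m) ⟩
  suc m * (suc (suc m + suc m) * bin (suc m) (suc m)) ∎)
  where
  open ≤-Reasoning
  l₁ : ∀ m x → suc m * (4 * x) ≡ 4 * suc m * x
  l₁ = solve-∀
  l₂ : ∀ m → 4 * suc m + 2 ≡ 2 * suc (suc m + suc m)
  l₂ = solve-∀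
  l₃ : ∀ a b c → 2 * a * (b * c) ≡ b * (a * (c + c))
  l₃ = solve-∀
  sym-bin : ∀ m → bin m (suc m) ≡ bin (suc m) m
  sym-bin m = *-cancelˡ-≡ _ _ (suc m) (trans (bin-right m m) (sym (bin-left m m)))

-- Nair's bound for the least common multiple of 1, ..., 2m + 1: it is divisible by the central
-- entry of the harmonic triangle.
commonMultiple≥ : ∀ X N m → 0 < X → suc (m + m) ≤ N → (∀ i → 0 < i → i ≤ N → i ∣ X) → 4 ^ m ≤ X
commonMultiple≥ X N m X>0 le h = ≤-trans (central m) (∣⇒≤ {{>-nonZero X>0}} (leibniz X N h m m le))

prime>0 : ∀ {p} → Prime p → 0 < p
prime>0 {zero}  pp = ⊥-elim (¬prime[0] pp)
prime>0 {suc p} pp = s≤s z≤n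

prime>1 : ∀ {p} → Prime p → 1 < p
prime>1 {zero}        pp = ⊥-elim (¬prime[0] pp)
prime>1 {suc zero}    pp = ⊥-elim (¬prime[1] pp)
prime>1 {suc (suc p)} pp = s≤s (s≤s z≤n)

primeDivisor : ∀ n → 1 < n → ∃[ p ] (Prime p × p ∣ n)
primeDivisor n lt = go (factorise n {{>-nonZero (<⇒≤ lt)}})
  where
  go : PrimeFactorisation n → ∃[ p ] (Prime p × p ∣ n)
  go record { factors = [] ; isFactorisation = eq } = ⊥-elim (<⇒≢ lt (sym eq))
  go record { factors = p ∷ ps ; isFactorisation = eq ; factorsPrime = pp ∷ _ } = p , pp , subst (p ∣_) (sym eq) (m∣m*n (product ps))

*-∣-prime^ : ∀ {p} → Prime p → ∀ e {r X} → ¬ p ∣ r → r ∣ X → p ^ e ∣ X → p ^ e * r ∣ X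
*-∣-prime^ {p} pp e {r} p∤ (divides Y refl) pe = *-monoˡ-∣ r (go e Y pe)
  where
  instance
    p≢0 : NonZero p
    p≢0 = >-nonZero (prime>0 pp)
  go : ∀ e Y → p ^ e ∣ Y * r → p ^ e ∣ Y
  go zero    Y _ = 1∣ Y
  go (suc e) Y d = fix (euclidsLemma Y r pp (∣-trans (m∣m*n (p ^ e)) d))
    where
    fix : p ∣ Y ⊎ p ∣ r → p * p ^ e ∣ Y
    fix (inj₂ pr) = ⊥-elim (p∤ pr)
    fix (inj₁ (divides Z refl)) = subst (p * p ^ e ∣_) (*-comm p Z) (*-monoʳ-∣ p (go e Z (*-cancelˡ-∣ p (subst (p * p ^ e ∣_) (lem Z p r) d))))
      where
      lem : ∀ z p r → z * p * r ≡ p * (z * r)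
      lem = solve-∀

removePower : ∀ {p} → Prime p → ∀ n → 0 < n → ∃[ e ] ∃[ r ] (n ≡ p ^ e * r × ¬ p ∣ r)
removePower {p} pp = <-rec _ go
  where
  go : ∀ n → (∀ {m} → m < n → 0 < m → ∃[ e ] ∃[ r ] (m ≡ p ^ e * r × ¬ p ∣ r)) → 0 < n → ∃[ e ] ∃[ r ] (n ≡ p ^ e * r × ¬ p ∣ r)
  go n rec pos with p ∣? n
  ... | no p∤ = 0 , n , sym (+-identityʳ n) , p∤
  ... | yes (divides zero eq) = ⊥-elim (<⇒≢ pos (sym eq))
  ... | yes (divides (suc k) refl) = next (rec smaller (s≤s z≤n))
    where
    smaller : suc k < suc k * p
    smaller = m<m*n (suc k) p (prime>1 pp)
    next : ∃[ e ] ∃[ r ] (suc k ≡ p ^ e * r × ¬ p ∣ r) → ∃[ e ] ∃[ r ] (suc k * p ≡ p ^ e * r × ¬ p ∣ r)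
    next (e , r , eq , p∤) = suc e , r , trans (cong (_* p) eq) (lem (p ^ e) r p) , p∤
      where
      lem : ∀ a r p → a * r * p ≡ p * a * r
      lem = solve-∀

-- Induction on n: the full power of one prime is split off, the cofactor divides X by induction,
-- and coprimality lets the two be multiplied.
∣-from-primePowers : ∀ X n → 0 < n → (∀ {p} → Prime p → ∀ e → p ^ e ∣ n → p ^ e ∣ X) → n ∣ X
∣-from-primePowers X = <-rec _ go
  where
  go : ∀ n → (∀ {m} → m < n → 0 < m → (∀ {p} → Prime p → ∀ e → p ^ e ∣ m → p ^ e ∣ X) → m ∣ X) →
       0 < n → (∀ {p} → Prime p → ∀ e → p ^ e ∣ n → p ^ e ∣ X) → n ∣ X
  go n rec pos h with 1 <? n
  ... | no ≤1 = subst (_∣ X) (≤-antisym pos (≮⇒≥ ≤1)) (1∣ X)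
  ... | yes lt = viaPrime (primeDivisor n lt)
    where
    viaPrime : ∃[ p ] (Prime p × p ∣ n) → n ∣ X
    viaPrime (p , pp , p∣n) = viaPower (removePower pp n pos)
      where
      viaPower : ∃[ e ] ∃[ r ] (n ≡ p ^ e * r × ¬ p ∣ r) → n ∣ X
      viaPower (zero , r , eq , p∤) = ⊥-elim (p∤ (subst (p ∣_) (trans eq (+-identityʳ r)) p∣n))
      viaPower (suc e , r , eq , p∤) = subst (_∣ X) (sym eq) (*-∣-prime^ pp (suc e) p∤
          (rec smaller r>0 (λ pq f d → h pq f (subst (_ ∣_) (sym eq) (∣n⇒∣m*n (p ^ suc e) d))))
          (h pp (suc e) (subst (p ^ suc e ∣_) (sym eq) (m∣m*n r))))
        where
        r>0 : 0 < r
        r>0 = n≢0⇒n>0 λ { refl → <⇒≢ pos (sym (trans eq (*-zeroʳ (p ^ suc e)))) }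
        smaller : r < n
        smaller = subst (r <_) (sym eq) (<-≤-trans (≤-trans (≤-reflexive (cong suc (sym (*-identityˡ r)))) (*-monoˡ-< r {{>-nonZero r>0}} (prime>1 pp)))
                    (*-monoˡ-≤ r (m≤m*n p (p ^ e) {{>-nonZero (m^n>0 p {{>-nonZero (prime>0 pp)}} e)}})))

topPower : ∀ p N → 1 < p → 0 < N → ∃[ e ] (p ^ e ≤ N × N < p ^ suc e)
topPower p N p>1 N>0 = search N (n<p^n N)
  where
  n<p^n : ∀ n → n < p ^ n
  n<p^n zero    = s≤s z≤n
  n<p^n (suc n) = ≤-trans (s≤s (n<p^n n)) (<-≤-trans (≤-reflexive (cong suc (sym (*-identityˡ (p ^ n))))) (*-monoˡ-< (p ^ n) {{>-nonZero (≤-<-trans z≤n (n<p^n n))}} p>1))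
  search : ∀ k → N < p ^ k → ∃[ e ] (p ^ e ≤ N × N < p ^ suc e)
  search zero    lt = ⊥-elim (<⇒≱ lt N>0)
  search (suc k) lt with p ^ k ≤? N
  ... | yes le = k , le , lt
  ... | no ¬le = search k (≰⇒> ¬le)

π : ℕ → ℕ
π zero    = 0
π (suc k) with prime? (suc k)
... | yes _ = suc (π k)
... | no _  = π k

π≤ : ∀ k → π k ≤ k
π≤ zero    = z≤n
π≤ (suc k) with prime? (suc k)
... | yes _ = s≤s (π≤ k)
... | no _  = ≤-trans (π≤ k) (n≤1+n k)

-- X is the product, over the primes p ≤ k, of the largest power of p not exceeding N.
powerProduct : ∀ N → 0 < N → ∀ k → ∃[ X ] (0 < X × X ≤ N ^ π k × (∀ {p} → Prime p → p ≤ k → ∀ e → p ^ e ≤ N → p ^ e ∣ X))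
powerProduct N N>0 zero = 1 , s≤s z≤n , ≤-refl , λ pp le → ⊥-elim (<⇒≱ (prime>0 pp) le)
powerProduct N N>0 (suc k) with prime? (suc k) | powerProduct N N>0 k
... | no ¬pr | X , X>0 , X≤ , d = X , X>0 , X≤ , λ {p} pp le → d pp (≤-pred (≤∧≢⇒< le λ { refl → ¬pr pp }))
... | yes pr | X , X>0 , X≤ , d = extend (topPower (suc k) N (prime>1 pr) N>0)
  where
  extend : ∃[ e ] (suc k ^ e ≤ N × N < suc k ^ suc e) → _
  extend (e , le , lt) = suc k ^ e * X , *-mono-< (m^n>0 (suc k) e) X>0 , *-mono-≤ le X≤ , (λ {_} → power)
    where
    power : ∀ {p} → Prime p → p ≤ suc k → ∀ f → p ^ f ≤ N → p ^ f ∣ suc k ^ e * X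
    power {p} pp p≤ f pf with p ℕ.≟ suc k
    ... | no p≢ = ∣n⇒∣m*n (suc k ^ e) (d pp (≤-pred (≤∧≢⇒< p≤ p≢)) f pf)
    ... | yes refl = ∣m⇒∣m*n X (subst (p ^ f ∣_) (trans (sym (^-distribˡ-+-* p f (e ∸ f))) (cong (p ^_) (m+[n∸m]≡n f≤e))) (m∣m*n (p ^ (e ∸ f))))
      where
      f≤e : f ≤ e
      f≤e = ≮⇒≥ λ e<f → <⇒≱ (<-≤-trans lt (^-monoʳ-≤ p e<f)) pf

-- Without primes between k and N, every prime power dividing some i ≤ N is a factor of the product
-- above.
commonMultiple≤ : ∀ k N → 0 < N → (∀ p → k < p → p ≤ N → ¬ Prime p) → ∃[ X ] (0 < X × X ≤ N ^ π k × (∀ i → 0 < i → i ≤ N → i ∣ X))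
commonMultiple≤ k N N>0 none with powerProduct N N>0 k
... | X , X>0 , X≤ , d = X , X>0 , X≤ , λ i i>0 i≤N → ∣-from-primePowers X i i>0 λ {p} pp → λ
  { zero    _  → 1∣ X
  ; (suc e) pe → d pp (≮⇒≥ λ k<p → none p k<p (≤-trans (∣⇒≤ {{>-nonZero i>0}} (∣-trans (m∣m*n (p ^ e)) pe)) i≤N) pp) (suc e) (≤-trans (∣⇒≤ {{>-nonZero i>0}} pe) i≤N) }

prime∤! : ∀ {p} → Prime p → ∀ k → k < p → ¬ p ∣ k !
prime∤! pp zero    lt d = <⇒≱ (prime>1 pp) (∣⇒≤ d)
prime∤! pp (suc k) lt d with euclidsLemma (suc k) (k !) pp d
... | inj₁ d₁ = <⇒≱ lt (∣⇒≤ d₁)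
... | inj₂ d₂ = prime∤! pp k (<-trans (n<1+n k) lt) d₂

∣! : ∀ p k → 0 < p → p ≤ k → p ∣ k !
∣! p zero    p>0 le = ⊥-elim (<⇒≱ p>0 le)
∣! p (suc k) p>0 le with p ℕ.≟ suc k
... | yes refl = m∣m*n (k !)
... | no p≢ = ∣n⇒∣m*n (suc k) (∣! p k p>0 (≤-pred (≤∧≢⇒< le p≢)))

prime∣central : ∀ {p} m → Prime p → m < p → p ≤ m + m → p ∣ bin m m
prime∣central {p} m pp lt le with euclidsLemma (m ! * m !) (bin m m) pp (subst (p ∣_) (sym (bin-! m m)) (∣! p (m + m) (prime>0 pp) le))
... | inj₂ d = d
... | inj₁ d with euclidsLemma (m !) (m !) pp d
...   | inj₁ d₁ = ⊥-elim (prime∤! pp m lt d₁)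
...   | inj₂ d₂ = ⊥-elim (prime∤! pp m lt d₂)

-- Y is the product of the c primes in (m, m + j]. Each is larger than m and divides the central
-- binomial coefficient; the last clause makes the next prime coprime to Y.
π-step : ∀ m j → j ≤ m → ∃[ c ] ∃[ Y ] (π (m + j) ≡ c + π m × m ^ c ≤ Y × Y ∣ bin m m × (∀ {p} → Prime p → m + j < p → ¬ p ∣ Y))
π-step m zero    _ = 0 , 1 , cong π (+-identityʳ m) , ≤-refl , 1∣ bin m m , λ pp _ d → <⇒≱ (prime>1 pp) (∣⇒≤ d)
π-step m (suc j) le with π-step m j (≤-trans (n≤1+n j) le)
... | c , Y , eq , m^c≤ , Y∣ , p∤ rewrite +-suc m j with prime? (suc (m + j))
...   | no _ = c , Y , eq , m^c≤ , Y∣ , λ pp lt → p∤ pp (<-trans (n<1+n (m + j)) lt)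
...   | yes pr = suc c , suc (m + j) * Y , cong suc eq , *-mono-≤ (≤-trans (m≤m+n m j) (n≤1+n (m + j))) m^c≤ ,
        subst (λ z → z * Y ∣ bin m m) (*-identityʳ (suc (m + j))) (*-∣-prime^ pr 1 (p∤ pr (n<1+n (m + j))) Y∣
          (subst (_∣ bin m m) (sym (*-identityʳ (suc (m + j)))) (prime∣central m pr (s≤s (m≤m+n m j)) (subst (_≤ m + m) (+-suc m j) (+-monoʳ-≤ m le))))) ,
        λ {p} pp lt d → new pp lt (euclidsLemma (suc (m + j)) Y pp d)
  where
  new : ∀ {p} → Prime p → suc (m + j) < p → p ∣ suc (m + j) ⊎ p ∣ Y → ⊥
  new pp lt (inj₁ d) = <⇒≱ lt (∣⇒≤ d)
  new pp lt (inj₂ d) = p∤ pp (<-trans (n<1+n (m + j)) lt) d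

-- The c primes between 2^t and 2^(t+1) have a product of at least 2^(tc), which divides a binomial
-- coefficient of size at most 2^(2 * 2^t).
π-double : ∀ t → ∃[ c ] (π (2 ^ suc t) ≡ c + π (2 ^ t) × t * c ≤ 2 * 2 ^ t)
π-double t with π-step (2 ^ t) (2 ^ t) ≤-refl
... | c , Y , eq , pow≤ , Y∣ , _ = c , trans (cong (λ z → π (2 ^ t + z)) (+-identityʳ (2 ^ t))) eq ,
  ≮⇒≥ λ big → <⇒≱ (^-monoʳ-< 2 (s≤s (s≤s z≤n)) big) (begin
    2 ^ (t * c)          ≡⟨ sym (^-*-assoc 2 t c) ⟩
    (2 ^ t) ^ c          ≤⟨ pow≤ ⟩
    Y                    ≤⟨ ∣⇒≤ {{>-nonZero (bin>0 (2 ^ t) (2 ^ t))}} Y∣ ⟩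
    bin (2 ^ t) (2 ^ t)  ≤⟨ bin≤2^ (2 ^ t) (2 ^ t) ⟩
    2 ^ (2 ^ t + 2 ^ t)  ≡⟨ cong (λ z → 2 ^ (2 ^ t + z)) (sym (+-identityʳ (2 ^ t))) ⟩
    2 ^ (2 * 2 ^ t)      ∎)
  where open ≤-Reasoning

-- The induction step needs 6(t + 1) ≤ 8t, that is t ≥ 3; the first four cases follow from π k ≤ k.
chebyshev : ∀ t → t * π (2 ^ t) ≤ 4 * 2 ^ t
chebyshev 0 = z≤n
chebyshev 1 = *-mono-≤ {1} {4} (s≤s z≤n) (π≤ 2)
chebyshev 2 = *-mono-≤ {2} {4} (s≤s (s≤s z≤n)) (π≤ 4)
chebyshev 3 = *-mono-≤ {3} {4} (s≤s (s≤s (s≤s z≤n))) (π≤ 8)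
chebyshev (suc (suc (suc (suc u)))) = next u (π-double (suc (suc (suc u)))) (chebyshev (suc (suc (suc u))))
  where
  next : ∀ u → let t = suc (suc (suc u)) in
    ∃[ c ] (π (2 ^ suc t) ≡ c + π (2 ^ t) × t * c ≤ 2 * 2 ^ t) → t * π (2 ^ t) ≤ 4 * 2 ^ t → suc t * π (2 ^ suc t) ≤ 4 * 2 ^ suc t
  next u (c , eq , tc) ih = *-cancelˡ-≤ t (begin
    t * (suc t * π (2 ^ suc t))           ≡⟨ cong (λ z → t * (suc t * z)) eq ⟩
    t * (suc t * (c + π (2 ^ t)))         ≡⟨ l₁ t c (π (2 ^ t)) ⟩
    suc t * (t * c + t * π (2 ^ t))       ≤⟨ *-monoʳ-≤ (suc t) (+-mono-≤ tc (ih)) ⟩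
    suc t * (2 * 2 ^ t + 4 * 2 ^ t)       ≤⟨ m≤m+n _ (2 * u * 2 ^ t) ⟩
    suc t * (2 * 2 ^ t + 4 * 2 ^ t) + 2 * u * 2 ^ t ≡⟨ l₂ u (2 ^ t) ⟩
    t * (4 * (2 * 2 ^ t))                 ∎)
    where
    t : ℕ
    t = suc (suc (suc u))
    open ≤-Reasoning
    l₁ : ∀ t c p → t * (suc t * (c + p)) ≡ suc t * (t * c + t * p)
    l₁ = solve-∀
    l₂ : ∀ u x → suc (suc (suc (suc u))) * (2 * x + 4 * x) + 2 * u * x ≡ suc (suc (suc u)) * (4 * (2 * x))
    l₂ = solve-∀

searchPrime : ∀ k j → (∃[ p ] (Prime p × k < p × p ≤ k + j)) ⊎ (∀ p → k < p → p ≤ k + j → ¬ Prime p)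
searchPrime k zero = inj₂ λ p lt le → ⊥-elim (<⇒≱ lt (≤-trans le (≤-reflexive (+-identityʳ k))))
searchPrime k (suc j) with searchPrime k j
... | inj₁ (p , pp , lt , le) = inj₁ (p , pp , lt , ≤-trans le (+-monoʳ-≤ k (n≤1+n j)))
... | inj₂ none with prime? (k + suc j)
...   | yes pp = inj₁ (k + suc j , pp , m<m+n k (s≤s z≤n) , ≤-refl)
...   | no ¬pp = inj₂ λ p lt le pp → none p lt (≤-pred (subst (p <_) (+-suc k j) (≤∧≢⇒< le λ { refl → ¬pp pp }))) pp

-- With k = 2^t and N = 16k, the absence of primes would give 4^(8k-1) ≤ N^(π k) by the two bounds
-- on common multiples. But the exponent of 2 on the right is (4 + t) π k ≤ 2t π k ≤ 8k, less than
-- 16k - 2.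
prime-between : ∀ t → 4 ≤ t → ∃[ p ] (Prime p × 2 ^ t < p × p ≤ 2 ^ (4 + t))
prime-between t 4≤t = go (searchPrime k (15 * k))
  where
  k N m : ℕ
  k = 2 ^ t
  N = 2 ^ (4 + t)
  m = pred (8 * k)
  k>0 : 0 < k
  k>0 = m^n>0 2 t
  N≡ : ∀ k → k + 15 * k ≡ 2 * (2 * (2 * (2 * k)))
  N≡ = solve-∀
  suc-m : suc m ≡ 8 * k
  suc-m = suc-pred (8 * k) {{>-nonZero (*-mono-< {0} {8} (s≤s z≤n) k>0)}}
  2m : m + m + 2 ≡ 2 * (2 * (2 * (2 * k)))
  2m = trans (l₁ m) (trans (cong (2 *_) suc-m) (l₂ k))
    where
    l₁ : ∀ m → m + m + 2 ≡ 2 * suc m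
    l₁ = solve-∀
    l₂ : ∀ k → 2 * (8 * k) ≡ 2 * (2 * (2 * (2 * k)))
    l₂ = solve-∀
  go : (∃[ p ] (Prime p × k < p × p ≤ k + 15 * k)) ⊎ (∀ p → k < p → p ≤ k + 15 * k → ¬ Prime p) → ∃[ p ] (Prime p × k < p × p ≤ N)
  go (inj₁ (p , pp , lt , le)) = p , pp , lt , ≤-trans le (≤-reflexive (N≡ k))
  go (inj₂ none) = ⊥-elim (absurd (commonMultiple≤ k N (m^n>0 2 (4 + t)) (λ p lt le → none p lt (≤-trans le (≤-reflexive (sym (N≡ k)))))))
    where
    absurd : ∃[ X ] (0 < X × X ≤ N ^ π k × (∀ i → 0 < i → i ≤ N → i ∣ X)) → ⊥
    absurd (X , X>0 , X≤ , d) = <⇒≱ small (begin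
      m + m               ≤⟨ ≮⇒≥ (λ lt → <⇒≱ (^-monoʳ-< 2 (s≤s (s≤s z≤n)) lt) power) ⟩
      (4 + t) * π k       ≤⟨ *-monoˡ-≤ (π k) (+-monoˡ-≤ t 4≤t) ⟩
      (t + t) * π k       ≡⟨ l₁ t (π k) ⟩
      2 * (t * π k)       ≤⟨ *-monoʳ-≤ 2 (chebyshev t) ⟩
      2 * (4 * k)         ∎)
      where
      open ≤-Reasoning
      l₁ : ∀ t p → (t + t) * p ≡ 2 * (t * p)
      l₁ = solve-∀
      power : 2 ^ (m + m) ≤ 2 ^ ((4 + t) * π k)
      power = begin
        2 ^ (m + m) ≡⟨ trans (cong (2 ^_) (double m)) (sym (^-*-assoc 2 2 m)) ⟩
        4 ^ m ≤⟨ commonMultiple≥ X N m X>0 (≤-trans (≤-trans (n≤1+n _) (≤-reflexive (trans (sym (+-comm (m + m) 2)) 2m))) ≤-refl) d ⟩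
        X ≤⟨ X≤ ⟩
        (2 ^ (4 + t)) ^ π k ≡⟨ ^-*-assoc 2 (4 + t) (π k) ⟩
        2 ^ ((4 + t) * π k) ∎
      small : 2 * (4 * k) < m + m
      small = +-cancelʳ-< 2 _ _ (begin-strict
        2 * (4 * k) + 2 <⟨ +-monoʳ-< (2 * (4 * k)) (≤-trans (s≤s (s≤s (s≤s z≤n))) (*-monoʳ-≤ 8 k>0)) ⟩
        2 * (4 * k) + 8 * k ≡⟨ l₃ k ⟩
        2 * (2 * (2 * (2 * k))) ≡⟨ sym 2m ⟩
        m + m + 2 ∎)
        where
        l₃ : ∀ k → 2 * (4 * k) + 8 * k ≡ 2 * (2 * (2 * (2 * k)))
        l₃ = solve-∀

-- Incidence graphs

∣-difference : ∀ {p s c c′} → p ∣ s + c → p ∣ s + c′ → c ≤ c′ → c′ < p → c ≡ c′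
∣-difference {p} {s} {c} {c′} d d′ c≤c′ c′<p with m≤n⇒∃[o]m+o≡n c≤c′
... | zero  , eq = trans (sym (+-identityʳ c)) eq
... | suc o , refl = ⊥-elim (<⇒≱ (≤-<-trans (m≤n+m (suc o) c) c′<p)
        (∣⇒≤ (∣m+n∣m⇒∣n (subst (p ∣_) (sym (+-assoc s c (suc o))) d′) d)))

∣-unique : ∀ {p s c c′} → p ∣ s + c → p ∣ s + c′ → c < p → c′ < p → c ≡ c′
∣-unique {c = c} {c′} d d′ lt lt′ with ≤-total c c′
... | inj₁ le = ∣-difference d d′ le lt′
... | inj₂ le = sym (∣-difference d′ d le lt)

-- Two distinct points (x , y), (x′ , y′) on two lines y + k x + c = 0: here x ≤ x′ and k ≤ k′ avoid subtraction.
twoLines : ∀ {p} → Prime p → ∀ {x x′ y y′ k k′ c c′} →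
  p ∣ y + k * x + c → p ∣ y′ + k * x′ + c → p ∣ y + k′ * x + c′ → p ∣ y′ + k′ * x′ + c′ →
  x ≤ x′ → k ≤ k′ → x′ < p → k′ < p → x ≡ x′ ⊎ k ≡ k′
twoLines {p} pp {x} {x′} {y} {y′} {k} {k′} {c} {c′} d₁ d₂ d₃ d₄ x≤ k≤ x<p k<p with m≤n⇒∃[o]m+o≡n x≤ | m≤n⇒∃[o]m+o≡n k≤
... | zero  , eq | _          = inj₁ (trans (sym (+-identityʳ x)) eq)
... | suc e , _  | zero  , eq = inj₂ (trans (sym (+-identityʳ k)) eq)
... | suc e , refl | suc d , refl = ⊥-elim (contra (euclidsLemma (suc d) (suc e) pp
        (∣m+n∣m⇒∣n (subst (p ∣_) (lem x (suc e) y y′ k (suc d) c c′) (∣m∣n⇒∣m+n d₁ d₄)) (∣m∣n⇒∣m+n d₂ d₃))))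
  where
  lem : ∀ x e y y′ k d c c′ → (y + k * x + c) + (y′ + (k + d) * (x + e) + c′) ≡ ((y′ + k * (x + e) + c) + (y + (k + d) * x + c′)) + d * e
  lem = solve-∀
  contra : p ∣ suc d ⊎ p ∣ suc e → ⊥
  contra (inj₁ h) = <⇒≱ (≤-<-trans (m≤n+m (suc d) k) k<p) (∣⇒≤ h)
  contra (inj₂ h) = <⇒≱ (≤-<-trans (m≤n+m (suc e) x) x<p) (∣⇒≤ h)

module Incidence (p : ℕ) (pp : Prime p) where

  private
    instance
      p≢0 : NonZero p
      p≢0 = prime⇒nonZero pp

  P : ℕ
  P = p * p

  eqn : ℕ → ℕ → ℕ
  eqn i l = (i % p) + (l / p) * (i / p) + (l % p)

  -- The point i = (x , y) with x = i / p, y = i % p lies on the line j = P + l with slope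
  -- k = l / p and intercept c = l % p when p divides y + k x + c.
  Inc : ℕ → ℕ → Set
  Inc i j = i < P × (P ≤ j × j < P + P) × p ∣ eqn i (j ∸ P)

  Inc? : ∀ i j → Dec (Inc i j)
  Inc? i j = (i <? P) ×-dec (((P ≤? j) ×-dec (j <? (P + P))) ×-dec (p ∣? eqn i (j ∸ P)))

  private
    quotient< : ∀ {i} → i < P → i / p < p
    quotient< {i} lt = m<n*o⇒m/o<n lt

    same : ∀ {i i′} → i / p ≡ i′ / p → i % p ≡ i′ % p → i ≡ i′
    same {i} {i′} q r = trans (m≡m%n+[m/n]*n i p) (trans (cong₂ (λ a b → a + b * p) r q) (sym (m≡m%n+[m/n]*n i′ p)))

    line< : ∀ {j} → P ≤ j → j < P + P → j ∸ P < P
    line< {j} le lt = +-cancelˡ-< P _ _ (subst (_< P + P) (sym (m+[n∸m]≡n le)) lt)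

    noC₄′ : ∀ {i i′ j j′} → Inc i j → Inc i′ j → Inc i j′ → Inc i′ j′ → i / p ≤ i′ / p → (j ∸ P) / p ≤ (j′ ∸ P) / p → i ≡ i′ ⊎ j ≡ j′
    noC₄′ {i} {i′} {j} {j′} (i< , (j≥ , j<) , d₁) (i′< , _ , d₂) (_ , (j′≥ , j′<) , d₃) (_ , _ , d₄) le le′
      with twoLines pp {i / p} {i′ / p} {i % p} {i′ % p} {(j ∸ P) / p} {(j′ ∸ P) / p} d₁ d₂ d₃ d₄ le le′ (quotient< i′<) (quotient< (line< j′≥ j′<))
    ... | inj₁ x≡ = inj₁ (same x≡ (∣-unique
            (subst (p ∣_) (l₁ (i % p) ((j ∸ P) / p * (i / p)) ((j ∸ P) % p)) d₁)
            (subst (p ∣_) (trans (l₁ (i′ % p) ((j ∸ P) / p * (i′ / p)) ((j ∸ P) % p)) (cong (λ x → (j ∸ P) / p * x + (j ∸ P) % p + i′ % p) (sym x≡))) d₂)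
            (m%n<n i p) (m%n<n i′ p)))
      where
      l₁ : ∀ y kx c → y + kx + c ≡ kx + c + y
      l₁ = solve-∀
    ... | inj₂ k≡ = inj₂ (trans (sym (m+[n∸m]≡n j≥)) (trans (cong (P +_) (same k≡ (∣-unique d₁
            (subst (λ k → p ∣ i % p + k * (i / p) + (j′ ∸ P) % p) (sym k≡) d₃) (m%n<n (j ∸ P) p) (m%n<n (j′ ∸ P) p)))) (m+[n∸m]≡n j′≥)))

  noC₄ : ∀ {i i′ j j′} → Inc i j → Inc i′ j → Inc i j′ → Inc i′ j′ → i ≡ i′ ⊎ j ≡ j′
  noC₄ {i} {i′} {j} {j′} a b c d with ≤-total (i / p) (i′ / p) | ≤-total ((j ∸ P) / p) ((j′ ∸ P) / p)
  ... | inj₁ x | inj₁ k = noC₄′ a b c d x k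
  ... | inj₁ x | inj₂ k = Sum.map₂ sym (noC₄′ c d a b x k)
  ... | inj₂ x | inj₁ k = Sum.map₁ sym (noC₄′ b a d c x k)
  ... | inj₂ x | inj₂ k = Sum.map sym sym (noC₄′ d c b a x k)

  -- The residue of -(y + kx) modulo p; the outer remainder sends p to 0.
  intercept : ℕ → ℕ → ℕ
  intercept i k = (p ∸ (i % p + k * (i / p)) % p) % p

  intercept-∣ : ∀ i k → p ∣ i % p + k * (i / p) + intercept i k
  intercept-∣ i k = ∣m+n∣m⇒∣n (subst (p ∣_) reorder whole) (n∣m*n (c / p))
    where
    s c : ℕ
    s = i % p + k * (i / p)
    c = p ∸ s % p
    whole : p ∣ s + c
    whole = divides (suc (s / p)) (begin
      s + c                                ≡⟨ cong (_+ c) (m≡m%n+[m/n]*n s p) ⟩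
      s % p + s / p * p + (p ∸ s % p)      ≡⟨ lem (s % p) (s / p * p) (p ∸ s % p) ⟩
      (s % p + (p ∸ s % p)) + s / p * p    ≡⟨ cong (_+ s / p * p) (m+[n∸m]≡n (<⇒≤ (m%n<n s p))) ⟩
      p + s / p * p                        ∎)
      where
      open ≡-Reasoning
      lem : ∀ a b c → a + b + c ≡ (a + c) + b
      lem = solve-∀
    reorder : s + c ≡ c / p * p + (s + c % p)
    reorder = trans (cong (s +_) (m≡m%n+[m/n]*n c p)) (lem s (c % p) (c / p * p))
      where
      lem : ∀ s a b → s + (a + b) ≡ b + (s + a)
      lem = solve-∀

  line : ℕ → ℕ → ℕ
  line i k = intercept i k + k * p

  private
    intercept< : ∀ i k → intercept i k < p
    intercept< i k = m%n<n _ p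

  line-quotient : ∀ i k → line i k / p ≡ k
  line-quotient i k = trans (+-distrib-/-∣ʳ (intercept i k) (n∣m*n k)) (cong₂ _+_ (m<n⇒m/n≡0 (intercept< i k)) (m*n/n≡m k p))

  line-remainder : ∀ i k → line i k % p ≡ intercept i k
  line-remainder i k = trans ([m+kn]%n≡m%n (intercept i k) k p) (m<n⇒m%n≡m (intercept< i k))

  line<P : ∀ i k → k < p → line i k < P
  line<P i k k<p = <-≤-trans (+-monoˡ-< (k * p) (intercept< i k)) (*-monoˡ-≤ p k<p)

  inc-line : ∀ i k → i < P → k < p → Inc i (P + line i k)
  inc-line i k i<P k<p = i<P , (m≤m+n P (line i k) , +-monoʳ-< P (line<P i k k<p)) ,
    subst (λ l → p ∣ eqn i l) (sym (m+n∸m≡n P (line i k)))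
      (subst₂ (λ a b → p ∣ i % p + a * (i / p) + b) (sym (line-quotient i k)) (sym (line-remainder i k)) (intercept-∣ i k))

  module _ (n : ℕ) (2P≤n : P + P ≤ n) where

    incidenceGraph : Graph n
    incidenceGraph = record
      { _~_      = λ u v → Inc (toℕ u) (toℕ v) ⊎ Inc (toℕ v) (toℕ u)
      ; ~-sym    = Sum.swap
      ; ~-irrefl = λ { refl (inj₁ (lt , (ge , _) , _)) → <⇒≱ lt ge ; refl (inj₂ (lt , (ge , _) , _)) → <⇒≱ lt ge }
      ; _~?_     = λ u v → Inc? (toℕ u) (toℕ v) ⊎-dec Inc? (toℕ v) (toℕ u)
      }

    private
      open Graph incidenceGraph using (_~_; _~?_)

      forward : ∀ {u v} → toℕ u < P → u ~ v → Inc (toℕ u) (toℕ v)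
      forward lt (inj₁ h) = h
      forward lt (inj₂ (_ , (ge , _) , _)) = ⊥-elim (<⇒≱ lt ge)

      point-or : ∀ {u v} → u ~ v → toℕ u < P ⊎ toℕ v < P
      point-or (inj₁ (lt , _)) = inj₁ lt
      point-or (inj₂ (lt , _)) = inj₂ lt

      other< : ∀ {u v} → P ≤ toℕ v → u ~ v → toℕ u < P
      other< ge (inj₁ (lt , _)) = lt
      other< ge (inj₂ (lt , _)) = ⊥-elim (<⇒≱ lt ge)

      square : ∀ {a b a′ b′} → toℕ a < P → a ~ b → a′ ~ b → a ~ b′ → a′ ~ b′ → a ≡ a′ ⊎ b ≡ b′
      square a< ab a′b ab′ a′b′ = Sum.map toℕ-injective toℕ-injective
        (noC₄ (forward a< ab) (forward a′< a′b) (forward a< ab′) (forward a′< a′b′))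
        where a′< = other< (proj₁ (proj₁ (proj₂ (forward a< ab)))) a′b

    C₄-free : ∀ {a b a′ b′} → a ~ b → a′ ~ b → a ~ b′ → a′ ~ b′ → a ≡ a′ ⊎ b ≡ b′
    C₄-free ab a′b ab′ a′b′ with point-or ab
    ... | inj₁ a< = square a< ab a′b ab′ a′b′
    ... | inj₂ b< = Sum.swap (square b< (Sum.swap ab) (Sum.swap ab′) (Sum.swap a′b) (Sum.swap a′b′))

    prismFree : ∀ q → prism (4 + q) -Free incidenceGraph
    -- Vertex 2i + s of the prism is side s of position i, so v₀ v₁ v₃ v₂ is the 4-cycle spanned by
    -- the first two rungs.
    prismFree q (f , inj , hom) = distinct (C₄-free (hom {v₀} {v₁} rung) (hom {v₃} {v₁} (inj₁ (side′ , refl))) (hom {v₀} {v₂} (inj₁ (side , refl))) (hom {v₃} {v₂} rung′))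
      where
      v₀ v₁ v₂ v₃ : Fin (2 * (4 + q) * 2)
      v₀ = zero
      v₁ = suc zero
      v₂ = suc (suc zero)
      v₃ = suc (suc (suc zero))
      open Graph (prism (4 + q)) using () renaming (_~_ to _~ₚ_)
      side : Graph._~_ (cycle (2 * (4 + q))) zero (suc zero)
      side = (λ ()) , inj₁ (inj₁ refl)
      side′ : Graph._~_ (cycle (2 * (4 + q))) (suc zero) zero
      side′ = (λ ()) , inj₂ (inj₁ refl)
      rung : v₀ ~ₚ v₁
      rung = inj₂ (refl , λ ())
      rung′ : v₃ ~ₚ v₂
      rung′ = inj₂ (refl , λ ())
      distinct : f v₀ ≡ f v₃ ⊎ f v₁ ≡ f v₂ → ⊥
      distinct (inj₁ e) with inj e
      ... | ()
      distinct (inj₂ e) with inj e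
      ... | ()

    private
      pt : ∀ {i} → i < P → i < n
      pt lt = <-≤-trans lt (≤-trans (m≤m+n P P) 2P≤n)

      ln : ∀ i k → k < p → P + line i k < n
      ln i k lt = <-≤-trans (+-monoʳ-< P (line<P i k lt)) 2P≤n

      flag : Fin P × Fin p → Fin n × Fin n
      flag (i , k) = fromℕ< (pt (toℕ<n i)) , fromℕ< (ln (toℕ i) (toℕ k) (toℕ<n k))

      flag-inj : ∀ {a b} → flag a ≡ flag b → a ≡ b
      flag-inj {i , k} {i′ , k′} eq = cong₂ _,_ (toℕ-injective i≡) (toℕ-injective k≡)
        where
        i≡ : toℕ i ≡ toℕ i′
        i≡ = trans (sym (toℕ-fromℕ< (pt (toℕ<n i)))) (trans (cong (toℕ ∘ proj₁) eq) (toℕ-fromℕ< (pt (toℕ<n i′))))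
        l≡ : line (toℕ i) (toℕ k) ≡ line (toℕ i′) (toℕ k′)
        l≡ = +-cancelˡ-≡ P _ _ (trans (sym (toℕ-fromℕ< (ln (toℕ i) (toℕ k) (toℕ<n k)))) (trans (cong (toℕ ∘ proj₂) eq) (toℕ-fromℕ< (ln (toℕ i′) (toℕ k′) (toℕ<n k′)))))
        k≡ : toℕ k ≡ toℕ k′
        k≡ = trans (sym (line-quotient (toℕ i) (toℕ k))) (trans (cong (_/ p) l≡) (line-quotient (toℕ i′) (toℕ k′)))

      flag-edge : ∀ a → proj₁ (flag a) Fin.< proj₂ (flag a) × proj₁ (flag a) ~ proj₂ (flag a)
      flag-edge (i , k) = subst₂ _<_ (sym e₁) (sym e₂) (<-≤-trans (toℕ<n i) (m≤m+n P (line (toℕ i) (toℕ k)))) ,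
        inj₁ (subst₂ Inc (sym e₁) (sym e₂) (inc-line (toℕ i) (toℕ k) (toℕ<n i) (toℕ<n k)))
        where
        e₁ = toℕ-fromℕ< (pt (toℕ<n i))
        e₂ = toℕ-fromℕ< (ln (toℕ i) (toℕ k) (toℕ<n k))

      flags : List (Fin n × Fin n)
      flags = map flag (cartesianProduct (allFin P) (allFin p))

      counted : {R : Fin n × Fin n → Set} (R? : ∀ e → Dec (R e)) → (∀ a → R (flag a)) →
        length flags ≤ length (filter R? (cartesianProduct (allFin n) (allFin n)))
      counted R? h = begin
        length flags ≡⟨ sym (trans (∑-const flags 1) (*-identityʳ (length flags))) ⟩
        (∑[ e ∈ flags ] 1) ≤⟨ ∑-sub _≟²_ {all} flags (map⁺ flag-inj (cartesianProduct⁺ (allFin⁺ P) (allFin⁺ p))) (λ {e} _ → ∈-cartesianProduct⁺ (∈-allFin (proj₁ e)) (∈-allFin (proj₂ e))) (λ _ → 1) ⟩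
        (∑[ e ∈ all ] ⟦ e ∈? flags ⟧ * 1) ≤⟨ ∑-mono all (λ e → ≤-trans (≤-reflexive (*-identityʳ ⟦ e ∈? flags ⟧)) (⟦⟧-mono (e ∈? flags) (R? e) (λ e∈ → member (∈-map⁻ flag e∈)))) ⟩
        (∑[ e ∈ all ] ⟦ R? e ⟧) ≡⟨ sym (length-filter R? all) ⟩
        length (filter R? all) ∎
        where
        open ≤-Reasoning
        _≟²_ : DecidableEquality (Fin n × Fin n)
        _≟²_ = ≡-dec Fin._≟_ Fin._≟_
        open DecMem _≟²_ using (_∈?_)
        all : List (Fin n × Fin n)
        all = cartesianProduct (allFin n) (allFin n)
        member : ∀ {e} → ∃[ a ] (a ∈ cartesianProduct (allFin P) (allFin p) × e ≡ flag a) → _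
        member (a , _ , refl) = h a

    private
      ∣allFin∣ : ∀ k → length (allFin k) ≡ k
      ∣allFin∣ k = length-tabulate (λ i → i)

    -- Each of the p² points lies on one line of every slope; these p³ flags are distinct edges,
    -- already listed with the smaller index first.
    manyEdges : p * p * p ≤ edges incidenceGraph
    manyEdges = ≤-trans (≤-reflexive (sym (trans (length-map flag (cartesianProduct (allFin P) (allFin p)))
      (trans (length-⊗ (allFin P) (allFin p)) (cong₂ _*_ (∣allFin∣ P) (∣allFin∣ p)))))) (counted _ flag-edge)

-- Let 4^(9+u) ≤ n < 4^(10+u) and t = 4 + u, with a prime p between 2^t and 2^(t+4). Then 2p² ≤
-- 4^(t+5) ≤ n, so the incidence graph fits, while n ≤ 4^6 4^t against at least p³ ≥ 2^(3t) edges
-- gives the factor 4^18. The exponent 9 is 5 + 4, as `prime-between` asks for t ≥ 4. The base 4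
-- stays symbolic as `b`.
denseFree : ∀ b → b ≡ 4 → ∀ q n → b ^ 9 ≤ n → ∃[ G ] (prism (4 + q) -Free G × n * (n * n) ≤ b ^ 18 * (edges {n} G * edges G))
denseFree b b≡4 q n n≥ = go (topPower b n (subst (1 <_) (sym b≡4) (s≤s (s≤s z≤n))) (≤-trans (m^n>0 b 9) n≥))
  where
  instance
    b≢0 : NonZero b
    b≢0 = subst NonZero (sym b≡4) _
  go : ∃[ e ] (b ^ e ≤ n × n < b ^ suc e) → ∃[ G ] (prism (4 + q) -Free G × n * (n * n) ≤ b ^ 18 * (edges {n} G * edges G))
  go (e , le , lt) = go₁ (m≤n⇒∃[o]m+o≡n 9≤e)
    where
    9≤e : 9 ≤ e
    9≤e = ≮⇒≥ λ e<9 → <⇒≱ lt (≤-trans (^-monoʳ-≤ b e<9) n≥)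
    go₁ : ∃[ u ] (9 + u ≡ e) → ∃[ G ] (prism (4 + q) -Free G × n * (n * n) ≤ b ^ 18 * (edges {n} G * edges G))
    go₁ (u , refl) = go₂ (prime-between (4 + u) (m≤m+n 4 u))
      where
      t : ℕ
      t = 4 + u
      pow : ∀ k → b ^ k ≡ 2 ^ k * 2 ^ k
      pow zero    = refl
      pow (suc k) = trans (cong₂ _*_ b≡4 (pow k)) (lem (2 ^ k))
        where
        lem : ∀ x → 4 * (x * x) ≡ 2 * x * (2 * x)
        lem = solve-∀
      go₂ : ∃[ p ] (Prime p × 2 ^ t < p × p ≤ 2 ^ (4 + t)) → ∃[ G ] (prism (4 + q) -Free G × n * (n * n) ≤ b ^ 18 * (edges {n} G * edges G))
      go₂ (p , pp , p> , p≤) = incidenceGraph n room , prismFree n room q , bound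
        where
        open Incidence p pp
        room : p * p + p * p ≤ n
        room = begin
          p * p + p * p ≤⟨ +-mono-≤ (*-mono-≤ p≤ p≤) (*-mono-≤ p≤ p≤) ⟩
          2 ^ (4 + t) * 2 ^ (4 + t) + 2 ^ (4 + t) * 2 ^ (4 + t) ≡⟨ cong₂ _+_ (sym (pow (4 + t))) (sym (pow (4 + t))) ⟩
          b ^ (4 + t) + b ^ (4 + t) ≤⟨ m≤m+n _ (b ^ (4 + t) + b ^ (4 + t)) ⟩
          b ^ (4 + t) + b ^ (4 + t) + (b ^ (4 + t) + b ^ (4 + t)) ≡⟨ trans (lem (b ^ (4 + t))) (cong (_* b ^ (4 + t)) (sym b≡4)) ⟩
          b ^ (5 + t) ≤⟨ le ⟩
          n ∎
          where
          open ≤-Reasoning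
          lem : ∀ x → x + x + (x + x) ≡ 4 * x
          lem = solve-∀
        x : ℕ
        x = b ^ t
        n≤ : n ≤ b ^ 6 * x
        n≤ = ≤-trans (<⇒≤ lt) (≤-reflexive (^-distribˡ-+-* b 6 t))
        bound : n * (n * n) ≤ b ^ 18 * (edges (incidenceGraph n room) * edges (incidenceGraph n room))
        bound = begin
          n * (n * n) ≤⟨ *-mono-≤ n≤ (*-mono-≤ n≤ n≤) ⟩
          b ^ 6 * x * (b ^ 6 * x * (b ^ 6 * x)) ≡⟨ l₁ (b ^ 6) x ⟩
          b ^ 6 * (b ^ 6 * b ^ 6) * (x * (x * x)) ≡⟨ cong (_* (x * (x * x))) (trans (cong (b ^ 6 *_) (sym (^-distribˡ-+-* b 6 6))) (sym (^-distribˡ-+-* b 6 12))) ⟩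
          b ^ 18 * (x * (x * x)) ≤⟨ *-monoʳ-≤ (b ^ 18) small ⟩
          b ^ 18 * (edges (incidenceGraph n room) * edges (incidenceGraph n room)) ∎
          where
          open ≤-Reasoning
          l₁ : ∀ a x → a * x * (a * x * (a * x)) ≡ a * (a * a) * (x * (x * x))
          l₁ = solve-∀
          l₂ : ∀ y → y * y * (y * y * (y * y)) ≡ y * y * y * (y * y * y)
          l₂ = solve-∀
          y≤p : 2 ^ t ≤ p
          y≤p = <⇒≤ p>
          cube≤ : 2 ^ t * 2 ^ t * 2 ^ t ≤ edges (incidenceGraph n room)
          cube≤ = ≤-trans (*-mono-≤ (*-mono-≤ y≤p y≤p) y≤p) (manyEdges n room)
          small : x * (x * x) ≤ edges (incidenceGraph n room) * edges (incidenceGraph n room)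
          small = ≤-trans (≤-reflexive (trans (cong (λ z → z * (z * z)) (pow t)) (l₂ (2 ^ t)))) (*-mono-≤ cube≤ cube≤)

-- Passing to rational constants

private
  fromℕ-≃ : ∀ n → toℚᵘ (fromℕ n) ≃ mkℚᵘ (ℤ.+ n) 0
  fromℕ-≃ n = toℚᵘ-fromℚᵘ (mkℚᵘ (ℤ.+ n) 0)

  square-≃ : ∀ c {u} → toℚᵘ c ≃ u → ∀ k → toℚᵘ (c ℚ.* c ℚ.* fromℕ k) ≃ (u ℚᵘ.* u) ℚᵘ.* mkℚᵘ (ℤ.+ k) 0
  square-≃ c e k = ≃-trans (toℚᵘ-homo-* (c ℚ.* c) (fromℕ k)) (ℚᵘₚ.*-cong (≃-trans (toℚᵘ-homo-* c c) (ℚᵘₚ.*-cong e e)) (fromℕ-≃ k))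

  upper-ℚ : ∀ D a k → a ≤ D * D * k → fromℕ a ℚ.≤ fromℕ D ℚ.* fromℕ D ℚ.* fromℕ k
  upper-ℚ D a k h = toℚᵘ-cancel-≤ (≤-respʳ-≃ (≃-sym (square-≃ (fromℕ D) (fromℕ-≃ D) k)) (≤-respˡ-≃ (≃-sym (fromℕ-≃ a))
    (*≤* (subst₂ ℤ._≤_ (sym (ℤₚ.*-identityʳ (ℤ.+ a))) (trans (trans (ℤₚ.pos-* (D * D) k) (cong (ℤ._* (ℤ.+ k)) (ℤₚ.pos-* D D))) (sym (ℤₚ.*-identityʳ _))) (ℤ.+≤+ h)))))

  lower-ℚ : ∀ N k a → k ≤ suc N * suc N * a → (ℤ.+ 1 ℚ./ suc N) ℚ.* (ℤ.+ 1 ℚ./ suc N) ℚ.* fromℕ k ℚ.≤ fromℕ a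
  lower-ℚ N k a h = toℚᵘ-cancel-≤ (≤-respˡ-≃ (≃-sym (square-≃ (ℤ.+ 1 ℚ./ suc N) (toℚᵘ-fromℚᵘ (mkℚᵘ (ℤ.+ 1) N)) k)) (≤-respʳ-≃ (≃-sym (fromℕ-≃ a))
    (*≤* (subst₂ ℤ._≤_ (sym (trans (ℤₚ.*-identityʳ _) (ℤₚ.*-identityˡ (ℤ.+ k)))) (ℤₚ.pos-* a (suc N * suc N * 1))
      (ℤ.+≤+ (≤-trans h (≤-reflexive (trans (*-comm (suc N * suc N) a) (cong (a *_) (sym (*-identityʳ (suc N * suc N))))))))))))

  0<fromℕ : ∀ D → 0ℚ ℚ.< fromℕ (suc D)
  0<fromℕ D = positive⁻¹ (fromℕ (suc D)) {{normalize-pos (suc D) 1}}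

  0<1/ : ∀ N → 0ℚ ℚ.< ℤ.+ 1 ℚ./ suc N
  0<1/ N = positive⁻¹ (ℤ.+ 1 ℚ./ suc N) {{normalize-pos 1 (suc N)}}

  LowerBound : ℕ → Set₁
  LowerBound N = ∀ q n → suc N ≤ n → ∃[ G ] (prism (4 + q) -Free G × n * (n * n) ≤ suc N * suc N * (edges {n} G * edges G))

  lowerBound : ∀ b → b ≡ 4 → ∃[ N ] LowerBound N
  lowerBound b b≡4 = pred (b ^ 9) , λ q n n≥ → restate (denseFree b b≡4 q n (≤-trans (≤-reflexive (sym eq)) n≥))
    where
    instance
      b≢0 : NonZero b
      b≢0 = subst NonZero (sym b≡4) _
      b⁹≢0 : NonZero (b ^ 9)
      b⁹≢0 = m^n≢0 b 9
    eq : suc (pred (b ^ 9)) ≡ b ^ 9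
    eq = suc-pred (b ^ 9)
    square : b ^ 18 ≡ suc (pred (b ^ 9)) * suc (pred (b ^ 9))
    square = trans (^-distribˡ-+-* b 9 9) (cong₂ _*_ (sym eq) (sym eq))
    restate : ∀ {q n} → ∃[ G ] (prism (4 + q) -Free G × n * (n * n) ≤ b ^ 18 * (edges {n} G * edges G)) →
              ∃[ G ] (prism (4 + q) -Free G × n * (n * n) ≤ suc (pred (b ^ 9)) * suc (pred (b ^ 9)) * (edges {n} G * edges G))
    restate (G , free , h) = G , free , ≤-trans h (*-monoˡ-≤ (edges G * edges G) (≤-reflexive square))

  Conclusion : ℕ → Set
  Conclusion ℓ = ∃[ c ] ∃[ C ] (0ℚ ℚ.< c × 0ℚ ℚ.< C ×
    (∃[ n₀ ] (∀ (n : ℕ) → n ≥ n₀ → (c · n ^3/2≤ ex n (prism ℓ)) × (ex n (prism ℓ) ≤ C · n ^3/2))))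

  cube : ∀ n → n * (n * n) ≡ n ^ 3
  cube n = cong (λ k → n * (n * k)) (sym (*-identityʳ n))

  sq : ∀ m → m * m ≡ m ^ 2
  sq m = cong (m *_) (sym (*-identityʳ m))

  conclude : ∀ q D → (∀ {n} (G : Graph n) → 0 < n → prism (4 + q) -Free G → edges G * edges G ≤ D * (n * (n * n))) →
             ∃[ N ] LowerBound N → Conclusion (4 + q)
  -- `suc N` serves both as 1 / c and as the threshold for n. C = D + 1 is enough, because only D ≤
  -- C² is needed.
  conclude q D upper (N , lower) = ℤ.+ 1 ℚ./ suc N , fromℕ (suc D) , 0<1/ N , 0<fromℕ D , suc N , λ n n≥ →
    lower-ℚ N (n ^ 3) (ex n (prism (4 + q)) ^ 2) (below n n≥) , upper-ℚ (suc D) (ex n (prism (4 + q)) ^ 2) (n ^ 3) (above n n≥)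
    where
    below : ∀ n → n ≥ suc N → n ^ 3 ≤ suc N * suc N * ex n (prism (4 + q)) ^ 2
    below n n≥ = go (lower q n n≥)
      where
      go : ∃[ G ] (prism (4 + q) -Free G × n * (n * n) ≤ suc N * suc N * (edges {n} G * edges G)) → n ^ 3 ≤ suc N * suc N * ex n (prism (4 + q)) ^ 2
      go (G , free , h) = ≤-trans (≤-reflexive (sym (cube n))) (≤-trans h (*-monoʳ-≤ (suc N * suc N) (≤-trans (*-mono-≤ e≤ e≤) (≤-reflexive (sq (ex n (prism (4 + q))))))))
        where
        e≤ : edges G ≤ ex n (prism (4 + q))
        e≤ = proj₂ (ex-prism-isExtremal n (4 + q)) G free
    above : ∀ n → n ≥ suc N → ex n (prism (4 + q)) ^ 2 ≤ suc D * suc D * n ^ 3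
    above n n≥ = go (proj₁ (ex-prism-isExtremal n (4 + q)))
      where
      go : Σ[ G ∈ Graph n ] (prism (4 + q) -Free G × edges G ≡ ex n (prism (4 + q))) → ex n (prism (4 + q)) ^ 2 ≤ suc D * suc D * n ^ 3
      go (G , free , eq) = ≤-trans (≤-reflexive (trans (sym (sq (ex n (prism (4 + q))))) (cong (λ m → m * m) (sym eq))))
        (≤-trans (upper G (≤-trans (s≤s z≤n) n≥) free) (≤-trans (≤-reflexive (cong (D *_) (cube n)))
          (*-monoˡ-≤ (n ^ 3) (≤-trans (n≤1+n D) (m≤m*n (suc D) (suc D))))))

  withExcess : ∀ {ℓ} → ∃[ q ] (4 + q ≡ ℓ) → Conclusion ℓ
  withExcess (q , refl) = conclude q (UpperBound.density q) (UpperBound.edges≤ q) (lowerBound 4 refl)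

theorem1p1 : ∀ (ℓ : ℕ) → ℓ ≥ 4 →
    ∃[ c ] ∃[ C ] (0ℚ ℚ.< c × 0ℚ ℚ.< C ×
      (∃[ n₀ ] (∀ (n : ℕ) → n ≥ n₀ →
        (c · n ^3/2≤ ex n (prism ℓ)) × (ex n (prism ℓ) ≤ C · n ^3/2))))
theorem1p1 ℓ ℓ≥4 = withExcess (m≤n⇒∃[o]m+o≡n ℓ≥4)
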